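{- Let $D>1$ be squarefree, $u=A+B\sqrt{D}\in\mathcal{S}_D$, $C=C(u)$, $d=-27C^2D$, and let $[a,2b,c]$ be a primitive binary quadratic form with $a>0$ and $b^2-ac=d$. Let $x,y$ be integers and $f=f(x,y)=ax^2+2bxy+cy^2$. Suppose that $$\gcd(af(x,y),\,3N(u)Dy)=1.$$ Then $L=R$, where $$L=\left(\frac{9Ay+(B/C)(ax+by)(1+2\omega)}{f(x,y)}\right)_3,\qquad R=\left(\frac{9A-(B/C)\,b\,(1+2\omega)}{a}\right)_3 .$$
   Context: For squarefree $D>1$, let $\mathcal{O}$ be the ring of integers of $\mathbb{Q}(\sqrt{D})$. The set $\mathcal{S}_D$ consists of those $u=A+B\sqrt{D}$ with $A,B\in\mathbb{Z}$ such that the norm $N(u)=A^2-B^2D$ is the cube of an integer, $u$ is not a cube in $\mathcal{O}$, and $\gcd(A,B)$ is not divisible by the cube of any prime. For $u\in\mathcal{S}_D$, $C(u)$ is the product of the distinct odd primes that divide $\gcd(A,B)$ but do not divide $D$ (so $C\mid B$). Let $\omega=(-1+i\sqrt{3})/2$. For $\alpha\in\mathbb{Z}[\omega]$ and a prime $\pi$ of $\mathbb{Z}[\omega]$ not dividing $3$, $(\alpha/\pi)_3\in\{0,1,\omega,\omega^2\}$ is the cubic residue symbol, $(\alpha/\pi)_3\equiv \alpha^{(N\pi-1)/3}\pmod{\pi}$; for a positive rational integer $n$ coprime to $3$, $(\alpha/n)_3$ is defined multiplicatively via the factorization of $n$ into primes of $\mathbb{Z}[\omega]$. (Note $f(x,y)>0$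 since $a>0$ and $d<0$.) -}

module Defs where

open import Data.Nat as ℕ using (ℕ; zero; suc)
import Data.Nat.Divisibility as ℕD
open import Data.Nat.GCD using (gcd)
open import Data.Nat.Primality using (Prime; prime?)
open import Data.Integer as ℤ using (ℤ; +_; _+_; _*_; -_; _-_; ∣_∣)
open import Data.Integer.Divisibility using () renaming (_∣_ to _∣ℤ_)
open import Data.List using (List; []; _∷_; map; foldr; filter; upTo)
open import Data.List.Relation.Unary.All using (All)
open import Data.Product using (Σ; ∃; _×_; _,_; proj₁; proj₂)
open import Data.Sum using (_⊎_)
open import Relation.Nullary using (¬_; _×-dec_; ¬?)
open import Relation.Binary.PropositionalEquality using (_≡_)

SquareFree : ℕ → Set
SquareFree n = ∀ p → Prime p → ¬ ((p ℕ.* p) ℕD.∣ n)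

normD : ℕ → ℤ → ℤ → ℤ
normD D A B = A * A - B * B * + D

IsIntCube : ℤ → Set
IsIntCube z = ∃ λ m → z ≡ m * m * m

-- Every element of the ring of integers O of ℚ(√D) (D squarefree, D > 1)
-- is (p + q√D)/2 with p q : ℤ, where
--   D ≡ 1 mod 4 : p ≡ q mod 2,
--   otherwise   : p, q both even.
InO : ℕ → ℤ → ℤ → Set
InO D p q = (D ℕ.% 4 ≡ 1 × (+ 2) ∣ℤ (p - q))
          ⊎ (¬ (D ℕ.% 4 ≡ 1) × (+ 2) ∣ℤ p × (+ 2) ∣ℤ q)

-- u = A + B√D is a cube in O :  ((p + q√D)/2)³ = A + B√D for some (p+q√D)/2 ∈ O,
-- i.e. (p + q√D)³ = 8(A + B√D).
IsCubeInO : ℕ → ℤ → ℤ → Set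
IsCubeInO D A B = ∃ λ p → ∃ λ q → InO D p q
  × (p * p * p + + 3 * p * q * q * + D ≡ + 8 * A)
  × (+ 3 * p * p * q + q * q * q * + D ≡ + 8 * B)

gcdAB : ℤ → ℤ → ℕ
gcdAB A B = gcd ∣ A ∣ ∣ B ∣

InS : ℕ → ℤ → ℤ → Set
InS D A B = IsIntCube (normD D A B)
          × ¬ IsCubeInO D A B
          × (∀ p → Prime p → ¬ ((p ℕ.* p ℕ.* p) ℕD.∣ gcdAB A B))

-- C(u): product of the distinct odd primes dividing gcd(A,B) but not D.
-- (every such prime is ≤ gcd(A,B), which is ≥ 1 for u ∈ S_D)
Cu : ℕ → ℤ → ℤ → ℕ
Cu D A B = foldr ℕ._*_ 1 (filter sel (upTo (suc g)))
  where
  g = gcdAB A B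
  sel = λ p → prime? p ×-dec ¬? (2 ℕD.∣? p) ×-dec (p ℕD.∣? g) ×-dec ¬? (p ℕD.∣? D)

-- Eisenstein integers ℤ[ω], x + yω represented as (x , y), ω² = -1 - ω

Zω : Set
Zω = ℤ × ℤ

ι : ℤ → Zω
ι n = n , + 0

0ω 1ω ωω ω²ω : Zω
0ω = + 0 , + 0
1ω = + 1 , + 0
ωω = + 0 , + 1
ω²ω = ℤ.-[1+ 0 ] , ℤ.-[1+ 0 ]

_+ω_ : Zω → Zω → Zω
(a , b) +ω (c , d) = (a + c) , (b + d)

_-ω_ : Zω → Zω → Zω
(a , b) -ω (c , d) = (a - c) , (b - d)

_*ω_ : Zω → Zω → Zω
(a , b) *ω (c , d) = (a * c - b * d) , (a * d + b * c - b * d)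

_^ω_ : Zω → ℕ → Zω
α ^ω zero = 1ω
α ^ω suc k = α *ω (α ^ω k)

prodω : List Zω → Zω
prodω = foldr _*ω_ 1ω

Nω : Zω → ℕ
Nω (x , y) = ∣ x * x - x * y + y * y ∣

_∣ω_ : Zω → Zω → Set
π ∣ω α = ∃ λ γ → α ≡ π *ω γ

IsUnitω : Zω → Set
IsUnitω ε = ∃ λ η → ε *ω η ≡ 1ω

PrimeZω : Zω → Set
PrimeZω π = ¬ (π ≡ 0ω) × ¬ IsUnitω π
          × (∀ α β → π ∣ω (α *ω β) → π ∣ω α ⊎ π ∣ω β)

IsCubicValue : Zω → Set
IsCubicValue χ = χ ≡ 0ω ⊎ χ ≡ 1ω ⊎ χ ≡ ωω ⊎ χ ≡ ω²ω

CubicSymPrime : Zω → Zω → Zω → Set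
CubicSymPrime α π χ =
  IsCubicValue χ × π ∣ω ((α ^ω ((Nω π ℕ.∸ 1) ℕ./ 3)) -ω χ)

-- (α/n)_3 = χ for a rational integer n coprime to 3: there is a factorisation
-- n = ε π₁ ⋯ πₖ into a unit and primes of ℤ[ω] (none dividing 3) and
-- χ = ∏ (α/πᵢ)_3.  Each entry of the list is a pair (πᵢ , (α/πᵢ)_3).
CubicSym : Zω → ℤ → Zω → Set
CubicSym α n χ = Σ (List (Zω × Zω)) λ ps →
    All (λ pc → PrimeZω (proj₁ pc) × ¬ (proj₁ pc ∣ω ι (+ 3))
                × CubicSymPrime α (proj₁ pc) (proj₂ pc)) ps
  × (∃ λ ε → IsUnitω ε × ι n ≡ ε *ω prodω (map proj₁ ps))
  × χ ≡ prodω (map proj₂ ps)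

Primitive : ℤ → ℤ → ℤ → Set
Primitive a b c = gcd (gcd ∣ a ∣ ∣ + 2 * b ∣) ∣ c ∣ ≡ 1

formVal : ℤ → ℤ → ℤ → ℤ → ℤ → ℤ
formVal a b c x y = a * x * x + + 2 * b * x * y + c * y * y

{-# OPTIONS --safe #-}

-- Put X = ax + by, m = a f(x,y) = X² + 27C²Dy² and γ = (B/C)X - 3√-3 Ay.  The numerator of L
-- is √-3 γ, and modulo a it is y times the conjugate of the numerator of R.  Symbols of
-- coprime rational integers are trivial (they are invariant under conjugation), and so is
-- that of √-3 over a rational integer; hence L conj(R) = (γ/m)₃, and the claim is (γ/m)₃ = 1.
--
-- Up to a rational factor γ is primary, so (γ/m)₃ = (m/γ)₃ by cubic reciprocity, and
-- (B/C)²m + 27y²N(u) = γ conj(γ) reduces this to symbols (ℓ/γ)₃ of rational primes ℓ.  Write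
-- γ = P - 3√-3 Q with P and Q coprime.  If ℓ ∣ PQ then (ℓ/γ)₃ = (γ/ℓ)₃ = 1, because γ is
-- rational or √-3 times rational modulo ℓ.  The remaining primes contribute a cube; that the
-- bad primes (common divisors of A and B/C) satisfy ℓ ∣ PQ is where the cube-freeness of
-- gcd(A,B) and the choice of C enter.  If 3 ∤ A, the element u is first replaced by u(√D)³,
-- which makes γ primary.
--
-- Reciprocity between a rational integer and a primary element comes from the Gauss sum
-- G = Σ χ(t)[t], taken in the group ring of ℤ/p: there G³ = J(p[0] - Σ[t]), and comparing
-- G^(q²) with Frobenius modulo q gives (pJ)^((q²-1)/3) ≡ χ(q), while Frobenius modulo 3
-- gives J ≡ -1.
module Submission where

open import Algebra.Bundles using (CommutativeRing)
import Algebra.Properties.CommutativeSemiring.Binomial as Binomial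
import Algebra.Properties.Semiring.Exp as Exp
import Algebra.Properties.Semiring.Mult as Mult
import Algebra.Properties.Semiring.Sum as Sums
import Algebra.Solver.Ring
open import Algebra.Solver.Ring.AlmostCommutativeRing using (fromCommutativeRing; _-Raw-AlmostCommutative⟶_)
open import Data.Fin as Fin using (Fin; zero; suc; toℕ; fromℕ; inject₁; fromℕ<)
import Data.Fin.Permutation as Permutation
import Data.Fin.Properties as Finₚ
open import Data.Integer as ℤ using (ℤ; +_; -[1+_]; _+_; _*_; -_; _-_; ∣_∣; _<_)
import Data.Integer.DivMod as ℤ÷
import Data.Integer.Divisibility.Signed as ℤ∣
import Data.Integer.Properties as ℤₚ
open import Data.Integer.Tactic.RingSolver using (solve-∀)
open import Data.List using (List; []; _∷_; map; foldr; _++_; filter; upTo)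
open import Data.List.Membership.Propositional.Properties using (∈-filter⁺; ∈-filter⁻; ∈-upTo⁺)
import Data.List.Properties as Listₚ
open import Data.List.Relation.Unary.All as All using (All; []; _∷_)
import Data.List.Relation.Unary.All.Properties as Allₚ
open import Data.List.Relation.Unary.AllPairs using ([]; _∷_)
open import Data.List.Relation.Unary.Unique.Propositional using (Unique)
import Data.List.Relation.Unary.Unique.Propositional.Properties as Uniqueₚ
open import Data.Maybe using (Maybe; just; nothing)
open import Data.Nat as ℕ using (ℕ; zero; suc; NonZero)
open import Data.Nat.Combinatorics using (nCk+nC[k+1]≡[n+1]C[k+1]; k>n⇒nCk≡0; nCn≡1; nCk≡nC[n∸k]) renaming (_C_ to _choose_)
open import Data.Nat.Coprimality using (coprime-Bézout; gcd≡1⇒coprime)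
import Data.Nat.DivMod as ℕ÷
import Data.Nat.Divisibility as ℕ∣
open import Data.Nat.GCD using (module Bézout; gcd; gcd[m,n]∣m; gcd[m,n]∣n; gcd-greatest; gcd[m,n]≡0⇒m≡0; gcd[m,n]≡0⇒n≡0)
open import Data.Nat.Induction using (<-wellFounded)
open import Data.Nat.ListAction using (product)
open import Data.Nat.ListAction.Properties using (∈⇒∣product)
open import Data.Nat.Primality using (Prime; euclidsLemma; prime⇒irreducible; prime⇒nonZero; ¬prime[1]; prime[2]; prime?)
open import Data.Nat.Primality.Factorisation using (factorise; PrimeFactorisation; factorisationHasAllPrimeFactors)
import Data.Nat.Properties as ℕₚ
import Data.Nat.Tactic.RingSolver as ℕSolver
open import Data.Product using (Σ; ∃; _×_; _,_; proj₁; proj₂)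
open import Data.Product.Properties using (≡-dec)
open import Data.Sum as Sum using (_⊎_; inj₁; inj₂; [_,_]′)
open import Defs
open import Function using (_∘_)
open import Induction.WellFounded using (Acc; acc)
open import Level using (0ℓ)
open import Relation.Binary.PropositionalEquality using (_≡_; refl; sym; trans; cong; cong₂; subst; subst₂; isEquivalence; module ≡-Reasoning)
open import Relation.Nullary using (¬_; Dec; yes; no; contradiction; _⊎-dec_; _×-dec_; ¬?)
open import Relation.Nullary.Decidable using (map′; from-yes)

-- Reciprocity is proved only for Jacobi sums and rational primes. An element prime to 3 and
-- rational modulo 3 is a product of these times a unit, and a unit rational modulo 3 is ±1; so the
-- result spreads to every such γ. The factor 27 = -(-3)³ is a cube, hence invisible in μ₃. The
-- obstacle: P/Q is (B/C)X/(Ay) in lowest terms, so common factors of A and B/C cancel out of γ. Let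
-- a prime ℓ divide both, and let n³ = N(u). Valuations in A² - B²D = n³ leave two cases. If ℓ ∣ D,
-- then v(B) = 1 < v(A), and ℓ ∣ Q. If ℓ ∤ D, then v(A) = v(B), and the division of B by C puts an
-- odd ℓ into Q; for ℓ = 2 the number m = X² + 27C²Dy² is odd, so exactly one of X and y is even.
-- The element u(√D)³ has norm -D³N(u), again a cube, but it must be divided by a rational integer,
-- after which its norm is a cube times a divisor of D. In the Gauss sum argument the group ring has
-- coefficients in ℤ[ω], so no p-th root of unity is adjoined; q² is used because q² ≡ 1 modulo 3
-- for every prime q ≠ 3, so that Frobenius applied twice fixes the values of χ.

infixl 6 _⊕_ _⊖_
infixl 7 _⊗_
infix 8 ⊝_

-- Opaque copies of the operations of ℤ[ω], so that type checking never
-- expands a product into its coordinates.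
opaque
  _⊕_ _⊗_ : Zω → Zω → Zω
  _⊕_ = _+ω_
  _⊗_ = _*ω_

  ⊝_ : Zω → Zω
  ⊝ (a , b) = - a , - b

  conj : Zω → Zω
  conj (x , y) = x - y , - y

  N : Zω → ℕ
  N = Nω

_⊖_ : Zω → Zω → Zω
α ⊖ β = α ⊕ ⊝ β

-- Ring structure, conjugation and norm of ℤ[ω]

opaque
  unfolding _⊕_

  ⊗≡*ω : ∀ α β → α ⊗ β ≡ α *ω β
  ⊗≡*ω α β = refl

  ⊖≡-ω : ∀ α β → α ⊖ β ≡ α -ω β
  ⊖≡-ω α β = refl

  N≡Nω : ∀ α → N α ≡ Nω α
  N≡Nω α = refl

  ⊕-assoc : ∀ α β γ → (α ⊕ β) ⊕ γ ≡ α ⊕ (β ⊕ γ)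
  ⊕-assoc (a , b) (c , d) (e , f) = cong₂ _,_ (ℤₚ.+-assoc a c e) (ℤₚ.+-assoc b d f)

  ⊕-comm : ∀ α β → α ⊕ β ≡ β ⊕ α
  ⊕-comm (a , b) (c , d) = cong₂ _,_ (ℤₚ.+-comm a c) (ℤₚ.+-comm b d)

  ⊕-identityˡ : ∀ α → 0ω ⊕ α ≡ α
  ⊕-identityˡ (a , b) = cong₂ _,_ (ℤₚ.+-identityˡ a) (ℤₚ.+-identityˡ b)

  ⊝-inverseˡ : ∀ α → ⊝ α ⊕ α ≡ 0ω
  ⊝-inverseˡ (a , b) = cong₂ _,_ (ℤₚ.+-inverseˡ a) (ℤₚ.+-inverseˡ b)

  ⊗-assoc : ∀ α β γ → (α ⊗ β) ⊗ γ ≡ α ⊗ (β ⊗ γ)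
  ⊗-assoc (a , b) (c , d) (e , f) = cong₂ _,_ (re a b c d e f) (im a b c d e f)
    where
    re : ∀ a b c d e f → (a * c - b * d) * e - (a * d + b * c - b * d) * f
                       ≡ a * (c * e - d * f) - b * (c * f + d * e - d * f)
    re = solve-∀
    im : ∀ a b c d e f →
         (a * c - b * d) * f + (a * d + b * c - b * d) * e - (a * d + b * c - b * d) * f
       ≡ a * (c * f + d * e - d * f) + b * (c * e - d * f) - b * (c * f + d * e - d * f)
    im = solve-∀

  ⊗-comm : ∀ α β → α ⊗ β ≡ β ⊗ α
  ⊗-comm (a , b) (c , d) = cong₂ _,_ (re a b c d) (im a b c d)
    where
    re : ∀ a b c d → a * c - b * d ≡ c * a - d * b
    re = solve-∀
    im : ∀ a b c d → a * d + b * c - b * d ≡ c * b + d * a - d * b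
    im = solve-∀

  ⊗-identityˡ : ∀ α → 1ω ⊗ α ≡ α
  ⊗-identityˡ (a , b) = cong₂ _,_ (re a b) (im a b)
    where
    re : ∀ a b → + 1 * a - + 0 * b ≡ a
    re = solve-∀
    im : ∀ a b → + 1 * b + + 0 * a - + 0 * b ≡ b
    im = solve-∀

  ⊗-distribˡ-⊕ : ∀ α β γ → α ⊗ (β ⊕ γ) ≡ (α ⊗ β) ⊕ (α ⊗ γ)
  ⊗-distribˡ-⊕ (a , b) (c , d) (e , f) = cong₂ _,_ (re a b c d e f) (im a b c d e f)
    where
    re : ∀ a b c d e f → a * (c + e) - b * (d + f) ≡ (a * c - b * d) + (a * e - b * f)
    re = solve-∀
    im : ∀ a b c d e f → a * (d + f) + b * (c + e) - b * (d + f)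
                       ≡ (a * d + b * c - b * d) + (a * f + b * e - b * f)
    im = solve-∀

  ι-⊕ : ∀ m n → ι (m + n) ≡ ι m ⊕ ι n
  ι-⊕ m n = refl

  ι-⊝ : ∀ m → ι (- m) ≡ ⊝ ι m
  ι-⊝ m = refl

  ι-⊗ : ∀ m n → ι (m * n) ≡ ι m ⊗ ι n
  ι-⊗ m n = cong₂ _,_ (re m n) (im m n)
    where
    re : ∀ m n → m * n ≡ m * n - + 0 * + 0
    re = solve-∀
    im : ∀ m n → + 0 ≡ m * + 0 + + 0 * n - + 0 * + 0
    im = solve-∀

  ι-scale : ∀ n a b → ι n ⊗ (a , b) ≡ (n * a , n * b)
  ι-scale n a b = cong₂ _,_ (re n a b) (im n a b)
    where
    re : ∀ n a b → n * a - + 0 * b ≡ n * a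
    re = solve-∀
    im : ∀ n a b → n * b + + 0 * a - + 0 * b ≡ n * b
    im = solve-∀

  ω-expansion : ∀ a b → (a , b) ≡ ι a ⊕ ι b ⊗ ωω
  ω-expansion a b = cong₂ _,_ (re a b) (im b)
    where
    re : ∀ a b → a ≡ a + (b * + 0 - + 0 * + 1)
    re = solve-∀
    im : ∀ b → b ≡ + 0 + (b * + 1 + + 0 * + 0 - + 0 * + 1)
    im = solve-∀

  conj-⊗ : ∀ α β → conj (α ⊗ β) ≡ conj α ⊗ conj β
  conj-⊗ (a , b) (c , d) = cong₂ _,_ (re a b c d) (im a b c d)
    where
    re : ∀ a b c d → (a * c - b * d) - (a * d + b * c - b * d) ≡ (a - b) * (c - d) - - b * - d
    re = solve-∀
    im : ∀ a b c d → - (a * d + b * c - b * d) ≡ (a - b) * - d + - b * (c - d) - - b * - d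
    im = solve-∀

  conj-⊕ : ∀ α β → conj (α ⊕ β) ≡ conj α ⊕ conj β
  conj-⊕ (a , b) (c , d) = cong₂ _,_ (re a b c d) (ℤₚ.neg-distrib-+ b d)
    where
    re : ∀ a b c d → (a + c) - (b + d) ≡ (a - b) + (c - d)
    re = solve-∀

  conj-⊝ : ∀ α → conj (⊝ α) ≡ ⊝ conj α
  conj-⊝ (a , b) = cong₂ _,_ (re a b) refl
    where
    re : ∀ a b → - a - - b ≡ - (a - b)
    re = solve-∀

  conj-involutive : ∀ α → conj (conj α) ≡ α
  conj-involutive (a , b) = cong₂ _,_ (re a b) (ℤₚ.neg-involutive b)
    where
    re : ∀ a b → (a - b) - - b ≡ a
    re = solve-∀

  conj-ι : ∀ n → conj (ι n) ≡ ι n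
  conj-ι n = cong₂ _,_ (ℤₚ.+-identityʳ n) refl

  ω⊗ω : ωω ⊗ ωω ≡ ω²ω
  ω⊗ω = refl

  ω⊗ω² : ωω ⊗ ω²ω ≡ 1ω
  ω⊗ω² = refl

conj-⊖ : ∀ α β → conj (α ⊖ β) ≡ conj α ⊖ conj β
conj-⊖ α β = trans (conj-⊕ α (⊝ β)) (cong (conj α ⊕_) (conj-⊝ β))

Zω-commutativeRing : CommutativeRing 0ℓ 0ℓ
Zω-commutativeRing = record
  { Carrier = Zω ; _≈_ = _≡_ ; _+_ = _⊕_ ; _*_ = _⊗_ ; -_ = ⊝_ ; 0# = 0ω ; 1# = 1ω
  ; isCommutativeRing = record
    { isRing = record
      { +-isAbelianGroup = record
        { isGroup = record
          { isMonoid = record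
            { isSemigroup = record
              { isMagma = record { isEquivalence = isEquivalence ; ∙-cong = cong₂ _⊕_ }
              ; assoc = ⊕-assoc }
            ; identity = ⊕-identityˡ , λ α → trans (⊕-comm α 0ω) (⊕-identityˡ α) }
          ; inverse = ⊝-inverseˡ , λ α → trans (⊕-comm α (⊝ α)) (⊝-inverseˡ α)
          ; ⁻¹-cong = cong ⊝_ }
        ; comm = ⊕-comm }
      ; *-cong = cong₂ _⊗_
      ; *-assoc = ⊗-assoc
      ; *-identity = ⊗-identityˡ , λ α → trans (⊗-comm α 1ω) (⊗-identityˡ α)
      ; distrib = ⊗-distribˡ-⊕
                , λ α β γ → trans (⊗-comm (β ⊕ γ) α)
                    (trans (⊗-distribˡ-⊕ α β γ) (cong₂ _⊕_ (⊗-comm α β) (⊗-comm α γ)))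
      }
    ; *-comm = ⊗-comm
    }
  }

open CommutativeRing Zω-commutativeRing public using ()
  renaming ( *-identityʳ to ⊗-identityʳ ; +-identityʳ to ⊕-identityʳ
           ; zeroˡ to ⊗-zeroˡ ; zeroʳ to ⊗-zeroʳ ; -‿inverseʳ to ⊖-inverse )

ι-homomorphism : CommutativeRing.rawRing ℤₚ.+-*-commutativeRing -Raw-AlmostCommutative⟶ fromCommutativeRing Zω-commutativeRing
ι-homomorphism = record
  { ⟦_⟧ = ι ; +-homo = ι-⊕ ; *-homo = ι-⊗ ; -‿homo = ι-⊝ ; 0-homo = refl ; 1-homo = refl }

ι-equal? : ∀ m n → Maybe (ι m ≡ ι n)
ι-equal? m n with m ℤₚ.≟ n
... | yes m≡n = just (cong ι m≡n)
... | no _ = nothing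

open module ω-Solver = Algebra.Solver.Ring (CommutativeRing.rawRing ℤₚ.+-*-commutativeRing)
  (fromCommutativeRing Zω-commutativeRing) ι-homomorphism ι-equal?
  using (solve; con; _:=_; _:+_; _:*_; _:-_; :-_; _:^_) public

infix 4 _≟ω_
_≟ω_ : (α β : Zω) → Dec (α ≡ β)
_≟ω_ = ≡-dec ℤₚ._≟_ ℤₚ._≟_

ι-injective : ∀ {m n} → ι m ≡ ι n → m ≡ n
ι-injective = cong proj₁

norm : Zω → ℤ
norm α = + N α

i*i≡∣i∣² : ∀ i → i * i ≡ + (∣ i ∣ ℕ.* ∣ i ∣)
i*i≡∣i∣² (+ n) = sym (ℤₚ.pos-* n n)
i*i≡∣i∣² -[1+ n ] = refl

private
  2*norm : ∀ x y → + 2 * (x * x - x * y + y * y) ≡ + (∣ x ∣ ℕ.* ∣ x ∣ ℕ.+ ∣ y ∣ ℕ.* ∣ y ∣ ℕ.+ ∣ x - y ∣ ℕ.* ∣ x - y ∣)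
  2*norm x y = trans (h x y) (cong₂ _+_ (cong₂ _+_ (i*i≡∣i∣² x) (i*i≡∣i∣² y)) (i*i≡∣i∣² (x - y)))
    where
    h : ∀ x y → + 2 * (x * x - x * y + y * y) ≡ x * x + y * y + (x - y) * (x - y)
    h = solve-∀

opaque
  unfolding _⊕_

  norm-coordinates : ∀ x y → norm (x , y) ≡ x * x - x * y + y * y
  norm-coordinates x y with x * x - x * y + y * y | 2*norm x y
  ... | + n | _ = refl
  ... | -[1+ n ] | ()

  α⊗conj-α : ∀ α → α ⊗ conj α ≡ ι (norm α)
  α⊗conj-α (x , y) = trans (cong₂ _,_ (re x y) (im x y)) (cong ι (sym (norm-coordinates x y)))
    where
    re : ∀ x y → x * (x - y) - y * - y ≡ x * x - x * y + y * y
    re = solve-∀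
    im : ∀ x y → x * - y + y * (x - y) - y * - y ≡ + 0
    im = solve-∀

N-⊗ : ∀ α β → N (α ⊗ β) ≡ N α ℕ.* N β
N-⊗ α β = ℤₚ.+-injective (ι-injective (begin
  ι (norm (α ⊗ β))                ≡⟨ α⊗conj-α (α ⊗ β) ⟨
  α ⊗ β ⊗ conj (α ⊗ β)            ≡⟨ cong (α ⊗ β ⊗_) (conj-⊗ α β) ⟩
  α ⊗ β ⊗ (conj α ⊗ conj β)       ≡⟨ solve 4 (λ a b c d → a :* b :* (c :* d) := a :* c :* (b :* d)) refl α β (conj α) (conj β) ⟩
  α ⊗ conj α ⊗ (β ⊗ conj β)       ≡⟨ cong₂ _⊗_ (α⊗conj-α α) (α⊗conj-α β) ⟩
  ι (norm α) ⊗ ι (norm β)         ≡⟨ ι-⊗ (norm α) (norm β) ⟨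
  ι (norm α * norm β)             ≡⟨ cong ι (ℤₚ.pos-* (N α) (N β)) ⟨
  ι (+ (N α ℕ.* N β))             ∎))
  where open ≡-Reasoning

N-conj : ∀ α → N (conj α) ≡ N α
N-conj α = ℤₚ.+-injective (ι-injective (begin
  ι (norm (conj α))       ≡⟨ α⊗conj-α (conj α) ⟨
  conj α ⊗ conj (conj α)  ≡⟨ cong (conj α ⊗_) (conj-involutive α) ⟩
  conj α ⊗ α              ≡⟨ ⊗-comm (conj α) α ⟩
  α ⊗ conj α              ≡⟨ α⊗conj-α α ⟩
  ι (norm α)              ∎))
  where open ≡-Reasoning

N-ι : ∀ n → N (ι n) ≡ ∣ n ∣ ℕ.* ∣ n ∣
N-ι n = ℤₚ.+-injective (trans (norm-coordinates n (+ 0)) (trans (h n) (i*i≡∣i∣² n)))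
  where
  h : ∀ n → n * n - n * + 0 + + 0 * + 0 ≡ n * n
  h = solve-∀

N≡0⇒≡0 : ∀ α → N α ≡ 0 → α ≡ 0ω
N≡0⇒≡0 α@(x , y) N≡0 = cong₂ _,_ (square≡0 x sx) (square≡0 y sy)
  where
  sum≡0 : ∣ x ∣ ℕ.* ∣ x ∣ ℕ.+ ∣ y ∣ ℕ.* ∣ y ∣ ℕ.+ ∣ x - y ∣ ℕ.* ∣ x - y ∣ ≡ 0
  sum≡0 = ℤₚ.+-injective (trans (sym (2*norm x y))
            (cong (+ 2 *_) (trans (sym (norm-coordinates x y)) (cong +_ N≡0))))
  square≡0 : ∀ i → ∣ i ∣ ℕ.* ∣ i ∣ ≡ 0 → i ≡ + 0
  square≡0 i eq = ℤₚ.∣i∣≡0⇒i≡0 ([ (λ z → z) , (λ z → z) ]′ (ℕₚ.m*n≡0⇒m≡0∨n≡0 ∣ i ∣ eq))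
  sxy = ℕₚ.m+n≡0⇒m≡0 (∣ x ∣ ℕ.* ∣ x ∣ ℕ.+ ∣ y ∣ ℕ.* ∣ y ∣) sum≡0
  sx = ℕₚ.m+n≡0⇒m≡0 (∣ x ∣ ℕ.* ∣ x ∣) sxy
  sy = ℕₚ.m+n≡0⇒n≡0 (∣ x ∣ ℕ.* ∣ x ∣) sxy

N[0]≡0 : N 0ω ≡ 0
N[0]≡0 = N-ι (+ 0)

N-nonZero : ∀ {α} → ¬ α ≡ 0ω → ℕ.NonZero (N α)
N-nonZero {α} α≢0 = ℕ.≢-nonZero (λ eq → α≢0 (N≡0⇒≡0 α eq))

integral : ∀ α β → α ⊗ β ≡ 0ω → α ≡ 0ω ⊎ β ≡ 0ω
integral α β eq =
  Sum.map (N≡0⇒≡0 α) (N≡0⇒≡0 β) (ℕₚ.m*n≡0⇒m≡0∨n≡0 (N α) (trans (sym (N-⊗ α β)) (trans (cong N eq) N[0]≡0)))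

⊖≡0⇒≡ : ∀ {α β} → α ⊖ β ≡ 0ω → α ≡ β
⊖≡0⇒≡ {α} {β} eq = trans (solve 2 (λ a b → a := (a :- b) :+ b) refl α β) (trans (cong (_⊕ β) eq) (⊕-identityˡ β))

⊗-cancelˡ : ∀ μ {α β} → ¬ μ ≡ 0ω → μ ⊗ α ≡ μ ⊗ β → α ≡ β
⊗-cancelˡ μ {α} {β} μ≢0 eq =
  [ (λ z → contradiction z μ≢0) , ⊖≡0⇒≡ ]′
    (integral μ (α ⊖ β) (trans (solve 3 (λ m a b → m :* (a :- b) := m :* a :- m :* b) refl μ α β)
      (trans (cong (_⊖ μ ⊗ β) eq) (⊖-inverse (μ ⊗ β)))))

-- Divisibility and congruences in ℤ[ω]

infix 4 _∣𝔼_
-- A record over the opaque product, unlike `_∣ω_`: both arguments can be inferred from a proof, and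
-- nothing unfolds into coordinates. The congruence below is a record for the same reason.
record _∣𝔼_ (α β : Zω) : Set where
  constructor divides
  field
    quotient : Zω
    equality : β ≡ α ⊗ quotient

∣𝔼⇒∣ω : ∀ {α β} → α ∣𝔼 β → α ∣ω β
∣𝔼⇒∣ω {α} (divides γ eq) = γ , trans eq (⊗≡*ω α γ)

∣ω⇒∣𝔼 : ∀ {α β} → α ∣ω β → α ∣𝔼 β
∣ω⇒∣𝔼 {α} (γ , eq) = divides γ (trans eq (sym (⊗≡*ω α γ)))

∣𝔼-refl : ∀ {α} → α ∣𝔼 α
∣𝔼-refl {α} = divides 1ω (sym (⊗-identityʳ α))

∣𝔼-trans : ∀ {α β γ} → α ∣𝔼 β → β ∣𝔼 γ → α ∣𝔼 γ
∣𝔼-trans {α} (divides δ refl) (divides ε refl) = divides (δ ⊗ ε) (⊗-assoc α δ ε)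

∣𝔼-⊗ʳ : ∀ {μ α} β → μ ∣𝔼 α → μ ∣𝔼 α ⊗ β
∣𝔼-⊗ʳ {μ} β (divides δ refl) = divides (δ ⊗ β) (⊗-assoc μ δ β)

∣𝔼-⊗ˡ : ∀ {μ β} α → μ ∣𝔼 β → μ ∣𝔼 α ⊗ β
∣𝔼-⊗ˡ {μ} {β} α d = subst (μ ∣𝔼_) (⊗-comm β α) (∣𝔼-⊗ʳ α d)

∣𝔼-⊕ : ∀ {μ α β} → μ ∣𝔼 α → μ ∣𝔼 β → μ ∣𝔼 α ⊕ β
∣𝔼-⊕ {μ} (divides δ refl) (divides ε refl) = divides (δ ⊕ ε) (sym (⊗-distribˡ-⊕ μ δ ε))

∣𝔼-⊝ : ∀ {μ α} → μ ∣𝔼 α → μ ∣𝔼 ⊝ α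
∣𝔼-⊝ {μ} (divides δ refl) = divides (⊝ δ) (solve 2 (λ m d → :- (m :* d) := m :* :- d) refl μ δ)

∣𝔼-⊖ : ∀ {μ α β} → μ ∣𝔼 α → μ ∣𝔼 β → μ ∣𝔼 α ⊖ β
∣𝔼-⊖ p q = ∣𝔼-⊕ p (∣𝔼-⊝ q)

∣𝔼0 : ∀ {μ} → μ ∣𝔼 0ω
∣𝔼0 {μ} = divides 0ω (sym (⊗-zeroʳ μ))

0∣𝔼⇒≡0 : ∀ {α} → 0ω ∣𝔼 α → α ≡ 0ω
0∣𝔼⇒≡0 (divides γ eq) = trans eq (⊗-zeroˡ γ)

∣𝔼-conj : ∀ {α β} → α ∣𝔼 β → conj α ∣𝔼 conj β
∣𝔼-conj {α} (divides γ eq) = divides (conj γ) (trans (cong conj eq) (conj-⊗ α γ))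

∣𝔼⇒N∣N : ∀ {α β} → α ∣𝔼 β → N α ℕ∣.∣ N β
∣𝔼⇒N∣N {α} (divides γ refl) = ℕ∣.divides (N γ) (trans (N-⊗ α γ) (ℕₚ.*-comm (N α) (N γ)))

infix 4 _≈_mod_
record _≈_mod_ (α β μ : Zω) : Set where
  constructor congruent
  field ∣-difference : μ ∣𝔼 α ⊖ β
open _≈_mod_ public

module _ {μ : Zω} where
  mod-reflexive : ∀ {α β} → α ≡ β → α ≈ β mod μ
  mod-reflexive {α} refl = congruent (subst (μ ∣𝔼_) (sym (⊖-inverse α)) ∣𝔼0)

  mod-sym : ∀ {α β} → α ≈ β mod μ → β ≈ α mod μ
  mod-sym {α} {β} (congruent d) = congruent (subst (μ ∣𝔼_)
    (solve 2 (λ a b → :- (a :- b) := b :- a) refl α β) (∣𝔼-⊝ d))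

  mod-trans : ∀ {α β γ} → α ≈ β mod μ → β ≈ γ mod μ → α ≈ γ mod μ
  mod-trans {α} {β} {γ} (congruent d) (congruent e) = congruent (subst (μ ∣𝔼_)
    (solve 3 (λ a b c → (a :- b) :+ (b :- c) := a :- c) refl α β γ) (∣𝔼-⊕ d e))

  mod-⊕ : ∀ {α β γ δ} → α ≈ β mod μ → γ ≈ δ mod μ → α ⊕ γ ≈ β ⊕ δ mod μ
  mod-⊕ {α} {β} {γ} {δ} (congruent d) (congruent e) = congruent (subst (μ ∣𝔼_)
    (solve 4 (λ a b c d → (a :- b) :+ (c :- d) := (a :+ c) :- (b :+ d)) refl α β γ δ) (∣𝔼-⊕ d e))

  mod-⊝ : ∀ {α β} → α ≈ β mod μ → ⊝ α ≈ ⊝ β mod μ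
  mod-⊝ {α} {β} (congruent d) = congruent (subst (μ ∣𝔼_)
    (solve 2 (λ a b → :- (a :- b) := :- a :- :- b) refl α β) (∣𝔼-⊝ d))

  mod-⊗ : ∀ {α β γ δ} → α ≈ β mod μ → γ ≈ δ mod μ → α ⊗ γ ≈ β ⊗ δ mod μ
  mod-⊗ {α} {β} {γ} {δ} (congruent d) (congruent e) = congruent (subst (μ ∣𝔼_)
    (solve 4 (λ a b c d → (a :- b) :* c :+ b :* (c :- d) := a :* c :- b :* d) refl α β γ δ)
    (∣𝔼-⊕ (∣𝔼-⊗ʳ γ d) (∣𝔼-⊗ˡ β e)))

  mod-trivial : ∀ {α} → μ ∣𝔼 α → α ≈ 0ω mod μ
  mod-trivial {α} d = congruent (subst (μ ∣𝔼_) (solve 1 (λ a → a := a :- con (+ 0)) refl α) d)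

  mod-0⇒∣ : ∀ {α} → α ≈ 0ω mod μ → μ ∣𝔼 α
  mod-0⇒∣ {α} (congruent d) = subst (μ ∣𝔼_) (solve 1 (λ a → a :- con (+ 0) := a) refl α) d

mod-∣ : ∀ {μ ν α β} → ν ∣𝔼 μ → α ≈ β mod μ → α ≈ β mod ν
mod-∣ d (congruent e) = congruent (∣𝔼-trans d e)

mod-conj : ∀ {μ α β} → α ≈ β mod μ → conj α ≈ conj β mod conj μ
mod-conj {μ} {α} {β} (congruent d) = congruent (subst (conj μ ∣𝔼_) (conj-⊖ α β) (∣𝔼-conj d))

-- The quotient ring ℤ[ω]/μ keeps the carrier and changes only the equality, so that results about
-- arbitrary commutative rings, such as `Frobenius`, apply to it.
Mod : Zω → CommutativeRing 0ℓ 0ℓ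
Mod μ = record
  { Carrier = Zω ; _≈_ = _≈_mod μ ; _+_ = _⊕_ ; _*_ = _⊗_ ; -_ = ⊝_ ; 0# = 0ω ; 1# = 1ω
  ; isCommutativeRing = record
    { isRing = record
      { +-isAbelianGroup = record
        { isGroup = record
          { isMonoid = record
            { isSemigroup = record
              { isMagma = record
                { isEquivalence = record { refl = mod-reflexive refl ; sym = mod-sym ; trans = mod-trans }
                ; ∙-cong = mod-⊕ }
              ; assoc = λ α β γ → mod-reflexive (R.+-assoc α β γ) }
            ; identity = (λ α → mod-reflexive (R.+-identityˡ α)) , (λ α → mod-reflexive (R.+-identityʳ α)) }
          ; inverse = (λ α → mod-reflexive (R.-‿inverseˡ α)) , (λ α → mod-reflexive (R.-‿inverseʳ α))
          ; ⁻¹-cong = mod-⊝ }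
        ; comm = λ α β → mod-reflexive (R.+-comm α β) }
      ; *-cong = mod-⊗
      ; *-assoc = λ α β γ → mod-reflexive (R.*-assoc α β γ)
      ; *-identity = (λ α → mod-reflexive (R.*-identityˡ α)) , (λ α → mod-reflexive (R.*-identityʳ α))
      ; distrib = (λ α β γ → mod-reflexive (R.distribˡ α β γ)) , (λ α β γ → mod-reflexive (R.distribʳ α β γ))
      }
    ; *-comm = λ α β → mod-reflexive (R.*-comm α β)
    }
  }
  where module R = CommutativeRing Zω-commutativeRing

-- Divisibility and factorisation in ℤ[ω]

-- If r ≤ s, adding r(s - r) ≥ 0 to the norm gives s², and symmetrically for s ≤ r. Hence rounding
-- coordinates down, rather than to the nearest integer, is enough for division with remainder.
N-box : ∀ r s n → r ℕ.< n → s ℕ.< n → N (+ r , + s) ℕ.< n ℕ.* n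
N-box r s n r<n s<n = [ caseʳ , caseˡ ]′ (ℕₚ.≤-total r s)
  where
  bound : ∀ a u v t → + a + u * v ≡ + t * + t → (∃ λ k → u * v ≡ + k) → t ℕ.< n → a ℕ.< n ℕ.* n
  bound a u v t eq (k , uv≡k) t<n =
    ℕₚ.≤-<-trans (ℕₚ.≤-trans (ℕₚ.m≤m+n a k) (ℕₚ.≤-reflexive (ℤₚ.+-injective
      (trans (cong (_+_ (+ a)) (sym uv≡k)) (trans eq (sym (ℤₚ.pos-* t t))))))) (ℕₚ.*-mono-< t<n t<n)
  nonneg : ∀ {a b} → a ℕ.≤ b → ∀ c → ∃ λ k → + c * (+ b - + a) ≡ + k
  nonneg {a} {b} a≤b c = c ℕ.* (b ℕ.∸ a) ,
    trans (cong (+ c *_) (trans (ℤₚ.m-n≡m⊖n b a) (ℤₚ.⊖-≥ a≤b))) (sym (ℤₚ.pos-* c (b ℕ.∸ a)))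
  caseʳ : r ℕ.≤ s → N (+ r , + s) ℕ.< n ℕ.* n
  caseʳ r≤s = bound (N (+ r , + s)) (+ r) (+ s - + r) s
    (trans (cong (_+ + r * (+ s - + r)) (norm-coordinates (+ r) (+ s))) (h (+ r) (+ s))) (nonneg r≤s r) s<n
    where
    h : ∀ r s → r * r - r * s + s * s + r * (s - r) ≡ s * s
    h = solve-∀
  caseˡ : s ℕ.≤ r → N (+ r , + s) ℕ.< n ℕ.* n
  caseˡ s≤r = bound (N (+ r , + s)) (+ s) (+ r - + s) r
    (trans (cong (_+ + s * (+ r - + s)) (norm-coordinates (+ r) (+ s))) (h (+ r) (+ s))) (nonneg s≤r s) r<n
    where
    h : ∀ r s → r * r - r * s + s * s + s * (r - s) ≡ r * r
    h = solve-∀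

record DivisionWithRemainder (α β : Zω) : Set where
  field
    quotient remainder : Zω
    equality : α ≡ β ⊗ quotient ⊕ remainder
    smaller : N remainder ℕ.< N β

opaque
  unfolding _⊕_

  round-down : ∀ α n → .{{NonZero n}} → ∃ λ κ → ∃ λ r → ∃ λ s →
    r ℕ.< n × s ℕ.< n × α ≡ (+ r , + s) ⊕ ι (+ n) ⊗ κ
  round-down (u , v) n = (u ℤ÷./ℕ n , v ℤ÷./ℕ n) , u ℤ÷.%ℕ n , v ℤ÷.%ℕ n
    , ℤ÷.n%ℕd<d u n , ℤ÷.n%ℕd<d v n
    , trans (cong₂ _,_ (coordinate u) (coordinate v))
            (cong ((+ (u ℤ÷.%ℕ n) , + (v ℤ÷.%ℕ n)) ⊕_) (sym (ι-scale (+ n) (u ℤ÷./ℕ n) (v ℤ÷./ℕ n))))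
    where
    coordinate : ∀ w → w ≡ + (w ℤ÷.%ℕ n) + + n * (w ℤ÷./ℕ n)
    coordinate w = trans (ℤ÷.a≡a%ℕn+[a/ℕn]*n w n) (cong (_+_ (+ (w ℤ÷.%ℕ n))) (ℤₚ.*-comm (w ℤ÷./ℕ n) (+ n)))

-- Multiplying by `conj β` turns the divisor into the integer `N β`. The remainder times `conj β`
-- lies in the box of `N-box`, and cancelling one factor `N β` gives the bound.
divide : ∀ α β → ¬ β ≡ 0ω → DivisionWithRemainder α β
divide α β β≢0 with round-down (α ⊗ conj β) (N β) {{N-nonZero β≢0}}
... | κ , r , s , r<n , s<n , αβ̄≡ = record
  { quotient = κ ; remainder = α ⊖ β ⊗ κ
  ; equality = solve 2 (λ a b → a := b :+ (a :- b)) refl α (β ⊗ κ)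
  ; smaller = ℕₚ.*-cancelʳ-< (N β) (N (α ⊖ β ⊗ κ)) (N β) (subst (ℕ._< N β ℕ.* N β) norm≡ (N-box r s (N β) r<n s<n)) }
  where
  open ≡-Reasoning
  ρβ̄≡ : (α ⊖ β ⊗ κ) ⊗ conj β ≡ (+ r , + s)
  ρβ̄≡ = begin
    (α ⊖ β ⊗ κ) ⊗ conj β                            ≡⟨ solve 4 (λ a b k c → (a :- b :* k) :* c := a :* c :- b :* c :* k) refl α β κ (conj β) ⟩
    α ⊗ conj β ⊖ β ⊗ conj β ⊗ κ                     ≡⟨ cong₂ (λ s t → s ⊖ t ⊗ κ) αβ̄≡ (α⊗conj-α β) ⟩
    (+ r , + s) ⊕ ι (norm β) ⊗ κ ⊖ ι (norm β) ⊗ κ   ≡⟨ solve 2 (λ a b → a :+ b :- b := a) refl (+ r , + s) (ι (norm β) ⊗ κ) ⟩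
    (+ r , + s)                                     ∎
  norm≡ : N (+ r , + s) ≡ N (α ⊖ β ⊗ κ) ℕ.* N β
  norm≡ = begin
    N (+ r , + s)                      ≡⟨ cong N ρβ̄≡ ⟨
    N ((α ⊖ β ⊗ κ) ⊗ conj β)           ≡⟨ N-⊗ (α ⊖ β ⊗ κ) (conj β) ⟩
    N (α ⊖ β ⊗ κ) ℕ.* N (conj β)       ≡⟨ cong (N (α ⊖ β ⊗ κ) ℕ.*_) (N-conj β) ⟩
    N (α ⊖ β ⊗ κ) ℕ.* N β              ∎

infix 4 _∣𝔼?_
opaque
  _∣𝔼?_ : ∀ α β → Dec (α ∣𝔼 β)
  α ∣𝔼? β with α ≟ω 0ω
  ... | yes refl = map′ (λ { refl → ∣𝔼0 }) 0∣𝔼⇒≡0 (β ≟ω 0ω)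
  ... | no α≢0 = decide (divide β α α≢0)
    where
    decide : DivisionWithRemainder β α → Dec (α ∣𝔼 β)
    decide record { quotient = κ ; remainder = ρ ; equality = eq ; smaller = lt } with ρ ≟ω 0ω
    ... | yes refl = yes (divides κ (trans eq (⊕-identityʳ (α ⊗ κ))))
    ... | no ρ≢0 = no λ α∣β → ℕₚ.<⇒≱ lt (ℕ∣.∣⇒≤ {{N-nonZero ρ≢0}} (∣𝔼⇒N∣N
      (subst (α ∣𝔼_) (trans (cong (_⊖ α ⊗ κ) eq) (solve 2 (λ a b → a :+ b :- a := b) refl (α ⊗ κ) ρ))
        (∣𝔼-⊖ α∣β (∣𝔼-⊗ʳ κ ∣𝔼-refl)))))

record BézoutDivisor (α β : Zω) : Set where
  field
    g s t : Zω
    g∣α : g ∣𝔼 α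
    g∣β : g ∣𝔼 β
    combination : g ≡ α ⊗ s ⊕ β ⊗ t

opaque
  bézout : ∀ α β → BézoutDivisor α β
  bézout α β = go α β (<-wellFounded (N β))
    where
    go : ∀ α β → Acc ℕ._<_ (N β) → BézoutDivisor α β
    go α β (acc rec) with β ≟ω 0ω
    ... | yes refl = record { g = α ; s = 1ω ; t = 0ω ; g∣α = ∣𝔼-refl ; g∣β = ∣𝔼0
                            ; combination = solve 1 (λ a → a := a :* con (+ 1) :+ con (+ 0) :* con (+ 0)) refl α }
    ... | no β≢0 = step (divide α β β≢0)
      where
      step : DivisionWithRemainder α β → BézoutDivisor α β
      step record { quotient = κ ; remainder = ρ ; equality = eq ; smaller = lt }
        with go β ρ (rec lt)
      ... | record { g = g ; s = s ; t = t ; g∣α = g∣β ; g∣β = g∣ρ ; combination = comb } = record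
        { g = g ; s = t ; t = s ⊖ κ ⊗ t
        ; g∣α = subst (g ∣𝔼_) (sym eq) (∣𝔼-⊕ (∣𝔼-⊗ʳ κ g∣β) g∣ρ)
        ; g∣β = g∣β
        ; combination = trans comb (trans
            (solve 5 (λ b k r s t → b :* s :+ r :* t := (b :* k :+ r) :* t :+ b :* (s :- k :* t)) refl β κ ρ s t)
            (cong (λ a → a ⊗ t ⊕ β ⊗ (s ⊖ κ ⊗ t)) (sym eq))) }

N≡1⇒unit : ∀ {ε} → N ε ≡ 1 → ε ⊗ conj ε ≡ 1ω
N≡1⇒unit {ε} N≡1 = trans (α⊗conj-α ε) (cong (ι ∘ +_) N≡1)

unit⇒N≡1 : ∀ {ε η} → ε ⊗ η ≡ 1ω → N ε ≡ 1
unit⇒N≡1 {ε} {η} eq = ℕₚ.m*n≡1⇒m≡1 (N ε) (N η) (trans (sym (N-⊗ ε η)) (trans (cong N eq) (N-ι (+ 1))))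

∣1⇒N≡1 : ∀ {ε} → ε ∣𝔼 1ω → N ε ≡ 1
∣1⇒N≡1 (divides η eq) = unit⇒N≡1 (sym eq)

∣unit⊗⇒∣ : ∀ {π ε α} → N ε ≡ 1 → π ∣𝔼 ε ⊗ α → π ∣𝔼 α
∣unit⊗⇒∣ {π} {ε} {α} N≡1 d = subst (π ∣𝔼_) (begin
  conj ε ⊗ (ε ⊗ α)  ≡⟨ solve 3 (λ e c a → c :* (e :* a) := e :* c :* a) refl ε (conj ε) α ⟩
  ε ⊗ conj ε ⊗ α    ≡⟨ cong (_⊗ α) (N≡1⇒unit {ε} N≡1) ⟩
  1ω ⊗ α            ≡⟨ ⊗-identityˡ α ⟩
  α                 ∎) (∣𝔼-⊗ˡ (conj ε) d)
  where open ≡-Reasoning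

record Prime𝔼 (π : Zω) : Set where
  field
    ≢0 : ¬ π ≡ 0ω
    N≢1 : ¬ N π ≡ 1
    euclid : ∀ α β → π ∣𝔼 α ⊗ β → π ∣𝔼 α ⊎ π ∣𝔼 β

  ∤1 : ¬ π ∣𝔼 1ω
  ∤1 d = N≢1 (∣1⇒N≡1 d)

prime⇒PrimeZω : ∀ {π} → Prime𝔼 π → PrimeZω π
prime⇒PrimeZω {π} P = ≢0
  , (λ (η , eq) → N≢1 (unit⇒N≡1 {π} {η} (trans (⊗≡*ω π η) eq)))
  , λ α β d → Sum.map ∣𝔼⇒∣ω ∣𝔼⇒∣ω (euclid α β (subst (π ∣𝔼_) (sym (⊗≡*ω α β)) (∣ω⇒∣𝔼 d)))
  where open Prime𝔼 P

PrimeZω⇒prime : ∀ {π} → PrimeZω π → Prime𝔼 π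
PrimeZω⇒prime {π} (≢0 , ¬unit , euclid) = record
  { ≢0 = ≢0
  ; N≢1 = λ N≡1 → ¬unit (conj π , trans (sym (⊗≡*ω π (conj π))) (N≡1⇒unit {π} N≡1))
  ; euclid = λ α β d → Sum.map ∣ω⇒∣𝔼 ∣ω⇒∣𝔼 (euclid α β (∣𝔼⇒∣ω (subst (π ∣𝔼_) (⊗≡*ω α β) d))) }

prime-conj : ∀ {π} → Prime𝔼 π → Prime𝔼 (conj π)
prime-conj {π} P = record
  { ≢0 = λ eq → ≢0 (trans (sym (conj-involutive π)) (trans (cong conj eq) (conj-ι (+ 0))))
  ; N≢1 = λ eq → N≢1 (trans (sym (N-conj π)) eq)
  ; euclid = λ α β d → Sum.map (back α) (back β) (euclid (conj α) (conj β)
      (subst₂ _∣𝔼_ (conj-involutive π) (conj-⊗ α β) (∣𝔼-conj d))) }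
  where
  open Prime𝔼 P
  back : ∀ α → π ∣𝔼 conj α → conj π ∣𝔼 α
  back α d = subst (conj π ∣𝔼_) (conj-involutive α) (∣𝔼-conj d)

-- Irreducibility is phrased by norms of divisors because these are easy to list: 1 and p when π has
-- prime norm p, and 1, p, p² when π is a rational prime. The Bézout divisor of π and α is then a
-- unit or an associate of π.
irreducible⇒prime : ∀ {π} → ¬ π ≡ 0ω → ¬ N π ≡ 1 →
  (∀ {δ} → δ ∣𝔼 π → N δ ≡ 1 ⊎ N δ ≡ N π) → Prime𝔼 π
irreducible⇒prime {π} π≢0 N≢1 irr = record { ≢0 = π≢0 ; N≢1 = N≢1 ; euclid = euclid }
  where
  instance _ = N-nonZero π≢0
  euclid : ∀ α β → π ∣𝔼 α ⊗ β → π ∣𝔼 α ⊎ π ∣𝔼 β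
  euclid α β π∣αβ with bézout π α
  ... | record { g = g ; s = s ; t = t ; g∣α = divides κ π≡gκ ; g∣β = g∣α ; combination = comb } with irr (divides κ π≡gκ)
  ...   | inj₁ Ng≡1 = inj₂ (∣unit⊗⇒∣ {ε = g} Ng≡1 (subst (π ∣𝔼_) (begin
    π ⊗ (s ⊗ β) ⊕ α ⊗ β ⊗ t    ≡⟨ solve 5 (λ p a s t b → p :* (s :* b) :+ a :* b :* t := (p :* s :+ a :* t) :* b) refl π α s t β ⟩
    (π ⊗ s ⊕ α ⊗ t) ⊗ β        ≡⟨ cong (_⊗ β) comb ⟨
    g ⊗ β                      ∎) (∣𝔼-⊕ (∣𝔼-⊗ʳ (s ⊗ β) ∣𝔼-refl) (∣𝔼-⊗ʳ t π∣αβ))))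
    where open ≡-Reasoning
  ...   | inj₂ Ng≡Nπ = inj₁ (∣𝔼-trans π∣g g∣α)
    where
    open ≡-Reasoning
    Nκ≡1 : N κ ≡ 1
    Nκ≡1 = ℕₚ.*-cancelˡ-≡ (N κ) 1 (N π) (begin
      N π ℕ.* N κ  ≡⟨ cong (ℕ._* N κ) Ng≡Nπ ⟨
      N g ℕ.* N κ  ≡⟨ N-⊗ g κ ⟨
      N (g ⊗ κ)    ≡⟨ cong N π≡gκ ⟨
      N π          ≡⟨ ℕₚ.*-identityʳ (N π) ⟨
      N π ℕ.* 1    ∎)
    π∣g : π ∣𝔼 g
    π∣g = ∣unit⊗⇒∣ {ε = κ} Nκ≡1 (subst (π ∣𝔼_) (trans π≡gκ (⊗-comm g κ)) ∣𝔼-refl)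

prime≢1 : ∀ {p} → Prime p → ¬ p ≡ 1
prime≢1 P refl = ¬prime[1] P

prime≢0 : ∀ {p} → Prime p → ¬ p ≡ 0
prime≢0 P eq = ℕ.≢-nonZero⁻¹ _ {{prime⇒nonZero P}} eq

N-prime⇒prime : ∀ {π} → Prime (N π) → Prime𝔼 π
N-prime⇒prime {π} P = irreducible⇒prime
  (λ { refl → prime≢0 P N[0]≡0 }) (prime≢1 P) (λ d → prime⇒irreducible P (∣𝔼⇒N∣N d))

∣p²⇒ : ∀ {p d} → Prime p → d ℕ∣.∣ p ℕ.* p → d ≡ 1 ⊎ d ≡ p ⊎ d ≡ p ℕ.* p
∣p²⇒ {p} {d} P d∣p² = [ multiple , coprime d∣p² ]′ (split (p ℕ∣.∣? d))
  where
  instance _ = prime⇒nonZero P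
  split : ∀ {A : Set} → Dec A → A ⊎ ¬ A
  split (yes a) = inj₁ a
  split (no ¬a) = inj₂ ¬a
  multiple : p ℕ∣.∣ d → d ≡ 1 ⊎ d ≡ p ⊎ d ≡ p ℕ.* p
  multiple (ℕ∣.divides e refl) =
    inj₂ (Sum.map (λ { refl → ℕₚ.*-identityˡ p }) (λ { refl → refl }) (prime⇒irreducible P (ℕ∣.*-cancelʳ-∣ {m = e} {n = p} p d∣p²)))
  coprime : d ℕ∣.∣ p ℕ.* p → ¬ p ℕ∣.∣ d → d ≡ 1 ⊎ d ≡ p ⊎ d ≡ p ℕ.* p
  coprime (ℕ∣.divides q eq) p∤d = [ quotient , (λ p∣d → contradiction p∣d p∤d) ]′
      (euclidsLemma q d P (subst (p ℕ∣.∣_) eq (ℕ∣.m∣m*n p)))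
    where
    quotient : p ℕ∣.∣ q → d ≡ 1 ⊎ d ≡ p ⊎ d ≡ p ℕ.* p
    quotient (ℕ∣.divides r refl) = [ inj₁ , (λ { refl → contradiction ℕ∣.∣-refl p∤d }) ]′
      (prime⇒irreducible P (ℕ∣.divides r (ℕₚ.*-cancelʳ-≡ p (r ℕ.* d) p (begin
        p ℕ.* p        ≡⟨ eq ⟩
        r ℕ.* p ℕ.* d  ≡⟨ ℕₚ.*-assoc r p d ⟩
        r ℕ.* (p ℕ.* d) ≡⟨ cong (r ℕ.*_) (ℕₚ.*-comm p d) ⟩
        r ℕ.* (d ℕ.* p) ≡⟨ ℕₚ.*-assoc r d p ⟨
        r ℕ.* d ℕ.* p  ∎))))
      where open ≡-Reasoning

-- From 2N = x² + y² + (x - y)². It confines the elements of a given norm to a finite box, which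
-- makes `N-attained?` a finite search.
N-coordinate-bound : ∀ x y → ∣ x ∣ ℕ.≤ 2 ℕ.* N (x , y) × ∣ y ∣ ℕ.≤ 2 ℕ.* N (x , y)
N-coordinate-bound x y = ℕₚ.≤-trans (square x) (ℕₚ.≤-trans (ℕₚ.≤-trans (ℕₚ.m≤m+n sx sy) (ℕₚ.m≤m+n (sx ℕ.+ sy) sz)) (ℕₚ.≤-reflexive eq))
                       , ℕₚ.≤-trans (square y) (ℕₚ.≤-trans (ℕₚ.≤-trans (ℕₚ.m≤n+m sy sx) (ℕₚ.m≤m+n (sx ℕ.+ sy) sz)) (ℕₚ.≤-reflexive eq))
  where
  sx = ∣ x ∣ ℕ.* ∣ x ∣
  sy = ∣ y ∣ ℕ.* ∣ y ∣
  sz = ∣ x - y ∣ ℕ.* ∣ x - y ∣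
  square : ∀ i → ∣ i ∣ ℕ.≤ ∣ i ∣ ℕ.* ∣ i ∣
  square i with ∣ i ∣
  ... | zero = ℕ.z≤n
  ... | suc n = ℕₚ.m≤m*n (suc n) (suc n)
  h : ∀ x y → x * x + y * y + (x - y) * (x - y) ≡ + 2 * (x * x - x * y + y * y)
  h = solve-∀
  eq : sx ℕ.+ sy ℕ.+ sz ≡ 2 ℕ.* N (x , y)
  eq = ℤₚ.+-injective (begin
    + sx + + sy + + sz                   ≡⟨ cong₂ _+_ (cong₂ _+_ (i*i≡∣i∣² x) (i*i≡∣i∣² y)) (i*i≡∣i∣² (x - y)) ⟨
    x * x + y * y + (x - y) * (x - y)    ≡⟨ h x y ⟩
    + 2 * (x * x - x * y + y * y)        ≡⟨ cong (+ 2 *_) (norm-coordinates x y) ⟨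
    + 2 * norm (x , y)                   ≡⟨ ℤₚ.pos-* 2 (N (x , y)) ⟨
    + (2 ℕ.* N (x , y))                  ∎)
    where open ≡-Reasoning

opaque
  -- Decides whether a rational prime splits by looking for an element of that norm; a prime that is
  -- not a norm is inert by `N-unattained⇒inert`.
  N-attained? : ∀ n → Dec (∃ λ α → N α ≡ n)
  N-attained? n = map′ found sought (ℕₚ.anyUpTo? (λ i → ℕₚ.anyUpTo? (λ j → attained? i j) B) B)
    where
    B : ℕ
    B = suc (2 ℕ.* n)
    Attained : ℕ → ℕ → Set
    Attained i j = (N (+ i , + j) ≡ n ⊎ N (+ i , - + j) ≡ n) ⊎ (N (- + i , + j) ≡ n ⊎ N (- + i , - + j) ≡ n)
    attained? : ∀ i j → Dec (Attained i j)
    attained? i j = ((N (+ i , + j) ℕₚ.≟ n) ⊎-dec (N (+ i , - + j) ℕₚ.≟ n))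
             ⊎-dec ((N (- + i , + j) ℕₚ.≟ n) ⊎-dec (N (- + i , - + j) ℕₚ.≟ n))
    found : (∃ λ i → i ℕ.< B × (∃ λ j → j ℕ.< B × Attained i j)) → ∃ λ α → N α ≡ n
    found (i , _ , j , _ , inj₁ (inj₁ e)) = _ , e
    found (i , _ , j , _ , inj₁ (inj₂ e)) = _ , e
    found (i , _ , j , _ , inj₂ (inj₁ e)) = _ , e
    found (i , _ , j , _ , inj₂ (inj₂ e)) = _ , e
    signs : ∀ x y → N (x , y) ≡ n → Attained ∣ x ∣ ∣ y ∣
    signs (+ i) (+ j) e = inj₁ (inj₁ e)
    signs (+ i) -[1+ j ] e = inj₁ (inj₂ e)
    signs -[1+ i ] (+ j) e = inj₂ (inj₁ e)
    signs -[1+ i ] -[1+ j ] e = inj₂ (inj₂ e)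
    sought : (∃ λ α → N α ≡ n) → ∃ λ i → i ℕ.< B × (∃ λ j → j ℕ.< B × Attained i j)
    sought ((x , y) , refl) =
      ∣ x ∣ , ℕ.s≤s (proj₁ (N-coordinate-bound x y)) , ∣ y ∣ , ℕ.s≤s (proj₂ (N-coordinate-bound x y)) , signs x y refl

N-unattained⇒inert : ∀ {p} → Prime p → ¬ (∃ λ α → N α ≡ p) → Prime𝔼 (ι (+ p))
N-unattained⇒inert {p} P none = irreducible⇒prime
  (λ eq → prime≢0 P (ℤₚ.+-injective (ι-injective eq)))
  (λ eq → prime≢1 P (ℕₚ.m*n≡1⇒m≡1 p p (trans (sym (N-ι (+ p))) eq)))
  (λ {δ} d → [ inj₁ , [ (λ e → contradiction (δ , e) none) , (λ e → inj₂ (trans e (sym (N-ι (+ p))))) ]′ ]′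
    (∣p²⇒ P (subst (N δ ℕ∣.∣_) (N-ι (+ p)) (∣𝔼⇒N∣N d))))

∣⇒∣𝔼 : ∀ {m n} → m ℕ∣.∣ n → ι (+ m) ∣𝔼 ι (+ n)
∣⇒∣𝔼 {m} (ℕ∣.divides q refl) = divides (ι (+ q)) (trans (cong ι (trans (ℤₚ.pos-* q m) (ℤₚ.*-comm (+ q) (+ m)))) (ι-⊗ (+ m) (+ q)))

N∣p²⇒∣prime : ∀ {β p} → Prime p → N β ≡ p ℕ.* p → β ∣𝔼 ι (+ p) → ι (+ p) ∣𝔼 β
N∣p²⇒∣prime {β} {p} P Nβ (divides κ p≡βκ) = divides (conj κ) (begin
  β                       ≡⟨ ⊗-identityʳ β ⟨
  β ⊗ 1ω                  ≡⟨ cong (β ⊗_) (N≡1⇒unit {κ} Nκ≡1) ⟨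
  β ⊗ (κ ⊗ conj κ)        ≡⟨ ⊗-assoc β κ (conj κ) ⟨
  β ⊗ κ ⊗ conj κ          ≡⟨ cong (_⊗ conj κ) p≡βκ ⟨
  ι (+ p) ⊗ conj κ        ∎)
  where
  open ≡-Reasoning
  instance _ = prime⇒nonZero P
  instance _ = ℕₚ.m*n≢0 p p
  Nκ≡1 : N κ ≡ 1
  Nκ≡1 = ℕₚ.*-cancelˡ-≡ (N κ) 1 (p ℕ.* p) (begin
    p ℕ.* p ℕ.* N κ   ≡⟨ cong (ℕ._* N κ) Nβ ⟨
    N β ℕ.* N κ       ≡⟨ N-⊗ β κ ⟨
    N (β ⊗ κ)         ≡⟨ cong N p≡βκ ⟨
    N (ι (+ p))       ≡⟨ N-ι (+ p) ⟩
    p ℕ.* p           ≡⟨ ℕₚ.*-identityʳ (p ℕ.* p) ⟨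
    p ℕ.* p ℕ.* 1     ∎)

opaque
  prime-divisor-ℕ : ∀ n → .{{NonZero n}} → ¬ n ≡ 1 → ∃ λ p → Prime p × p ℕ∣.∣ n
  prime-divisor-ℕ n n≢1 with factorise n
  ... | record { factors = [] ; isFactorisation = eq } = contradiction eq n≢1
  ... | record { factors = p ∷ ps ; isFactorisation = eq ; factorsPrime = P ∷ _ } =
    p , P , ℕ∣.divides (product ps) (trans eq (ℕₚ.*-comm p (product ps)))

-- For p ∣ N β, the gcd of β and p is a non-unit whose norm divides p²; if it is p²
-- then p ∣ β, and p is either inert or divisible by an element of norm p.
opaque
  prime-divisor : ∀ β → ¬ β ≡ 0ω → ¬ N β ≡ 1 → ∃ λ π → Prime𝔼 π × π ∣𝔼 β
  prime-divisor β β≢0 N≢1 = common (prime-divisor-ℕ (N β) {{N-nonZero β≢0}} N≢1)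
    where
    Goal : Set
    Goal = ∃ λ π → Prime𝔼 π × π ∣𝔼 β
    module _ {p : ℕ} (P : Prime p) (p∣Nβ : p ℕ∣.∣ N β) (B : BézoutDivisor β (ι (+ p))) where
      open BézoutDivisor B
      -- Were g a unit, p ∣ β conj β would give p ∣ conj β by the Bézout identity, hence p ∣ β by
      -- conjugation, hence p ∣ g.
      g-nonunit : ¬ N g ≡ 1
      g-nonunit Ng≡1 = prime≢1 P (ℕₚ.m*n≡1⇒m≡1 p p (trans (sym (N-ι (+ p))) (∣1⇒N≡1 p∣1)))
        where
        p∣conjβ : ι (+ p) ∣𝔼 conj β
        p∣conjβ = ∣unit⊗⇒∣ {ε = g} Ng≡1 (subst (ι (+ p) ∣𝔼_)
          (trans (solve 5 (λ b c s p t → b :* c :* s :+ p :* (t :* c) := (b :* s :+ p :* t) :* c) refl β (conj β) s (ι (+ p)) t)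
                 (cong (_⊗ conj β) (sym combination)))
          (∣𝔼-⊕ (∣𝔼-⊗ʳ s (subst (ι (+ p) ∣𝔼_) (sym (α⊗conj-α β)) (∣⇒∣𝔼 p∣Nβ))) (∣𝔼-⊗ʳ (t ⊗ conj β) ∣𝔼-refl)))
        p∣1 : ι (+ p) ∣𝔼 1ω
        p∣1 = ∣unit⊗⇒∣ {ε = g} Ng≡1 (subst (ι (+ p) ∣𝔼_) (trans (sym combination) (sym (⊗-identityʳ g)))
          (∣𝔼-⊕ (∣𝔼-⊗ʳ s (subst₂ _∣𝔼_ (conj-ι (+ p)) (conj-involutive β) (∣𝔼-conj p∣conjβ))) (∣𝔼-⊗ʳ t ∣𝔼-refl)))
      p∣β : N g ≡ p ℕ.* p → ι (+ p) ∣𝔼 β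
      p∣β Ng≡p² = ∣𝔼-trans (N∣p²⇒∣prime P Ng≡p² g∣β) g∣α
      split-or-inert : N g ≡ p ℕ.* p → Dec (∃ λ α → N α ≡ p) → Goal
      split-or-inert Ng≡p² (yes (α , refl)) =
        α , N-prime⇒prime P , ∣𝔼-trans (divides (conj α) (sym (α⊗conj-α α))) (p∣β Ng≡p²)
      split-or-inert Ng≡p² (no none) = ι (+ p) , N-unattained⇒inert P none , p∣β Ng≡p²
      conclude : N g ≡ 1 ⊎ N g ≡ p ⊎ N g ≡ p ℕ.* p → Goal
      conclude (inj₁ Ng≡1) = contradiction Ng≡1 g-nonunit
      conclude (inj₂ (inj₁ Ng≡p)) = g , N-prime⇒prime (subst Prime (sym Ng≡p) P) , g∣α
      conclude (inj₂ (inj₂ Ng≡p²)) = split-or-inert Ng≡p² (N-attained? p)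
    common : (∃ λ p → Prime p × p ℕ∣.∣ N β) → Goal
    common (p , P , p∣Nβ) = 
      conclude P p∣Nβ (bézout β (ι (+ p)))
        (∣p²⇒ P (subst (N (BézoutDivisor.g (bézout β (ι (+ p)))) ℕ∣.∣_) (N-ι (+ p)) (∣𝔼⇒N∣N (BézoutDivisor.g∣β (bézout β (ι (+ p)))))))

Π : List Zω → Zω
Π = foldr _⊗_ 1ω

Π≡prodω : ∀ αs → Π αs ≡ prodω αs
Π≡prodω [] = refl
Π≡prodω (α ∷ αs) = trans (cong (α ⊗_) (Π≡prodω αs)) (⊗≡*ω α (prodω αs))

record Factorisation (β : Zω) : Set where
  field
    ε : Zω
    primes : List Zω
    unit : N ε ≡ 1
    allPrime : All Prime𝔼 primes
    product≡ : β ≡ ε ⊗ Π primes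

opaque
  factor : ∀ β → ¬ β ≡ 0ω → Factorisation β
  factor β β≢0 = go β β≢0 (<-wellFounded (N β))
    where
    go : ∀ β → ¬ β ≡ 0ω → Acc ℕ._<_ (N β) → Factorisation β
    go β β≢0 (acc rec) with N β ℕₚ.≟ 1
    ... | yes N≡1 = record { ε = β ; primes = [] ; unit = N≡1 ; allPrime = [] ; product≡ = sym (⊗-identityʳ β) }
    ... | no N≢1 with prime-divisor β β≢0 N≢1
    ...   | π , P , divides κ eq = cons (go κ κ≢0 (rec Nκ<Nβ))
      where
      κ≢0 : ¬ κ ≡ 0ω
      κ≢0 refl = β≢0 (trans eq (⊗-zeroʳ π))
      N>1 : ∀ n → ¬ n ≡ 0 → ¬ n ≡ 1 → 1 ℕ.< n
      N>1 zero n≢0 _ = contradiction refl n≢0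
      N>1 (suc zero) _ n≢1 = contradiction refl n≢1
      N>1 (suc (suc n)) _ _ = ℕ.s≤s (ℕ.s≤s ℕ.z≤n)
      Nκ<Nβ : N κ ℕ.< N β
      Nκ<Nβ = subst (N κ ℕ.<_) (trans (ℕₚ.*-comm (N κ) (N π)) (trans (sym (N-⊗ π κ)) (cong N (sym eq))))
        (ℕₚ.m<m*n (N κ) (N π) {{N-nonZero κ≢0}} (N>1 (N π) (λ e → Prime𝔼.≢0 P (N≡0⇒≡0 π e)) (Prime𝔼.N≢1 P)))
      cons : Factorisation κ → Factorisation β
      cons F = record { ε = F.ε ; primes = π ∷ F.primes ; unit = F.unit ; allPrime = P ∷ F.allPrime
                      ; product≡ = trans eq (trans (cong (π ⊗_) F.product≡)
                          (solve 3 (λ p e q → p :* (e :* q) := e :* (p :* q)) refl π F.ε (Π F.primes))) }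
        where module F = Factorisation F

opaque
  prime∣prime⇒associate : ∀ {π ρ} → Prime𝔼 π → Prime𝔼 ρ → π ∣𝔼 ρ → ∃ λ ε → N ε ≡ 1 × ρ ≡ π ⊗ ε
  prime∣prime⇒associate {π} {ρ} P R (divides ε refl) with Prime𝔼.euclid R π ε ∣𝔼-refl
  ... | inj₁ (divides w π≡ρw) = ε , unit⇒N≡1 {ε} {w} (⊗-cancelˡ π (Prime𝔼.≢0 P)
    (trans (sym (⊗-assoc π ε w)) (trans (sym π≡ρw) (sym (⊗-identityʳ π))))) , refl
  ... | inj₂ (divides v ε≡ρv) = contradiction (unit⇒N≡1 {π} {v} (⊗-cancelˡ ε (λ { refl → Prime𝔼.≢0 R (⊗-zeroʳ π) })
    (trans (solve 3 (λ e p v → e :* (p :* v) := p :* e :* v) refl ε π v) (trans (sym ε≡ρv) (sym (⊗-identityʳ ε)))))) (Prime𝔼.N≢1 P)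

module _ (f : Zω → Zω) (f-assoc : ∀ {π ρ} → Prime𝔼 π → Prime𝔼 ρ → π ∣𝔼 ρ → f π ≡ f ρ) where
  extract : ∀ {π} → Prime𝔼 π → ∀ ρs → All Prime𝔼 ρs → π ∣𝔼 Π ρs →
    ∃ λ ε → ∃ λ σs → N ε ≡ 1 × All Prime𝔼 σs × Π ρs ≡ π ⊗ (ε ⊗ Π σs) × Π (map f ρs) ≡ f π ⊗ Π (map f σs)
  extract P [] [] d = contradiction d (Prime𝔼.∤1 P)
  extract {π} P (ρ ∷ ρs) (R ∷ Rs) d with Prime𝔼.euclid P ρ (Π ρs) d
  ... | inj₁ π∣ρ = let ε , u , ρ≡πε = prime∣prime⇒associate P R π∣ρ in
    ε , ρs , u , Rs , trans (cong (_⊗ Π ρs) ρ≡πε) (⊗-assoc π ε (Π ρs)) , cong (_⊗ Π (map f ρs)) (sym (f-assoc P R π∣ρ))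
  ... | inj₂ π∣ρs with extract P ρs Rs π∣ρs
  ...   | ε , σs , u , Ss , eq , eqf = ε , ρ ∷ σs , u , R ∷ Ss
    , trans (cong (ρ ⊗_) eq) (solve 4 (λ r p e q → r :* (p :* (e :* q)) := p :* (e :* (r :* q))) refl ρ π ε (Π σs))
    , trans (cong (f ρ ⊗_) eqf) (solve 3 (λ r p q → r :* (p :* q) := p :* (r :* q)) refl (f ρ) (f π) (Π (map f σs)))

  -- Unique factorisation seen through a function f that is constant on associates. Only the product
  -- of the values of f matters for the symbol, so permutations and unit factors of the two lists
  -- need not be recorded.
  unique : ∀ πs ρs → All Prime𝔼 πs → All Prime𝔼 ρs → ∀ {ε η} → N ε ≡ 1 → N η ≡ 1 →
    ε ⊗ Π πs ≡ η ⊗ Π ρs → Π (map f πs) ≡ Π (map f ρs)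
  unique [] [] _ _ _ _ _ = refl
  unique [] (ρ ∷ ρs) _ (R ∷ _) {ε} {η} u v eq =
    contradiction (∣unit⊗⇒∣ {ε = ε} u (subst (ρ ∣𝔼_) (sym eq) (∣𝔼-⊗ˡ η (∣𝔼-⊗ʳ (Π ρs) ∣𝔼-refl)))) (Prime𝔼.∤1 R)
  unique (π ∷ πs) ρs (P ∷ Ps) Rs {ε} {η} u v eq
    with extract P ρs Rs (∣unit⊗⇒∣ {ε = η} v (subst (π ∣𝔼_) eq (∣𝔼-⊗ˡ ε (∣𝔼-⊗ʳ (Π πs) ∣𝔼-refl))))
  ... | θ , σs , w , Ss , eqρ , eqf = trans (cong (f π ⊗_) (unique πs σs Ps Ss {ε} {η ⊗ θ} u
      (trans (N-⊗ η θ) (cong₂ ℕ._*_ v w))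
      (⊗-cancelˡ π (Prime𝔼.≢0 P) (begin
        π ⊗ (ε ⊗ Π πs)          ≡⟨ solve 3 (λ p e q → p :* (e :* q) := e :* (p :* q)) refl π ε (Π πs) ⟩
        ε ⊗ (π ⊗ Π πs)          ≡⟨ eq ⟩
        η ⊗ Π ρs                ≡⟨ cong (η ⊗_) eqρ ⟩
        η ⊗ (π ⊗ (θ ⊗ Π σs))    ≡⟨ solve 4 (λ h p t q → h :* (p :* (t :* q)) := p :* (h :* t :* q)) refl η π θ (Π σs) ⟩
        π ⊗ (η ⊗ θ ⊗ Π σs)      ∎)))) (sym eqf)
    where open ≡-Reasoning

opaque
  -- π divides π conj π = N π and so one of the rational primes p in that norm; then N π divides N p
  -- = p².
  prime-over-rational : ∀ {π} → Prime𝔼 π → ∃ λ p → Prime p × π ∣𝔼 ι (+ p) × (N π ≡ p ⊎ N π ≡ p ℕ.* p)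
  prime-over-rational {π} P = go (factorise (N π) {{N-nonZero ≢0}})
    where
    open Prime𝔼 P
    search : ∀ ps → All Prime ps → π ∣𝔼 ι (+ product ps) → ∃ λ p → Prime p × π ∣𝔼 ι (+ p)
    search [] _ d = contradiction d ∤1
    search (p ∷ ps) (Q ∷ Qs) d with euclid (ι (+ p)) (ι (+ product ps))
      (subst (π ∣𝔼_) (trans (cong ι (ℤₚ.pos-* p (product ps))) (ι-⊗ (+ p) (+ product ps))) d)
    ... | inj₁ π∣p = p , Q , π∣p
    ... | inj₂ π∣ps = search ps Qs π∣ps
    go : PrimeFactorisation (N π) → ∃ λ p → Prime p × π ∣𝔼 ι (+ p) × (N π ≡ p ⊎ N π ≡ p ℕ.* p)
    go F with search (PrimeFactorisation.factors F) (PrimeFactorisation.factorsPrime F)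
      (subst (λ n → π ∣𝔼 ι (+ n)) (PrimeFactorisation.isFactorisation F) (divides (conj π) (sym (α⊗conj-α π))))
    ... | p , Q , π∣p = p , Q , π∣p , [ (λ e → contradiction e N≢1) , (λ e → e) ]′
        (∣p²⇒ Q (subst (N π ℕ∣.∣_) (N-ι (+ p)) (∣𝔼⇒N∣N π∣p)))

-- The Frobenius map in characteristic q

nC0≡1 : ∀ n → n choose 0 ≡ 1
nC0≡1 n = trans (nCk≡nC[n∸k] {k = 0} {n = n} ℕ.z≤n) (nCn≡1 n)

absorption : ∀ n k → suc k ℕ.* (suc n choose suc k) ≡ suc n ℕ.* (n choose k)
absorption zero zero = refl
absorption zero (suc k) = trans (cong (suc (suc k) ℕ.*_) (k>n⇒nCk≡0 (ℕ.s≤s (ℕ.s≤s (ℕ.z≤n {k})))))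
  (trans (ℕₚ.*-zeroʳ (suc (suc k))) (sym (cong (1 ℕ.*_) (k>n⇒nCk≡0 (ℕ.s≤s (ℕ.z≤n {k}))))))
absorption (suc n) zero = begin
  1 ℕ.* (suc (suc n) choose 1)               ≡⟨ cong (1 ℕ.*_) (nCk+nC[k+1]≡[n+1]C[k+1] (suc n) 0) ⟨
  1 ℕ.* ((suc n choose 0) ℕ.+ (suc n choose 1))   ≡⟨ ℕₚ.*-distribˡ-+ 1 (suc n choose 0) (suc n choose 1) ⟩
  1 ℕ.* (suc n choose 0) ℕ.+ 1 ℕ.* (suc n choose 1) ≡⟨ cong₂ (λ a b → 1 ℕ.* a ℕ.+ b) (nC0≡1 (suc n)) (trans (absorption n 0) (trans (cong (suc n ℕ.*_) (nC0≡1 n)) (ℕₚ.*-identityʳ (suc n)))) ⟩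
  suc (suc n)                           ≡⟨ ℕₚ.*-identityʳ (suc (suc n)) ⟨
  suc (suc n) ℕ.* 1                     ≡⟨ cong (suc (suc n) ℕ.*_) (nC0≡1 (suc n)) ⟨
  suc (suc n) ℕ.* (suc n choose 0)           ∎
  where open ≡-Reasoning
absorption (suc n) (suc k) = begin
  suc (suc k) ℕ.* (suc (suc n) choose suc (suc k))   ≡⟨ cong (suc (suc k) ℕ.*_) (nCk+nC[k+1]≡[n+1]C[k+1] (suc n) (suc k)) ⟨
  suc (suc k) ℕ.* (c₁ ℕ.+ c₂)                   ≡⟨ h₁ k c₁ c₂ ⟩
  suc k ℕ.* c₁ ℕ.+ suc (suc k) ℕ.* c₂ ℕ.+ c₁    ≡⟨ cong₂ (λ a b → a ℕ.+ b ℕ.+ c₁) (absorption n k) (absorption n (suc k)) ⟩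
  suc n ℕ.* (n choose k) ℕ.+ suc n ℕ.* (n choose suc k) ℕ.+ c₁ ≡⟨ cong (ℕ._+ c₁) (ℕₚ.*-distribˡ-+ (suc n) (n choose k) (n choose suc k)) ⟨
  suc n ℕ.* ((n choose k) ℕ.+ (n choose suc k)) ℕ.+ c₁    ≡⟨ cong (λ a → suc n ℕ.* a ℕ.+ c₁) (nCk+nC[k+1]≡[n+1]C[k+1] n k) ⟩
  suc n ℕ.* c₁ ℕ.+ c₁                           ≡⟨ ℕₚ.+-comm (suc n ℕ.* c₁) c₁ ⟩
  suc (suc n) ℕ.* c₁                            ∎
  where
  open ≡-Reasoning
  c₁ = suc n choose suc k
  c₂ = suc n choose suc (suc k)
  h₁ : ∀ k a b → suc (suc k) ℕ.* (a ℕ.+ b) ≡ suc k ℕ.* a ℕ.+ suc (suc k) ℕ.* b ℕ.+ a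
  h₁ = ℕSolver.solve-∀

prime∣pCk : ∀ {n k} → Prime (suc n) → suc k ℕ.< suc n → suc n ℕ∣.∣ suc n choose suc k
prime∣pCk {n} {k} P k<n =
  [ (λ d → contradiction (ℕ∣.∣⇒≤ d) (ℕₚ.<⇒≱ k<n)) , (λ d → d) ]′
    (euclidsLemma (suc k) (suc n choose suc k) P
      (ℕ∣.divides (n choose k) (trans (absorption n k) (ℕₚ.*-comm (suc n) (n choose k)))))

-- Used for two rings of characteristic q: ℤ[ω]/q, and the group ring of ℤ/p with coefficients in
-- ℤ[ω]/q.
module Frobenius {c ℓ} (R : CommutativeRing c ℓ) {n} (P : Prime (suc n))
  (char : ∀ x → CommutativeRing._≈_ R (Mult._×_ (CommutativeRing.semiring R) (suc n) x) (CommutativeRing.0# R)) where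
  open CommutativeRing R using (Carrier; _≈_; 0#; 1#; semiring; commutativeSemiring; setoid; +-cong; +-congˡ; *-cong; *-congˡ; *-congʳ; +-identityˡ; +-identityʳ; +-comm; *-identityˡ; *-identityʳ; zeroˡ)
    renaming (_+_ to _⊞_; _*_ to _⊠_; refl to ≈-refl; sym to ≈-sym; trans to ≈-trans; reflexive to ≈-reflexive)
  open Mult semiring using (×-assocˡ; ×-congʳ; ×-congˡ; ×-homo-1) renaming (_×_ to _·_)
  open Exp semiring using (_^_; ^-congˡ)
  open Sums semiring using (sum; sum-cong-≋; sum-replicate-zero; sum-init-last)
  open Binomial commutativeSemiring using (theorem; binomialTerm)
  open import Relation.Binary.Reasoning.Setoid setoid

  multiple≈0 : ∀ {m} x → suc n ℕ∣.∣ m → m · x ≈ 0#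
  multiple≈0 x (ℕ∣.divides k refl) = begin
    (k ℕ.* suc n) · x   ≈⟨ ×-congˡ (ℕₚ.*-comm k (suc n)) ⟩
    (suc n ℕ.* k) · x   ≈⟨ ×-assocˡ x (suc n) k ⟨
    suc n · (k · x)     ≈⟨ char (k · x) ⟩
    0#                  ∎

  ^-distrib-⊞ : ∀ x y → (x ⊞ y) ^ suc n ≈ x ^ suc n ⊞ y ^ suc n
  ^-distrib-⊞ x y = begin
    (x ⊞ y) ^ suc n                       ≈⟨ theorem (suc n) x y ⟩
    term zero ⊞ sum (term ∘ suc)          ≈⟨ +-cong first (sum-init-last (term ∘ suc)) ⟩
    y ^ suc n ⊞ (sum middle ⊞ last)       ≈⟨ +-congˡ (+-cong middle≈0 last≈) ⟩
    y ^ suc n ⊞ (0# ⊞ x ^ suc n)          ≈⟨ +-congˡ (+-identityˡ (x ^ suc n)) ⟩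
    y ^ suc n ⊞ x ^ suc n                 ≈⟨ +-comm (y ^ suc n) (x ^ suc n) ⟩
    x ^ suc n ⊞ y ^ suc n                 ∎
    where
    term = binomialTerm x y (suc n)
    middle = λ (i : Fin n) → term (suc (inject₁ i))
    last = term (suc (fromℕ n))
    first : term zero ≈ y ^ suc n
    first = ≈-trans (×-congˡ (nC0≡1 (suc n))) (≈-trans (×-homo-1 _) (*-identityˡ (y ^ suc n)))
    middle≈0 : sum middle ≈ 0#
    middle≈0 = ≈-trans (sum-cong-≋ (λ i → multiple≈0 _ (subst (λ k → suc n ℕ∣.∣ suc n choose suc k) (sym (Finₚ.toℕ-inject₁ i))
      (prime∣pCk P (ℕ.s≤s (Finₚ.toℕ<n i)))))) (sum-replicate-zero n)
    last≈ : last ≈ x ^ suc n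
    last≈ = begin
      (suc n choose suc (toℕ (fromℕ n))) · (x ^ suc (toℕ (fromℕ n)) ⊠ y ^ (n ℕ.∸ toℕ (fromℕ n)))
        ≡⟨ cong (λ k → (suc n choose suc k) · (x ^ suc k ⊠ y ^ (n ℕ.∸ k))) (Finₚ.toℕ-fromℕ n) ⟩
      (suc n choose suc n) · (x ^ suc n ⊠ y ^ (n ℕ.∸ n))
        ≡⟨ cong₂ (λ a b → a · (x ^ suc n ⊠ y ^ b)) (nCn≡1 (suc n)) (ℕₚ.n∸n≡0 n) ⟩
      1 · (x ^ suc n ⊠ 1#)   ≈⟨ ×-homo-1 _ ⟩
      x ^ suc n ⊠ 1#         ≈⟨ *-identityʳ (x ^ suc n) ⟩
      x ^ suc n              ∎

  ^-distrib-sum : ∀ {m} (f : Fin m → Carrier) → sum f ^ suc n ≈ sum (λ i → f i ^ suc n)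
  ^-distrib-sum {zero} f = zeroˡ (0# ^ n)
  ^-distrib-sum {suc m} f = ≈-trans (^-distrib-⊞ (f zero) (sum (f ∘ suc))) (+-congˡ (^-distrib-sum (f ∘ suc)))

-- Fermat and Euler congruences in ℤ[ω]

infixr 8 _↑_
_↑_ : Zω → ℕ → Zω
α ↑ zero = 1ω
α ↑ suc k = α ⊗ α ↑ k

↑≡^ω : ∀ α k → α ↑ k ≡ α ^ω k
↑≡^ω α zero = refl
↑≡^ω α (suc k) = trans (⊗≡*ω α (α ↑ k)) (cong (α *ω_) (↑≡^ω α k))

↑-+ : ∀ α m n → α ↑ (m ℕ.+ n) ≡ α ↑ m ⊗ α ↑ n
↑-+ α zero n = sym (⊗-identityˡ (α ↑ n))
↑-+ α (suc m) n = trans (cong (α ⊗_) (↑-+ α m n)) (sym (⊗-assoc α (α ↑ m) (α ↑ n)))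

↑-* : ∀ α m n → α ↑ (n ℕ.* m) ≡ (α ↑ m) ↑ n
↑-* α m zero = refl
↑-* α m (suc n) = trans (↑-+ α m (n ℕ.* m)) (cong (α ↑ m ⊗_) (↑-* α m n))

↑-⊗ : ∀ α β n → (α ⊗ β) ↑ n ≡ α ↑ n ⊗ β ↑ n
↑-⊗ α β zero = sym (⊗-identityʳ 1ω)
↑-⊗ α β (suc n) = trans (cong (α ⊗ β ⊗_) (↑-⊗ α β n))
  (solve 4 (λ a b c d → a :* b :* (c :* d) := a :* c :* (b :* d)) refl α β (α ↑ n) (β ↑ n))

1↑ : ∀ n → 1ω ↑ n ≡ 1ω
1↑ zero = refl
1↑ (suc n) = trans (⊗-identityˡ (1ω ↑ n)) (1↑ n)

conj-↑ : ∀ α n → conj (α ↑ n) ≡ conj α ↑ n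
conj-↑ α zero = conj-ι (+ 1)
conj-↑ α (suc n) = trans (conj-⊗ α (α ↑ n)) (cong (conj α ⊗_) (conj-↑ α n))

mod-↑ : ∀ {μ α β} n → α ≈ β mod μ → α ↑ n ≈ β ↑ n mod μ
mod-↑ zero e = mod-reflexive refl
mod-↑ (suc n) e = mod-⊗ e (mod-↑ n e)

prime∣↑⇒∣ : ∀ {π α} → Prime𝔼 π → ∀ n → π ∣𝔼 α ↑ n → π ∣𝔼 α
prime∣↑⇒∣ P zero d = contradiction d (Prime𝔼.∤1 P)
prime∣↑⇒∣ {α = α} P (suc n) d = [ (λ e → e) , prime∣↑⇒∣ P n ]′ (Prime𝔼.euclid P α (α ↑ n) d)

Mod-^ : ∀ μ α n → Exp._^_ (CommutativeRing.semiring (Mod μ)) α n ≡ α ↑ n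
Mod-^ μ α zero = refl
Mod-^ μ α (suc n) = cong (α ⊗_) (Mod-^ μ α n)

Mod-× : ∀ μ n α → Mult._×_ (CommutativeRing.semiring (Mod μ)) n α ≡ ι (+ n) ⊗ α
Mod-× μ zero α = sym (⊗-zeroˡ α)
Mod-× μ (suc n) α = trans (cong (α ⊕_) (Mod-× μ n α))
  (trans (solve 2 (λ a m → a :+ m :* a := (con (+ 1) :+ m) :* a) refl α (ι (+ n)))
         (cong (_⊗ α) (sym (ι-⊕ (+ 1) (+ n)))))

Mod-characteristic : ∀ n α → Mult._×_ (CommutativeRing.semiring (Mod (ι (+ n)))) n α ≈ 0ω mod ι (+ n)
Mod-characteristic n α = mod-trans (mod-reflexive (Mod-× (ι (+ n)) n α)) (mod-trivial (∣𝔼-⊗ʳ α ∣𝔼-refl))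

freshman : ∀ {q} → Prime q → ∀ α β → (α ⊕ β) ↑ q ≈ α ↑ q ⊕ β ↑ q mod ι (+ q)
freshman {zero} Q α β = contradiction refl (prime≢0 Q)
freshman {q@(suc n)} Q α β = subst₂ (_≈_mod ι (+ q)) (Mod-^ (ι (+ q)) (α ⊕ β) q)
  (cong₂ _⊕_ (Mod-^ (ι (+ q)) α q) (Mod-^ (ι (+ q)) β q))
  (Frobenius.^-distrib-⊞ (Mod (ι (+ q))) Q (Mod-characteristic q) α β)

∣⇒ι∣ι : ∀ {m n} → m ℤ∣.∣ n → ι m ∣𝔼 ι n
∣⇒ι∣ι {m} (ℤ∣.divides k refl) = divides (ι k) (trans (cong ι (ℤₚ.*-comm k m)) (ι-⊗ m k))

ι-mod : ∀ {m a b} → m ℤ∣.∣ a - b → ι a ≈ ι b mod ι m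
ι-mod {m} {a} {b} d = congruent (subst (ι m ∣𝔼_) (trans (ι-⊕ a (- b)) (cong (ι a ⊕_) (ι-⊝ b))) (∣⇒ι∣ι d))

-- Induction with `freshman` covers natural numbers; a general integer is first replaced by its
-- least residue.
fermat : ∀ {q} → Prime q → ∀ a → ι a ↑ q ≈ ι a mod ι (+ q)
fermat {q} Q a = mod-trans (mod-↑ q a≈r) (mod-trans (natural r) (mod-sym a≈r))
  where
  instance
    _ : NonZero q
    _ = prime⇒nonZero Q
  r : ℕ
  r = a ℤ÷.%ℕ q
  a≈r : ι a ≈ ι (+ r) mod ι (+ q)
  a≈r = ι-mod (ℤ∣.divides (a ℤ÷./ℕ q) (trans (cong (_- + r) (ℤ÷.a≡a%ℕn+[a/ℕn]*n a q)) (h (+ r) (a ℤ÷./ℕ q * + q))))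
    where
    h : ∀ r b → r + b - r ≡ b
    h = solve-∀
  zero↑ : ∀ k → .{{NonZero k}} → 0ω ↑ k ≡ 0ω
  zero↑ (suc k) = ⊗-zeroˡ (0ω ↑ k)
  natural : ∀ n → ι (+ n) ↑ q ≈ ι (+ n) mod ι (+ q)
  natural zero = mod-reflexive (zero↑ q)
  natural (suc n) = subst (λ α → α ↑ q ≈ α mod ι (+ q)) (sym (ι-⊕ (+ 1) (+ n)))
    (mod-trans (freshman Q 1ω (ι (+ n))) (mod-⊕ (mod-reflexive (1↑ q)) (natural n)))

prime[3] : Prime 3
prime[3] = from-yes (prime? 3)

square-mod-3 : ∀ s → ¬ 3 ℕ∣.∣ s → ∃ λ k → s ℕ.* s ≡ 1 ℕ.+ 3 ℕ.* k
square-mod-3 s 3∤s = go (s ℕ÷.% 3) (s ℕ÷./ 3) (ℕ÷.m%n<n s 3) (ℕ÷.m≡m%n+[m/n]*n s 3)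
  where
  go : ∀ r t → r ℕ.< 3 → s ≡ r ℕ.+ t ℕ.* 3 → ∃ λ k → s ℕ.* s ≡ 1 ℕ.+ 3 ℕ.* k
  go 0 t _ eq = contradiction (ℕ∣.divides t eq) 3∤s
  go 1 t _ refl = 2 ℕ.* t ℕ.+ 3 ℕ.* t ℕ.* t , h t
    where
    h : ∀ t → (1 ℕ.+ t ℕ.* 3) ℕ.* (1 ℕ.+ t ℕ.* 3) ≡ 1 ℕ.+ 3 ℕ.* (2 ℕ.* t ℕ.+ 3 ℕ.* t ℕ.* t)
    h = ℕSolver.solve-∀
  go 2 t _ refl = 1 ℕ.+ 4 ℕ.* t ℕ.+ 3 ℕ.* t ℕ.* t , h t
    where
    h : ∀ t → (2 ℕ.+ t ℕ.* 3) ℕ.* (2 ℕ.+ t ℕ.* 3) ≡ 1 ℕ.+ 3 ℕ.* (1 ℕ.+ 4 ℕ.* t ℕ.+ 3 ℕ.* t ℕ.* t)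
    h = ℕSolver.solve-∀
  go (suc (suc (suc _))) _ (ℕ.s≤s (ℕ.s≤s (ℕ.s≤s ()))) _

-- x² - xy + y² = (x + y)² - 3xy, so the norm is a square modulo 3.
N-mod-3 : ∀ α → ¬ 3 ℕ∣.∣ N α → ∃ λ e → N α ≡ 1 ℕ.+ 3 ℕ.* e
N-mod-3 α@(x , y) 3∤N = conclude (square-mod-3 s 3∤s)
  where
  s : ℕ
  s = ∣ x + y ∣
  N≡ : + N α ≡ + (s ℕ.* s) - + 3 * (x * y)
  N≡ = trans (norm-coordinates x y) (trans (h x y) (cong (_- + 3 * (x * y)) (i*i≡∣i∣² (x + y))))
    where
    h : ∀ x y → x * x - x * y + y * y ≡ (x + y) * (x + y) - + 3 * (x * y)
    h = solve-∀
  3∤s : ¬ 3 ℕ∣.∣ s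
  3∤s 3∣s = 3∤N (ℤ∣.∣⇒∣ᵤ {+ 3} {+ N α} (subst (+ 3 ℤ∣.∣_) (sym N≡)
    (ℤ∣.∣m∣n⇒∣m-n (ℤ∣.∣ᵤ⇒∣ {+ 3} {+ (s ℕ.* s)} (ℕ∣.∣m⇒∣m*n s 3∣s)) (ℤ∣.∣m⇒∣m*n {m = + 3} (x * y) ℤ∣.∣-refl))))
  conclude : (∃ λ k → s ℕ.* s ≡ 1 ℕ.+ 3 ℕ.* k) → ∃ λ e → N α ≡ 1 ℕ.+ 3 ℕ.* e
  conclude (k , eq) = from-divisor (N α) 3∣N-1 (λ N≡0 → 3∤N (subst (3 ℕ∣.∣_) (sym N≡0) (3 ℕ∣.∣0)))
    where
    3∣N-1 : + 3 ℤ∣.∣ + N α - + 1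
    3∣N-1 = ℤ∣.divides (+ k - x * y) (trans (cong (_- + 1) (trans N≡ (cong (_- + 3 * (x * y))
      (trans (cong +_ eq) (trans (ℤₚ.pos-+ 1 (3 ℕ.* k)) (cong (_+_ (+ 1)) (ℤₚ.pos-* 3 k))))))) (h (+ k) (x * y)))
      where
      h : ∀ k z → (+ 1 + + 3 * k) - + 3 * z - + 1 ≡ (k - z) * + 3
      h = solve-∀
    from-divisor : ∀ n → + 3 ℤ∣.∣ + n - + 1 → ¬ n ≡ 0 → ∃ λ e → n ≡ 1 ℕ.+ 3 ℕ.* e
    from-divisor zero _ n≢0 = contradiction refl n≢0
    from-divisor (suc n) d _ with ℤ∣.∣⇒∣ᵤ d
    ... | ℕ∣.divides e eq = e , cong suc (trans eq (ℕₚ.*-comm e 3))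

prime-square-mod-3 : ∀ {q} → Prime q → ¬ q ≡ 3 → ∃ λ k → q ℕ.* q ≡ 1 ℕ.+ 3 ℕ.* k
prime-square-mod-3 {q} Q q≢3 = square-mod-3 q (λ 3∣q → [ (λ ()) , (λ e → q≢3 (sym e)) ]′ (prime⇒irreducible Q 3∣q))

ω↑ : ∀ k → ωω ↑ (1 ℕ.+ 3 ℕ.* k) ≡ ωω
ω↑ k = trans (cong (ωω ⊗_) (trans (cong (ωω ↑_) (ℕₚ.*-comm 3 k)) (trans (↑-* ωω 3 k) (trans (cong (_↑ k) ω³) (1↑ k))))) (⊗-identityʳ ωω)
  where
  ω³ : ωω ↑ 3 ≡ 1ω
  ω³ = trans (cong (λ z → ωω ⊗ (ωω ⊗ z)) (⊗-identityʳ ωω)) (trans (cong (ωω ⊗_) ω⊗ω) ω⊗ω²)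

-- Frobenius fixes the rational coordinates and sends ω to ω^q. Applied twice it fixes ω as well,
-- since q² ≡ 1 modulo 3.
fermat² : ∀ {q} → Prime q → ¬ q ≡ 3 → ∀ α → α ↑ (q ℕ.* q) ≈ α mod ι (+ q)
fermat² {q} Q q≢3 α@(x , y) = subst (_≈ α mod ι (+ q)) (sym (↑-* α q q))
  (mod-trans (mod-↑ q (frobenius α ω-form))
  (mod-trans (frobenius (ι x ⊕ ι y ⊗ ωω ↑ q) (mod-reflexive refl))
  (mod-reflexive (trans (cong (λ z → ι x ⊕ ι y ⊗ z) ω-fixed) (sym (ω-expansion x y))))))
  where
  ω-form : α ≈ ι x ⊕ ι y ⊗ ωω mod ι (+ q)
  ω-form = mod-reflexive (ω-expansion x y)
  frobenius : ∀ β {ζ} → β ≈ ι x ⊕ ι y ⊗ ζ mod ι (+ q) → β ↑ q ≈ ι x ⊕ ι y ⊗ ζ ↑ q mod ι (+ q)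
  frobenius β {ζ} e = mod-trans (mod-↑ q e) (mod-trans (freshman Q (ι x) (ι y ⊗ ζ))
    (mod-⊕ (fermat Q x) (mod-trans (mod-reflexive (↑-⊗ (ι y) ζ q)) (mod-⊗ (fermat Q y) (mod-reflexive refl)))))
  ω-fixed : (ωω ↑ q) ↑ q ≡ ωω
  ω-fixed = trans (sym (↑-* ωω q q)) (trans (cong (ωω ↑_) (proj₂ (prime-square-mod-3 Q q≢3))) (ω↑ (proj₁ (prime-square-mod-3 Q q≢3))))

infix 4 _⊥ℤ_
record _⊥ℤ_ (a b : ℤ) : Set where
  constructor comaximal
  field
    s t : ℤ
    equality : a * s + b * t ≡ + 1

coprime⇒⊥ℤ : ∀ a b → (∀ {d} → d ℕ∣.∣ ∣ a ∣ × d ℕ∣.∣ ∣ b ∣ → d ≡ 1) → a ⊥ℤ b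
coprime⇒⊥ℤ a b c = go (coprime-Bézout c)
  where
  unsign : ∀ a → ∃ λ u → + ∣ a ∣ ≡ a * u
  unsign a@(+ _) = + 1 , sym (ℤₚ.*-identityʳ a)
  unsign a@(-[1+ n ]) = - + 1 , trans (sym (ℤₚ.*-identityʳ (- a))) (h a)
    where
    h : ∀ a → - a * + 1 ≡ a * - + 1
    h = solve-∀
  u = proj₁ (unsign a)
  v = proj₁ (unsign b)
  h₁ : ∀ a b x y u v → a * (u * x) + b * (- (v * y)) ≡ x * (a * u) - y * (b * v)
  h₁ = solve-∀
  h₂ : ∀ y b → + 1 + y * b - y * b ≡ + 1
  h₂ = solve-∀
  lift : ∀ x y m n → 1 ℕ.+ y ℕ.* n ≡ x ℕ.* m → + 1 + + y * + n ≡ + x * + m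
  lift x y m n eq = trans (cong (_+_ (+ 1)) (sym (ℤₚ.pos-* y n))) (trans (sym (ℤₚ.pos-+ 1 (y ℕ.* n))) (trans (cong +_ eq) (ℤₚ.pos-* x m)))
  combine : ∀ a b u v → + ∣ a ∣ ≡ a * u → + ∣ b ∣ ≡ b * v → ∀ x y → 1 ℕ.+ y ℕ.* ∣ b ∣ ≡ x ℕ.* ∣ a ∣ → a * (u * + x) + b * (- (v * + y)) ≡ + 1
  combine a b u v eu ev x y eq = begin
    a * (u * + x) + b * (- (v * + y))      ≡⟨ h₁ a b (+ x) (+ y) u v ⟩
    + x * (a * u) - + y * (b * v)          ≡⟨ cong₂ (λ p q → + x * p - + y * q) eu ev ⟨
    + x * + ∣ a ∣ - + y * + ∣ b ∣          ≡⟨ cong (_- + y * + ∣ b ∣) (lift x y ∣ a ∣ ∣ b ∣ eq) ⟨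
    + 1 + + y * + ∣ b ∣ - + y * + ∣ b ∣    ≡⟨ h₂ (+ y) (+ ∣ b ∣) ⟩
    + 1                                    ∎
    where open ≡-Reasoning
  go : Bézout.Identity 1 ∣ a ∣ ∣ b ∣ → a ⊥ℤ b
  go (Bézout.+- x y eq) = comaximal (u * + x) (- (v * + y)) (combine a b u v (proj₂ (unsign a)) (proj₂ (unsign b)) x y eq)
  go (Bézout.-+ x y eq) = comaximal (- (u * + x)) (v * + y) (trans (ℤₚ.+-comm (a * - (u * + x)) (b * (v * + y)))
    (combine b a v u (proj₂ (unsign b)) (proj₂ (unsign a)) y x eq))

prime∤⇒⊥ℤ : ∀ {p} → Prime p → ∀ {a} → ¬ p ℕ∣.∣ ∣ a ∣ → + p ⊥ℤ a
prime∤⇒⊥ℤ {p} P {a} p∤a = coprime⇒⊥ℤ (+ p) a λ (d∣p , d∣a) →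
  [ (λ e → e) , (λ { refl → contradiction d∣a p∤a }) ]′ (prime⇒irreducible P d∣p)

-- Modulo π = x + yω one has ω ≡ -x/y, and y is invertible modulo p = N π. So ℤ maps onto ℤ[ω]/π.
rational-residue : ∀ {π} → Prime (N π) → ∀ α → ∃ λ a → α ≈ ι a mod π
rational-residue {π@(x , y)} P α@(a , b) = a - b * (x * t) , mod-trans (mod-reflexive (ω-expansion a b))
    (mod-trans (mod-⊕ (mod-reflexive {α = ι a} refl) (mod-⊗ (mod-reflexive {α = ι b} refl) ω≈))
      (mod-reflexive (trans (cong (ι a ⊕_) (trans (cong (ι b ⊗_) (sym (ι-⊝ (x * t)))) (sym (ι-⊗ b (- (x * t))))))
        (trans (sym (ι-⊕ a (b * - (x * t)))) (cong ι (h₂ a b (x * t)))))))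
  where
  p : ℕ
  p = N π
  h₂ : ∀ a b c → a + b * - c ≡ a - b * c
  h₂ = solve-∀
  -- If p ∣ y, then p ∣ x² and so p ∣ x, which makes p² divide the norm p.
  p∤y : ¬ p ℕ∣.∣ ∣ y ∣
  p∤y p∣y = prime≢1 P (ℕₚ.m*n≡1⇒m≡1 p p (p≡p²*⇒ p (prime⇒nonZero P) (ℤ∣.∣⇒∣ᵤ p²∣p)))
    where
    p≡p²*⇒ : ∀ p → NonZero p → p ℕ.* p ℕ∣.∣ p → p ℕ.* p ≡ 1
    p≡p²*⇒ p nz d = cong₂ ℕ._*_ p≡1 p≡1
      where
      p≡1 : p ≡ 1
      p≡1 = ℕ∣.∣1⇒≡1 (ℕ∣.*-cancelˡ-∣ p {{nz}} (subst (p ℕ.* p ℕ∣.∣_) (sym (ℕₚ.*-identityʳ p)) d))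
    q∣y : + p ℤ∣.∣ y
    q∣y = ℤ∣.∣ᵤ⇒∣ p∣y
    h : ∀ x y → x * x ≡ x * x - x * y + y * y - (y - x) * y
    h = solve-∀
    q∣x : + p ℤ∣.∣ x
    q∣x = ℤ∣.∣ᵤ⇒∣ ([ (λ d → d) , (λ d → d) ]′ (euclidsLemma ∣ x ∣ ∣ x ∣ P (subst (p ℕ∣.∣_) (ℤₚ.abs-* x x)
      (ℤ∣.∣⇒∣ᵤ (subst (+ p ℤ∣.∣_) (trans (cong (_- (y - x) * y) (norm-coordinates x y)) (sym (h x y)))
        (ℤ∣.∣m∣n⇒∣m-n {+ p} {+ p} ℤ∣.∣-refl (ℤ∣.∣n⇒∣m*n (y - x) q∣y)))))))
    p²∣p : + (p ℕ.* p) ℤ∣.∣ + p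
    p²∣p = go q∣x q∣y
      where
      h′ : ∀ c d p → (c * p) * (c * p) - (c * p) * (d * p) + (d * p) * (d * p) ≡ (c * c - c * d + d * d) * (p * p)
      h′ = solve-∀
      go : + p ℤ∣.∣ x → + p ℤ∣.∣ y → + (p ℕ.* p) ℤ∣.∣ + p
      go (ℤ∣.divides c ex) (ℤ∣.divides d ey) = ℤ∣.divides (c * c - c * d + d * d) (begin
        + p                        ≡⟨ norm-coordinates x y ⟩
        x * x - x * y + y * y      ≡⟨ cong₂ (λ x y → x * x - x * y + y * y) ex ey ⟩
        (c * + p) * (c * + p) - (c * + p) * (d * + p) + (d * + p) * (d * + p) ≡⟨ h′ c d (+ p) ⟩
        (c * c - c * d + d * d) * (+ p * + p) ≡⟨ cong ((c * c - c * d + d * d) *_) (ℤₚ.pos-* p p) ⟨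
        (c * c - c * d + d * d) * + (p ℕ.* p) ∎)
        where open ≡-Reasoning
  open _⊥ℤ_ (prime∤⇒⊥ℤ P {y} p∤y) using (s; t; equality)
  ω≈ : ωω ≈ ⊝ ι (x * t) mod π
  ω≈ = congruent (subst (π ∣𝔼_) (begin
    π ⊗ ι t ⊕ ι (+ p) ⊗ (ι s ⊗ ωω)
      ≡⟨ cong (λ z → z ⊗ ι t ⊕ ι (+ p) ⊗ (ι s ⊗ ωω)) (ω-expansion x y) ⟩
    (ι x ⊕ ι y ⊗ ωω) ⊗ ι t ⊕ ι (+ p) ⊗ (ι s ⊗ ωω)
      ≡⟨ solve 6 (λ x y w t p s → (x :+ y :* w) :* t :+ p :* (s :* w) := (p :* s :+ y :* t) :* w :+ x :* t) refl (ι x) (ι y) ωω (ι t) (ι (+ p)) (ι s) ⟩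
    (ι (+ p) ⊗ ι s ⊕ ι y ⊗ ι t) ⊗ ωω ⊕ ι x ⊗ ι t
      ≡⟨ cong₂ (λ u v → u ⊗ ωω ⊕ v) (trans (sym (trans (ι-⊕ (+ p * s) (y * t)) (cong₂ _⊕_ (ι-⊗ (+ p) s) (ι-⊗ y t)))) (cong ι equality)) (sym (ι-⊗ x t)) ⟩
    1ω ⊗ ωω ⊕ ι (x * t)
      ≡⟨ solve 2 (λ w c → con (+ 1) :* w :+ c := w :- :- c) refl ωω (ι (x * t)) ⟩
    ωω ⊖ ⊝ ι (x * t) ∎)
    (∣𝔼-⊕ (∣𝔼-⊗ʳ (ι t) ∣𝔼-refl) (∣𝔼-⊗ʳ (ι s ⊗ ωω) (divides (conj π) (sym (α⊗conj-α π))))))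
    where open ≡-Reasoning

module _ {π} (P : Prime𝔼 π) (π∤3 : ¬ π ∣𝔼 ι (+ 3)) where
  3∤N : ¬ 3 ℕ∣.∣ N π
  3∤N 3∣N = go (prime-over-rational P)
    where
    go : ¬ (∃ λ p → Prime p × π ∣𝔼 ι (+ p) × (N π ≡ p ⊎ N π ≡ p ℕ.* p))
    go (p , Q , π∣p , N≡) = π∤3 (subst (λ n → π ∣𝔼 ι (+ n)) (sym 3≡p) π∣p)
      where
      3∣p : 3 ℕ∣.∣ p
      3∣p = [ (λ e → subst (3 ℕ∣.∣_) e 3∣N) , (λ e → [ (λ d → d) , (λ d → d) ]′ (euclidsLemma p p prime[3] (subst (3 ℕ∣.∣_) e 3∣N))) ]′ N≡
      3≡p : 3 ≡ p
      3≡p = [ (λ ()) , (λ e → e) ]′ (prime⇒irreducible Q 3∣p)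

  -- Obtained without counting the residue field: for norm p² it is `fermat²`, and for norm p every
  -- α is congruent to a rational integer, where `fermat` applies.
  euler : ∀ α → α ↑ N π ≈ α mod π
  euler α = go (prime-over-rational P)
    where
    go : (∃ λ p → Prime p × π ∣𝔼 ι (+ p) × (N π ≡ p ⊎ N π ≡ p ℕ.* p)) → α ↑ N π ≈ α mod π
    go (p , Q , π∣p , inj₂ N≡p²) = subst (λ n → α ↑ n ≈ α mod π) (sym N≡p²)
      (mod-∣ π∣p (fermat² Q (λ { refl → π∤3 π∣p }) α))
    go (p , Q , π∣p , inj₁ N≡p) = mod-trans (mod-↑ (N π) α≈a)
      (mod-trans (subst (λ n → ι a ↑ n ≈ ι a mod π) (sym N≡p) (mod-∣ π∣p (fermat Q a))) (mod-sym α≈a))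
      where
      residue : ∃ λ a → α ≈ ι a mod π
      residue = rational-residue (subst Prime (sym N≡p) Q) α
      a : ℤ
      a = proj₁ residue
      α≈a : α ≈ ι a mod π
      α≈a = proj₂ residue

-- The cubic residue symbol

pattern is0 e = inj₁ e
pattern is1 e = inj₂ (inj₁ e)
pattern isω e = inj₂ (inj₂ (inj₁ e))
pattern isω² e = inj₂ (inj₂ (inj₂ e))

opaque
  unfolding _⊕_

  cubicValue-⊗ : ∀ {χ ψ} → IsCubicValue χ → IsCubicValue ψ → IsCubicValue (χ ⊗ ψ)
  cubicValue-⊗ (is0 refl) (is0 refl) = is0 refl
  cubicValue-⊗ (is0 refl) (is1 refl) = is0 refl
  cubicValue-⊗ (is0 refl) (isω refl) = is0 refl
  cubicValue-⊗ (is0 refl) (isω² refl) = is0 refl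
  cubicValue-⊗ (is1 refl) (is0 refl) = is0 refl
  cubicValue-⊗ (is1 refl) (is1 refl) = is1 refl
  cubicValue-⊗ (is1 refl) (isω refl) = isω refl
  cubicValue-⊗ (is1 refl) (isω² refl) = isω² refl
  cubicValue-⊗ (isω refl) (is0 refl) = is0 refl
  cubicValue-⊗ (isω refl) (is1 refl) = isω refl
  cubicValue-⊗ (isω refl) (isω refl) = isω² refl
  cubicValue-⊗ (isω refl) (isω² refl) = is1 refl
  cubicValue-⊗ (isω² refl) (is0 refl) = is0 refl
  cubicValue-⊗ (isω² refl) (is1 refl) = isω² refl
  cubicValue-⊗ (isω² refl) (isω refl) = is1 refl
  cubicValue-⊗ (isω² refl) (isω² refl) = isω refl

  cubicValue-conj : ∀ {χ} → IsCubicValue χ → IsCubicValue (conj χ)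
  cubicValue-conj (is0 refl) = is0 refl
  cubicValue-conj (is1 refl) = is1 refl
  cubicValue-conj (isω refl) = isω² refl
  cubicValue-conj (isω² refl) = isω refl

  cubicValue-square : ∀ {χ} → IsCubicValue χ → χ ⊗ χ ≡ conj χ
  cubicValue-square (is0 refl) = refl
  cubicValue-square (is1 refl) = refl
  cubicValue-square (isω refl) = refl
  cubicValue-square (isω² refl) = refl

  cubicValue-cube : ∀ {χ} → IsCubicValue χ → ¬ χ ≡ 0ω → χ ⊗ χ ⊗ χ ≡ 1ω
  cubicValue-cube (is0 refl) χ≢0 = contradiction refl χ≢0
  cubicValue-cube (is1 refl) _ = refl
  cubicValue-cube (isω refl) _ = refl
  cubicValue-cube (isω² refl) _ = refl

  cubicValue-real : ∀ {χ} → IsCubicValue χ → conj χ ≡ χ → χ ≡ 0ω ⊎ χ ≡ 1ω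
  cubicValue-real (is0 refl) _ = inj₁ refl
  cubicValue-real (is1 refl) _ = inj₂ refl
  cubicValue-real (isω refl) e = contradiction (cong proj₁ e) λ ()
  cubicValue-real (isω² refl) e = contradiction (cong proj₁ e) λ ()

  cubicValue-difference : ∀ {χ ψ} → IsCubicValue χ → IsCubicValue ψ → χ ≡ ψ ⊎ N (χ ⊖ ψ) ≡ 1 ⊎ N (χ ⊖ ψ) ≡ 3
  cubicValue-difference (is0 refl) (is0 refl) = inj₁ refl
  cubicValue-difference (is0 refl) (is1 refl) = inj₂ (inj₁ refl)
  cubicValue-difference (is0 refl) (isω refl) = inj₂ (inj₁ refl)
  cubicValue-difference (is0 refl) (isω² refl) = inj₂ (inj₁ refl)
  cubicValue-difference (is1 refl) (is0 refl) = inj₂ (inj₁ refl)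
  cubicValue-difference (is1 refl) (is1 refl) = inj₁ refl
  cubicValue-difference (is1 refl) (isω refl) = inj₂ (inj₂ refl)
  cubicValue-difference (is1 refl) (isω² refl) = inj₂ (inj₂ refl)
  cubicValue-difference (isω refl) (is0 refl) = inj₂ (inj₁ refl)
  cubicValue-difference (isω refl) (is1 refl) = inj₂ (inj₂ refl)
  cubicValue-difference (isω refl) (isω refl) = inj₁ refl
  cubicValue-difference (isω refl) (isω² refl) = inj₂ (inj₂ refl)
  cubicValue-difference (isω² refl) (is0 refl) = inj₂ (inj₁ refl)
  cubicValue-difference (isω² refl) (is1 refl) = inj₂ (inj₂ refl)
  cubicValue-difference (isω² refl) (isω refl) = inj₂ (inj₂ refl)
  cubicValue-difference (isω² refl) (isω² refl) = inj₁ refl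

  ω⊕ω² : ωω ⊕ ω²ω ≡ ι (- + 1)
  ω⊕ω² = refl

-- The fourth power covers the value 0 as well. It also shows that a value with square 1 is 1.
cubicValue-↑4 : ∀ {χ} → IsCubicValue χ → χ ⊗ χ ⊗ χ ⊗ χ ≡ χ
cubicValue-↑4 {χ} v with χ ≟ω 0ω
... | yes refl = ⊗-zeroʳ (0ω ⊗ 0ω ⊗ 0ω)
... | no χ≢0 = trans (cong (_⊗ χ) (cubicValue-cube v χ≢0)) (⊗-identityˡ χ)

-- squaring a cubic value is conjugation
cubicValue-square-injective : ∀ {χ ψ} → IsCubicValue χ → IsCubicValue ψ → χ ⊗ χ ≡ ψ ⊗ ψ → χ ≡ ψ
cubicValue-square-injective {χ} {ψ} v w eq = begin
  χ              ≡⟨ conj-involutive χ ⟨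
  conj (conj χ)  ≡⟨ cong conj (trans (sym (cubicValue-square v)) (trans eq (cubicValue-square w))) ⟩
  conj (conj ψ)  ≡⟨ conj-involutive ψ ⟩
  ψ              ∎
  where open ≡-Reasoning

-- Distinct values differ by an element of norm 1 or 3, which no prime away from 3 divides. So a
-- congruence modulo one such prime determines a symbol.
cubicValue-mod-injective : ∀ {π χ ψ} → Prime𝔼 π → ¬ π ∣𝔼 ι (+ 3) → IsCubicValue χ → IsCubicValue ψ →
  χ ≈ ψ mod π → χ ≡ ψ
cubicValue-mod-injective {π} {χ} {ψ} P π∤3 v w (congruent d) =
  [ (λ e → e) , [ (λ N≡1 → contradiction (∣𝔼⇒N∣N d) (λ N∣ → Prime𝔼.N≢1 P (ℕ∣.∣1⇒≡1 (subst (N π ℕ∣.∣_) N≡1 N∣))))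
                , (λ N≡3 → contradiction (subst (π ∣𝔼_) (trans (α⊗conj-α (χ ⊖ ψ)) (cong (ι ∘ +_) N≡3)) (∣𝔼-⊗ʳ (conj (χ ⊖ ψ)) d)) π∤3) ]′ ]′
    (cubicValue-difference v w)

exponent : Zω → ℕ
exponent π = (N π ℕ.∸ 1) ℕ./ 3

cube-minus-1 : ∀ z → (z ⊖ 1ω) ⊗ ((z ⊖ ωω) ⊗ (z ⊖ ω²ω)) ≡ z ⊗ (z ⊗ z) ⊖ 1ω
cube-minus-1 z = begin
  (z ⊖ 1ω) ⊗ ((z ⊖ ωω) ⊗ (z ⊖ ω²ω))
    ≡⟨ solve 3 (λ z w v → (z :- con (+ 1)) :* ((z :- w) :* (z :- v)) := (z :- con (+ 1)) :* (z :* z :- (w :+ v) :* z :+ w :* v)) refl z ωω ω²ω ⟩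
  (z ⊖ 1ω) ⊗ (z ⊗ z ⊖ (ωω ⊕ ω²ω) ⊗ z ⊕ ωω ⊗ ω²ω)
    ≡⟨ cong₂ (λ s p → (z ⊖ 1ω) ⊗ (z ⊗ z ⊖ s ⊗ z ⊕ p)) ω⊕ω² ω⊗ω² ⟩
  (z ⊖ 1ω) ⊗ (z ⊗ z ⊖ ι (- + 1) ⊗ z ⊕ 1ω)
    ≡⟨ solve 1 (λ z → (z :- con (+ 1)) :* (z :* z :- con (- + 1) :* z :+ con (+ 1)) := z :* (z :* z) :- con (+ 1)) refl z ⟩
  z ⊗ (z ⊗ z) ⊖ 1ω ∎
  where open ≡-Reasoning

opaque
  -- Total in both arguments: three congruences are tested and `0ω` is the default. For primes not
  -- above 3 this is the cubic residue symbol, by `res-≈`.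
  res : Zω → Zω → Zω
  res α π with π ∣𝔼? α ↑ exponent π ⊖ 1ω
  ... | yes _ = 1ω
  ... | no _ with π ∣𝔼? α ↑ exponent π ⊖ ωω
  ...   | yes _ = ωω
  ...   | no _ with π ∣𝔼? α ↑ exponent π ⊖ ω²ω
  ...     | yes _ = ω²ω
  ...     | no _ = 0ω

  res-spec : ∀ α π → α ↑ exponent π ≈ res α π mod π ⊎ res α π ≡ 0ω ×
    ¬ π ∣𝔼 α ↑ exponent π ⊖ 1ω × ¬ π ∣𝔼 α ↑ exponent π ⊖ ωω × ¬ π ∣𝔼 α ↑ exponent π ⊖ ω²ω
  res-spec α π with π ∣𝔼? α ↑ exponent π ⊖ 1ω
  ... | yes d = inj₁ (congruent d)
  ... | no n₁ with π ∣𝔼? α ↑ exponent π ⊖ ωω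
  ...   | yes d = inj₁ (congruent d)
  ...   | no n₂ with π ∣𝔼? α ↑ exponent π ⊖ ω²ω
  ...     | yes d = inj₁ (congruent d)
  ...     | no n₃ = inj₂ (refl , n₁ , n₂ , n₃)

  res-value : ∀ α π → IsCubicValue (res α π)
  res-value α π with π ∣𝔼? α ↑ exponent π ⊖ 1ω
  ... | yes _ = is1 refl
  ... | no _ with π ∣𝔼? α ↑ exponent π ⊖ ωω
  ...   | yes _ = isω refl
  ...   | no _ with π ∣𝔼? α ↑ exponent π ⊖ ω²ω
  ...     | yes _ = isω² refl
  ...     | no _ = is0 refl

module _ {π} (P : Prime𝔼 π) (π∤3 : ¬ π ∣𝔼 ι (+ 3)) where
  open Prime𝔼 P

  N≡1+3e : N π ≡ 1 ℕ.+ 3 ℕ.* exponent π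
  N≡1+3e = trans (proj₂ k) (cong (λ e → 1 ℕ.+ 3 ℕ.* e) (sym e≡k))
    where
    k : ∃ λ k → N π ≡ 1 ℕ.+ 3 ℕ.* k
    k = N-mod-3 π (3∤N P π∤3)
    e≡k : exponent π ≡ proj₁ k
    e≡k = trans (cong (λ n → (n ℕ.∸ 1) ℕ./ 3) (proj₂ k)) (trans (cong (ℕ._/ 3) (ℕₚ.*-comm 3 (proj₁ k))) (ℕ÷.m*n/n≡m (proj₁ k) 3))

  ∣⇒↑≈0 : ∀ {α} → π ∣𝔼 α → α ↑ exponent π ≈ 0ω mod π
  ∣⇒↑≈0 {α} d = go (exponent π) N≡1+3e
    where
    go : ∀ e → N π ≡ 1 ℕ.+ 3 ℕ.* e → α ↑ e ≈ 0ω mod π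
    -- A zero exponent would give the power 1 even for α ≡ 0; it is excluded because a prime has
    -- norm different from 1.
    go zero eq = contradiction eq N≢1
    go (suc e) _ = mod-trivial (∣𝔼-⊗ʳ (α ↑ e) d)

  ∤⇒cube : ∀ {α} → ¬ π ∣𝔼 α → (let z = α ↑ exponent π) → π ∣𝔼 z ⊗ (z ⊗ z) ⊖ 1ω
  ∤⇒cube {α} π∤α = [ (λ d → contradiction d π∤α) , (λ d → d) ]′ (euclid α (z ⊗ (z ⊗ z) ⊖ 1ω)
    (subst (π ∣𝔼_) (trans (cong (_⊖ α) α↑N≡) (solve 2 (λ a c → a :* c :- a := a :* (c :- con (+ 1))) refl α (z ⊗ (z ⊗ z))))
      (∣-difference (euler P π∤3 α))))
    where
    z : Zω
    z = α ↑ exponent π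
    α↑N≡ : α ↑ N π ≡ α ⊗ (z ⊗ (z ⊗ z))
    α↑N≡ = trans (cong (α ↑_) N≡1+3e) (cong (α ⊗_) (trans (↑-* α (exponent π) 3) (cong (λ y → z ⊗ (z ⊗ y)) (⊗-identityʳ z))))

  -- If π ∤ α, then π divides z³ - 1 = (z - 1)(z - ω)(z - ω²) and so one of the factors. The default
  -- of `res` is thus reached only for π ∣ α, where 0 is the right value.
  res-≈ : ∀ α → α ↑ exponent π ≈ res α π mod π
  res-≈ α = [ (λ e → e) , (λ (eq , n₁ , n₂ , n₃) → subst (λ χ → z ≈ χ mod π) (sym eq) (vanishing n₁ n₂ n₃ (π ∣𝔼? α))) ]′ (res-spec α π)
    where
    z : Zω
    z = α ↑ exponent π
    vanishing : ¬ π ∣𝔼 z ⊖ 1ω → ¬ π ∣𝔼 z ⊖ ωω → ¬ π ∣𝔼 z ⊖ ω²ω → Dec (π ∣𝔼 α) → z ≈ 0ω mod π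
    vanishing _ _ _ (yes d) = ∣⇒↑≈0 d
    vanishing n₁ n₂ n₃ (no π∤α) = contradiction (subst (π ∣𝔼_) (sym (cube-minus-1 z)) (∤⇒cube π∤α))
      (λ d → [ n₁ , (λ d → [ n₂ , n₃ ]′ (euclid (z ⊖ ωω) (z ⊖ ω²ω) d)) ]′ (euclid (z ⊖ 1ω) ((z ⊖ ωω) ⊗ (z ⊖ ω²ω)) d))

  res-unique : ∀ {α χ} → IsCubicValue χ → α ↑ exponent π ≈ χ mod π → res α π ≡ χ
  res-unique {α} v e = cubicValue-mod-injective P π∤3 (res-value α π) v (mod-trans (mod-sym (res-≈ α)) e)

  res-⊗ : ∀ α β → res (α ⊗ β) π ≡ res α π ⊗ res β π
  res-⊗ α β = res-unique (cubicValue-⊗ (res-value α π) (res-value β π))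
    (mod-trans (mod-reflexive (↑-⊗ α β (exponent π))) (mod-⊗ (res-≈ α) (res-≈ β)))

  res-cong : ∀ {α β} → α ≈ β mod π → res α π ≡ res β π
  res-cong {α} {β} e = res-unique (res-value β π) (mod-trans (mod-↑ (exponent π) e) (res-≈ β))

  res≡0⇒∣ : ∀ {α} → res α π ≡ 0ω → π ∣𝔼 α
  res≡0⇒∣ {α} eq = prime∣↑⇒∣ P (exponent π) (mod-0⇒∣ (subst (λ χ → α ↑ exponent π ≈ χ mod π) eq (res-≈ α)))

  ∣⇒res≡0 : ∀ {α} → π ∣𝔼 α → res α π ≡ 0ω
  ∣⇒res≡0 {α} d = res-unique (is0 refl) (∣⇒↑≈0 d)

res-conj : ∀ {π} → Prime𝔼 π → ¬ π ∣𝔼 ι (+ 3) → ∀ α → res (conj α) (conj π) ≡ conj (res α π)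
res-conj {π} P π∤3 α = res-unique (prime-conj P) conjπ∤3 (cubicValue-conj (res-value α π))
  (mod-trans (mod-reflexive (trans (cong (conj α ↑_) e≡) (sym (conj-↑ α (exponent π))))) (mod-conj (res-≈ P π∤3 α)))
  where
  conjπ∤3 : ¬ conj π ∣𝔼 ι (+ 3)
  conjπ∤3 d = π∤3 (subst₂ _∣𝔼_ (conj-involutive π) (conj-ι (+ 3)) (∣𝔼-conj d))
  e≡ : exponent (conj π) ≡ exponent π
  e≡ = cong (λ n → (n ℕ.∸ 1) ℕ./ 3) (N-conj π)

res-associate : ∀ {π ρ} → Prime𝔼 π → Prime𝔼 ρ → ¬ π ∣𝔼 ι (+ 3) → π ∣𝔼 ρ → ∀ α → res α π ≡ res α ρ
res-associate {π} {ρ} P R π∤3 π∣ρ α = cubicValue-mod-injective P π∤3 (res-value α π) (res-value α ρ)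
  (mod-trans (mod-sym (res-≈ P π∤3 α)) (subst (λ e → α ↑ e ≈ res α ρ mod π) e≡ (mod-∣ π∣ρ (res-≈ R ρ∤3 α))))
  where
  ρ∤3 : ¬ ρ ∣𝔼 ι (+ 3)
  ρ∤3 d = π∤3 (∣𝔼-trans π∣ρ d)
  assoc : ∃ λ ε → N ε ≡ 1 × ρ ≡ π ⊗ ε
  assoc = prime∣prime⇒associate P R π∣ρ
  e≡ : exponent ρ ≡ exponent π
  e≡ = cong (λ n → (n ℕ.∸ 1) ℕ./ 3) (trans (cong N (proj₂ (proj₂ assoc)))
    (trans (N-⊗ π (proj₁ assoc)) (trans (cong (N π ℕ.*_) (proj₁ (proj₂ assoc))) (ℕₚ.*-identityʳ (N π)))))

-- Comaximality and the symbol over composite moduli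

infix 4 _⊥_
-- Coprimality is carried as a Bézout identity: it passes to products, divisors, conjugates and
-- congruent elements by algebra alone.
record _⊥_ (α β : Zω) : Set where
  constructor comaximal
  field
    s t : Zω
    equality : α ⊗ s ⊕ β ⊗ t ≡ 1ω

⊥-sym : ∀ {α β} → α ⊥ β → β ⊥ α
⊥-sym {α} {β} (comaximal s t eq) = comaximal t s (trans (⊕-comm (β ⊗ t) (α ⊗ s)) eq)

⊥-∣ : ∀ {δ α β} → δ ∣𝔼 α → α ⊥ β → δ ⊥ β
⊥-∣ {δ} {α} {β} (divides κ refl) (comaximal s t eq) = comaximal (κ ⊗ s) t (trans (cong (_⊕ β ⊗ t) (sym (⊗-assoc δ κ s))) eq)

⊥-⊗ : ∀ {α β γ} → α ⊥ γ → β ⊥ γ → α ⊗ β ⊥ γ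
⊥-⊗ {α} {β} {γ} (comaximal s t eq) (comaximal u v eq′) = comaximal (s ⊗ u) (α ⊗ s ⊗ v ⊕ t)
  (begin
    α ⊗ β ⊗ (s ⊗ u) ⊕ γ ⊗ (α ⊗ s ⊗ v ⊕ t)  ≡⟨ solve 7 (λ a b c s t u v → a :* b :* (s :* u) :+ c :* (a :* s :* v :+ t) := a :* s :* (b :* u :+ c :* v) :+ c :* t) refl α β γ s t u v ⟩
    α ⊗ s ⊗ (β ⊗ u ⊕ γ ⊗ v) ⊕ γ ⊗ t        ≡⟨ cong (λ z → α ⊗ s ⊗ z ⊕ γ ⊗ t) eq′ ⟩
    α ⊗ s ⊗ 1ω ⊕ γ ⊗ t                     ≡⟨ cong (_⊕ γ ⊗ t) (⊗-identityʳ (α ⊗ s)) ⟩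
    α ⊗ s ⊕ γ ⊗ t                          ≡⟨ eq ⟩
    1ω                                     ∎)
  where open ≡-Reasoning

⊥-conj : ∀ {α β} → α ⊥ β → conj α ⊥ conj β
⊥-conj {α} {β} (comaximal s t eq) = comaximal (conj s) (conj t) (trans
  (sym (trans (conj-⊕ (α ⊗ s) (β ⊗ t)) (cong₂ _⊕_ (conj-⊗ α s) (conj-⊗ β t)))) (trans (cong conj eq) (conj-ι (+ 1))))

⊥-ι : ∀ {a b} → a ⊥ℤ b → ι a ⊥ ι b
⊥-ι {a} {b} (comaximal s t eq) = comaximal (ι s) (ι t)
  (trans (sym (trans (ι-⊕ (a * s) (b * t)) (cong₂ _⊕_ (ι-⊗ a s) (ι-⊗ b t)))) (cong ι eq))

⊥-mod : ∀ {α β γ} → α ≈ β mod γ → α ⊥ γ → β ⊥ γ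
⊥-mod {α} {β} {γ} (congruent (divides q eq′)) (comaximal s t eq) = comaximal s (q ⊗ s ⊕ t) (begin
  β ⊗ s ⊕ γ ⊗ (q ⊗ s ⊕ t)                ≡⟨ solve 5 (λ b s c q t → b :* s :+ c :* (q :* s :+ t) := c :* q :* s :+ b :* s :+ c :* t) refl β s γ q t ⟩
  γ ⊗ q ⊗ s ⊕ β ⊗ s ⊕ γ ⊗ t              ≡⟨ cong (λ z → z ⊗ s ⊕ β ⊗ s ⊕ γ ⊗ t) eq′ ⟨
  (α ⊖ β) ⊗ s ⊕ β ⊗ s ⊕ γ ⊗ t            ≡⟨ solve 4 (λ a b s x → (a :- b) :* s :+ b :* s :+ x := a :* s :+ x) refl α β s (γ ⊗ t) ⟩
  α ⊗ s ⊕ γ ⊗ t                          ≡⟨ eq ⟩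
  1ω                                     ∎)
  where open ≡-Reasoning

⊥-unit : ∀ {ε α} → N ε ≡ 1 → ε ⊥ α
⊥-unit {ε} {α} N≡1 = comaximal (conj ε) 0ω (trans (cong (ε ⊗ conj ε ⊕_) (⊗-zeroʳ α)) (trans (⊕-identityʳ (ε ⊗ conj ε)) (N≡1⇒unit {ε} N≡1)))

⊥⇒∤ : ∀ {π α β} → Prime𝔼 π → α ⊥ β → π ∣𝔼 α → ¬ π ∣𝔼 β
⊥⇒∤ {π} P (comaximal s t eq) d e = Prime𝔼.∤1 P (subst (π ∣𝔼_) eq (∣𝔼-⊕ (∣𝔼-⊗ʳ s d) (∣𝔼-⊗ʳ t e)))

prime∤⇒⊥ : ∀ {π α} → Prime𝔼 π → ¬ π ∣𝔼 α → π ⊥ α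
prime∤⇒⊥ {π} {α} P π∤α = go (bézout π α)
  where
  go : BézoutDivisor π α → π ⊥ α
  go record { g = g ; s = s ; t = t ; g∣α = divides κ π≡gκ ; g∣β = g∣α ; combination = comb } =
    [ (λ π∣g → contradiction (∣𝔼-trans π∣g g∣α) π∤α)
    , (λ { (divides δ κ≡πδ) → comaximal (s ⊗ δ) (t ⊗ δ) (⊗-cancelˡ π (Prime𝔼.≢0 P) (begin
        π ⊗ (π ⊗ (s ⊗ δ) ⊕ α ⊗ (t ⊗ δ))   ≡⟨ solve 5 (λ p s d a t → p :* (p :* (s :* d) :+ a :* (t :* d)) := (p :* s :+ a :* t) :* (p :* d)) refl π s δ α t ⟩
        (π ⊗ s ⊕ α ⊗ t) ⊗ (π ⊗ δ)         ≡⟨ cong₂ _⊗_ (sym comb) (sym κ≡πδ) ⟩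
        g ⊗ κ                             ≡⟨ π≡gκ ⟨
        π                                 ≡⟨ ⊗-identityʳ π ⟨
        π ⊗ 1ω                            ∎)) }) ]′
      (Prime𝔼.euclid P g κ (subst (π ∣𝔼_) π≡gκ ∣𝔼-refl))
    where open ≡-Reasoning

⊥3⇒≢0 : ∀ {β} → β ⊥ ι (+ 3) → ¬ β ≡ 0ω
⊥3⇒≢0 (comaximal s t eq) refl = contradiction (∣1⇒N≡1 (divides {ι (+ 3)} t (trans (sym eq)
  (solve 2 (λ s x → con (+ 0) :* s :+ x := x) refl s (ι (+ 3) ⊗ t))))) λ N≡1 → contradiction (trans (sym (N-ι (+ 3))) N≡1) λ ()

opaque
  -- junk value 1 at β = 0
  ⟨_/_⟩ : Zω → Zω → Zω
  ⟨ α / β ⟩ with β ≟ω 0ω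
  ... | yes _ = 1ω
  ... | no β≢0 = Π (map (res α) (Factorisation.primes (factor β β≢0)))

  ⟨/⟩-unfold : ∀ β → ¬ β ≡ 0ω → ∃ λ (F : Factorisation β) → ∀ α → ⟨ α / β ⟩ ≡ Π (map (res α) (Factorisation.primes F))
  ⟨/⟩-unfold β β≢0 with β ≟ω 0ω
  ... | yes e = contradiction e β≢0
  ... | no β≢0′ = factor β β≢0′ , λ _ → refl

record CoprimeFactorisation (β : Zω) : Set where
  field
    ε : Zω
    primes : List Zω
    unit : N ε ≡ 1
    allPrime : All Prime𝔼 primes
    all∤3 : All (λ π → ¬ π ∣𝔼 ι (+ 3)) primes
    all∣ : All (_∣𝔼 β) primes
    product≡ : β ≡ ε ⊗ Π primes
    symbol≡ : ∀ α → ⟨ α / β ⟩ ≡ Π (map (res α) primes)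

all∣Π : ∀ πs → All (_∣𝔼 Π πs) πs
all∣Π [] = []
all∣Π (π ∷ πs) = ∣𝔼-⊗ʳ (Π πs) ∣𝔼-refl ∷ All.map (∣𝔼-⊗ˡ π) (all∣Π πs)

coprimeFactorisation : ∀ {β} → β ⊥ ι (+ 3) → CoprimeFactorisation β
coprimeFactorisation {β} β⊥3 = go (⟨/⟩-unfold β (⊥3⇒≢0 β⊥3))
  where
  go : (∃ λ (F : Factorisation β) → ∀ α → ⟨ α / β ⟩ ≡ Π (map (res α) (Factorisation.primes F))) → CoprimeFactorisation β
  go (record { ε = ε ; primes = πs ; unit = u ; allPrime = Ps ; product≡ = eq } , eqs) = record
    { ε = ε ; primes = πs ; unit = u ; allPrime = Ps
    ; all∤3 = All.zipWith (λ (P , d) → ⊥⇒∤ P β⊥3 d) (Ps , ∣β)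
    ; all∣ = ∣β ; product≡ = eq ; symbol≡ = eqs }
    where
    ∣β : All (_∣𝔼 β) πs
    ∣β = All.map (λ {π} d → subst (π ∣𝔼_) (sym eq) (∣𝔼-⊗ˡ ε d)) (all∣Π πs)

-- The value does not depend on the factorisation that `factor` happens to find. Multiplicativity in
-- β, compatibility with conjugation and the agreement with `CubicSym` all come from choosing a
-- convenient one.
symbol-unique : ∀ {β} → β ⊥ ι (+ 3) → ∀ {ε} πs → N ε ≡ 1 → All Prime𝔼 πs → β ≡ ε ⊗ Π πs →
  ∀ α → ⟨ α / β ⟩ ≡ Π (map (res α) πs)
symbol-unique {β} β⊥3 {ε} πs u Ps eq α = trans (F.symbol≡ α)
  (trans (sym (map-f F.primes F.all∤3))
  (trans (unique f f-assoc F.primes πs F.allPrime Ps {F.ε} {ε} F.unit u (trans (sym F.product≡) eq)) (map-f πs ∤3s)))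
  where
  module F = CoprimeFactorisation (coprimeFactorisation β⊥3)
  -- res α is constant on associates only away from 3, so primes over 3 are sent to 1 first
  f : Zω → Zω
  f π with π ∣𝔼? ι (+ 3)
  ... | yes _ = 1ω
  ... | no _ = res α π
  f≡ : ∀ π → ¬ π ∣𝔼 ι (+ 3) → f π ≡ res α π
  f≡ π π∤3 with π ∣𝔼? ι (+ 3)
  ... | yes d = contradiction d π∤3
  ... | no _ = refl
  f≡1 : ∀ π → π ∣𝔼 ι (+ 3) → f π ≡ 1ω
  f≡1 π d with π ∣𝔼? ι (+ 3)
  ... | yes _ = refl
  ... | no π∤3 = contradiction d π∤3
  f-assoc : ∀ {π ρ} → Prime𝔼 π → Prime𝔼 ρ → π ∣𝔼 ρ → f π ≡ f ρ
  f-assoc {π} {ρ} P R π∣ρ = go (ρ ∣𝔼? ι (+ 3)) (π ∣𝔼? ι (+ 3))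
    where
    back : ρ ∣𝔼 π
    back = let ε , u , ρ≡πε = prime∣prime⇒associate P R π∣ρ in
      ∣unit⊗⇒∣ {ε = ε} u (subst (ρ ∣𝔼_) (trans ρ≡πε (⊗-comm π ε)) ∣𝔼-refl)
    go : Dec (ρ ∣𝔼 ι (+ 3)) → Dec (π ∣𝔼 ι (+ 3)) → f π ≡ f ρ
    go (yes d) _ = trans (f≡1 π (∣𝔼-trans π∣ρ d)) (sym (f≡1 ρ d))
    go (no n) (yes d) = contradiction (∣𝔼-trans back d) n
    go (no n) (no m) = trans (f≡ π m) (trans (res-associate P R m π∣ρ α) (sym (f≡ ρ n)))
  map-f : ∀ ρs → All (λ π → ¬ π ∣𝔼 ι (+ 3)) ρs → Π (map f ρs) ≡ Π (map (res α) ρs)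
  map-f [] [] = refl
  map-f (ρ ∷ ρs) (n ∷ ns) = cong₂ _⊗_ (f≡ ρ n) (map-f ρs ns)
  ∤3s : All (λ π → ¬ π ∣𝔼 ι (+ 3)) πs
  ∤3s = All.zipWith (λ {π} (P , d) → ⊥⇒∤ P β⊥3 (subst (π ∣𝔼_) (sym eq) (∣𝔼-⊗ˡ ε d))) (Ps , all∣Π πs)

Π-++ : ∀ πs ρs → Π (πs ++ ρs) ≡ Π πs ⊗ Π ρs
Π-++ [] ρs = sym (⊗-identityˡ (Π ρs))
Π-++ (π ∷ πs) ρs = trans (cong (π ⊗_) (Π-++ πs ρs)) (sym (⊗-assoc π (Π πs) (Π ρs)))

Π-value : ∀ α πs → IsCubicValue (Π (map (res α) πs))
Π-value α [] = is1 refl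
Π-value α (π ∷ πs) = cubicValue-⊗ (res-value α π) (Π-value α πs)

module _ {β} (β⊥3 : β ⊥ ι (+ 3)) where
  private module F = CoprimeFactorisation (coprimeFactorisation β⊥3)

  symbol-value : ∀ α → IsCubicValue ⟨ α / β ⟩
  symbol-value α = subst IsCubicValue (sym (F.symbol≡ α)) (Π-value α F.primes)

  symbol-⊗ : ∀ α α′ → ⟨ α ⊗ α′ / β ⟩ ≡ ⟨ α / β ⟩ ⊗ ⟨ α′ / β ⟩
  symbol-⊗ α α′ = trans (F.symbol≡ (α ⊗ α′)) (trans (go F.primes F.allPrime F.all∤3) (sym (cong₂ _⊗_ (F.symbol≡ α) (F.symbol≡ α′))))
    where
    go : ∀ πs → All Prime𝔼 πs → All (λ π → ¬ π ∣𝔼 ι (+ 3)) πs →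
      Π (map (res (α ⊗ α′)) πs) ≡ Π (map (res α) πs) ⊗ Π (map (res α′) πs)
    go [] [] [] = sym (⊗-identityʳ 1ω)
    go (π ∷ πs) (P ∷ Ps) (n ∷ ns) = trans (cong₂ _⊗_ (res-⊗ P n α α′) (go πs Ps ns))
      (solve 4 (λ a b c d → a :* b :* (c :* d) := a :* c :* (b :* d)) refl (res α π) (res α′ π) (Π (map (res α) πs)) (Π (map (res α′) πs)))

  symbol-cong : ∀ {α α′} → α ≈ α′ mod β → ⟨ α / β ⟩ ≡ ⟨ α′ / β ⟩
  symbol-cong {α} {α′} e = trans (F.symbol≡ α) (trans (go F.primes F.allPrime F.all∤3 F.all∣) (sym (F.symbol≡ α′)))
    where
    go : ∀ πs → All Prime𝔼 πs → All (λ π → ¬ π ∣𝔼 ι (+ 3)) πs → All (_∣𝔼 β) πs →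
      Π (map (res α) πs) ≡ Π (map (res α′) πs)
    go [] [] [] [] = refl
    go (π ∷ πs) (P ∷ Ps) (n ∷ ns) (d ∷ ds) = cong₂ _⊗_ (res-cong P n (mod-∣ d e)) (go πs Ps ns ds)

  symbol-≢0 : ∀ {α} → α ⊥ β → ¬ ⟨ α / β ⟩ ≡ 0ω
  symbol-≢0 {α} α⊥β eq = go F.primes F.allPrime F.all∤3 F.all∣ (trans (sym (F.symbol≡ α)) eq)
    where
    go : ∀ πs → All Prime𝔼 πs → All (λ π → ¬ π ∣𝔼 ι (+ 3)) πs → All (_∣𝔼 β) πs → ¬ Π (map (res α) πs) ≡ 0ω
    go [] [] [] [] = λ ()
    go (π ∷ πs) (P ∷ Ps) (n ∷ ns) (d ∷ ds) eq = [ (λ z → ⊥⇒∤ P α⊥β (res≡0⇒∣ P n z) d) , go πs Ps ns ds ]′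
      (integral (res α π) (Π (map (res α) πs)) eq)

  symbol-⊗ʳ : ∀ {β′} → β′ ⊥ ι (+ 3) → ∀ α → ⟨ α / β ⊗ β′ ⟩ ≡ ⟨ α / β ⟩ ⊗ ⟨ α / β′ ⟩
  symbol-⊗ʳ {β′} β′⊥3 α = trans (symbol-unique (⊥-⊗ β⊥3 β′⊥3) (F.primes ++ G.primes)
      (trans (N-⊗ F.ε G.ε) (cong₂ ℕ._*_ F.unit G.unit)) (Allₚ.++⁺ F.allPrime G.allPrime)
      (trans (cong₂ _⊗_ F.product≡ G.product≡) (trans
        (solve 4 (λ a b c d → a :* b :* (c :* d) := a :* c :* (b :* d)) refl F.ε (Π F.primes) G.ε (Π G.primes))
        (cong (F.ε ⊗ G.ε ⊗_) (sym (Π-++ F.primes G.primes))))) α)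
    (trans (cong Π (Listₚ.map-++ (res α) F.primes G.primes)) (trans (Π-++ (map (res α) F.primes) (map (res α) G.primes))
      (sym (cong₂ _⊗_ (F.symbol≡ α) (G.symbol≡ α)))))
    where module G = CoprimeFactorisation (coprimeFactorisation β′⊥3)

  symbol-conj : ∀ α → ⟨ conj α / conj β ⟩ ≡ conj ⟨ α / β ⟩
  symbol-conj α = trans (symbol-unique conjβ⊥3 (map conj F.primes) (trans (N-conj F.ε) F.unit)
      (Allₚ.map⁺ (All.map prime-conj F.allPrime))
      (trans (cong conj F.product≡) (trans (conj-⊗ F.ε (Π F.primes)) (cong (conj F.ε ⊗_) (conj-Π F.primes)))) (conj α))
    (trans (go F.primes F.allPrime F.all∤3) (cong conj (sym (F.symbol≡ α))))
    where
    conjβ⊥3 : conj β ⊥ ι (+ 3)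
    conjβ⊥3 = subst (conj β ⊥_) (conj-ι (+ 3)) (⊥-conj β⊥3)
    conj-Π : ∀ πs → conj (Π πs) ≡ Π (map conj πs)
    conj-Π [] = conj-ι (+ 1)
    conj-Π (π ∷ πs) = trans (conj-⊗ π (Π πs)) (cong (conj π ⊗_) (conj-Π πs))
    go : ∀ πs → All Prime𝔼 πs → All (λ π → ¬ π ∣𝔼 ι (+ 3)) πs →
      Π (map (res (conj α)) (map conj πs)) ≡ conj (Π (map (res α) πs))
    go [] [] [] = sym (conj-ι (+ 1))
    go (π ∷ πs) (P ∷ Ps) (n ∷ ns) = trans (cong₂ _⊗_ (res-conj P n α) (go πs Ps ns)) (sym (conj-⊗ (res α π) (Π (map (res α) πs))))

symbol-unit : ∀ {β} → N β ≡ 1 → ∀ α → ⟨ α / β ⟩ ≡ 1ω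
symbol-unit {β} u α = symbol-unique (⊥-unit u) [] u [] (sym (⊗-identityʳ β)) α

symbol-prime : ∀ {π} → Prime𝔼 π → ¬ π ∣𝔼 ι (+ 3) → ∀ α → ⟨ α / π ⟩ ≡ res α π
symbol-prime {π} P π∤3 α = trans (symbol-unique (prime∤⇒⊥ P π∤3) {1ω} (π ∷ []) (N-ι (+ 1)) (P ∷ [])
  (solve 1 (λ p → p := con (+ 1) :* (p :* con (+ 1))) refl π) α) (⊗-identityʳ (res α π))

-- The value is idempotent by multiplicativity and nonzero by comaximality.
symbol-1 : ∀ {β} → β ⊥ ι (+ 3) → ⟨ 1ω / β ⟩ ≡ 1ω
symbol-1 {β} β⊥3 = sym (⊗-cancelˡ χ χ≢0 (begin
  χ ⊗ 1ω        ≡⟨ ⊗-identityʳ χ ⟩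
  χ             ≡⟨ cong (λ α → ⟨ α / β ⟩) (⊗-identityʳ 1ω) ⟨
  ⟨ 1ω ⊗ 1ω / β ⟩ ≡⟨ symbol-⊗ β⊥3 1ω 1ω ⟩
  χ ⊗ χ         ∎))
  where
  open ≡-Reasoning
  χ = ⟨ 1ω / β ⟩
  χ≢0 : ¬ χ ≡ 0ω
  χ≢0 = symbol-≢0 β⊥3 (⊥-unit (N-ι (+ 1)))

symbol-rational : ∀ {a b} → ι a ⊥ ι b → ι b ⊥ ι (+ 3) → ⟨ ι a / ι b ⟩ ≡ 1ω
symbol-rational {a} {b} a⊥b b⊥3 = [ (λ z → contradiction z (symbol-≢0 b⊥3 a⊥b)) , (λ e → e) ]′
  (cubicValue-real (symbol-value b⊥3 (ι a)) (trans (sym (symbol-conj b⊥3 (ι a))) (cong₂ ⟨_/_⟩ (conj-ι a) (conj-ι b))))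

√-3 : Zω
√-3 = + 1 , + 2

opaque
  unfolding _⊕_

  √-3² : √-3 ⊗ √-3 ≡ ι (- + 3)
  √-3² = refl

  conj-√-3 : conj √-3 ≡ ⊝ √-3
  conj-√-3 = refl

⊥-neg : ∀ {a β} → ι a ⊥ β → ι (- a) ⊥ β
⊥-neg {a} {β} (comaximal s t eq) = comaximal (⊝ s) t (trans (cong (λ z → z ⊗ ⊝ s ⊕ β ⊗ t) (ι-⊝ a))
  (trans (solve 4 (λ a s b t → :- a :* :- s :+ b :* t := a :* s :+ b :* t) refl (ι a) s β t) eq))

-- The square of √-3 is the rational integer -3, so the square of the symbol is 1, and μ₃ has no
-- element of order 2.
symbol-√-3 : ∀ {b} → ι b ⊥ ι (+ 3) → ⟨ √-3 / ι b ⟩ ≡ 1ω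
symbol-√-3 {b} b⊥3 = begin
  χ                    ≡⟨ cubicValue-↑4 (symbol-value b⊥3 √-3) ⟨
  χ ⊗ χ ⊗ χ ⊗ χ        ≡⟨ ⊗-assoc (χ ⊗ χ) χ χ ⟩
  χ ⊗ χ ⊗ (χ ⊗ χ)      ≡⟨ cong₂ _⊗_ χ²≡1 χ²≡1 ⟩
  1ω ⊗ 1ω              ≡⟨ ⊗-identityʳ 1ω ⟩
  1ω                   ∎
  where
  open ≡-Reasoning
  χ = ⟨ √-3 / ι b ⟩
  χ²≡1 : χ ⊗ χ ≡ 1ω
  χ²≡1 = trans (sym (symbol-⊗ b⊥3 √-3 √-3)) (trans (cong (λ α → ⟨ α / ι b ⟩) √-3²)
    (symbol-rational {a = - + 3} (⊥-neg {+ 3} (⊥-sym b⊥3)) b⊥3))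

-- The group ring of ℤ/p

module Σω = Sums (CommutativeRing.semiring Zω-commutativeRing)
open Σω using (sum) public

sum-cong : ∀ {n} {f g : Fin n → Zω} → (∀ i → f i ≡ g i) → sum f ≡ sum g
sum-cong = Σω.sum-cong-≗

sum-mod : ∀ {μ n} {f g : Fin n → Zω} → (∀ i → f i ≈ g i mod μ) → sum f ≈ sum g mod μ
sum-mod {n = zero} e = mod-reflexive refl
sum-mod {n = suc n} e = mod-⊕ (e zero) (sum-mod (e ∘ suc))

sum-zero : ∀ {n} {f : Fin n → Zω} → (∀ i → f i ≡ 0ω) → sum f ≡ 0ω
sum-zero {n} e = trans (sum-cong e) (Σω.sum-replicate-zero n)

sum-single : ∀ {n} (j : Fin n) (f : Fin n → Zω) → (∀ i → ¬ i ≡ j → f i ≡ 0ω) → sum f ≡ f j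
sum-single zero f e = trans (cong (f zero ⊕_) (sum-zero (λ i → e (suc i) λ ()))) (⊕-identityʳ (f zero))
sum-single (suc j) f e = trans (cong₂ _⊕_ (e zero λ ()) (sum-single j (f ∘ suc) (λ i i≢j → e (suc i) (i≢j ∘ Finₚ.suc-injective))))
  (⊕-identityˡ (f (suc j)))

infix 4 _≡_modℤ_
record _≡_modℤ_ (a b m : ℤ) : Set where
  constructor congruentℤ
  field ∣-differenceℤ : m ℤ∣.∣ a - b

module Residues (p : ℕ) .{{_ : NonZero p}} where
  ≡-refl : ∀ {a b} → a ≡ b → a ≡ b modℤ + p
  ≡-refl {a} refl = congruentℤ (subst (+ p ℤ∣.∣_) (sym (ℤₚ.+-inverseʳ a)) (ℤ∣.divides (+ 0) refl))

  ≡-sym : ∀ {a b} → a ≡ b modℤ + p → b ≡ a modℤ + p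
  ≡-sym {a} {b} (congruentℤ d) = congruentℤ (subst (+ p ℤ∣.∣_) (h a b) (ℤ∣.∣m⇒∣-m d))
    where
    h : ∀ a b → - (a - b) ≡ b - a
    h = solve-∀

  ≡-trans : ∀ {a b c} → a ≡ b modℤ + p → b ≡ c modℤ + p → a ≡ c modℤ + p
  ≡-trans {a} {b} {c} (congruentℤ d) (congruentℤ e) = congruentℤ (subst (+ p ℤ∣.∣_) (h a b c) (ℤ∣.∣m∣n⇒∣m+n d e))
    where
    h : ∀ a b c → a - b + (b - c) ≡ a - c
    h = solve-∀

  ≡-shift : ∀ {a b c d} k → c - d ≡ k * (a - b) → a ≡ b modℤ + p → c ≡ d modℤ + p
  ≡-shift {a} {b} k eq (congruentℤ e) = congruentℤ (subst (+ p ℤ∣.∣_) (sym eq) (ℤ∣.∣n⇒∣m*n k e))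

  reduce : ℤ → Fin p
  reduce t = fromℕ< (ℤ÷.n%ℕd<d t p)

  at : Fin p → ℤ
  at i = + toℕ i

  at-reduce : ∀ t → at (reduce t) ≡ t modℤ + p
  at-reduce t = congruentℤ (ℤ∣.divides (- (t ℤ÷./ℕ p)) (trans (cong₂ (λ r t → + r - t) (Finₚ.toℕ-fromℕ< (ℤ÷.n%ℕd<d t p)) (ℤ÷.a≡a%ℕn+[a/ℕn]*n t p))
    (h (+ (t ℤ÷.%ℕ p)) (t ℤ÷./ℕ p) (+ p))))
    where
    h : ∀ r k p → r - (r + k * p) ≡ - k * p
    h = solve-∀

  at-injective : ∀ {i j} → at i ≡ at j modℤ + p → i ≡ j
  at-injective {i} {j} d@(congruentℤ d′) = Finₚ.toℕ-injective (ordered (ℕₚ.≤-total (toℕ i) (toℕ j)))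
    where
    close : ∀ m n → n ℕ.< p → + p ℤ∣.∣ + n - + m → m ℕ.≤ n → m ≡ n
    close m n n<p d m≤n = ℕₚ.≤-antisym m≤n (ℕₚ.m∸n≡0⇒m≤n (small (n ℕ.∸ m) (ℕₚ.≤-<-trans (ℕₚ.m∸n≤m n m) n<p)
      (ℤ∣.∣⇒∣ᵤ (subst (+ p ℤ∣.∣_) (trans (ℤₚ.m-n≡m⊖n n m) (ℤₚ.⊖-≥ m≤n)) d))))
      where
      small : ∀ k → k ℕ.< p → p ℕ∣.∣ k → k ≡ 0
      small zero _ _ = refl
      small (suc k) k<p p∣k = contradiction (ℕ∣.∣⇒≤ p∣k) (ℕₚ.<⇒≱ k<p)
    ordered : toℕ i ℕ.≤ toℕ j ⊎ toℕ j ℕ.≤ toℕ i → toℕ i ≡ toℕ j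
    ordered (inj₁ i≤j) = close (toℕ i) (toℕ j) (Finₚ.toℕ<n j) (_≡_modℤ_.∣-differenceℤ (≡-sym d)) i≤j
    ordered (inj₂ j≤i) = sym (close (toℕ j) (toℕ i) (Finₚ.toℕ<n i) d′ j≤i)

  -- Group ring elements are p-periodic functions on ℤ. Arithmetic on the indices then stays in ℤ;
  -- `Fin p` serves only to index the sums.
  Periodic : (ℤ → Zω) → Set
  Periodic f = ∀ {a b} → a ≡ b modℤ + p → f a ≡ f b

  Σₚ : (ℤ → Zω) → Zω
  Σₚ f = sum (f ∘ at)

  Σₚ-cong : ∀ {f g} → (∀ a → f a ≡ g a) → Σₚ f ≡ Σₚ g
  Σₚ-cong e = sum-cong (e ∘ at)

  Σₚ-reindex : ∀ {f} → Periodic f → (σ τ : ℤ → ℤ) →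
    (∀ {a b} → a ≡ b modℤ + p → σ a ≡ σ b modℤ + p) → (∀ {a b} → a ≡ b modℤ + p → τ a ≡ τ b modℤ + p) →
    (∀ a → σ (τ a) ≡ a modℤ + p) → (∀ a → τ (σ a) ≡ a modℤ + p) → Σₚ f ≡ Σₚ (f ∘ σ)
  Σₚ-reindex {f} f-per σ τ σ-resp τ-resp στ τσ =
    trans (Σω.sum-permute (f ∘ at) perm) (sum-cong (λ i → f-per (at-reduce (σ (at i)))))
    where
    to from : Fin p → Fin p
    to i = reduce (σ (at i))
    from i = reduce (τ (at i))
    to-from : ∀ i → to (from i) ≡ i
    to-from i = at-injective (≡-trans {at (to (from i))} {σ (at (from i))} {at i} (at-reduce (σ (at (from i))))
      (≡-trans {σ (at (from i))} {σ (τ (at i))} {at i} (σ-resp {at (from i)} {τ (at i)} (at-reduce (τ (at i)))) (στ (at i))))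
    from-to : ∀ i → from (to i) ≡ i
    from-to i = at-injective (≡-trans {at (from (to i))} {τ (at (to i))} {at i} (at-reduce (τ (at (to i))))
      (≡-trans {τ (at (to i))} {τ (σ (at i))} {at i} (τ-resp {at (to i)} {σ (at i)} (at-reduce (σ (at i)))) (τσ (at i))))
    perm : Permutation.Permutation p p
    perm = Permutation.permutation to from to-from from-to

  Σₚ-single : ∀ c f → (∀ a → ¬ a ≡ c modℤ + p → f a ≡ 0ω) → Periodic f → Σₚ f ≡ f c
  Σₚ-single c f e f-per = trans (sum-single (reduce c) (f ∘ at)
    (λ i i≢ → e (at i) (λ d → i≢ (at-injective (≡-trans {at i} {c} {at (reduce c)} d (≡-sym {at (reduce c)} {c} (at-reduce c)))))))
    (f-per (at-reduce c))

  opaque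
    δ : ℤ → Zω
    δ t with + p ℤ∣.∣? t
    ... | yes _ = 1ω
    ... | no _ = 0ω

    δ-1 : ∀ {t} → + p ℤ∣.∣ t → δ t ≡ 1ω
    δ-1 {t} d with + p ℤ∣.∣? t
    ... | yes _ = refl
    ... | no n = contradiction d n

    δ-0 : ∀ {t} → ¬ + p ℤ∣.∣ t → δ t ≡ 0ω
    δ-0 {t} n with + p ℤ∣.∣? t
    ... | yes d = contradiction d n
    ... | no _ = refl

  δ-cong : ∀ {s t} → (+ p ℤ∣.∣ s → + p ℤ∣.∣ t) → (+ p ℤ∣.∣ t → + p ℤ∣.∣ s) → δ s ≡ δ t
  δ-cong {s} {t} f g with + p ℤ∣.∣? s
  ... | yes d = trans (δ-1 d) (sym (δ-1 (f d)))
  ... | no n = trans (δ-0 n) (sym (δ-0 (n ∘ g)))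

  δ-periodic : Periodic δ
  δ-periodic {a} {b} (congruentℤ d) = δ-cong (λ e → subst (+ p ℤ∣.∣_) (h a b) (ℤ∣.∣m∣n⇒∣m-n e d)) (λ e → subst (+ p ℤ∣.∣_) (h′ a b) (ℤ∣.∣m∣n⇒∣m+n d e))
    where
    h : ∀ a b → a - (a - b) ≡ b
    h = solve-∀
    h′ : ∀ a b → a - b + b ≡ a
    h′ = solve-∀

  Σₚ-δ : ∀ c f → Periodic f → Σₚ (λ a → δ (a - c) ⊗ f a) ≡ f c
  Σₚ-δ c f f-per = trans (Σₚ-single c (λ a → δ (a - c) ⊗ f a)
      (λ a n → trans (cong (_⊗ f a) (δ-0 (n ∘ congruentℤ))) (⊗-zeroˡ (f a)))
      (λ {a} {b} d → cong₂ _⊗_ (δ-periodic (≡-shift {a} {b} (+ 1) (h a b c) d)) (f-per d)))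
    (trans (cong (_⊗ f c) (δ-1 (_≡_modℤ_.∣-differenceℤ (≡-refl {c} refl)))) (⊗-identityˡ (f c)))
    where
    h : ∀ a b c → a - c - (b - c) ≡ + 1 * (a - b)
    h = solve-∀

  record PeriodicFunction : Set where
    constructor periodicFunction
    field
      fun : ℤ → Zω
      periodic : Periodic fun
  open PeriodicFunction public

  _⋆_ : (ℤ → Zω) → (ℤ → Zω) → ℤ → Zω
  (f ⋆ g) t = Σₚ (λ a → f a ⊗ g (t - a))

  private
    ≡-⊖ : ∀ {s t} a → s ≡ t modℤ + p → s - a ≡ t - a modℤ + p
    ≡-⊖ {s} {t} a = ≡-shift {s} {t} (+ 1) (h s t a)
      where
      h : ∀ s t a → s - a - (t - a) ≡ + 1 * (s - t)
      h = solve-∀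
    ≡-⊖ʳ : ∀ {s t} a → s ≡ t modℤ + p → a - s ≡ a - t modℤ + p
    ≡-⊖ʳ {s} {t} a = ≡-shift {s} {t} (- + 1) (h s t a)
      where
      h : ∀ s t a → a - s - (a - t) ≡ - + 1 * (s - t)
      h = solve-∀
    ≡-⊕ : ∀ {s t} a → s ≡ t modℤ + p → s + a ≡ t + a modℤ + p
    ≡-⊕ {s} {t} a = ≡-shift {s} {t} (+ 1) (h s t a)
      where
      h : ∀ s t a → s + a - (t + a) ≡ + 1 * (s - t)
      h = solve-∀
    a-[a-b]≡b : ∀ a b → a - (a - b) ≡ b
    a-[a-b]≡b = solve-∀
    a+b-b≡a : ∀ a b → a + b - b ≡ a
    a+b-b≡a = solve-∀
    a-b+b≡a : ∀ a b → a - b + b ≡ a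
    a-b+b≡a = solve-∀
    t-[c+a]≡ : ∀ t c a → t - (c + a) ≡ t - a - c
    t-[c+a]≡ = solve-∀

  ⋆-periodic : ∀ {f g} → Periodic g → Periodic (f ⋆ g)
  ⋆-periodic {f} g-per {s} {t} d = Σₚ-cong (λ a → cong (f a ⊗_) (g-per (≡-⊖ {s} {t} a d)))

  Σₚ-translate : ∀ {f} → Periodic f → ∀ c → Σₚ f ≡ Σₚ (λ a → f (a + c))
  Σₚ-translate f-per c = Σₚ-reindex f-per (_+ c) (_- c) (λ {a} {b} → ≡-⊕ {a} {b} c) (λ {a} {b} → ≡-⊖ {a} {b} c)
    (λ a → ≡-refl (a-b+b≡a a c)) (λ a → ≡-refl (a+b-b≡a a c))

  Σₚ-reflect : ∀ {f} → Periodic f → ∀ c → Σₚ f ≡ Σₚ (λ a → f (c - a))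
  Σₚ-reflect f-per c = Σₚ-reindex f-per (λ a → c - a) (λ a → c - a) (λ {a} {b} → ≡-⊖ʳ {a} {b} c) (λ {a} {b} → ≡-⊖ʳ {a} {b} c)
    (λ a → ≡-refl (a-[a-b]≡b c a)) (λ a → ≡-refl (a-[a-b]≡b c a))

  product-periodic : ∀ {f g} → Periodic f → Periodic g → ∀ t → Periodic (λ a → f a ⊗ g (t - a))
  product-periodic f-per g-per t {a} {b} d = cong₂ _⊗_ (f-per d) (g-per (≡-⊖ʳ {a} {b} t d))

  ⋆-comm : ∀ {f g} → Periodic f → Periodic g → ∀ t → (f ⋆ g) t ≡ (g ⋆ f) t
  ⋆-comm {f} {g} f-per g-per t = trans (Σₚ-reflect (product-periodic f-per g-per t) t)
    (Σₚ-cong (λ a → trans (cong (f (t - a) ⊗_) (cong g (a-[a-b]≡b t a))) (⊗-comm (f (t - a)) (g a))))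

  ⋆-assoc : ∀ {f g h} → Periodic f → Periodic g → Periodic h → ∀ t → ((f ⋆ g) ⋆ h) t ≡ (f ⋆ (g ⋆ h)) t
  ⋆-assoc {f} {g} {h} f-per g-per h-per t = begin
    Σₚ (λ b → Σₚ (λ a → f a ⊗ g (b - a)) ⊗ h (t - b))
      ≡⟨ Σₚ-cong (λ b → Σω.*-distribʳ-sum (h (t - b)) ((λ a → f a ⊗ g (b - a)) ∘ at)) ⟩
    Σₚ (λ b → Σₚ (λ a → f a ⊗ g (b - a) ⊗ h (t - b)))
      ≡⟨ Σω.∑-comm {p} {p} (λ i j → f (at j) ⊗ g (at i - at j) ⊗ h (t - at i)) ⟩
    Σₚ (λ a → Σₚ (λ b → f a ⊗ g (b - a) ⊗ h (t - b)))
      ≡⟨ Σₚ-cong inner ⟩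
    Σₚ (λ a → f a ⊗ (g ⋆ h) (t - a)) ∎
    where
    open ≡-Reasoning
    inner : ∀ a → Σₚ (λ b → f a ⊗ g (b - a) ⊗ h (t - b)) ≡ f a ⊗ (g ⋆ h) (t - a)
    inner a = begin
      Σₚ (λ b → f a ⊗ g (b - a) ⊗ h (t - b))
        ≡⟨ Σₚ-translate (λ {b} {c} d → cong₂ _⊗_ (cong (f a ⊗_) (g-per (≡-⊖ {b} {c} a d))) (h-per (≡-⊖ʳ {b} {c} t d))) a ⟩
      Σₚ (λ c → f a ⊗ g (c + a - a) ⊗ h (t - (c + a)))
        ≡⟨ Σₚ-cong (λ c → trans (cong₂ (λ u v → f a ⊗ g u ⊗ h v) (a+b-b≡a c a) (t-[c+a]≡ t c a)) (⊗-assoc (f a) (g c) (h (t - a - c)))) ⟩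
      Σₚ (λ c → f a ⊗ (g c ⊗ h (t - a - c)))
        ≡⟨ Σω.*-distribˡ-sum (f a) ((λ c → g c ⊗ h (t - a - c)) ∘ at) ⟨
      f a ⊗ (g ⋆ h) (t - a) ∎

  private
    s-a≡0 : ∀ a → a - + 0 ≡ a
    s-a≡0 = ℤₚ.+-identityʳ

  ⋆-identityˡ : ∀ {f} → Periodic f → ∀ t → (δ ⋆ f) t ≡ f t
  ⋆-identityˡ {f} f-per t = trans (Σₚ-cong (λ a → cong (λ z → δ z ⊗ f (t - a)) (sym (s-a≡0 a))))
    (trans (Σₚ-δ (+ 0) (λ a → f (t - a)) (λ {a} {b} d → f-per (≡-⊖ʳ {a} {b} t d))) (cong f (s-a≡0 t)))

  ⋆-distribˡ : ∀ f g h t → (f ⋆ (λ a → g a ⊕ h a)) t ≡ (f ⋆ g) t ⊕ (f ⋆ h) t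
  ⋆-distribˡ f g h t = trans (Σₚ-cong (λ a → ⊗-distribˡ-⊕ (f a) (g (t - a)) (h (t - a))))
    (Σω.∑-distrib-+ {p} ((λ a → f a ⊗ g (t - a)) ∘ at) ((λ a → f a ⊗ h (t - a)) ∘ at))

  _⊞_ _⊠_ : PeriodicFunction → PeriodicFunction → PeriodicFunction
  periodicFunction f f-per ⊞ periodicFunction g g-per = periodicFunction (λ t → f t ⊕ g t) (λ d → cong₂ _⊕_ (f-per d) (g-per d))
  periodicFunction f f-per ⊠ periodicFunction g g-per = periodicFunction (f ⋆ g) (⋆-periodic {f} {g} g-per)

  -- coefficients in ℤ[ω]/μ; the coefficient of [t] in F is fun F t
  groupRing : Zω → CommutativeRing 0ℓ 0ℓ
  groupRing μ = record
    { Carrier = PeriodicFunction ; _≈_ = λ F G → ∀ t → fun F t ≈ fun G t mod μ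
    ; _+_ = _⊞_ ; _*_ = _⊠_
    ; -_ = λ F → periodicFunction (λ t → ⊝ fun F t) (λ d → cong ⊝_ (periodic F d))
    ; 0# = periodicFunction (λ _ → 0ω) (λ _ → refl)
    ; 1# = periodicFunction δ δ-periodic
    ; isCommutativeRing = record
      { isRing = record
        { +-isAbelianGroup = record
          { isGroup = record
            { isMonoid = record
              { isSemigroup = record
                { isMagma = record
                  { isEquivalence = record
                    { refl = λ t → mod-reflexive refl ; sym = λ e t → mod-sym (e t) ; trans = λ e e′ t → mod-trans (e t) (e′ t) }
                  ; ∙-cong = λ e e′ t → mod-⊕ (e t) (e′ t) }
                ; assoc = λ F G H t → mod-reflexive (⊕-assoc (fun F t) (fun G t) (fun H t)) }
              ; identity = (λ F t → mod-reflexive (⊕-identityˡ (fun F t))) , (λ F t → mod-reflexive (⊕-identityʳ (fun F t))) }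
            ; inverse = (λ F t → mod-reflexive (⊝-inverseˡ (fun F t))) , (λ F t → mod-reflexive (⊖-inverse (fun F t)))
            ; ⁻¹-cong = λ e t → mod-⊝ (e t) }
          ; comm = λ F G t → mod-reflexive (⊕-comm (fun F t) (fun G t)) }
        ; *-cong = λ e e′ t → sum-mod (λ i → mod-⊗ (e (at i)) (e′ (t - at i)))
        ; *-assoc = λ F G H t → mod-reflexive (⋆-assoc (periodic F) (periodic G) (periodic H) t)
        ; *-identity = (λ F t → mod-reflexive (⋆-identityˡ (periodic F) t))
                     , (λ F t → mod-reflexive (trans (⋆-comm (periodic F) δ-periodic t) (⋆-identityˡ (periodic F) t)))
        ; distrib = (λ F G H t → mod-reflexive (⋆-distribˡ (fun F) (fun G) (fun H) t))
                  , (λ F G H t → mod-reflexive (trans (⋆-comm (periodic (G ⊞ H)) (periodic F) t)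
                      (trans (⋆-distribˡ (fun F) (fun G) (fun H) t)
                        (cong₂ _⊕_ (⋆-comm (periodic F) (periodic G) t) (⋆-comm (periodic F) (periodic H) t)))))
        }
      ; *-comm = λ F G t → mod-reflexive (⋆-comm (periodic F) (periodic G) t)
      }
    }

  monomial : Zω → ℤ → PeriodicFunction
  monomial s c = periodicFunction (λ t → s ⊗ δ (t - c)) (λ {a} {b} d → cong (s ⊗_) (δ-periodic (≡-⊖ {a} {b} c d)))

  module _ (μ : Zω) where
    private module GR = CommutativeRing (groupRing μ)
    open Exp GR.semiring using (_^_)
    open Mult GR.semiring using () renaming (_×_ to _·_)
    open Sums GR.semiring using () renaming (sum to sumG)

    ×-eval : ∀ n F t → fun (n · F) t ≡ ι (+ n) ⊗ fun F t
    ×-eval zero F t = sym (⊗-zeroˡ (fun F t))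
    ×-eval (suc n) F t = trans (cong (fun F t ⊕_) (×-eval n F t))
      (trans (solve 2 (λ a m → a :+ m :* a := (con (+ 1) :+ m) :* a) refl (fun F t) (ι (+ n)))
             (cong (_⊗ fun F t) (sym (ι-⊕ (+ 1) (+ n)))))

    sum-eval : ∀ {n} (f : Fin n → PeriodicFunction) t → fun (sumG f) t ≡ sum (λ i → fun (f i) t)
    sum-eval {zero} f t = refl
    sum-eval {suc n} f t = cong (fun (f zero) t ⊕_) (sum-eval (f ∘ suc) t)

    monomial-expansion : ∀ F → F GR.≈ sumG (λ i → monomial (fun F (at i)) (at i))
    monomial-expansion F t = mod-reflexive (sym (trans (sum-eval (λ i → monomial (fun F (at i)) (at i)) t)
      (trans (sum-cong (λ i → trans (⊗-comm (fun F (at i)) (δ (t - at i))) (cong (_⊗ fun F (at i)) (δ-flip t (at i)))))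
             (Σₚ-δ t (fun F) (periodic F)))))
      where
      flip : ∀ s t → - (s - t) ≡ t - s
      flip = solve-∀
      δ-flip : ∀ s t → δ (s - t) ≡ δ (t - s)
      δ-flip s t = δ-cong (λ d → subst (+ p ℤ∣.∣_) (flip s t) (ℤ∣.∣m⇒∣-m d)) (λ d → subst (+ p ℤ∣.∣_) (flip t s) (ℤ∣.∣m⇒∣-m d))

    monomial-^ : ∀ s c n → (monomial s c ^ n) GR.≈ monomial (s ↑ n) (+ n * c)
    monomial-^ s c zero t = mod-reflexive (trans (sym (⊗-identityˡ (δ t))) (cong (λ z → 1ω ⊗ δ z) (sym (ℤₚ.+-identityʳ t))))
    monomial-^ s c (suc n) = GR.trans {monomial s c ^ suc n} {monomial s c ⊠ monomial (s ↑ n) (+ n * c)} {monomial (s ↑ suc n) (+ suc n * c)} (GR.*-congˡ {monomial s c} {monomial s c ^ n} {monomial (s ↑ n) (+ n * c)} (monomial-^ s c n)) λ t → mod-reflexive (begin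
      Σₚ (λ a → s ⊗ δ (a - c) ⊗ (s ↑ n ⊗ δ (t - a - + n * c)))
        ≡⟨ Σₚ-cong (λ a → solve 4 (λ s d r e → s :* d :* (r :* e) := d :* (s :* r :* e)) refl s (δ (a - c)) (s ↑ n) (δ (t - a - + n * c))) ⟩
      Σₚ (λ a → δ (a - c) ⊗ (s ⊗ s ↑ n ⊗ δ (t - a - + n * c)))
        ≡⟨ Σₚ-δ c (λ a → s ⊗ s ↑ n ⊗ δ (t - a - + n * c)) (λ {a} {b} d → cong (s ⊗ s ↑ n ⊗_) (δ-periodic (≡-shift {a} {b} (- + 1) (h₁ t a b (+ n * c)) d))) ⟩
      s ⊗ s ↑ n ⊗ δ (t - c - + n * c)
        ≡⟨ cong (λ z → s ⊗ s ↑ n ⊗ δ z) (trans (h₂ t c (+ n)) (cong (λ m → t - m * c) (sym (ℤₚ.pos-+ 1 n)))) ⟩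
      s ⊗ s ↑ n ⊗ δ (t - + suc n * c) ∎)
      where
      open ≡-Reasoning
      h₁ : ∀ t a b m → t - a - m - (t - b - m) ≡ - + 1 * (a - b)
      h₁ = solve-∀
      h₂ : ∀ t c n → t - c - n * c ≡ t - (+ 1 + n) * c
      h₂ = solve-∀

  -- (Σ f(a)[a])^q = Σ f(a)^q [qa], and q′ inverts q modulo p
  frobenius : ∀ {q} → Prime q → ∀ q′ → + q * q′ ≡ + 1 modℤ + p → ∀ F t →
    fun (Exp._^_ (CommutativeRing.semiring (groupRing (ι (+ q)))) F q) t ≈ fun F (q′ * t) ↑ q mod ι (+ q)
  frobenius {zero} Q q′ qq′≡1 F t = contradiction refl (prime≢0 Q)
  frobenius {q@(suc n)} Q q′ (congruentℤ qq′≡1) F t =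
    mod-trans (Exp.^-congˡ GR.semiring q (monomial-expansion (ι (+ q)) F) t)
    (mod-trans (Frobenius.^-distrib-sum (groupRing (ι (+ q))) Q char (λ i → monomial (fun F (at i)) (at i)) t)
    (mod-trans (Sums.sum-cong-≋ GR.semiring (λ i → monomial-^ (ι (+ q)) (fun F (at i)) (at i) q) t)
    (mod-reflexive (trans (sum-eval (ι (+ q)) (λ i → monomial (fun F (at i) ↑ q) (+ q * at i)) t)
    (trans (sum-cong (λ i → trans (⊗-comm (fun F (at i) ↑ q) (δ (t - + q * at i))) (cong (_⊗ fun F (at i) ↑ q) (δ-solve (at i)))))
           (Σₚ-δ (q′ * t) (λ a → fun F a ↑ q) (λ d → cong (_↑ q) (periodic F d))))))))
    where
    module GR = CommutativeRing (groupRing (ι (+ q)))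
    char : ∀ G → Mult._×_ GR.semiring q G GR.≈ GR.0#
    char G t = mod-trans (mod-reflexive (×-eval (ι (+ q)) q G t)) (mod-trivial (∣𝔼-⊗ʳ (fun G t) ∣𝔼-refl))
    δ-solve : ∀ a → δ (t - + q * a) ≡ δ (a - q′ * t)
    δ-solve a = δ-cong
      (λ d → subst (+ p ℤ∣.∣_) (h₁ t (+ q) a q′) (ℤ∣.∣m∣n⇒∣m-n (ℤ∣.∣n⇒∣m*n (- q′) d) (ℤ∣.∣n⇒∣m*n a qq′≡1)))
      (λ d → subst (+ p ℤ∣.∣_) (h₂ t (+ q) a q′) (ℤ∣.∣m∣n⇒∣m-n (ℤ∣.∣n⇒∣m*n (- + q) d) (ℤ∣.∣n⇒∣m*n t qq′≡1)))
      where
      h₁ : ∀ t q a q′ → - q′ * (t - q * a) - a * (q * q′ - + 1) ≡ a - q′ * t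
      h₁ = solve-∀
      h₂ : ∀ t q a q′ → - q * (a - q′ * t) - t * (q * q′ - + 1) ≡ t - q * a
      h₂ = solve-∀

-- Gauss and Jacobi sums

hockey-stick : ∀ n k → sum {n} (λ i → ι (+ (toℕ i choose k))) ≡ ι (+ (n choose suc k))
hockey-stick zero k = cong (ι ∘ +_) (sym (k>n⇒nCk≡0 {0} {suc k} (ℕ.s≤s ℕ.z≤n)))
hockey-stick (suc n) k = begin
  sum {suc n} (λ i → f (toℕ i))                    ≡⟨ sum-init-last-toℕ n f ⟩
  sum {n} (λ i → f (toℕ i)) ⊕ f n                  ≡⟨ cong (_⊕ f n) (hockey-stick n k) ⟩
  ι (+ (n choose suc k)) ⊕ ι (+ (n choose k))                ≡⟨ ⊕-comm (ι (+ (n choose suc k))) (f n) ⟩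
  ι (+ (n choose k)) ⊕ ι (+ (n choose suc k))                ≡⟨ ι-⊕ (+ (n choose k)) (+ (n choose suc k)) ⟨
  ι (+ (n choose k) + + (n choose suc k))                    ≡⟨ cong ι (ℤₚ.pos-+ (n choose k) (n choose suc k)) ⟨
  ι (+ ((n choose k) ℕ.+ (n choose suc k)))                  ≡⟨ cong (ι ∘ +_) (nCk+nC[k+1]≡[n+1]C[k+1] n k) ⟩
  ι (+ (suc n choose suc k))                            ∎
  where
  open ≡-Reasoning
  f : ℕ → Zω
  f m = ι (+ (m choose k))
  sum-init-last-toℕ : ∀ n (f : ℕ → Zω) → sum {suc n} (λ i → f (toℕ i)) ≡ sum {n} (λ i → f (toℕ i)) ⊕ f n
  sum-init-last-toℕ zero f = trans (⊕-identityʳ (f 0)) (sym (⊕-identityˡ (f 0)))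
  sum-init-last-toℕ (suc n) f = trans (cong (f 0 ⊕_) (sum-init-last-toℕ n (f ∘ suc))) (sym (⊕-assoc (f 0) _ (f (suc n))))

nCk-step : ∀ t k → suc k ℕ.* (t choose suc k) ℕ.+ k ℕ.* (t choose k) ≡ t ℕ.* (t choose k)
nCk-step t k = ℕₚ.+-cancelˡ-≡ (t choose k) _ _ (begin
  (t choose k) ℕ.+ (suc k ℕ.* (t choose suc k) ℕ.+ k ℕ.* (t choose k)) ≡⟨ h (t choose k) (t choose suc k) k ⟩
  suc k ℕ.* ((t choose k) ℕ.+ (t choose suc k))                   ≡⟨ cong (suc k ℕ.*_) (nCk+nC[k+1]≡[n+1]C[k+1] t k) ⟩
  suc k ℕ.* (suc t choose suc k)                             ≡⟨ absorption t k ⟩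
  suc t ℕ.* (t choose k)                                     ∎)
  where
  open ≡-Reasoning
  h : ∀ a b k → a ℕ.+ (suc k ℕ.* b ℕ.+ k ℕ.* a) ≡ suc k ℕ.* (a ℕ.+ b)
  h = ℕSolver.solve-∀

-- The binomial factor makes the induction work: t C(t,k) = (k+1) C(t,k+1) + k C(t,k).
power-sum : ∀ {p} → Prime p → ∀ i j k → i ℕ.+ j ℕ.+ suc k ℕ.< p →
  sum {p} (λ t → ι (+ toℕ t) ↑ i ⊗ ι (+ 1 - + toℕ t) ↑ j ⊗ ι (+ (toℕ t choose k))) ≈ 0ω mod ι (+ p)
power-sum {zero} P = λ _ _ _ ()
power-sum {suc n} P = bothPowers
  where
  T : ℕ → ℕ → ℕ → Fin (suc n) → Zω
  T i j k t = ι (+ toℕ t) ↑ i ⊗ ι (+ 1 - + toℕ t) ↑ j ⊗ ι (+ (toℕ t choose k))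
  leftPower : ∀ i k → i ℕ.+ suc k ℕ.< suc n → sum (T i 0 k) ≈ 0ω mod ι (+ suc n)
  -- The sum of C(t,k) over t < p is C(p,k+1), which p divides because 0 < k + 1 < p.
  leftPower zero k lt = mod-trans (mod-reflexive (trans
      (sum-cong {suc n} {T zero 0 k} {λ t → ι (+ (toℕ t choose k))} (λ t → trans (cong (_⊗ ι (+ (toℕ t choose k))) (⊗-identityʳ 1ω)) (⊗-identityˡ (ι (+ (toℕ t choose k))))))
      (hockey-stick (suc n) k)))
    (mod-trivial (∣𝔼-trans (∣⇒∣𝔼 (prime∣pCk P lt)) ∣𝔼-refl))
  leftPower (suc i) k lt = mod-trans (mod-reflexive (trans (sum-cong step)
      (trans (Σω.∑-distrib-+ {suc n} (λ t → ι (+ suc k) ⊗ T i 0 (suc k) t) (λ t → ι (+ k) ⊗ T i 0 k t))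
        (sym (cong₂ _⊕_ (Σω.*-distribˡ-sum (ι (+ suc k)) (T i 0 (suc k))) (Σω.*-distribˡ-sum (ι (+ k)) (T i 0 k)))))))
    (mod-trans (mod-⊕ (mod-⊗ (mod-reflexive {α = ι (+ suc k)} refl) (leftPower i (suc k) (subst (ℕ._< suc n) (sym (ℕₚ.+-suc i (suc k))) lt)))
                      (mod-⊗ (mod-reflexive {α = ι (+ k)} refl) (leftPower i k (ℕₚ.<-trans (ℕₚ.n<1+n _) lt))))
      (mod-reflexive (solve 2 (λ a b → a :* con (+ 0) :+ b :* con (+ 0) := con (+ 0)) refl (ι (+ suc k)) (ι (+ k)))))
    where
    step : ∀ t → T (suc i) 0 k t ≡ ι (+ suc k) ⊗ T i 0 (suc k) t ⊕ ι (+ k) ⊗ T i 0 k t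
    step t = begin
      τ ⊗ τ ↑ i ⊗ 1ω ⊗ ι (+ c)                ≡⟨ solve 3 (λ t u c → t :* u :* con (+ 1) :* c := u :* con (+ 1) :* (t :* c)) refl τ (τ ↑ i) (ι (+ c)) ⟩
      τ ↑ i ⊗ 1ω ⊗ (τ ⊗ ι (+ c))              ≡⟨ cong (τ ↑ i ⊗ 1ω ⊗_) (sym (trans (cong ι (ℤₚ.pos-* m c)) (ι-⊗ (+ m) (+ c)))) ⟩
      τ ↑ i ⊗ 1ω ⊗ ι (+ (m ℕ.* c))            ≡⟨ cong (λ z → τ ↑ i ⊗ 1ω ⊗ ι (+ z)) (nCk-step m k) ⟨
      τ ↑ i ⊗ 1ω ⊗ ι (+ (suc k ℕ.* d ℕ.+ k ℕ.* c))
        ≡⟨ cong (τ ↑ i ⊗ 1ω ⊗_) (trans (cong ι (trans (ℤₚ.pos-+ (suc k ℕ.* d) (k ℕ.* c)) (cong₂ _+_ (ℤₚ.pos-* (suc k) d) (ℤₚ.pos-* k c))))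
             (trans (ι-⊕ (+ suc k * + d) (+ k * + c)) (cong₂ _⊕_ (ι-⊗ (+ suc k) (+ d)) (ι-⊗ (+ k) (+ c))))) ⟩
      τ ↑ i ⊗ 1ω ⊗ (ι (+ suc k) ⊗ ι (+ d) ⊕ ι (+ k) ⊗ ι (+ c))
        ≡⟨ solve 5 (λ u a d b c → u :* (a :* d :+ b :* c) := a :* (u :* d) :+ b :* (u :* c)) refl (τ ↑ i ⊗ 1ω) (ι (+ suc k)) (ι (+ d)) (ι (+ k)) (ι (+ c)) ⟩
      ι (+ suc k) ⊗ (τ ↑ i ⊗ 1ω ⊗ ι (+ d)) ⊕ ι (+ k) ⊗ (τ ↑ i ⊗ 1ω ⊗ ι (+ c)) ∎
      where
      open ≡-Reasoning
      m c d : ℕ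
      m = toℕ t
      c = m choose k
      d = m choose suc k
      τ : Zω
      τ = ι (+ m)
  bothPowers : ∀ i j k → i ℕ.+ j ℕ.+ suc k ℕ.< suc n → sum (T i j k) ≈ 0ω mod ι (+ suc n)
  bothPowers i zero k lt = leftPower i k (subst (λ m → m ℕ.+ suc k ℕ.< suc n) (ℕₚ.+-identityʳ i) lt)
  -- One factor 1 - t is expanded; the term with t moves a unit from the exponent j + 1 to i, which
  -- keeps the total degree below the bound.
  bothPowers i (suc j) k lt = mod-trans (mod-reflexive (trans (sum-cong step)
      (trans (Σω.∑-distrib-+ {suc n} (T i j k) (λ t → ι (- + 1) ⊗ T (suc i) j k t))
        (cong (sum (T i j k) ⊕_) (sym (Σω.*-distribˡ-sum (ι (- + 1)) (T (suc i) j k)))))))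
    (mod-trans (mod-⊕ (bothPowers i j k (ℕₚ.<-trans (ℕₚ.n<1+n _) lt′)) (mod-⊗ (mod-reflexive {α = ι (- + 1)} refl) (bothPowers (suc i) j k lt′)))
      (mod-reflexive (solve 0 (con (+ 0) :+ con (- + 1) :* con (+ 0) := con (+ 0)) refl)))
    where
    lt′ : suc (i ℕ.+ j ℕ.+ suc k) ℕ.< suc n
    lt′ = subst (λ m → m ℕ.+ suc k ℕ.< suc n) (ℕₚ.+-suc i j) lt
    step : ∀ t → T i (suc j) k t ≡ T i j k t ⊕ ι (- + 1) ⊗ T (suc i) j k t
    step t = trans (cong (λ z → τ ↑ i ⊗ (z ⊗ u ↑ j) ⊗ c) (trans (ι-⊕ (+ 1) (- + m)) (cong (1ω ⊕_) (ι-⊝ (+ m)))))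
      (solve 4 (λ t a b c → a :* ((con (+ 1) :- t) :* b) :* c := a :* b :* c :+ con (- + 1) :* (t :* a :* b :* c)) refl τ (τ ↑ i) (u ↑ j) c)
      where
      m : ℕ
      m = toℕ t
      τ u c : Zω
      τ = ι (+ m)
      u = ι (+ 1 - + m)
      c = ι (+ (m choose k))

cubicValue-↑[1+3k] : ∀ {χ} → IsCubicValue χ → ∀ k → χ ↑ (1 ℕ.+ k ℕ.* 3) ≡ χ
cubicValue-↑[1+3k] {χ} v zero = ⊗-identityʳ χ
cubicValue-↑[1+3k] {χ} v (suc k) = trans (cong (λ z → χ ⊗ (χ ⊗ (χ ⊗ z))) (cubicValue-↑[1+3k] v k))
  (trans (solve 1 (λ x → x :* (x :* (x :* x)) := x :* x :* x :* x) refl χ) (cubicValue-↑4 v))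

-- Since N π is a prime p, the residue field of π is ℤ/p, and the symbol modulo π restricts to a
-- cubic character χ of ℤ/p.
module GaussSum {π} (P : Prime𝔼 π) (π∤3 : ¬ π ∣𝔼 ι (+ 3)) (Q : Prime (N π)) where
  p e : ℕ
  p = N π
  e = exponent π
  instance
    p-nonZero : NonZero p
    p-nonZero = prime⇒nonZero Q
  open Residues p public

  π∣p : π ∣𝔼 ι (+ p)
  π∣p = divides (conj π) (sym (α⊗conj-α π))

  χ χ̄ : ℤ → Zω
  χ t = res (ι t) π
  χ̄ t = conj (χ t)

  χ-value : ∀ t → IsCubicValue (χ t)
  χ-value t = res-value (ι t) π

  χ-periodic : Periodic χ
  χ-periodic (congruentℤ d) = res-cong P π∤3 (mod-∣ π∣p (ι-mod d))

  χ̄-periodic : Periodic χ̄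
  χ̄-periodic d = cong conj (χ-periodic d)

  χ-* : ∀ a b → χ (a * b) ≡ χ a ⊗ χ b
  χ-* a b = trans (cong (λ α → res α π) (ι-⊗ a b)) (res-⊗ P π∤3 (ι a) (ι b))

  χ-0 : ∀ {t} → + p ℤ∣.∣ t → χ t ≡ 0ω
  χ-0 d = ∣⇒res≡0 P π∤3 (∣𝔼-trans π∣p (∣⇒ι∣ι d))

  χ-≢0 : ∀ {t} → ¬ + p ℤ∣.∣ t → ¬ χ t ≡ 0ω
  χ-≢0 {t} p∤t eq = p∤t (ℤ∣.∣ᵤ⇒∣ ([ (λ d → d) , (λ d → d) ]′ (euclidsLemma ∣ t ∣ ∣ t ∣ Q
    (subst (p ℕ∣.∣_) (N-ι t) (∣𝔼⇒N∣N (res≡0⇒∣ P π∤3 eq))))))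

  χ-1 : χ (+ 1) ≡ 1ω
  χ-1 = res-unique P π∤3 (is1 refl) (mod-reflexive (1↑ e))

  χ--1 : χ (- + 1) ≡ 1ω
  χ--1 = begin
    χ (- + 1)                        ≡⟨ cubicValue-↑4 (χ-value (- + 1)) ⟨
    v ⊗ v ⊗ v ⊗ v                    ≡⟨ ⊗-assoc (v ⊗ v) v v ⟩
    v ⊗ v ⊗ (v ⊗ v)                  ≡⟨ cong₂ _⊗_ v²≡1 v²≡1 ⟩
    1ω ⊗ 1ω                          ≡⟨ ⊗-identityʳ 1ω ⟩
    1ω                               ∎
    where
    open ≡-Reasoning
    v : Zω
    v = χ (- + 1)
    v²≡1 : v ⊗ v ≡ 1ω
    v²≡1 = trans (sym (χ-* (- + 1) (- + 1))) χ-1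

  χ-neg : ∀ a → χ (- a) ≡ χ a
  χ-neg a = trans (cong χ (h a)) (trans (χ-* (- + 1) a) (trans (cong (_⊗ χ a) χ--1) (⊗-identityˡ (χ a))))
    where
    h : ∀ a → - a ≡ - + 1 * a
    h = solve-∀

  p∤1 : ¬ + p ℤ∣.∣ + 1
  p∤1 d = prime≢1 Q (ℕ∣.∣1⇒≡1 (ℤ∣.∣⇒∣ᵤ d))

  inverse : ∀ {b} → ¬ + p ℤ∣.∣ b → ∃ λ b′ → b * b′ ≡ + 1 modℤ + p
  inverse {b} p∤b = go (prime∤⇒⊥ℤ Q {b} (p∤b ∘ ℤ∣.∣ᵤ⇒∣))
    where
    go : + p ⊥ℤ b → ∃ λ b′ → b * b′ ≡ + 1 modℤ + p
    go (comaximal s t eq) = t , congruentℤ (ℤ∣.divides (- s) (trans (cong (λ z → b * t - z) (sym eq)) (h (+ p) b s t)))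
      where
      h : ∀ p b s t → b * t - (p * s + b * t) ≡ - s * p
      h = solve-∀

  Σₚ-scale : ∀ {f} → Periodic f → ∀ {b} → ¬ + p ℤ∣.∣ b → Σₚ f ≡ Σₚ (λ a → f (b * a))
  Σₚ-scale f-per {b} p∤b = Σₚ-reindex f-per (b *_) (b′ *_)
    (λ {s} {t} → ≡-shift b (h b s t)) (λ {s} {t} → ≡-shift b′ (h b′ s t))
    (λ a → ≡-shift a (h₁ b b′ a) bb′≡1) (λ a → ≡-shift a (h₂ b b′ a) bb′≡1)
    where
    b′ : ℤ
    b′ = proj₁ (inverse p∤b)
    bb′≡1 : b * b′ ≡ + 1 modℤ + p
    bb′≡1 = proj₂ (inverse p∤b)
    h : ∀ b s t → b * s - b * t ≡ b * (s - t)
    h = solve-∀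
    h₁ : ∀ b b′ a → b * (b′ * a) - a ≡ a * (b * b′ - + 1)
    h₁ = solve-∀
    h₂ : ∀ b b′ a → b′ * (b * a) - a ≡ a * (b * b′ - + 1)
    h₂ = solve-∀

  p≡1+3e : p ≡ 1 ℕ.+ 3 ℕ.* e
  p≡1+3e = N≡1+3e P π∤3

  e>0 : 0 ℕ.< e
  e>0 = go e p≡1+3e
    where
    go : ∀ e → p ≡ 1 ℕ.+ 3 ℕ.* e → 0 ℕ.< e
    go zero eq = contradiction eq (prime≢1 Q)
    go (suc e) _ = ℕ.s≤s ℕ.z≤n

  -- The bound of `power-sum` with i = j = e and k = 0: the polynomial t^e (1 - t)^e has degree 2e <
  -- p - 1 = 3e.
  2e+1<p : e ℕ.+ e ℕ.+ 1 ℕ.< p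
  2e+1<p = subst (e ℕ.+ e ℕ.+ 1 ℕ.<_) (trans (h e) (sym p≡1+3e)) (ℕₚ.m<m+n (e ℕ.+ e ℕ.+ 1) e>0)
    where
    h : ∀ e → e ℕ.+ e ℕ.+ 1 ℕ.+ e ≡ 1 ℕ.+ 3 ℕ.* e
    h = ℕSolver.solve-∀

  -- Modulo π the character is t^e, so this is a power sum of degree e < p - 1.
  Σχ≈0 : Σₚ χ ≈ 0ω mod π
  Σχ≈0 = mod-trans (sum-mod (λ i → mod-trans (mod-sym (res-≈ P π∤3 (ι (at i)))) (mod-reflexive (h i))))
    (mod-∣ π∣p (power-sum Q e 0 0 (ℕₚ.≤-<-trans (ℕₚ.+-monoˡ-≤ 1 (ℕₚ.+-monoʳ-≤ e ℕ.z≤n)) 2e+1<p)))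
    where
    h : ∀ i → ι (at i) ↑ e ≡ ι (+ toℕ i) ↑ e ⊗ 1ω ⊗ ι (+ (toℕ i choose 0))
    h i = trans (solve 1 (λ x → x := x :* con (+ 1) :* con (+ 1)) refl (ι (at i) ↑ e)) (cong (λ c → ι (at i) ↑ e ⊗ 1ω ⊗ ι (+ c)) (sym (nC0≡1 (toℕ i))))

  Σδ≡1 : Σₚ δ ≡ 1ω
  Σδ≡1 = trans (Σₚ-cong (λ a → trans (cong δ (sym (ℤₚ.+-identityʳ a))) (sym (⊗-identityʳ (δ (a - + 0)))))) (Σₚ-δ (+ 0) (λ _ → 1ω) (λ _ → refl))

  sum-1 : ∀ n → sum {n} (λ _ → 1ω) ≡ ι (+ n)
  sum-1 zero = refl
  sum-1 (suc n) = trans (cong (1ω ⊕_) (sum-1 n)) (sym (ι-⊕ (+ 1) (+ n)))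

  -- A substitute for a primitive root. If χ took only the values 0 and 1, then χ + δ would be
  -- constantly 1; summing over ℤ/p gives Σχ + 1 = p, and π would divide 1.
  nonresidue : ∃ λ i → ¬ (χ (at i) ≡ 0ω ⊎ χ (at i) ≡ 1ω)
  nonresidue = go (Finₚ.all? trivial?)
    where
    trivial? : ∀ i → Dec (χ (at i) ≡ 0ω ⊎ χ (at i) ≡ 1ω)
    trivial? i = (χ (at i) ≟ω 0ω) ⊎-dec (χ (at i) ≟ω 1ω)
    complement : ∀ i → (χ (at i) ≡ 0ω ⊎ χ (at i) ≡ 1ω) → χ (at i) ⊕ δ (at i) ≡ 1ω
    complement i t = by-cases (+ p ℤ∣.∣? at i)
      where
      by-cases : Dec (+ p ℤ∣.∣ at i) → χ (at i) ⊕ δ (at i) ≡ 1ω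
      by-cases (yes d) = trans (cong₂ _⊕_ (χ-0 d) (δ-1 d)) (⊕-identityˡ 1ω)
      by-cases (no n) = trans (cong₂ _⊕_ ([ (λ z → contradiction z (χ-≢0 n)) , (λ z → z) ]′ t) (δ-0 n)) (⊕-identityʳ 1ω)
    go : Dec (∀ i → χ (at i) ≡ 0ω ⊎ χ (at i) ≡ 1ω) → ∃ λ i → ¬ (χ (at i) ≡ 0ω ⊎ χ (at i) ≡ 1ω)
    go (no n) = Finₚ.¬∀⟶∃¬ p (λ i → χ (at i) ≡ 0ω ⊎ χ (at i) ≡ 1ω) trivial? n
    go (yes all) = contradiction π∣1 (Prime𝔼.∤1 P)
      where
      total : Σₚ χ ⊕ 1ω ≡ ι (+ p)
      total = trans (cong (Σₚ χ ⊕_) (sym Σδ≡1)) (trans (sym (Σω.∑-distrib-+ {p} (χ ∘ at) (δ ∘ at))) (trans (sum-cong (λ i → complement i (all i))) (sum-1 p)))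
      π∣1 : π ∣𝔼 1ω
      π∣1 = subst (π ∣𝔼_) (trans (cong (_⊖ Σₚ χ) (sym total)) (solve 1 (λ s → s :+ con (+ 1) :- s := con (+ 1)) refl (Σₚ χ)))
        (∣𝔼-⊖ π∣p (mod-0⇒∣ Σχ≈0))

  -- Scaling the variable by a nonresidue b permutes the terms and multiplies the sum by χ(b) ≠ 1.
  Σχ≡0 : Σₚ χ ≡ 0ω
  Σχ≡0 = [ (λ z → contradiction (inj₂ (⊖≡0⇒≡ z)) b-nontrivial) , (λ z → z) ]′ (integral (χ b ⊖ 1ω) (Σₚ χ)
    (trans (solve 2 (λ c s → (c :- con (+ 1)) :* s := c :* s :- s) refl (χ b) (Σₚ χ)) (trans (cong (_⊖ Σₚ χ) scaled) (⊖-inverse (Σₚ χ)))))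
    where
    b : ℤ
    b = at (proj₁ nonresidue)
    b-nontrivial : ¬ (χ b ≡ 0ω ⊎ χ b ≡ 1ω)
    b-nontrivial = proj₂ nonresidue
    scaled : χ b ⊗ Σₚ χ ≡ Σₚ χ
    scaled = trans (Σω.*-distribˡ-sum (χ b) (χ ∘ at)) (trans (Σₚ-cong (λ a → sym (χ-* b a))) (sym (Σₚ-scale χ-periodic {b} (λ d → b-nontrivial (inj₁ (χ-0 d))))))

  conj-sum : ∀ {n} (f : Fin n → Zω) → conj (sum f) ≡ sum (conj ∘ f)
  conj-sum {zero} f = conj-ι (+ 0)
  conj-sum {suc n} f = trans (conj-⊕ (f zero) (sum (f ∘ suc))) (cong (conj (f zero) ⊕_) (conj-sum (f ∘ suc)))

  Σχ̄≡0 : Σₚ χ̄ ≡ 0ω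
  Σχ̄≡0 = trans (sym (conj-sum (χ ∘ at))) (trans (cong conj Σχ≡0) (conj-ι (+ 0)))

  J : Zω
  J = Σₚ (λ a → χ a ⊗ χ (+ 1 - a))

  private
    t-ta≡ : ∀ t a → t - t * a ≡ t * (+ 1 - a)
    t-ta≡ = solve-∀

  ⋆-scaleʳ : ∀ f c g t → (f ⋆ (λ a → c ⊗ g a)) t ≡ c ⊗ (f ⋆ g) t
  ⋆-scaleʳ f c g t = trans (Σₚ-cong (λ a → solve 3 (λ x c y → x :* (c :* y) := c :* (x :* y)) refl (f a) c (g (t - a))))
    (sym (Σω.*-distribˡ-sum c ((λ a → f a ⊗ g (t - a)) ∘ at)))

  ⋆-congʳ : ∀ f {g h} → (∀ t → g t ≡ h t) → ∀ t → (f ⋆ g) t ≡ (f ⋆ h) t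
  ⋆-congʳ f eq t = Σₚ-cong (λ a → cong (f a ⊗_) (eq (t - a)))

  ⋆-homogeneous : ∀ {f g} → Periodic f → Periodic g → (∀ a b → f (a * b) ≡ f a ⊗ f b) → (∀ a b → g (a * b) ≡ g a ⊗ g b) →
    ∀ {t} → ¬ + p ℤ∣.∣ t → (f ⋆ g) t ≡ f t ⊗ g t ⊗ (f ⋆ g) (+ 1)
  ⋆-homogeneous {f} {g} f-per g-per f-* g-* {t} n = begin
    Σₚ (λ a → f a ⊗ g (t - a))
      ≡⟨ Σₚ-scale (product-periodic f-per g-per t) n ⟩
    Σₚ (λ a → f (t * a) ⊗ g (t - t * a))
      ≡⟨ Σₚ-cong (λ a → trans (cong₂ _⊗_ (f-* t a) (trans (cong g (t-ta≡ t a)) (g-* t (+ 1 - a))))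
           (solve 4 (λ x a y b → x :* a :* (y :* b) := x :* y :* (a :* b)) refl (f t) (f a) (g t) (g (+ 1 - a)))) ⟩
    Σₚ (λ a → f t ⊗ g t ⊗ (f a ⊗ g (+ 1 - a)))
      ≡⟨ Σω.*-distribˡ-sum (f t ⊗ g t) ((λ a → f a ⊗ g (+ 1 - a)) ∘ at) ⟨
    f t ⊗ g t ⊗ (f ⋆ g) (+ 1) ∎
    where open ≡-Reasoning

  χ̄-* : ∀ a b → χ̄ (a * b) ≡ χ̄ a ⊗ χ̄ b
  χ̄-* a b = trans (cong conj (χ-* a b)) (conj-⊗ (χ a) (χ b))

  private
    [t-a]-[-a]≡ : ∀ t a → t - a - - a ≡ + 1 * (t - + 0)
    [t-a]-[-a]≡ = solve-∀

  reflected : ∀ {t} → + p ℤ∣.∣ t → ∀ a → χ (t - a) ≡ χ a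
  reflected {t} d a = trans (χ-periodic (≡-shift {t} {+ 0} (+ 1) ([t-a]-[-a]≡ t a) (congruentℤ (subst (+ p ℤ∣.∣_) (sym (ℤₚ.+-identityʳ t)) d)))) (χ-neg a)

  -- For t prime to p the substitution a ↦ ta extracts χ(t)² = χ̄(t). For p ∣ t the sum becomes
  -- Σχ(a)χ(-a) = Σχ̄ = 0, in agreement with χ̄(t) = 0.
  χ⋆χ : ∀ t → (χ ⋆ χ) t ≡ J ⊗ χ̄ t
  χ⋆χ t = go (+ p ℤ∣.∣? t)
    where
    open ≡-Reasoning
    go : Dec (+ p ℤ∣.∣ t) → (χ ⋆ χ) t ≡ J ⊗ χ̄ t
    go (no n) = begin
      (χ ⋆ χ) t          ≡⟨ ⋆-homogeneous χ-periodic χ-periodic χ-* χ-* n ⟩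
      χ t ⊗ χ t ⊗ J      ≡⟨ cong (_⊗ J) (cubicValue-square (χ-value t)) ⟩
      χ̄ t ⊗ J            ≡⟨ ⊗-comm (χ̄ t) J ⟩
      J ⊗ χ̄ t            ∎
    go (yes d) = begin
      (χ ⋆ χ) t                  ≡⟨ Σₚ-cong (λ a → trans (cong (χ a ⊗_) (reflected d a)) (cubicValue-square (χ-value a))) ⟩
      Σₚ χ̄                       ≡⟨ Σχ̄≡0 ⟩
      0ω                         ≡⟨ ⊗-zeroʳ J ⟨
      J ⊗ 0ω                     ≡⟨ cong (J ⊗_) (trans (cong conj (χ-0 d)) (conj-ι (+ 0))) ⟨
      J ⊗ χ̄ t                    ∎

  D : ℤ → Zω
  D t = ι (+ p) ⊗ δ t ⊖ 1ω

  χχ̄≡1-δ : ∀ a → χ a ⊗ χ̄ a ≡ 1ω ⊖ δ a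
  χχ̄≡1-δ a = go (+ p ℤ∣.∣? a)
    where
    go : Dec (+ p ℤ∣.∣ a) → χ a ⊗ χ̄ a ≡ 1ω ⊖ δ a
    go (yes d) = trans (cong (_⊗ χ̄ a) (χ-0 d)) (trans (⊗-zeroˡ (χ̄ a)) (trans (sym (⊖-inverse 1ω)) (cong (1ω ⊖_) (sym (δ-1 d)))))
    go (no n) = trans (cong (χ a ⊗_) (sym (cubicValue-square (χ-value a)))) (trans (sym (⊗-assoc (χ a) (χ a) (χ a)))
      (trans (cubicValue-cube (χ-value a) (χ-≢0 n)) (trans (solve 0 (con (+ 1) := con (+ 1) :- con (+ 0)) refl) (cong (1ω ⊖_) (sym (δ-0 n))))))

  sum-⊝ : ∀ {n} (f : Fin n → Zω) → sum (λ i → ⊝ f i) ≡ ⊝ sum f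
  sum-⊝ {zero} f = solve 0 (con (+ 0) := :- con (+ 0)) refl
  sum-⊝ {suc n} f = trans (cong (⊝ f zero ⊕_) (sum-⊝ (f ∘ suc))) (solve 2 (λ a b → :- a :+ :- b := :- (a :+ b)) refl (f zero) (sum (f ∘ suc)))

  Σ[1-δ]≡p-1 : Σₚ (λ a → 1ω ⊖ δ a) ≡ ι (+ p) ⊖ 1ω
  Σ[1-δ]≡p-1 = trans (Σω.∑-distrib-+ {p} (λ _ → 1ω) (λ i → ⊝ δ (at i))) (cong₂ _⊕_ (sum-1 p) (trans (sum-⊝ (δ ∘ at)) (cong ⊝_ Σδ≡1)))

  Σₚ-convolution : ∀ {f g} → Periodic g → Σₚ (f ⋆ g) ≡ Σₚ f ⊗ Σₚ g
  Σₚ-convolution {f} {g} g-per = begin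
    Σₚ (λ t → Σₚ (λ a → f a ⊗ g (t - a)))   ≡⟨ Σω.∑-comm {p} {p} (λ i j → f (at j) ⊗ g (at i - at j)) ⟩
    Σₚ (λ a → Σₚ (λ t → f a ⊗ g (t - a)))   ≡⟨ Σₚ-cong (λ a → trans (sym (Σω.*-distribˡ-sum (f a) ((λ t → g (t - a)) ∘ at)))
                                                 (cong (f a ⊗_) (sym (Σₚ-translate g-per (- a))))) ⟩
    Σₚ (λ a → f a ⊗ Σₚ g)                   ≡⟨ Σω.*-distribʳ-sum (Σₚ g) (f ∘ at) ⟨
    Σₚ f ⊗ Σₚ g                             ∎
    where open ≡-Reasoning

  K : Zω
  K = (χ ⋆ χ̄) (+ 1)

  χ⋆χ̄-form : ∀ t → (χ ⋆ χ̄) t ≡ (ι (+ p) ⊖ 1ω) ⊗ δ t ⊕ K ⊗ (1ω ⊖ δ t)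
  χ⋆χ̄-form t = go (+ p ℤ∣.∣? t)
    where
    open ≡-Reasoning
    go : Dec (+ p ℤ∣.∣ t) → (χ ⋆ χ̄) t ≡ (ι (+ p) ⊖ 1ω) ⊗ δ t ⊕ K ⊗ (1ω ⊖ δ t)
    go (no n) = begin
      (χ ⋆ χ̄) t             ≡⟨ ⋆-homogeneous χ-periodic χ̄-periodic χ-* χ̄-* n ⟩
      χ t ⊗ χ̄ t ⊗ K         ≡⟨ cong (_⊗ K) (χχ̄≡1-δ t) ⟩
      (1ω ⊖ δ t) ⊗ K        ≡⟨ cong (λ z → (1ω ⊖ z) ⊗ K) (δ-0 n) ⟩
      (1ω ⊖ 0ω) ⊗ K         ≡⟨ solve 2 (λ p k → (con (+ 1) :- con (+ 0)) :* k := (p :- con (+ 1)) :* con (+ 0) :+ k :* (con (+ 1) :- con (+ 0))) refl (ι (+ p)) K ⟩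
      (ι (+ p) ⊖ 1ω) ⊗ 0ω ⊕ K ⊗ (1ω ⊖ 0ω) ≡⟨ cong (λ z → (ι (+ p) ⊖ 1ω) ⊗ z ⊕ K ⊗ (1ω ⊖ z)) (δ-0 n) ⟨
      (ι (+ p) ⊖ 1ω) ⊗ δ t ⊕ K ⊗ (1ω ⊖ δ t) ∎
    go (yes d) = begin
      (χ ⋆ χ̄) t             ≡⟨ Σₚ-cong (λ a → trans (cong (χ a ⊗_) (cong conj (reflected d a))) (χχ̄≡1-δ a)) ⟩
      Σₚ (λ a → 1ω ⊖ δ a)   ≡⟨ Σ[1-δ]≡p-1 ⟩
      ι (+ p) ⊖ 1ω          ≡⟨ solve 2 (λ p k → p := p :* con (+ 1) :+ k :* (con (+ 1) :- con (+ 1))) refl (ι (+ p) ⊖ 1ω) K ⟩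
      (ι (+ p) ⊖ 1ω) ⊗ 1ω ⊕ K ⊗ (1ω ⊖ 1ω) ≡⟨ cong (λ z → (ι (+ p) ⊖ 1ω) ⊗ z ⊕ K ⊗ (1ω ⊖ z)) (δ-1 d) ⟨
      (ι (+ p) ⊖ 1ω) ⊗ δ t ⊕ K ⊗ (1ω ⊖ δ t) ∎

  -- Summing χ⋆χ̄ over all t gives (Σχ)(Σχ̄) = 0, which determines K.
  K≡-1 : K ≡ ⊝ 1ω
  K≡-1 = [ (λ z → contradiction (p≡1 z) (prime≢1 Q))
         , (λ z → trans (solve 1 (λ k → k := con (+ 1) :+ k :- con (+ 1)) refl K) (trans (cong (_⊖ 1ω) z) (⊕-identityˡ (⊝ 1ω)))) ]′
    (integral (ι (+ p) ⊖ 1ω) (1ω ⊕ K) (begin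
      (ι (+ p) ⊖ 1ω) ⊗ (1ω ⊕ K)
        ≡⟨ solve 2 (λ p k → p :* (con (+ 1) :+ k) := p :* con (+ 1) :+ k :* p) refl (ι (+ p) ⊖ 1ω) K ⟩
      (ι (+ p) ⊖ 1ω) ⊗ 1ω ⊕ K ⊗ (ι (+ p) ⊖ 1ω)
        ≡⟨ cong₂ (λ a b → (ι (+ p) ⊖ 1ω) ⊗ a ⊕ K ⊗ b) Σδ≡1 Σ[1-δ]≡p-1 ⟨
      (ι (+ p) ⊖ 1ω) ⊗ Σₚ δ ⊕ K ⊗ Σₚ (λ t → 1ω ⊖ δ t)
        ≡⟨ cong₂ _⊕_ (Σω.*-distribˡ-sum (ι (+ p) ⊖ 1ω) (δ ∘ at)) (Σω.*-distribˡ-sum K ((λ t → 1ω ⊖ δ t) ∘ at)) ⟩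
      Σₚ (λ t → (ι (+ p) ⊖ 1ω) ⊗ δ t) ⊕ Σₚ (λ t → K ⊗ (1ω ⊖ δ t))
        ≡⟨ Σω.∑-distrib-+ {p} ((λ t → (ι (+ p) ⊖ 1ω) ⊗ δ t) ∘ at) ((λ t → K ⊗ (1ω ⊖ δ t)) ∘ at) ⟨
      Σₚ (λ t → (ι (+ p) ⊖ 1ω) ⊗ δ t ⊕ K ⊗ (1ω ⊖ δ t))
        ≡⟨ Σₚ-cong χ⋆χ̄-form ⟨
      Σₚ (χ ⋆ χ̄)
        ≡⟨ Σₚ-convolution {χ} {χ̄} χ̄-periodic ⟩
      Σₚ χ ⊗ Σₚ χ̄
        ≡⟨ cong (_⊗ Σₚ χ̄) Σχ≡0 ⟩
      0ω ⊗ Σₚ χ̄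
        ≡⟨ ⊗-zeroˡ (Σₚ χ̄) ⟩
      0ω ∎))
    where
    open ≡-Reasoning
    p≡1 : ι (+ p) ⊖ 1ω ≡ 0ω → p ≡ 1
    p≡1 z = ℤₚ.+-injective (ι-injective (⊖≡0⇒≡ z))

  χ⋆χ̄ : ∀ t → (χ ⋆ χ̄) t ≡ D t
  χ⋆χ̄ t = trans (χ⋆χ̄-form t) (trans (cong (λ k → (ι (+ p) ⊖ 1ω) ⊗ δ t ⊕ k ⊗ (1ω ⊖ δ t)) K≡-1)
    (solve 2 (λ p d → (p :- con (+ 1)) :* d :+ :- con (+ 1) :* (con (+ 1) :- d) := p :* d :- con (+ 1)) refl (ι (+ p)) (δ t)))

  -- Convolution with the part Σ[t] of `D` yields only the total Σf, which vanishes here; the part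
  -- p[0] multiplies by p.
  ⋆D : ∀ {f} → Periodic f → Σₚ f ≡ 0ω → ∀ t → (f ⋆ D) t ≡ ι (+ p) ⊗ f t
  ⋆D {f} f-per Σf≡0 t = begin
    (f ⋆ D) t                                                     ≡⟨ ⋆-distribˡ f (λ a → ι (+ p) ⊗ δ a) (λ _ → ⊝ 1ω) t ⟩
    (f ⋆ (λ a → ι (+ p) ⊗ δ a)) t ⊕ Σₚ (λ a → f a ⊗ ⊝ 1ω)         ≡⟨ cong₂ _⊕_ (⋆-scaleʳ f (ι (+ p)) δ t) (sym (Σω.*-distribʳ-sum (⊝ 1ω) (f ∘ at))) ⟩
    ι (+ p) ⊗ (f ⋆ δ) t ⊕ Σₚ f ⊗ ⊝ 1ω                             ≡⟨ cong₂ (λ a b → ι (+ p) ⊗ a ⊕ b ⊗ ⊝ 1ω) (trans (⋆-comm f-per δ-periodic t) (⋆-identityˡ f-per t)) Σf≡0 ⟩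
    ι (+ p) ⊗ f t ⊕ 0ω ⊗ ⊝ 1ω                                     ≡⟨ solve 1 (λ x → x :+ con (+ 0) :* :- con (+ 1) := x) refl (ι (+ p) ⊗ f t) ⟩
    ι (+ p) ⊗ f t                                                 ∎
    where open ≡-Reasoning

  D-1 : D (+ 1) ≡ ⊝ 1ω
  D-1 = trans (cong (λ d → ι (+ p) ⊗ d ⊖ 1ω) (δ-0 p∤1)) (solve 1 (λ p → p :* con (+ 0) :- con (+ 1) := :- con (+ 1)) refl (ι (+ p)))

  χ̄⋆χ̄ : ∀ t → (χ̄ ⋆ χ̄) t ≡ conj J ⊗ χ t
  χ̄⋆χ̄ t = begin
    Σₚ (λ a → χ̄ a ⊗ χ̄ (t - a))           ≡⟨ Σₚ-cong (λ a → sym (conj-⊗ (χ a) (χ (t - a)))) ⟩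
    Σₚ (λ a → conj (χ a ⊗ χ (t - a)))    ≡⟨ conj-sum ((λ a → χ a ⊗ χ (t - a)) ∘ at) ⟨
    conj ((χ ⋆ χ) t)                     ≡⟨ cong conj (χ⋆χ t) ⟩
    conj (J ⊗ χ̄ t)                       ≡⟨ conj-⊗ J (χ̄ t) ⟩
    conj J ⊗ conj (χ̄ t)                  ≡⟨ cong (conj J ⊗_) (conj-involutive (χ t)) ⟩
    conj J ⊗ χ t                         ∎
    where open ≡-Reasoning

  -- evaluate χ⋆χ⋆χ̄⋆χ̄ at 1 in two ways
  J⊗conj-J : J ⊗ conj J ≡ ι (+ p)
  J⊗conj-J = begin
    J ⊗ conj J                  ≡⟨ solve 2 (λ j k → j :* k := :- (k :* (j :* :- con (+ 1)))) refl J (conj J) ⟩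
    ⊝ (conj J ⊗ (J ⊗ ⊝ 1ω))     ≡⟨ cong ⊝_ (trans (sym viaJ) viaP) ⟩
    ⊝ (ι (+ p) ⊗ ⊝ 1ω)          ≡⟨ solve 1 (λ p → :- (p :* :- con (+ 1)) := p) refl (ι (+ p)) ⟩
    ι (+ p)                     ∎
    where
    open ≡-Reasoning
    viaJ : (χ ⋆ (χ ⋆ (χ̄ ⋆ χ̄))) (+ 1) ≡ conj J ⊗ (J ⊗ ⊝ 1ω)
    viaJ = begin
      (χ ⋆ (χ ⋆ (χ̄ ⋆ χ̄))) (+ 1)                 ≡⟨ ⋆-congʳ χ (λ s → trans (⋆-congʳ χ χ̄⋆χ̄ s) (trans (⋆-scaleʳ χ (conj J) χ s) (cong (conj J ⊗_) (χ⋆χ s)))) (+ 1) ⟩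
      (χ ⋆ (λ s → conj J ⊗ (J ⊗ χ̄ s))) (+ 1)    ≡⟨ ⋆-scaleʳ χ (conj J) (λ s → J ⊗ χ̄ s) (+ 1) ⟩
      conj J ⊗ (χ ⋆ (λ s → J ⊗ χ̄ s)) (+ 1)      ≡⟨ cong (conj J ⊗_) (trans (⋆-scaleʳ χ J χ̄ (+ 1)) (cong (J ⊗_) (trans (χ⋆χ̄ (+ 1)) D-1))) ⟩
      conj J ⊗ (J ⊗ ⊝ 1ω)                       ∎
    viaP : (χ ⋆ (χ ⋆ (χ̄ ⋆ χ̄))) (+ 1) ≡ ι (+ p) ⊗ ⊝ 1ω
    viaP = begin
      (χ ⋆ (χ ⋆ (χ̄ ⋆ χ̄))) (+ 1)          ≡⟨ ⋆-congʳ χ (λ s → trans (sym (⋆-assoc χ-periodic χ̄-periodic χ̄-periodic s))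
                                              (trans (⋆-comm {χ ⋆ χ̄} {χ̄} (⋆-periodic {χ} {χ̄} χ̄-periodic) χ̄-periodic s)
                                              (trans (⋆-congʳ χ̄ χ⋆χ̄ s) (⋆D χ̄-periodic Σχ̄≡0 s)))) (+ 1) ⟩
      (χ ⋆ (λ s → ι (+ p) ⊗ χ̄ s)) (+ 1)  ≡⟨ trans (⋆-scaleʳ χ (ι (+ p)) χ̄ (+ 1)) (cong (ι (+ p) ⊗_) (trans (χ⋆χ̄ (+ 1)) D-1)) ⟩
      ι (+ p) ⊗ ⊝ 1ω                     ∎

  -- Modulo π the terms are a^e (1 - a)^e, a power sum of degree 2e < p - 1. Together with J conj J
  -- = p this decides that J is an associate of π itself.
  J≈0 : J ≈ 0ω mod π
  J≈0 = mod-trans (sum-mod (λ i → mod-trans (mod-⊗ (mod-sym (res-≈ P π∤3 (ι (at i)))) (mod-sym (res-≈ P π∤3 (ι (+ 1 - at i))))) (mod-reflexive (h i))))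
    (mod-∣ π∣p (power-sum Q e e 0 2e+1<p))
    where
    h : ∀ i → ι (at i) ↑ e ⊗ ι (+ 1 - at i) ↑ e ≡ ι (+ toℕ i) ↑ e ⊗ ι (+ 1 - + toℕ i) ↑ e ⊗ ι (+ (toℕ i choose 0))
    h i = trans (sym (⊗-identityʳ _)) (cong (λ c → ι (at i) ↑ e ⊗ ι (+ 1 - at i) ↑ e ⊗ ι (+ c)) (sym (nC0≡1 (toℕ i))))

  N[J]≡p : N J ≡ p
  N[J]≡p = ℤₚ.+-injective (ι-injective (trans (sym (α⊗conj-α J)) J⊗conj-J))

  J-associate : ∃ λ η → N η ≡ 1 × J ≡ π ⊗ η
  J-associate = go (mod-0⇒∣ J≈0)
    where
    go : π ∣𝔼 J → ∃ λ η → N η ≡ 1 × J ≡ π ⊗ η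
    go (divides η J≡πη) = η , ℕₚ.*-cancelˡ-≡ (N η) 1 p (trans (sym (N-⊗ π η)) (trans (cong N (sym J≡πη)) (trans N[J]≡p (sym (ℕₚ.*-identityʳ p))))) , J≡πη

  G : PeriodicFunction
  G = periodicFunction χ χ-periodic

  module _ (μ : Zω) where
    open Exp (CommutativeRing.semiring (groupRing μ)) using (_^_; ^-assocʳ)

    G³ : ∀ t → fun (G ^ 3) t ≡ J ⊗ D t
    G³ t = trans (⋆-congʳ χ (λ s → trans (⋆-congʳ χ (λ r → trans (⋆-comm χ-periodic δ-periodic r) (⋆-identityˡ χ-periodic r)) s) (χ⋆χ s)) t)
      (trans (⋆-scaleʳ χ J χ̄ t) (cong (J ⊗_) (χ⋆χ̄ t)))

    -- Each factor G³ = J D multiplies χ by pJ, because Σχ = 0 lets D act as multiplication by p.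
    G^[1+3k] : ∀ k t → fun (G ^ (1 ℕ.+ k ℕ.* 3)) t ≡ (ι (+ p) ⊗ J) ↑ k ⊗ χ t
    G^[1+3k] zero t = trans (⋆-comm χ-periodic δ-periodic t) (trans (⋆-identityˡ χ-periodic t) (sym (⊗-identityˡ (χ t))))
    G^[1+3k] (suc k) t = begin
      (χ ⋆ (χ ⋆ (χ ⋆ fun (G ^ (1 ℕ.+ k ℕ.* 3))))) t
        ≡⟨ ⋆-congʳ χ (λ s → ⋆-congʳ χ (λ r → trans (⋆-congʳ χ (G^[1+3k] k) r) (trans (⋆-scaleʳ χ c χ r) (cong (c ⊗_) (χ⋆χ r)))) s) t ⟩
      (χ ⋆ (χ ⋆ (λ r → c ⊗ (J ⊗ χ̄ r)))) t
        ≡⟨ ⋆-congʳ χ (λ s → trans (⋆-scaleʳ χ c (λ r → J ⊗ χ̄ r) s) (cong (c ⊗_) (trans (⋆-scaleʳ χ J χ̄ s) (cong (J ⊗_) (χ⋆χ̄ s))))) t ⟩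
      (χ ⋆ (λ s → c ⊗ (J ⊗ D s))) t
        ≡⟨ trans (⋆-scaleʳ χ c (λ s → J ⊗ D s) t) (cong (c ⊗_) (trans (⋆-scaleʳ χ J D t) (cong (J ⊗_) (⋆D χ-periodic Σχ≡0 t)))) ⟩
      c ⊗ (J ⊗ (ι (+ p) ⊗ χ t))
        ≡⟨ solve 4 (λ c j p x → c :* (j :* (p :* x)) := p :* j :* c :* x) refl c J (ι (+ p)) (χ t) ⟩
      (ι (+ p) ⊗ J) ↑ suc k ⊗ χ t ∎
      where
      open ≡-Reasoning
      c : Zω
      c = (ι (+ p) ⊗ J) ↑ k

  p∤prime : ∀ {q} → Prime q → ¬ q ≡ p → ¬ + p ℤ∣.∣ + q
  p∤prime {q} Q′ q≢p d = [ prime≢1 Q , (λ z → q≢p (sym z)) ]′ (prime⇒irreducible Q′ (ℤ∣.∣⇒∣ᵤ d))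

  -- Frobenius with q = 3, at G³
  J≈-1 : J ≈ ⊝ 1ω mod ι (+ 3)
  J≈-1 = mod-trans (mod-reflexive (solve 1 (λ j → j := :- (j :* :- con (+ 1))) refl J))
    -- Coefficients of [1] are compared: in G³ it is J D(1) = -J, and Frobenius gives χ(b)³ = 1,
    -- where 3b ≡ 1 modulo p.
    (mod-⊝ (mod-trans (mod-reflexive (sym (trans (G³ (ι (+ 3)) (+ 1)) (cong (J ⊗_) D-1))))
      (mod-trans (frobenius prime[3] b 3b≡1 G (+ 1)) (mod-reflexive (trans (solve 1 (λ x → x :* (x :* (x :* con (+ 1))) := x :* x :* x) refl (χ (b * + 1)))
        (cubicValue-cube (χ-value (b * + 1)) χb≢0))))))
    where
    p∤3 : ¬ + p ℤ∣.∣ + 3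
    p∤3 = p∤prime prime[3] (λ z → π∤3 (subst (λ n → π ∣𝔼 ι (+ n)) (sym z) π∣p))
    b : ℤ
    b = proj₁ (inverse p∤3)
    3b≡1 : + 3 * b ≡ + 1 modℤ + p
    3b≡1 = proj₂ (inverse p∤3)
    χb≢0 : ¬ χ (b * + 1) ≡ 0ω
    χb≢0 z = contradiction (trans (sym χ-1) (trans (sym (χ-periodic 3b≡1)) (trans (χ-* (+ 3) b)
      (trans (cong (χ (+ 3) ⊗_) (trans (cong χ (sym (ℤₚ.*-identityʳ b))) z)) (⊗-zeroʳ (χ (+ 3))))))) λ ()

  -- Coefficients of [1] in G^(q²) are compared. Frobenius applied twice moves the argument to b²
  -- with qb ≡ 1 modulo p, and χ(b²) = χ(b)² = χ(q) because χ(b) is a cube root of unity inverse to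
  -- χ(q).
  [pJ]↑k≈χ[q] : ∀ {q k} → Prime q → ¬ q ≡ p → q ℕ.* q ≡ 1 ℕ.+ k ℕ.* 3 →
    (ι (+ p) ⊗ J) ↑ k ≈ χ (+ q) mod ι (+ q)
  [pJ]↑k≈χ[q] {q} {k} Q′ q≢p q²≡ = mod-trans (mod-reflexive pJ≡) (mod-trans twice (mod-reflexive (trans collapse χ[b²]≡)))
    where
    open ≡-Reasoning
    μ : Zω
    μ = ι (+ q)
    open Exp (CommutativeRing.semiring (groupRing μ)) using (_^_; ^-assocʳ)
    p∤q : ¬ + p ℤ∣.∣ + q
    p∤q = p∤prime Q′ q≢p
    b : ℤ
    b = proj₁ (inverse p∤q)
    qb≡1 : + q * b ≡ + 1 modℤ + p
    qb≡1 = proj₂ (inverse p∤q)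
    v : Zω
    v = χ (b * (b * + 1))
    pJ≡ : (ι (+ p) ⊗ J) ↑ k ≡ fun (G ^ (q ℕ.* q)) (+ 1)
    pJ≡ = sym (trans (cong (λ n → fun (G ^ n) (+ 1)) q²≡) (trans (G^[1+3k] μ k (+ 1)) (trans (cong ((ι (+ p) ⊗ J) ↑ k ⊗_) χ-1) (⊗-identityʳ _))))
    twice : fun (G ^ (q ℕ.* q)) (+ 1) ≈ (v ↑ q) ↑ q mod μ
    twice = mod-trans (mod-sym (^-assocʳ G q q (+ 1))) (mod-trans (frobenius Q′ b qb≡1 (G ^ q) (+ 1))
      (mod-↑ q (frobenius Q′ b qb≡1 G (b * + 1))))
    collapse : (v ↑ q) ↑ q ≡ v
    collapse = trans (sym (↑-* v q q)) (trans (cong (v ↑_) q²≡) (cubicValue-↑[1+3k] (χ-value _) k))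
    χb⊗χq≡1 : χ (+ q) ⊗ χ b ≡ 1ω
    χb⊗χq≡1 = trans (sym (χ-* (+ q) b)) (trans (χ-periodic qb≡1) χ-1)
    χb≢0 : ¬ χ b ≡ 0ω
    χb≢0 z = contradiction (trans (sym χb⊗χq≡1) (trans (cong (χ (+ q) ⊗_) z) (⊗-zeroʳ (χ (+ q))))) λ ()
    χ[b²]≡ : v ≡ χ (+ q)
    χ[b²]≡ = begin
      χ (b * (b * + 1))                  ≡⟨ trans (cong (λ z → χ (b * z)) (ℤₚ.*-identityʳ b)) (χ-* b b) ⟩
      χ b ⊗ χ b                          ≡⟨ ⊗-identityˡ (χ b ⊗ χ b) ⟨
      1ω ⊗ (χ b ⊗ χ b)                   ≡⟨ cong (_⊗ (χ b ⊗ χ b)) χb⊗χq≡1 ⟨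
      χ (+ q) ⊗ χ b ⊗ (χ b ⊗ χ b)        ≡⟨ solve 2 (λ a b → a :* b :* (b :* b) := a :* (b :* b :* b)) refl (χ (+ q)) (χ b) ⟩
      χ (+ q) ⊗ (χ b ⊗ χ b ⊗ χ b)        ≡⟨ cong (χ (+ q) ⊗_) (cubicValue-cube (χ-value b) χb≢0) ⟩
      χ (+ q) ⊗ 1ω                       ≡⟨ ⊗-identityʳ (χ (+ q)) ⟩
      χ (+ q)                            ∎

-- Cubic reciprocity for rational integers

⊥ℤ-sym : ∀ {a b} → a ⊥ℤ b → b ⊥ℤ a
⊥ℤ-sym {a} {b} (comaximal s t eq) = comaximal t s (trans (ℤₚ.+-comm (b * t) (a * s)) eq)

⊥ℤ-∣ : ∀ {d a b} → d ℤ∣.∣ a → a ⊥ℤ b → d ⊥ℤ b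
⊥ℤ-∣ {d} {b = b} (ℤ∣.divides q refl) (comaximal s t eq) = comaximal (q * s) t (trans (h d q s (b * t)) eq)
  where
  h : ∀ d q s x → d * (q * s) + x ≡ q * d * s + x
  h = solve-∀

⊥ℤ-* : ∀ {a b c} → a ⊥ℤ c → b ⊥ℤ c → a * b ⊥ℤ c
⊥ℤ-* {a} {b} {c} (comaximal s t eq) (comaximal u v eq′) = comaximal (s * u) (a * s * v + t)
  (trans (h a b c s t u v) (trans (cong (λ z → a * s * z + c * t) eq′) (trans (cong (_+ c * t) (ℤₚ.*-identityʳ (a * s))) eq)))
  where
  h : ∀ a b c s t u v → a * b * (s * u) + c * (a * s * v + t) ≡ a * s * (b * u + c * v) + c * t
  h = solve-∀

⊥ℤ-prime : ∀ {p a b} → Prime p → a ⊥ℤ b → + p ℤ∣.∣ a → ¬ + p ℤ∣.∣ b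
⊥ℤ-prime {p} P (comaximal s t eq) d e = prime≢1 P (ℕ∣.∣1⇒≡1 (ℤ∣.∣⇒∣ᵤ (subst (+ p ℤ∣.∣_) eq (ℤ∣.∣m∣n⇒∣m+n (ℤ∣.∣m⇒∣m*n s d) (ℤ∣.∣m⇒∣m*n t e)))))

prime∤ℤ⇒⊥ℤ : ∀ {p a} → Prime p → ¬ + p ℤ∣.∣ a → + p ⊥ℤ a
prime∤ℤ⇒⊥ℤ {p} {a} P n = prime∤⇒⊥ℤ P {a} (n ∘ ℤ∣.∣ᵤ⇒∣)

prime∣*ℤ : ∀ {p} → Prime p → ∀ a b → + p ℤ∣.∣ a * b → + p ℤ∣.∣ a ⊎ + p ℤ∣.∣ b
prime∣*ℤ {p} P a b d = Sum.map ℤ∣.∣ᵤ⇒∣ ℤ∣.∣ᵤ⇒∣ (euclidsLemma ∣ a ∣ ∣ b ∣ P (subst (p ℕ∣.∣_) (ℤₚ.abs-* a b) (ℤ∣.∣⇒∣ᵤ d)))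

record LowestTerms (a b : ℤ) : Set where
  field
    g a′ b′ : ℤ
    a≡ : a ≡ g * a′
    b≡ : b ≡ g * b′
    a′⊥b′ : a′ ⊥ℤ b′

opaque
  lowestTerms : ∀ a b → LowestTerms a b
  lowestTerms a b = go (gcd ∣ a ∣ ∣ b ∣ ℕₚ.≟ 0)
    where
    go : Dec (gcd ∣ a ∣ ∣ b ∣ ≡ 0) → LowestTerms a b
    -- For a = b = 0 the fraction is taken to be 1/0 with g = 0, so that the cofactors are still
    -- comaximal.
    go (yes g≡0) = record { g = + 0 ; a′ = + 1 ; b′ = + 0
      ; a≡ = ℤₚ.∣i∣≡0⇒i≡0 (gcd[m,n]≡0⇒m≡0 g≡0) ; b≡ = ℤₚ.∣i∣≡0⇒i≡0 (gcd[m,n]≡0⇒n≡0 ∣ a ∣ g≡0) ; a′⊥b′ = comaximal (+ 1) (+ 0) refl }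
    go (no g≢0) = combine (ℤ∣.∣ᵤ⇒∣ {+ gcd ∣ a ∣ ∣ b ∣} {a} (gcd[m,n]∣m ∣ a ∣ ∣ b ∣)) (ℤ∣.∣ᵤ⇒∣ {+ gcd ∣ a ∣ ∣ b ∣} {b} (gcd[m,n]∣n ∣ a ∣ ∣ b ∣))
      where
      n : ℕ
      n = gcd ∣ a ∣ ∣ b ∣
      combine : + n ℤ∣.∣ a → + n ℤ∣.∣ b → LowestTerms a b
      combine (ℤ∣.divides a′ ea) (ℤ∣.divides b′ eb) = record { g = + n ; a′ = a′ ; b′ = b′
        ; a≡ = trans ea (ℤₚ.*-comm a′ (+ n)) ; b≡ = trans eb (ℤₚ.*-comm b′ (+ n)) ; a′⊥b′ = coprime⇒⊥ℤ a′ b′ coprime }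
        where
        multiple : ∀ {d c c′} → d ℕ∣.∣ ∣ c′ ∣ → c ≡ c′ * + n → d ℕ.* n ℕ∣.∣ ∣ c ∣
        multiple {d} {c} {c′} e eq = subst (d ℕ.* n ℕ∣.∣_) (trans (sym (ℤₚ.abs-* c′ (+ n))) (cong ∣_∣ (sym eq))) (ℕ∣.*-monoˡ-∣ n e)
        coprime : ∀ {d} → d ℕ∣.∣ ∣ a′ ∣ × d ℕ∣.∣ ∣ b′ ∣ → d ≡ 1
        coprime {d} (da , db) = ℕ∣.∣1⇒≡1 (ℕ∣.*-cancelʳ-∣ {m = d} {n = 1} n {{ℕ.≢-nonZero g≢0}}
          (subst (d ℕ.* n ℕ∣.∣_) (sym (ℕₚ.*-identityˡ n)) (gcd-greatest (multiple {d} {a} {a′} da ea) (multiple {d} {b} {b′} db eb))))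

symbol-square≡1 : ∀ {β} → β ⊥ ι (+ 3) → ∀ {α} → ⟨ α / β ⟩ ⊗ ⟨ α / β ⟩ ≡ 1ω → ⟨ α / β ⟩ ≡ 1ω
symbol-square≡1 {β} β⊥3 {α} v²≡1 = trans (sym (cubicValue-↑4 (symbol-value β⊥3 α)))
  (trans (⊗-assoc (v ⊗ v) v v) (trans (cong₂ _⊗_ v²≡1 v²≡1) (⊗-identityʳ 1ω)))
  where
  v : Zω
  v = ⟨ α / β ⟩

symbol--1 : ∀ {β} → β ⊥ ι (+ 3) → ⟨ ι (- + 1) / β ⟩ ≡ 1ω
symbol--1 {β} β⊥3 = symbol-square≡1 β⊥3 (trans (sym (symbol-⊗ β⊥3 (ι (- + 1)) (ι (- + 1))))
  (trans (cong (λ α → ⟨ α / β ⟩) (sym (ι-⊗ (- + 1) (- + 1)))) (symbol-1 β⊥3)))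

prime⊥3 : ∀ {q} → Prime q → ¬ q ≡ 3 → ι (+ q) ⊥ ι (+ 3)
prime⊥3 Q q≢3 = ⊥-ι (⊥ℤ-sym (prime∤ℤ⇒⊥ℤ prime[3] (λ d → [ (λ ()) , (λ e → q≢3 (sym e)) ]′ (prime⇒irreducible Q (ℤ∣.∣⇒∣ᵤ d)))))

module JacobiReciprocity {π} (P : Prime𝔼 π) (π∤3 : ¬ π ∣𝔼 ι (+ 3)) (pPrime : Prime (N π)) where
  open GaussSum P π∤3 pPrime using (p; J; χ; χ-value; [pJ]↑k≈χ[q]; p∤prime)

  module _ {q} (Q : Prime q) (q≢3 : ¬ q ≡ 3) (q≢p : ¬ q ≡ p) where
    q⊥3 : ι (+ q) ⊥ ι (+ 3)
    q⊥3 = prime⊥3 Q q≢3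

    p⊥q : ι (+ p) ⊥ ι (+ q)
    p⊥q = ⊥-ι (prime∤ℤ⇒⊥ℤ pPrime (p∤prime Q q≢p))

    -- Here (q² - 1)/3 is exactly the exponent of ϖ, so the congruence for pJ is already the
    -- definition of its symbol.
    inert : ∀ {ϖ} → Prime𝔼 ϖ → ¬ ϖ ∣𝔼 ι (+ 3) → ϖ ∣𝔼 ι (+ q) → N ϖ ≡ q ℕ.* q → ⟨ ι (+ p) ⊗ J / ι (+ q) ⟩ ≡ χ (+ q)
    inert {ϖ} W ϖ∤3 ϖ∣q Nϖ≡q² = trans (symbol-associate ϖ∣q)
      (res-unique W ϖ∤3 (χ-value (+ q)) (mod-∣ ϖ∣q ([pJ]↑k≈χ[q] {k = exponent ϖ} Q q≢p
        (trans (sym Nϖ≡q²) (trans (N≡1+3e W ϖ∤3) (cong suc (ℕₚ.*-comm 3 (exponent ϖ))))))))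
      where
      symbol-associate : ϖ ∣𝔼 ι (+ q) → ⟨ ι (+ p) ⊗ J / ι (+ q) ⟩ ≡ res (ι (+ p) ⊗ J) ϖ
      symbol-associate (divides κ eq) = trans (symbol-unique q⊥3 {κ} (ϖ ∷ []) Nκ≡1 (W ∷ [])
          (trans eq (solve 2 (λ a k → a :* k := k :* (a :* con (+ 1))) refl ϖ κ)) (ι (+ p) ⊗ J)) (⊗-identityʳ _)
        where
        instance
          _ : NonZero (q ℕ.* q)
          _ = ℕₚ.m*n≢0 q q {{prime⇒nonZero Q}} {{prime⇒nonZero Q}}
        Nκ≡1 : N κ ≡ 1
        Nκ≡1 = ℕₚ.*-cancelˡ-≡ (N κ) 1 (q ℕ.* q) (trans (cong (ℕ._* N κ) (sym Nϖ≡q²)) (trans (sym (N-⊗ ϖ κ))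
          (trans (cong N (sym eq)) (trans (N-ι (+ q)) (sym (ℕₚ.*-identityʳ (q ℕ.* q)))))))

    -- With e = (q - 1)/3 one has (q² - 1)/3 = (q + 1)e, where q + 1 = 2 + 3e. The congruence
    -- therefore determines the symbol of pJ only through its square.
    split-square : ∀ {ϖ} → Prime𝔼 ϖ → ¬ ϖ ∣𝔼 ι (+ 3) → ϖ ∣𝔼 ι (+ q) → N ϖ ≡ q →
      res (ι (+ p) ⊗ J) ϖ ⊗ res (ι (+ p) ⊗ J) ϖ ≡ χ (+ q)
    split-square {ϖ} W ϖ∤3 ϖ∣q Nϖ≡q = cubicValue-mod-injective W ϖ∤3 (cubicValue-⊗ (res-value _ ϖ) (res-value _ ϖ)) (χ-value (+ q))
      (mod-trans (mod-reflexive (sym v↑)) (mod-trans (mod-sym (mod-↑ (2 ℕ.+ 3 ℕ.* e′) (res-≈ W ϖ∤3 (ι (+ p) ⊗ J))))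
        (mod-trans (mod-reflexive (sym (↑-* (ι (+ p) ⊗ J) e′ (2 ℕ.+ 3 ℕ.* e′))))
          (mod-∣ ϖ∣q ([pJ]↑k≈χ[q] {k = (2 ℕ.+ 3 ℕ.* e′) ℕ.* e′} Q q≢p q²≡)))))
      where
      e′ : ℕ
      e′ = exponent ϖ
      q≡ : q ≡ 1 ℕ.+ 3 ℕ.* e′
      q≡ = trans (sym Nϖ≡q) (N≡1+3e W ϖ∤3)
      h : ∀ e → (1 ℕ.+ 3 ℕ.* e) ℕ.* (1 ℕ.+ 3 ℕ.* e) ≡ 1 ℕ.+ (2 ℕ.+ 3 ℕ.* e) ℕ.* e ℕ.* 3
      h = ℕSolver.solve-∀
      q²≡ : q ℕ.* q ≡ 1 ℕ.+ (2 ℕ.+ 3 ℕ.* e′) ℕ.* e′ ℕ.* 3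
      q²≡ = trans (cong (λ n → n ℕ.* n) q≡) (h e′)
      v : Zω
      v = res (ι (+ p) ⊗ J) ϖ
      v↑ : v ↑ (2 ℕ.+ 3 ℕ.* e′) ≡ v ⊗ v
      v↑ = cong (v ⊗_) (trans (cong (λ n → v ↑ suc n) (ℕₚ.*-comm 3 e′)) (cubicValue-↑[1+3k] (res-value _ ϖ) e′))

    -- The symbol over q is the product over ϖ and its conjugate. Both factors have square χ(q), so
    -- the product has square χ(q)², and squaring is injective on cubic values.
    split : ∀ {ϖ} → Prime𝔼 ϖ → ¬ ϖ ∣𝔼 ι (+ 3) → ϖ ∣𝔼 ι (+ q) → N ϖ ≡ q → ⟨ ι (+ p) ⊗ J / ι (+ q) ⟩ ≡ χ (+ q)
    split {ϖ} W ϖ∤3 ϖ∣q Nϖ≡q = trans (symbol-unique q⊥3 {1ω} (ϖ ∷ conj ϖ ∷ []) (N-ι (+ 1)) (W ∷ prime-conj W ∷ [])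
        (trans (cong (ι ∘ +_) (sym Nϖ≡q)) (trans (sym (α⊗conj-α ϖ)) (solve 2 (λ a b → a :* b := con (+ 1) :* (a :* (b :* con (+ 1)))) refl ϖ (conj ϖ))))
        (ι (+ p) ⊗ J))
      (trans (cong (v ⊗_) (⊗-identityʳ w))
      (cubicValue-square-injective (cubicValue-⊗ (res-value _ ϖ) (res-value _ (conj ϖ))) (χ-value (+ q))
        (trans (solve 2 (λ a b → a :* b :* (a :* b) := a :* a :* (b :* b)) refl v w)
          (cong₂ _⊗_ (split-square W ϖ∤3 ϖ∣q Nϖ≡q)
            (split-square (prime-conj W) (λ d → ϖ∤3 (subst₂ _∣𝔼_ (conj-involutive ϖ) (conj-ι (+ 3)) (∣𝔼-conj d)))
              (subst (conj ϖ ∣𝔼_) (conj-ι (+ q)) (∣𝔼-conj ϖ∣q)) (trans (N-conj ϖ) Nϖ≡q))))))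
      where
      v w : Zω
      v = res (ι (+ p) ⊗ J) ϖ
      w = res (ι (+ p) ⊗ J) (conj ϖ)

    jacobi-reciprocity : ⟨ J / ι (+ q) ⟩ ≡ ⟨ ι (+ q) / π ⟩
    jacobi-reciprocity = begin
      ⟨ J / ι (+ q) ⟩                                 ≡⟨ ⊗-identityˡ _ ⟨
      1ω ⊗ ⟨ J / ι (+ q) ⟩                            ≡⟨ cong (_⊗ ⟨ J / ι (+ q) ⟩) (symbol-rational {a = + p} p⊥q q⊥3) ⟨
      ⟨ ι (+ p) / ι (+ q) ⟩ ⊗ ⟨ J / ι (+ q) ⟩         ≡⟨ symbol-⊗ q⊥3 (ι (+ p)) J ⟨
      ⟨ ι (+ p) ⊗ J / ι (+ q) ⟩                       ≡⟨ byNorm (prime-divisor (ι (+ q)) (⊥3⇒≢0 q⊥3) (λ e → prime≢1 Q (ℕₚ.m*n≡1⇒m≡1 q q (trans (sym (N-ι (+ q))) e)))) ⟩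
      χ (+ q)                                         ≡⟨ symbol-prime P π∤3 (ι (+ q)) ⟨
      ⟨ ι (+ q) / π ⟩                                 ∎
      where
      open ≡-Reasoning
      byNorm : (∃ λ ϖ → Prime𝔼 ϖ × ϖ ∣𝔼 ι (+ q)) → ⟨ ι (+ p) ⊗ J / ι (+ q) ⟩ ≡ χ (+ q)
      byNorm (ϖ , W , ϖ∣q) = [ (λ e → contradiction e (Prime𝔼.N≢1 W)) , [ split W ϖ∤3 ϖ∣q , inert W ϖ∤3 ϖ∣q ]′ ]′
          (∣p²⇒ Q (subst (N ϖ ℕ∣.∣_) (N-ι (+ q)) (∣𝔼⇒N∣N ϖ∣q)))
        where
        ϖ∤3 : ¬ ϖ ∣𝔼 ι (+ 3)
        ϖ∤3 = ⊥⇒∤ W q⊥3 ϖ∣q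

RationalMod3 : Zω → Set
RationalMod3 γ = ∃ λ r → γ ≈ ι r mod ι (+ 3)

Reciprocal : Zω → Set
Reciprocal γ = ∀ {q} → Prime q → ¬ q ≡ 3 → ι (+ q) ⊥ γ → ⟨ γ / ι (+ q) ⟩ ≡ ⟨ ι (+ q) / γ ⟩

record PrimaryAssociate (π : Zω) : Set where
  field
    ρ η : Zω
    unit : N η ≡ 1
    ρ≡πη : ρ ≡ π ⊗ η
    rational : RationalMod3 ρ
    reciprocal : Reciprocal ρ

symbol-unitʳ : ∀ {β η} → β ⊥ ι (+ 3) → N η ≡ 1 → ∀ α → ⟨ α / β ⊗ η ⟩ ≡ ⟨ α / β ⟩
symbol-unitʳ {β} β⊥3 u α = trans (symbol-⊗ʳ β⊥3 (⊥-unit u) α) (trans (cong (⟨ α / β ⟩ ⊗_) (symbol-unit u α)) (⊗-identityʳ ⟨ α / β ⟩))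

-- For prime norm the associate is the Jacobi sum, which is -1 modulo 3. For norm p² it is p, and
-- both sides of reciprocity are symbols between rational integers, hence 1.
primaryAssociate : ∀ {π} → Prime𝔼 π → ¬ π ∣𝔼 ι (+ 3) → PrimaryAssociate π
primaryAssociate {π} P π∤3 = go (prime-over-rational P)
  where
  π⊥3 : π ⊥ ι (+ 3)
  π⊥3 = prime∤⇒⊥ P π∤3
  go : (∃ λ p → Prime p × π ∣𝔼 ι (+ p) × (N π ≡ p ⊎ N π ≡ p ℕ.* p)) → PrimaryAssociate π
  go (p , pPrime , π∣p , inj₁ Nπ≡p) = record
    { ρ = J ; η = proj₁ J-associate ; unit = proj₁ (proj₂ J-associate) ; ρ≡πη = proj₂ (proj₂ J-associate)
    ; rational = - + 1 , mod-trans J≈-1 (mod-reflexive (sym (ι-⊝ (+ 1))))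
    ; reciprocal = λ {q} Q q≢3 q⊥J → trans (JacobiReciprocity.jacobi-reciprocity P π∤3 NπPrime Q q≢3 (q≢p Q q⊥J))
        (sym (trans (cong (λ β → ⟨ ι (+ q) / β ⟩) (proj₂ (proj₂ J-associate))) (symbol-unitʳ π⊥3 (proj₁ (proj₂ J-associate)) (ι (+ q))))) }
    where
    NπPrime : Prime (N π)
    NπPrime = subst Prime (sym Nπ≡p) pPrime
    open GaussSum P π∤3 NπPrime using (J; J-associate; J≈-1)
    q≢p : ∀ {q} → Prime q → ι (+ q) ⊥ J → ¬ q ≡ N π
    q≢p Q q⊥J refl = ⊥⇒∤ P q⊥J (divides (conj π) (sym (α⊗conj-α π)))
      (subst (π ∣𝔼_) (sym (proj₂ (proj₂ J-associate))) (∣𝔼-⊗ʳ _ ∣𝔼-refl))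
  go (p , pPrime , divides κ p≡πκ , inj₂ Nπ≡p²) = record
    { ρ = ι (+ p) ; η = κ ; unit = Nκ≡1 ; ρ≡πη = p≡πκ
    ; rational = + p , mod-reflexive refl
    ; reciprocal = λ {q} Q q≢3 q⊥p → trans (symbol-rational {a = + p} (⊥-sym q⊥p) (prime⊥3 Q q≢3)) (sym (symbol-rational {a = + q} q⊥p p⊥3)) }
    where
    p⊥3 : ι (+ p) ⊥ ι (+ 3)
    p⊥3 = prime⊥3 pPrime λ { refl → π∤3 (divides κ p≡πκ) }
    instance
      _ : NonZero (p ℕ.* p)
      _ = ℕₚ.m*n≢0 p p {{prime⇒nonZero pPrime}} {{prime⇒nonZero pPrime}}
    Nκ≡1 : N κ ≡ 1
    Nκ≡1 = ℕₚ.*-cancelˡ-≡ (N κ) 1 (p ℕ.* p) (trans (cong (ℕ._* N κ) (sym Nπ≡p²)) (trans (sym (N-⊗ π κ))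
      (trans (cong N (sym p≡πκ)) (trans (N-ι (+ p)) (sym (ℕₚ.*-identityʳ (p ℕ.* p)))))))

primaryProduct : ∀ πs → All Prime𝔼 πs → All (λ π → ¬ π ∣𝔼 ι (+ 3)) πs → PrimaryAssociate (Π πs)
primaryProduct [] [] [] = record
  { ρ = 1ω ; η = 1ω ; unit = N-ι (+ 1) ; ρ≡πη = sym (⊗-identityʳ 1ω) ; rational = + 1 , mod-reflexive refl
  ; reciprocal = λ {q} Q q≢3 _ → trans (symbol-1 (prime⊥3 Q q≢3)) (sym (symbol-unit (N-ι (+ 1)) (ι (+ q)))) }
primaryProduct (π ∷ πs) (P ∷ Ps) (n ∷ ns) = combine (primaryAssociate P n) (primaryProduct πs Ps ns)
  where
  Π⊥3 : ∀ πs → All Prime𝔼 πs → All (λ π → ¬ π ∣𝔼 ι (+ 3)) πs → Π πs ⊥ ι (+ 3)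
  Π⊥3 [] [] [] = ⊥-unit (N-ι (+ 1))
  Π⊥3 (π ∷ πs) (P ∷ Ps) (n ∷ ns) = ⊥-⊗ (prime∤⇒⊥ P n) (Π⊥3 πs Ps ns)
  combine : PrimaryAssociate π → PrimaryAssociate (Π πs) → PrimaryAssociate (π ⊗ Π πs)
  combine A B = record
    { ρ = A.ρ ⊗ B.ρ ; η = A.η ⊗ B.η ; unit = trans (N-⊗ A.η B.η) (cong₂ ℕ._*_ A.unit B.unit)
    ; ρ≡πη = trans (cong₂ _⊗_ A.ρ≡πη B.ρ≡πη) (solve 4 (λ a b c d → a :* b :* (c :* d) := a :* c :* (b :* d)) refl π A.η (Π πs) B.η)
    ; rational = proj₁ A.rational * proj₁ B.rational
        , mod-trans (mod-⊗ (proj₂ A.rational) (proj₂ B.rational)) (mod-reflexive (sym (ι-⊗ (proj₁ A.rational) (proj₁ B.rational))))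
    ; reciprocal = λ {q} Q q≢3 q⊥ρ → trans (symbol-⊗ (prime⊥3 Q q≢3) A.ρ B.ρ)
        (trans (cong₂ _⊗_ (A.reciprocal Q q≢3 (⊥-sym (⊥-∣ (∣𝔼-⊗ʳ B.ρ ∣𝔼-refl) (⊥-sym q⊥ρ))))
                          (B.reciprocal Q q≢3 (⊥-sym (⊥-∣ (∣𝔼-⊗ˡ A.ρ ∣𝔼-refl) (⊥-sym q⊥ρ)))))
          (sym (symbol-⊗ʳ (subst (_⊥ ι (+ 3)) (sym A.ρ≡πη) (⊥-⊗ (prime∤⇒⊥ P n) (⊥-unit A.unit)))
                          (subst (_⊥ ι (+ 3)) (sym B.ρ≡πη) (⊥-⊗ (Π⊥3 πs Ps ns) (⊥-unit B.unit))) (ι (+ q))))) }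
    where
    module A = PrimaryAssociate A
    module B = PrimaryAssociate B

ι∣⇒coordinates : ∀ {n x y} → ι n ∣𝔼 (x , y) → n ℤ∣.∣ x × n ℤ∣.∣ y
ι∣⇒coordinates {n} (divides (u , v) eq) =
    ℤ∣.divides u (trans (cong proj₁ (trans eq (ι-scale n u v))) (ℤₚ.*-comm n u))
  , ℤ∣.divides v (trans (cong proj₂ (trans eq (ι-scale n u v))) (ℤₚ.*-comm n v))

-- Write ε = a + bω. Comparing ω-coordinates modulo 3 gives 3 ∣ b, while |b| ≤ 2N(ε) = 2.
rational-unit : ∀ {ε ρ γ} → N ε ≡ 1 → ρ ⊥ ι (+ 3) → RationalMod3 ρ → RationalMod3 γ → γ ≡ ρ ⊗ ε → ∃ λ a → ε ≡ ι a
rational-unit {ε@(a , b)} {ρ} {γ} u ρ⊥3 (r , ρ≈r) (s , γ≈s) γ≡ρε = a , cong (a ,_) (b≡0 b ∣b∣≤2 3∣b)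
  where
  opaque
    unfolding _⊕_
    difference : ∀ x y z → (x , y) ⊖ ι z ≡ (x - z , y)
    difference x y z = cong (x - z ,_) (ℤₚ.+-identityʳ y)
  rε≈s : ι r ⊗ (a , b) ≈ ι s mod ι (+ 3)
  rε≈s = mod-trans (mod-sym (mod-⊗ ρ≈r (mod-reflexive refl))) (mod-trans (mod-reflexive (sym γ≡ρε)) γ≈s)
  3∣rb : + 3 ℤ∣.∣ r * b
  3∣rb = proj₂ (ι∣⇒coordinates (subst (ι (+ 3) ∣𝔼_) (trans (cong (_⊖ ι s) (ι-scale r a b)) (difference (r * a) (r * b) s)) (∣-difference rε≈s)))
  r⊥3 : ι r ⊥ ι (+ 3)
  r⊥3 = ⊥-mod ρ≈r ρ⊥3
  3∤r : ¬ + 3 ℤ∣.∣ r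
  3∤r d = contradiction (∣1⇒N≡1 (3∣1 r⊥3)) λ e → contradiction (trans (sym (N-ι (+ 3))) e) λ ()
    where
    3∣1 : ι r ⊥ ι (+ 3) → ι (+ 3) ∣𝔼 1ω
    3∣1 (comaximal s t eq) = subst (ι (+ 3) ∣𝔼_) eq (∣𝔼-⊕ (∣𝔼-⊗ʳ s (∣⇒ι∣ι d)) (∣𝔼-⊗ʳ t ∣𝔼-refl))
  3∣b : + 3 ℤ∣.∣ b
  3∣b = [ (λ d → contradiction d 3∤r) , (λ d → d) ]′ (prime∣*ℤ prime[3] r b 3∣rb)
  ∣b∣≤2 : ∣ b ∣ ℕ.≤ 2
  ∣b∣≤2 = subst (∣ b ∣ ℕ.≤_) (cong (2 ℕ.*_) u) (proj₂ (N-coordinate-bound a b))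
  b≡0 : ∀ b → ∣ b ∣ ℕ.≤ 2 → + 3 ℤ∣.∣ b → b ≡ + 0
  b≡0 b le d = ℤₚ.∣i∣≡0⇒i≡0 (small ∣ b ∣ le (ℤ∣.∣⇒∣ᵤ d))
    where
    small : ∀ n → n ℕ.≤ 2 → 3 ℕ∣.∣ n → n ≡ 0
    small zero _ _ = refl
    small (suc n) le d = contradiction (ℕ∣.∣⇒≤ d) (ℕₚ.<⇒≱ (ℕ.s≤s le))

-- γ differs from the product of the primary associates of its prime factors by a unit. That unit is
-- rational by `rational-unit`, so its symbol over q is 1.
primary⇒reciprocal : ∀ {γ} → γ ⊥ ι (+ 3) → RationalMod3 γ → Reciprocal γ
primary⇒reciprocal {γ} γ⊥3 γ-rational {q} Q q≢3 q⊥γ = trans top (trans (A.reciprocal Q q≢3 q⊥ρ) bottom)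
  where
  module F = CoprimeFactorisation (coprimeFactorisation γ⊥3)
  module A = PrimaryAssociate (primaryProduct F.primes F.allPrime F.all∤3)
  ε : Zω
  ε = F.ε ⊗ conj A.η
  Nε≡1 : N ε ≡ 1
  Nε≡1 = trans (N-⊗ F.ε (conj A.η)) (cong₂ ℕ._*_ F.unit (trans (N-conj A.η) A.unit))
  γ≡ρε : γ ≡ A.ρ ⊗ ε
  γ≡ρε = begin
    γ                                        ≡⟨ F.product≡ ⟩
    F.ε ⊗ Π F.primes                         ≡⟨ solve 2 (λ e p → e :* p := p :* con (+ 1) :* e) refl F.ε (Π F.primes) ⟩
    Π F.primes ⊗ 1ω ⊗ F.ε                    ≡⟨ cong (λ z → Π F.primes ⊗ z ⊗ F.ε) (N≡1⇒unit {A.η} A.unit) ⟨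
    Π F.primes ⊗ (A.η ⊗ conj A.η) ⊗ F.ε      ≡⟨ solve 4 (λ p h c e → p :* (h :* c) :* e := p :* h :* (e :* c)) refl (Π F.primes) A.η (conj A.η) F.ε ⟩
    Π F.primes ⊗ A.η ⊗ ε                     ≡⟨ cong (_⊗ ε) A.ρ≡πη ⟨
    A.ρ ⊗ ε                                  ∎
    where open ≡-Reasoning
  ρ∣γ : A.ρ ∣𝔼 γ
  ρ∣γ = divides ε γ≡ρε
  ρ⊥3 : A.ρ ⊥ ι (+ 3)
  ρ⊥3 = ⊥-∣ ρ∣γ γ⊥3
  q⊥ρ : ι (+ q) ⊥ A.ρ
  q⊥ρ = ⊥-sym (⊥-∣ ρ∣γ (⊥-sym q⊥γ))
  q⊥3 : ι (+ q) ⊥ ι (+ 3)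
  q⊥3 = prime⊥3 Q q≢3
  ε-rational : ∃ λ a → ε ≡ ι a
  ε-rational = rational-unit {ε} Nε≡1 ρ⊥3 A.rational γ-rational γ≡ρε
  ε-symbol : ⟨ ε / ι (+ q) ⟩ ≡ 1ω
  ε-symbol = trans (cong (λ α → ⟨ α / ι (+ q) ⟩) (proj₂ ε-rational))
    (symbol-rational {a = proj₁ ε-rational} (⊥-unit (trans (cong N (sym (proj₂ ε-rational))) Nε≡1)) q⊥3)
  top : ⟨ γ / ι (+ q) ⟩ ≡ ⟨ A.ρ / ι (+ q) ⟩
  top = trans (cong (λ α → ⟨ α / ι (+ q) ⟩) γ≡ρε) (trans (symbol-⊗ q⊥3 A.ρ ε)
    (trans (cong (⟨ A.ρ / ι (+ q) ⟩ ⊗_) ε-symbol) (⊗-identityʳ _)))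
  bottom : ⟨ ι (+ q) / A.ρ ⟩ ≡ ⟨ ι (+ q) / γ ⟩
  bottom = sym (trans (cong (λ β → ⟨ ι (+ q) / β ⟩) γ≡ρε) (symbol-unitʳ ρ⊥3 Nε≡1 (ι (+ q))))

reciprocity : ∀ {γ k} → γ ⊥ ι (+ 3) → RationalMod3 γ → ι k ⊥ ι (+ 3) → ι k ⊥ γ → ⟨ γ / ι k ⟩ ≡ ⟨ ι k / γ ⟩
reciprocity {γ} {k} γ⊥3 γ-rational k⊥3 k⊥γ = bySign k k⊥3 k⊥γ
  where
  onProduct : ∀ qs → All Prime qs → ι (+ product qs) ⊥ ι (+ 3) → ι (+ product qs) ⊥ γ →
    ⟨ γ / ι (+ product qs) ⟩ ≡ ⟨ ι (+ product qs) / γ ⟩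
  onProduct [] [] _ _ = trans (symbol-unit (N-ι (+ 1)) γ) (sym (symbol-1 γ⊥3))
  onProduct (q ∷ qs) (Q ∷ Qs) m⊥3 m⊥γ = begin
    ⟨ γ / ι (+ product (q ∷ qs)) ⟩                          ≡⟨ cong (λ β → ⟨ γ / β ⟩) m≡ ⟩
    ⟨ γ / ι (+ q) ⊗ ι (+ product qs) ⟩                      ≡⟨ symbol-⊗ʳ (⊥-∣ q∣m m⊥3) (⊥-∣ n∣m m⊥3) γ ⟩
    ⟨ γ / ι (+ q) ⟩ ⊗ ⟨ γ / ι (+ product qs) ⟩              ≡⟨ cong₂ _⊗_ (primary⇒reciprocal γ⊥3 γ-rational Q q≢3 (⊥-∣ q∣m m⊥γ))
                                                                        (onProduct qs Qs (⊥-∣ n∣m m⊥3) (⊥-∣ n∣m m⊥γ)) ⟩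
    ⟨ ι (+ q) / γ ⟩ ⊗ ⟨ ι (+ product qs) / γ ⟩              ≡⟨ symbol-⊗ γ⊥3 (ι (+ q)) (ι (+ product qs)) ⟨
    ⟨ ι (+ q) ⊗ ι (+ product qs) / γ ⟩                      ≡⟨ cong (λ α → ⟨ α / γ ⟩) m≡ ⟨
    ⟨ ι (+ product (q ∷ qs)) / γ ⟩                          ∎
    where
    open ≡-Reasoning
    m≡ : ι (+ product (q ∷ qs)) ≡ ι (+ q) ⊗ ι (+ product qs)
    m≡ = trans (cong ι (ℤₚ.pos-* q (product qs))) (ι-⊗ (+ q) (+ product qs))
    q∣m : ι (+ q) ∣𝔼 ι (+ product (q ∷ qs))
    q∣m = divides (ι (+ product qs)) m≡
    n∣m : ι (+ product qs) ∣𝔼 ι (+ product (q ∷ qs))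
    n∣m = divides (ι (+ q)) (trans m≡ (⊗-comm (ι (+ q)) (ι (+ product qs))))
    q≢3 : ¬ q ≡ 3
    q≢3 refl = contradiction (∣1⇒N≡1 (3∣1 (⊥-∣ q∣m m⊥3))) λ e → contradiction (trans (sym (N-ι (+ 3))) e) λ ()
      where
      3∣1 : ι (+ 3) ⊥ ι (+ 3) → ι (+ 3) ∣𝔼 1ω
      3∣1 (comaximal s t eq) = subst (ι (+ 3) ∣𝔼_) eq (∣𝔼-⊕ (∣𝔼-⊗ʳ s ∣𝔼-refl) (∣𝔼-⊗ʳ t ∣𝔼-refl))
  onPositive : ∀ n → ι (+ n) ⊥ ι (+ 3) → ι (+ n) ⊥ γ → ⟨ γ / ι (+ n) ⟩ ≡ ⟨ ι (+ n) / γ ⟩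
  onPositive zero n⊥3 _ = contradiction refl (⊥3⇒≢0 n⊥3)
  onPositive (suc n) n⊥3 n⊥γ = transport (factorise (suc n))
    where
    transport : PrimeFactorisation (suc n) → ⟨ γ / ι (+ suc n) ⟩ ≡ ⟨ ι (+ suc n) / γ ⟩
    transport F = subst (λ m → ⟨ γ / ι (+ m) ⟩ ≡ ⟨ ι (+ m) / γ ⟩) (sym eq)
      (onProduct (PrimeFactorisation.factors F) (PrimeFactorisation.factorsPrime F)
        (subst (λ m → ι (+ m) ⊥ ι (+ 3)) eq n⊥3) (subst (λ m → ι (+ m) ⊥ γ) eq n⊥γ))
      where
      eq : suc n ≡ product (PrimeFactorisation.factors F)
      eq = PrimeFactorisation.isFactorisation F
  bySign : ∀ k → ι k ⊥ ι (+ 3) → ι k ⊥ γ → ⟨ γ / ι k ⟩ ≡ ⟨ ι k / γ ⟩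
  bySign (+ n) = onPositive n
  bySign k@(-[1+ n ]) k⊥3 k⊥γ = begin
    ⟨ γ / ι k ⟩                                     ≡⟨ cong (λ β → ⟨ γ / β ⟩) k≡ʳ ⟩
    ⟨ γ / ι (+ suc n) ⊗ ι (- + 1) ⟩                 ≡⟨ symbol-unitʳ m⊥3 (N-ι (- + 1)) γ ⟩
    ⟨ γ / ι (+ suc n) ⟩                             ≡⟨ onPositive (suc n) m⊥3 (⊥-neg k⊥γ) ⟩
    ⟨ ι (+ suc n) / γ ⟩                             ≡⟨ ⊗-identityʳ _ ⟨
    ⟨ ι (+ suc n) / γ ⟩ ⊗ 1ω                        ≡⟨ cong (⟨ ι (+ suc n) / γ ⟩ ⊗_) (symbol--1 γ⊥3) ⟨
    ⟨ ι (+ suc n) / γ ⟩ ⊗ ⟨ ι (- + 1) / γ ⟩         ≡⟨ symbol-⊗ γ⊥3 (ι (+ suc n)) (ι (- + 1)) ⟨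
    ⟨ ι (+ suc n) ⊗ ι (- + 1) / γ ⟩                 ≡⟨ cong (λ α → ⟨ α / γ ⟩) k≡ʳ ⟨
    ⟨ ι k / γ ⟩                                     ∎
    where
    open ≡-Reasoning
    m⊥3 : ι (+ suc n) ⊥ ι (+ 3)
    m⊥3 = ⊥-neg k⊥3
    k≡ʳ : ι k ≡ ι (+ suc n) ⊗ ι (- + 1)
    k≡ʳ = trans (cong ι (trans (sym (ℤₚ.-1*i≡-i (+ suc n))) (ℤₚ.*-comm (- + 1) (+ suc n)))) (ι-⊗ (+ suc n) (- + 1))

-- The symbol of γ over m

infix 8 _⊖√-3_
_⊖√-3_ : ℤ → ℤ → Zω
P ⊖√-3 Q = ι P ⊖ ι Q ⊗ √-3

√-3∣3 : √-3 ∣𝔼 ι (+ 3)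
√-3∣3 = divides (⊝ √-3) (trans (ι-⊝ (- + 3)) (trans (cong ⊝_ (sym √-3²)) (solve 1 (λ w → :- (w :* w) := w :* :- w) refl √-3)))

√-3-mod : ∀ {μ} P Q → μ ∣𝔼 ι Q → P ⊖√-3 Q ≈ ι P mod μ
√-3-mod {μ} P Q d = congruent (subst (μ ∣𝔼_) (solve 3 (λ p q w → :- (q :* w) := p :- q :* w :- p) refl (ι P) (ι Q) √-3)
  (∣𝔼-⊝ (∣𝔼-⊗ʳ √-3 d)))

√-3-modˡ : ∀ {μ} P Q → μ ∣𝔼 ι P → P ⊖√-3 Q ≈ ι (- Q) ⊗ √-3 mod μ
√-3-modˡ {μ} P Q d = congruent (subst (μ ∣𝔼_) (trans (solve 3 (λ p q w → p := p :- q :* w :- :- q :* w) refl (ι P) (ι Q) √-3)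
  (cong (λ z → P ⊖√-3 Q ⊖ z ⊗ √-3) (sym (ι-⊝ Q)))) d)

√-3-norm : ∀ P Q → P ⊖√-3 Q ⊗ (ι P ⊕ ι Q ⊗ √-3) ≡ ι (P * P + + 3 * (Q * Q))
√-3-norm P Q = begin
  P ⊖√-3 Q ⊗ (ι P ⊕ ι Q ⊗ √-3)
    ≡⟨ solve 3 (λ p q w → (p :- q :* w) :* (p :+ q :* w) := p :* p :- w :* w :* (q :* q)) refl (ι P) (ι Q) √-3 ⟩
  ι P ⊗ ι P ⊖ √-3 ⊗ √-3 ⊗ (ι Q ⊗ ι Q)
    ≡⟨ cong (λ z → ι P ⊗ ι P ⊖ z ⊗ (ι Q ⊗ ι Q)) √-3² ⟩
  ι P ⊗ ι P ⊖ ι (- + 3) ⊗ (ι Q ⊗ ι Q)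
    ≡⟨ solve 2 (λ p q → p :* p :- con (- + 3) :* (q :* q) := p :* p :+ con (+ 3) :* (q :* q)) refl (ι P) (ι Q) ⟩
  ι P ⊗ ι P ⊕ ι (+ 3) ⊗ (ι Q ⊗ ι Q)
    ≡⟨ cong₂ _⊕_ (ι-⊗ P P) (trans (ι-⊗ (+ 3) (Q * Q)) (cong (ι (+ 3) ⊗_) (ι-⊗ Q Q))) ⟨
  ι (P * P) ⊕ ι (+ 3 * (Q * Q))
    ≡⟨ ι-⊕ (P * P) (+ 3 * (Q * Q)) ⟨
  ι (P * P + + 3 * (Q * Q)) ∎
  where open ≡-Reasoning

√-3-scale : ∀ g P Q → (g * P) ⊖√-3 (+ 3 * (g * Q)) ≡ ι g ⊗ P ⊖√-3 (+ 3 * Q)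
√-3-scale g P Q = begin
  ι (g * P) ⊖ ι (+ 3 * (g * Q)) ⊗ √-3
    ≡⟨ cong₂ (λ a b → a ⊖ b ⊗ √-3) (ι-⊗ g P) (trans (cong ι (h g Q)) (ι-⊗ g (+ 3 * Q))) ⟩
  ι g ⊗ ι P ⊖ ι g ⊗ ι (+ 3 * Q) ⊗ √-3
    ≡⟨ solve 4 (λ g p q w → g :* p :- g :* q :* w := g :* (p :- q :* w)) refl (ι g) (ι P) (ι (+ 3 * Q)) √-3 ⟩
  ι g ⊗ P ⊖√-3 (+ 3 * Q) ∎
  where
  open ≡-Reasoning
  h : ∀ g Q → + 3 * (g * Q) ≡ g * (+ 3 * Q)
  h = solve-∀

√-3⊥ : ∀ {k} → ι k ⊥ ι (+ 3) → √-3 ⊥ ι k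
√-3⊥ k⊥3 = ⊥-∣ √-3∣3 (⊥-sym k⊥3)

module _ {P Q k : ℤ} (k⊥3 : ι k ⊥ ι (+ 3)) where
  module _ (k∣P : k ℤ∣.∣ P) (k⊥Q : k ⊥ℤ Q) where
    private
      Q⊥k : ι (- Q) ⊥ ι k
      Q⊥k = ⊥-neg (⊥-ι (⊥ℤ-sym k⊥Q))
    √-3-⊥ˡ : P ⊖√-3 Q ⊥ ι k
    √-3-⊥ˡ = ⊥-mod (mod-sym (√-3-modˡ P Q (∣⇒ι∣ι k∣P))) (⊥-⊗ Q⊥k (√-3⊥ k⊥3))

    √-3-symbolˡ : ⟨ P ⊖√-3 Q / ι k ⟩ ≡ 1ω
    √-3-symbolˡ = trans (symbol-cong k⊥3 (√-3-modˡ P Q (∣⇒ι∣ι k∣P))) (trans (symbol-⊗ k⊥3 (ι (- Q)) √-3)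
      (trans (cong₂ _⊗_ (symbol-rational {a = - Q} Q⊥k k⊥3) (symbol-√-3 k⊥3)) (⊗-identityʳ 1ω)))

  module _ (k∣Q : k ℤ∣.∣ Q) (k⊥P : k ⊥ℤ P) where
    √-3-⊥ʳ : P ⊖√-3 Q ⊥ ι k
    √-3-⊥ʳ = ⊥-mod (mod-sym (√-3-mod P Q (∣⇒ι∣ι k∣Q))) (⊥-ι (⊥ℤ-sym k⊥P))

    √-3-symbolʳ : ⟨ P ⊖√-3 Q / ι k ⟩ ≡ 1ω
    √-3-symbolʳ = trans (symbol-cong k⊥3 (√-3-mod P Q (∣⇒ι∣ι k∣Q))) (symbol-rational {a = P} (⊥-ι (⊥ℤ-sym k⊥P)) k⊥3)

3∣3* : ∀ Q → + 3 ℤ∣.∣ + 3 * Q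
3∣3* Q = ℤ∣.∣m⇒∣m*n Q ℤ∣.∣-refl

primary-rational : ∀ P Q → RationalMod3 (P ⊖√-3 (+ 3 * Q))
primary-rational P Q = P , √-3-mod P (+ 3 * Q) (∣⇒ι∣ι (3∣3* Q))

primary-⊥3 : ∀ {P} Q → P ⊥ℤ + 3 → P ⊖√-3 (+ 3 * Q) ⊥ ι (+ 3)
primary-⊥3 {P} Q P⊥3 = ⊥-mod (mod-sym (√-3-mod P (+ 3 * Q) (∣⇒ι∣ι (3∣3* Q)))) (⊥-ι P⊥3)

-- In μ₃ the relations ⟨√-3⟩² = ⟨3⟩ and ⟨3⟩²⟨√-3⟩ = 1 force ⟨3⟩ = 1; the second one comes from
-- 9√-3 Q ≡ P modulo P - 9√-3 Q and reciprocity.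
supplement-coprime : ∀ {P Q} → P ⊥ℤ + 3 → Q ⊥ℤ + 3 → P ⊥ℤ Q → ⟨ ι (+ 3) / P ⊖√-3 (+ 3 * (+ 3 * Q)) ⟩ ≡ 1ω
supplement-coprime {P} {Q} P⊥3 Q⊥3 P⊥Q = begin
  t                                    ≡⟨ w²≡t ⟨
  w ⊗ w                                ≡⟨ cong (_⊗ w) (cubicValue-↑4 (symbol-value γ⊥3 √-3)) ⟨
  w ⊗ w ⊗ w ⊗ w ⊗ w                    ≡⟨ solve 1 (λ w → w :* w :* w :* w :* w := w :* w :* (w :* w) :* w) refl w ⟩
  w ⊗ w ⊗ (w ⊗ w) ⊗ w                  ≡⟨ cong (λ z → z ⊗ z ⊗ w) w²≡t ⟩
  t ⊗ t ⊗ w                            ≡⟨ t²w≡1 ⟩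
  1ω                                   ∎
  where
  open ≡-Reasoning
  γ : Zω
  γ = P ⊖√-3 (+ 3 * (+ 3 * Q))
  γ⊥3 : γ ⊥ ι (+ 3)
  γ⊥3 = primary-⊥3 (+ 3 * Q) P⊥3
  γ-rational : RationalMod3 γ
  γ-rational = primary-rational P (+ 3 * Q)
  t w : Zω
  t = ⟨ ι (+ 3) / γ ⟩
  w = ⟨ √-3 / γ ⟩
  w²≡t : w ⊗ w ≡ t
  w²≡t = begin
    w ⊗ w                              ≡⟨ symbol-⊗ γ⊥3 √-3 √-3 ⟨
    ⟨ √-3 ⊗ √-3 / γ ⟩                  ≡⟨ cong (λ α → ⟨ α / γ ⟩) (trans √-3² (ι-⊗ (- + 1) (+ 3))) ⟩
    ⟨ ι (- + 1) ⊗ ι (+ 3) / γ ⟩        ≡⟨ symbol-⊗ γ⊥3 (ι (- + 1)) (ι (+ 3)) ⟩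
    ⟨ ι (- + 1) / γ ⟩ ⊗ t              ≡⟨ cong (_⊗ t) (symbol--1 γ⊥3) ⟩
    1ω ⊗ t                             ≡⟨ ⊗-identityˡ t ⟩
    t                                  ∎
  P⊥9Q : P ⊥ℤ + 3 * (+ 3 * Q)
  P⊥9Q = ⊥ℤ-sym (⊥ℤ-* (⊥ℤ-sym P⊥3) (⊥ℤ-* (⊥ℤ-sym P⊥3) (⊥ℤ-sym P⊥Q)))
  Q∣9Q : Q ℤ∣.∣ + 3 * (+ 3 * Q)
  Q∣9Q = ℤ∣.∣n⇒∣m*n (+ 3) (ℤ∣.∣n⇒∣m*n (+ 3) ℤ∣.∣-refl)
  v[P]≡1 : ⟨ ι P / γ ⟩ ≡ 1ω
  v[P]≡1 = trans (sym (reciprocity γ⊥3 γ-rational (⊥-ι P⊥3) (⊥-sym (√-3-⊥ˡ (⊥-ι P⊥3) ℤ∣.∣-refl P⊥9Q)))) (√-3-symbolˡ (⊥-ι P⊥3) ℤ∣.∣-refl P⊥9Q)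
  v[Q]≡1 : ⟨ ι Q / γ ⟩ ≡ 1ω
  v[Q]≡1 = trans (sym (reciprocity γ⊥3 γ-rational (⊥-ι Q⊥3) (⊥-sym (√-3-⊥ʳ (⊥-ι Q⊥3) Q∣9Q (⊥ℤ-sym P⊥Q))))) (√-3-symbolʳ (⊥-ι Q⊥3) Q∣9Q (⊥ℤ-sym P⊥Q))
  P≈ : ι P ≈ ι (+ 3) ⊗ ι (+ 3) ⊗ ι Q ⊗ √-3 mod γ
  P≈ = congruent (subst (γ ∣𝔼_) (cong (λ z → ι P ⊖ z ⊗ √-3) (trans (ι-⊗ (+ 3) (+ 3 * Q)) (trans (cong (ι (+ 3) ⊗_) (ι-⊗ (+ 3) Q)) (sym (⊗-assoc (ι (+ 3)) (ι (+ 3)) (ι Q)))))) ∣𝔼-refl)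
  t²w≡1 : t ⊗ t ⊗ w ≡ 1ω
  t²w≡1 = begin
    t ⊗ t ⊗ w                                       ≡⟨ cong (_⊗ w) (⊗-identityʳ (t ⊗ t)) ⟨
    t ⊗ t ⊗ 1ω ⊗ w                                  ≡⟨ cong (λ z → t ⊗ t ⊗ z ⊗ w) v[Q]≡1 ⟨
    t ⊗ t ⊗ ⟨ ι Q / γ ⟩ ⊗ w                         ≡⟨ cong (λ z → z ⊗ ⟨ ι Q / γ ⟩ ⊗ w) (symbol-⊗ γ⊥3 (ι (+ 3)) (ι (+ 3))) ⟨
    ⟨ ι (+ 3) ⊗ ι (+ 3) / γ ⟩ ⊗ ⟨ ι Q / γ ⟩ ⊗ w     ≡⟨ cong (_⊗ w) (symbol-⊗ γ⊥3 (ι (+ 3) ⊗ ι (+ 3)) (ι Q)) ⟨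
    ⟨ ι (+ 3) ⊗ ι (+ 3) ⊗ ι Q / γ ⟩ ⊗ w             ≡⟨ symbol-⊗ γ⊥3 (ι (+ 3) ⊗ ι (+ 3) ⊗ ι Q) √-3 ⟨
    ⟨ ι (+ 3) ⊗ ι (+ 3) ⊗ ι Q ⊗ √-3 / γ ⟩           ≡⟨ symbol-cong γ⊥3 P≈ ⟨
    ⟨ ι P / γ ⟩                                     ≡⟨ v[P]≡1 ⟩
    1ω                                              ∎

⊥ℤ3⇒3∤ : ∀ {a} → a ⊥ℤ + 3 → ¬ + 3 ℤ∣.∣ a
⊥ℤ3⇒3∤ a⊥3 d = ⊥ℤ-prime prime[3] a⊥3 d ℤ∣.∣-refl

3∤⇒⊥ℤ3 : ∀ {a} → ¬ + 3 ℤ∣.∣ a → a ⊥ℤ + 3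
3∤⇒⊥ℤ3 n = ⊥ℤ-sym (prime∤ℤ⇒⊥ℤ prime[3] n)

-- A common factor g of P and Q splits off from the modulus as a rational integer prime to 3, over
-- which the symbol of 3 is 1.
supplement-prime-to-3 : ∀ {P Q} → P ⊥ℤ + 3 → Q ⊥ℤ + 3 → ⟨ ι (+ 3) / P ⊖√-3 (+ 3 * (+ 3 * Q)) ⟩ ≡ 1ω
supplement-prime-to-3 {P} {Q} P⊥3 Q⊥3 = reduce (lowestTerms P Q)
  where
  reduce : LowestTerms P Q → ⟨ ι (+ 3) / P ⊖√-3 (+ 3 * (+ 3 * Q)) ⟩ ≡ 1ω
  reduce record { g = g ; a′ = P′ ; b′ = Q′ ; a≡ = P≡ ; b≡ = Q≡ ; a′⊥b′ = P′⊥Q′ } = begin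
    ⟨ ι (+ 3) / P ⊖√-3 (+ 3 * (+ 3 * Q)) ⟩
      ≡⟨ cong (λ β → ⟨ ι (+ 3) / β ⟩) (trans (cong₂ (λ a b → a ⊖√-3 (+ 3 * b)) P≡ (trans (cong (+ 3 *_) Q≡) (h g Q′))) (√-3-scale g P′ (+ 3 * Q′))) ⟩
    ⟨ ι (+ 3) / ι g ⊗ P′ ⊖√-3 (+ 3 * (+ 3 * Q′)) ⟩
      ≡⟨ symbol-⊗ʳ g⊥3 (primary-⊥3 (+ 3 * Q′) P′⊥3) (ι (+ 3)) ⟩
    ⟨ ι (+ 3) / ι g ⟩ ⊗ ⟨ ι (+ 3) / P′ ⊖√-3 (+ 3 * (+ 3 * Q′)) ⟩
      ≡⟨ cong₂ _⊗_ (symbol-rational {a = + 3} (⊥-sym g⊥3) g⊥3) (supplement-coprime P′⊥3 Q′⊥3 P′⊥Q′) ⟩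
    1ω ⊗ 1ω
      ≡⟨ ⊗-identityʳ 1ω ⟩
    1ω ∎
    where
    open ≡-Reasoning
    h : ∀ g Q → + 3 * (g * Q) ≡ g * (+ 3 * Q)
    h = solve-∀
    P′⊥3 : P′ ⊥ℤ + 3
    P′⊥3 = ⊥ℤ-∣ (ℤ∣.divides g P≡) P⊥3
    Q′⊥3 : Q′ ⊥ℤ + 3
    Q′⊥3 = ⊥ℤ-∣ (ℤ∣.divides g Q≡) Q⊥3
    g⊥3 : ι g ⊥ ι (+ 3)
    g⊥3 = ⊥-ι (⊥ℤ-∣ (ℤ∣.divides P′ (trans P≡ (ℤₚ.*-comm g P′))) P⊥3)

-- When 3 ∣ Q, multiply by 1 - 9√-3 first.
supplement : ∀ {P} Q → P ⊥ℤ + 3 → ⟨ ι (+ 3) / P ⊖√-3 (+ 3 * (+ 3 * Q)) ⟩ ≡ 1ω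
supplement {P} Q P⊥3 = go (+ 3 ℤ∣.∣? Q)
  where
  open ≡-Reasoning
  go : Dec (+ 3 ℤ∣.∣ Q) → ⟨ ι (+ 3) / P ⊖√-3 (+ 3 * (+ 3 * Q)) ⟩ ≡ 1ω
  go (no n) = supplement-prime-to-3 P⊥3 (3∤⇒⊥ℤ3 n)
  go (yes 3∣Q) = begin
    ⟨ ι (+ 3) / γ ⟩                            ≡⟨ ⊗-identityʳ _ ⟨
    ⟨ ι (+ 3) / γ ⟩ ⊗ 1ω                       ≡⟨ cong (⟨ ι (+ 3) / γ ⟩ ⊗_) (supplement-prime-to-3 {+ 1} {+ 1} 1⊥3 1⊥3) ⟨
    ⟨ ι (+ 3) / γ ⟩ ⊗ ⟨ ι (+ 3) / γ₁ ⟩         ≡⟨ symbol-⊗ʳ (primary-⊥3 (+ 3 * Q) P⊥3) (primary-⊥3 (+ 3 * + 1) 1⊥3) (ι (+ 3)) ⟨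
    ⟨ ι (+ 3) / γ ⊗ γ₁ ⟩                       ≡⟨ cong (λ β → ⟨ ι (+ 3) / β ⟩) product≡ ⟩
    ⟨ ι (+ 3) / (P - + 243 * Q) ⊖√-3 (+ 3 * (+ 3 * (P + Q))) ⟩ ≡⟨ supplement-prime-to-3 P′⊥3 Q′⊥3 ⟩
    1ω                                         ∎
    where
    1⊥3 : + 1 ⊥ℤ + 3
    1⊥3 = comaximal (+ 1) (+ 0) refl
    γ γ₁ : Zω
    γ = P ⊖√-3 (+ 3 * (+ 3 * Q))
    γ₁ = (+ 1) ⊖√-3 (+ 3 * (+ 3 * + 1))
    product≡ : γ ⊗ γ₁ ≡ (P - + 243 * Q) ⊖√-3 (+ 3 * (+ 3 * (P + Q)))
    product≡ = begin
      (ι P ⊖ ι (+ 3 * (+ 3 * Q)) ⊗ √-3) ⊗ (ι (+ 1) ⊖ ι (+ 9) ⊗ √-3)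
        ≡⟨ cong (λ z → (ι P ⊖ z ⊗ √-3) ⊗ (ι (+ 1) ⊖ ι (+ 9) ⊗ √-3)) (ι9 Q) ⟩
      (ι P ⊖ ι (+ 9) ⊗ ι Q ⊗ √-3) ⊗ (ι (+ 1) ⊖ ι (+ 9) ⊗ √-3)
        ≡⟨ solve 3 (λ p q w → (p :- con (+ 9) :* q :* w) :* (con (+ 1) :- con (+ 9) :* w)
             := p :+ con (+ 81) :* q :* (w :* w) :- con (+ 9) :* (p :+ q) :* w) refl (ι P) (ι Q) √-3 ⟩
      ι P ⊕ ι (+ 81) ⊗ ι Q ⊗ (√-3 ⊗ √-3) ⊖ ι (+ 9) ⊗ (ι P ⊕ ι Q) ⊗ √-3
        ≡⟨ cong (λ z → ι P ⊕ ι (+ 81) ⊗ ι Q ⊗ z ⊖ ι (+ 9) ⊗ (ι P ⊕ ι Q) ⊗ √-3) √-3² ⟩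
      ι P ⊕ ι (+ 81) ⊗ ι Q ⊗ ι (- + 3) ⊖ ι (+ 9) ⊗ (ι P ⊕ ι Q) ⊗ √-3
        ≡⟨ solve 3 (λ p q x → p :+ con (+ 81) :* q :* con (- + 3) :- x := p :- con (+ 243) :* q :- x) refl (ι P) (ι Q) (ι (+ 9) ⊗ (ι P ⊕ ι Q) ⊗ √-3) ⟩
      ι P ⊖ ι (+ 243) ⊗ ι Q ⊖ ι (+ 9) ⊗ (ι P ⊕ ι Q) ⊗ √-3
        ≡⟨ cong₂ (λ a b → a ⊖ b ⊗ √-3) P-243Q (trans (cong (ι (+ 9) ⊗_) (sym (ι-⊕ P Q))) (sym (ι9 (P + Q)))) ⟩
      ι (P - + 243 * Q) ⊖ ι (+ 3 * (+ 3 * (P + Q))) ⊗ √-3 ∎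
      where
      ι9 : ∀ a → ι (+ 3 * (+ 3 * a)) ≡ ι (+ 9) ⊗ ι a
      ι9 a = trans (cong ι (sym (ℤₚ.*-assoc (+ 3) (+ 3) a))) (ι-⊗ (+ 9) a)
      P-243Q : ι P ⊖ ι (+ 243) ⊗ ι Q ≡ ι (P - + 243 * Q)
      P-243Q = sym (trans (ι-⊕ P (- (+ 243 * Q))) (cong (ι P ⊕_) (trans (ι-⊝ (+ 243 * Q)) (cong ⊝_ (ι-⊗ (+ 243) Q)))))
    P′⊥3 : P - + 243 * Q ⊥ℤ + 3
    P′⊥3 = 3∤⇒⊥ℤ3 λ d → ⊥ℤ3⇒3∤ P⊥3 (ℤ∣.∣m+n∣n⇒∣m d (ℤ∣.∣m⇒∣-m (ℤ∣.∣n⇒∣m*n (+ 243) 3∣Q)))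
    -- The product with 1 - 9√-3 has P + Q in the place of Q, and 3 ∤ P + Q because 3 ∣ Q and 3 ∤ P.
    Q′⊥3 : P + Q ⊥ℤ + 3
    Q′⊥3 = 3∤⇒⊥ℤ3 λ d → ⊥ℤ3⇒3∤ P⊥3 (ℤ∣.∣m+n∣n⇒∣m d 3∣Q)

module PrimaryElement {P Q : ℤ} (P⊥3 : P ⊥ℤ + 3) (P⊥Q : P ⊥ℤ Q) where
  γ : Zω
  γ = P ⊖√-3 (+ 3 * Q)

  γ⊥3 : γ ⊥ ι (+ 3)
  γ⊥3 = primary-⊥3 Q P⊥3

  v : ℤ → Zω
  v k = ⟨ ι k / γ ⟩

  v-* : ∀ j k → v (j * k) ≡ v j ⊗ v k
  v-* j k = trans (cong (λ α → ⟨ α / γ ⟩) (ι-⊗ j k)) (symbol-⊗ γ⊥3 (ι j) (ι k))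

  v-value : ∀ k → IsCubicValue (v k)
  v-value k = symbol-value γ⊥3 (ι k)

  -- Reciprocity covers ℓ ≠ 3. The prime 3 can divide only Q; then the coefficient of √-3 in γ is
  -- divisible by 9, and `supplement` applies.
  v-prime : ∀ {ℓ} → Prime ℓ → + ℓ ℤ∣.∣ P * Q → v (+ ℓ) ≡ 1ω
  v-prime {ℓ} L ℓ∣PQ = go (ℓ ℕₚ.≟ 3) (prime∣*ℤ L P Q ℓ∣PQ)
    where
    byReciprocity : ι (+ ℓ) ⊥ ι (+ 3) → γ ⊥ ι (+ ℓ) → ⟨ γ / ι (+ ℓ) ⟩ ≡ 1ω → v (+ ℓ) ≡ 1ω
    byReciprocity ℓ⊥3 γ⊥ℓ eq = trans (sym (reciprocity γ⊥3 (primary-rational P Q) ℓ⊥3 (⊥-sym γ⊥ℓ))) eq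
    go : Dec (ℓ ≡ 3) → + ℓ ℤ∣.∣ P ⊎ + ℓ ℤ∣.∣ Q → v (+ ℓ) ≡ 1ω
    go (yes refl) (inj₁ d) = contradiction d (⊥ℤ3⇒3∤ P⊥3)
    go (yes refl) (inj₂ (ℤ∣.divides c eq)) = trans (cong (λ q → ⟨ ι (+ 3) / P ⊖√-3 (+ 3 * q) ⟩) (trans eq (ℤₚ.*-comm c (+ 3)))) (supplement c P⊥3)
    go (no ℓ≢3) (inj₁ d) = byReciprocity ℓ⊥3 (√-3-⊥ˡ ℓ⊥3 d ℓ⊥3Q) (√-3-symbolˡ ℓ⊥3 d ℓ⊥3Q)
      where
      ℓ⊥3 : ι (+ ℓ) ⊥ ι (+ 3)
      ℓ⊥3 = prime⊥3 L ℓ≢3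
      ℓ⊥3Q : + ℓ ⊥ℤ + 3 * Q
      ℓ⊥3Q = ⊥ℤ-∣ d (⊥ℤ-sym (⊥ℤ-* (⊥ℤ-sym P⊥3) (⊥ℤ-sym P⊥Q)))
    go (no ℓ≢3) (inj₂ d) = byReciprocity ℓ⊥3 (√-3-⊥ʳ ℓ⊥3 ℓ∣3Q ℓ⊥P) (√-3-symbolʳ ℓ⊥3 ℓ∣3Q ℓ⊥P)
      where
      ℓ⊥3 : ι (+ ℓ) ⊥ ι (+ 3)
      ℓ⊥3 = prime⊥3 L ℓ≢3
      ℓ∣3Q : + ℓ ℤ∣.∣ + 3 * Q
      ℓ∣3Q = ℤ∣.∣n⇒∣m*n (+ 3) d
      ℓ⊥P : + ℓ ⊥ℤ P
      ℓ⊥P = ⊥ℤ-∣ d (⊥ℤ-sym P⊥Q)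

  v≡1 : ∀ j → ¬ j ≡ + 0 → (∀ {ℓ} → Prime ℓ → + ℓ ℤ∣.∣ j → + ℓ ℤ∣.∣ P * Q) → v j ≡ 1ω
  v≡1 j j≢0 smooth = trans (cong v (proj₂ (signed j))) (trans (v-* (proj₁ (signed j)) (+ ∣ j ∣)) (trans (cong₂ _⊗_ (v-sign (signs j)) positive) (⊗-identityʳ 1ω)))
    where
    signed : ∀ j → ∃ λ s → j ≡ s * + ∣ j ∣
    signed (+ n) = + 1 , sym (ℤₚ.*-identityˡ (+ n))
    signed -[1+ n ] = - + 1 , sym (ℤₚ.-1*i≡-i (+ suc n))
    signs : ∀ j → proj₁ (signed j) ≡ + 1 ⊎ proj₁ (signed j) ≡ - + 1
    signs (+ n) = inj₁ refl
    signs -[1+ n ] = inj₂ refl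
    v-sign : ∀ {s} → s ≡ + 1 ⊎ s ≡ - + 1 → v s ≡ 1ω
    v-sign (inj₁ refl) = symbol-1 γ⊥3
    v-sign (inj₂ refl) = symbol--1 γ⊥3
    onProduct : ∀ qs → All Prime qs → (∀ {ℓ} → Prime ℓ → ℓ ℕ∣.∣ product qs → + ℓ ℤ∣.∣ P * Q) → v (+ product qs) ≡ 1ω
    onProduct [] [] _ = symbol-1 γ⊥3
    onProduct (q ∷ qs) (L ∷ Ls) s = trans (cong v (ℤₚ.pos-* q (product qs))) (trans (v-* (+ q) (+ product qs))
      (trans (cong₂ _⊗_ (v-prime L (s L (ℕ∣.m∣m*n (product qs)))) (onProduct qs Ls (λ L′ d → s L′ (ℕ∣.∣n⇒∣m*n q d)))) (⊗-identityʳ 1ω)))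
    positive : v (+ ∣ j ∣) ≡ 1ω
    positive = transport (factorise ∣ j ∣ {{ℕ.≢-nonZero (j≢0 ∘ ℤₚ.∣i∣≡0⇒i≡0)}})
      where
      transport : PrimeFactorisation ∣ j ∣ → v (+ ∣ j ∣) ≡ 1ω
      transport F = subst (λ n → v (+ n) ≡ 1ω) (sym (PrimeFactorisation.isFactorisation F))
        (onProduct (PrimeFactorisation.factors F) (PrimeFactorisation.factorsPrime F)
          (λ {ℓ} L d → smooth L (ℤ∣.∣ᵤ⇒∣ {+ ℓ} {j} (subst (ℓ ℕ∣.∣_) (sym (PrimeFactorisation.isFactorisation F)) d))))

-- ℓ divides the numerator or the denominator of s / t in lowest terms
Splits : ℤ → ℤ → ℕ → Set
Splits s t ℓ = ∀ P Q → P ⊥ℤ Q → s * Q ≡ t * P → + ℓ ℤ∣.∣ P * Q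

-- The parameter `B` is the quotient B/C of the statement. `E` measures how far the norm is from a
-- cube: it is 1 for u itself and a divisor of D up to sign for the modified element. The last three
-- hypotheses say that the bad primes still divide PQ and that γ is primary.
module MainSymbol
  (A B C D X y E n m : ℤ)
  (m≡ : m ≡ X * X + + 27 * (C * C) * D * (y * y))
  (norm≡ : A * A - (B * C) * (B * C) * D ≡ E * (n * n * n))
  (m⊥3 : m ⊥ℤ + 3) (m⊥y : m ⊥ℤ y) (m⊥n : m ⊥ℤ n) (m⊥E : m ⊥ℤ E) (E≢0 : ¬ E ≡ + 0)
  (splitsE : ∀ {ℓ} → Prime ℓ → + ℓ ℤ∣.∣ E → Splits (B * X) (A * y) ℓ)
  (splitsAB : ∀ {ℓ} → Prime ℓ → + ℓ ℤ∣.∣ A → + ℓ ℤ∣.∣ B → Splits (B * X) (A * y) ℓ)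
  (3∤numerator : ∀ P Q → P ⊥ℤ Q → B * X * Q ≡ A * y * P → ¬ + 3 ℤ∣.∣ P)
  where
  Γ : Zω
  Γ = (B * X) ⊖√-3 (+ 3 * (A * y))

  ιm⊥3 : ι m ⊥ ι (+ 3)
  ιm⊥3 = ⊥-ι m⊥3

  -- Γ times its conjugate is (BX)² + 27(Ay)², which is congruent to 27y²En³ modulo m, and every
  -- factor of that is prime to m.
  Γ⊥m : Γ ⊥ ι m
  Γ⊥m = ⊥-∣ (divides _ (sym (√-3-norm (B * X) (+ 3 * (A * y)))))
    (⊥-mod (ι-mod (ℤ∣.divides (- (B * B)) difference)) (⊥-ι (⊥ℤ-sym (⊥ℤ-sym 27y²En³⊥m))))
    where
    K : ℤ
    K = + 3 * (+ 3 * (+ 3 * (y * (y * (E * (n * (n * n)))))))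
    27y²En³⊥m : K ⊥ℤ m
    27y²En³⊥m = ⊥ℤ-* 3⊥m (⊥ℤ-* 3⊥m (⊥ℤ-* 3⊥m (⊥ℤ-* y⊥m (⊥ℤ-* y⊥m (⊥ℤ-* (⊥ℤ-sym m⊥E) (⊥ℤ-* n⊥m (⊥ℤ-* n⊥m n⊥m)))))))
      where
      3⊥m : + 3 ⊥ℤ m
      3⊥m = ⊥ℤ-sym m⊥3
      y⊥m : y ⊥ℤ m
      y⊥m = ⊥ℤ-sym m⊥y
      n⊥m : n ⊥ℤ m
      n⊥m = ⊥ℤ-sym m⊥n
    h₁ : ∀ y E n → + 3 * (+ 3 * (+ 3 * (y * (y * (E * (n * (n * n))))))) ≡ + 27 * (y * y) * (E * (n * n * n))
    h₁ = solve-∀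
    h₂ : ∀ A B C D X y → + 27 * (y * y) * (A * A - (B * C) * (B * C) * D) - ((B * X) * (B * X) + + 3 * ((+ 3 * (A * y)) * (+ 3 * (A * y))))
       ≡ - (B * B) * (X * X + + 27 * (C * C) * D * (y * y))
    h₂ = solve-∀
    difference : K - ((B * X) * (B * X) + + 3 * ((+ 3 * (A * y)) * (+ 3 * (A * y)))) ≡ - (B * B) * m
    difference = trans (cong (_- ((B * X) * (B * X) + + 3 * ((+ 3 * (A * y)) * (+ 3 * (A * y))))) (trans (h₁ y E n) (cong (+ 27 * (y * y) *_) (sym norm≡))))
      (trans (h₂ A B C D X y) (cong (- (B * B) *_) (sym m≡)))

  X⊥y : X ⊥ℤ y
  X⊥y = go m⊥y
    where
    h : ∀ X y C D s t → X * (X * s) + y * (+ 27 * (C * C) * D * y * s + t) ≡ (X * X + + 27 * (C * C) * D * (y * y)) * s + y * t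
    h = solve-∀
    go : m ⊥ℤ y → X ⊥ℤ y
    go (comaximal s t eq) = comaximal (X * s) (+ 27 * (C * C) * D * y * s + t)
      (trans (h X y C D s t) (trans (cong (λ z → z * s + y * t) (sym m≡)) eq))

  degenerate : A * y ≡ + 0 → ⟨ Γ / ι m ⟩ ≡ 1ω
  degenerate Ay≡0 = trans (cong (λ α → ⟨ α / ι m ⟩) Γ≡) (symbol-rational {a = B * X} (subst (_⊥ ι m) Γ≡ Γ⊥m) ιm⊥3)
    where
    Γ≡ : Γ ≡ ι (B * X)
    Γ≡ = trans (cong (λ z → (B * X) ⊖√-3 (+ 3 * z)) Ay≡0) (solve 2 (λ p w → p :- con (+ 0) :* w := p) refl (ι (B * X)) √-3)

  -- BX/(Ay) is reduced by three successive gcds instead of one, to keep track of the origin of each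
  -- cancelled factor. g₁ comes from y and B, g₂ from A and the rest of B, g₃ from the rest of A and
  -- X; X and y are comaximal. Only g₂ divides the norm as a square factor, and g₂ divides both A
  -- and B, so `splitsAB` applies to its primes.
  module Generic (Ay≢0 : ¬ A * y ≡ + 0)
    {g₁ y₁ b₁} (y≡ : y ≡ g₁ * y₁) (B≡ : B ≡ g₁ * b₁) (y₁⊥b₁ : y₁ ⊥ℤ b₁)
    {g₂ A₁ b₂} (A≡ : A ≡ g₂ * A₁) (b₁≡ : b₁ ≡ g₂ * b₂) (A₁⊥b₂ : A₁ ⊥ℤ b₂)
    {g₃ A₂ X₁} (A₁≡ : A₁ ≡ g₃ * A₂) (X≡ : X ≡ g₃ * X₁) (A₂⊥X₁ : A₂ ⊥ℤ X₁) where
    P Q g k : ℤ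
    P = b₂ * X₁
    Q = A₂ * y₁
    g = g₁ * g₂ * g₃
    k = A₁ * A₁ - (g₁ * b₂ * C) * (g₁ * b₂ * C) * D

    BX≡ : B * X ≡ g * P
    BX≡ = trans (cong₂ _*_ (trans B≡ (cong (g₁ *_) b₁≡)) X≡) (h g₁ g₂ g₃ b₂ X₁)
      where
      h : ∀ g₁ g₂ g₃ b X → g₁ * (g₂ * b) * (g₃ * X) ≡ g₁ * g₂ * g₃ * (b * X)
      h = solve-∀

    Ay≡ : A * y ≡ g * Q
    Ay≡ = trans (cong₂ _*_ (trans A≡ (cong (g₂ *_) A₁≡)) y≡) (h g₁ g₂ g₃ A₂ y₁)
      where
      h : ∀ g₁ g₂ g₃ A y → g₂ * (g₃ * A) * (g₁ * y) ≡ g₁ * g₂ * g₃ * (A * y)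
      h = solve-∀

    cross : B * X * Q ≡ A * y * P
    cross = trans (cong (_* Q) BX≡) (trans (h g P Q) (cong (_* P) (sym Ay≡)))
      where
      h : ∀ g P Q → g * P * Q ≡ g * Q * P
      h = solve-∀

    P⊥Q : P ⊥ℤ Q
    P⊥Q = ⊥ℤ-* (⊥ℤ-sym (⊥ℤ-* (⊥ℤ-∣ (ℤ∣.divides g₃ A₁≡) A₁⊥b₂) (⊥ℤ-sym (⊥ℤ-∣ (ℤ∣.divides g₂ b₁≡) (⊥ℤ-sym y₁⊥b₁)))))
               (⊥ℤ-sym (⊥ℤ-* A₂⊥X₁ (⊥ℤ-sym (⊥ℤ-∣ (ℤ∣.divides g₃ X≡) (⊥ℤ-sym (⊥ℤ-∣ (ℤ∣.divides g₁ y≡) (⊥ℤ-sym X⊥y)))))))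

    3∤P : ¬ + 3 ℤ∣.∣ P
    3∤P = 3∤numerator P Q P⊥Q cross

    P⊥3 : P ⊥ℤ + 3
    P⊥3 = 3∤⇒⊥ℤ3 3∤P

    open PrimaryElement P⊥3 P⊥Q

    Γ≡gγ : Γ ≡ ι g ⊗ γ
    Γ≡gγ = trans (cong₂ (λ a b → a ⊖√-3 (+ 3 * b)) BX≡ Ay≡) (√-3-scale g P Q)

    γ⊥m : γ ⊥ ι m
    γ⊥m = ⊥-∣ (divides (ι g) (trans Γ≡gγ (⊗-comm (ι g) γ))) Γ⊥m

    g⊥m : ι g ⊥ ι m
    g⊥m = ⊥-∣ (divides γ Γ≡gγ) Γ⊥m

    -- This is B²m + 27y²(A² - B²C²D) = Γ conj Γ divided by (g₁g₂)², with `k` equal to the norm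
    -- divided by g₂². The factor 27 is written as -(-3)³ to show that it is a cube.
    relation : b₂ * b₂ * m - - + 3 * - + 3 * - + 3 * (y₁ * y₁) * k ≡ g₃ * g₃ * (P * P + + 3 * ((+ 3 * Q) * (+ 3 * Q)))
    relation = trans (cong₂ (λ a b → b₂ * b₂ * a - - + 3 * - + 3 * - + 3 * (y₁ * y₁) * (b * b - (g₁ * b₂ * C) * (g₁ * b₂ * C) * D))
        (trans m≡ (cong₂ (λ x y → x * x + + 27 * (C * C) * D * (y * y)) X≡ y≡)) A₁≡)
      (h g₁ g₃ b₂ X₁ A₂ y₁ C D)
      where
      h : ∀ g₁ g₃ b X A y C D →
        b * b * (g₃ * X * (g₃ * X) + + 27 * (C * C) * D * (g₁ * y * (g₁ * y))) - - + 3 * - + 3 * - + 3 * (y * y) * (g₃ * A * (g₃ * A) - (g₁ * b * C) * (g₁ * b * C) * D)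
        ≡ g₃ * g₃ * ((b * X) * (b * X) + + 3 * ((+ 3 * (A * y)) * (+ 3 * (A * y))))
      h = solve-∀

    b₂²m≈ : ι (b₂ * b₂ * m) ≈ ι (- + 3 * - + 3 * - + 3 * (y₁ * y₁) * k) mod γ
    b₂²m≈ = congruent (subst (γ ∣𝔼_) (trans (sym (trans (cong ι relation) (ι-⊗ (g₃ * g₃) (P * P + + 3 * ((+ 3 * Q) * (+ 3 * Q))))))
        (trans (ι-⊕ (b₂ * b₂ * m) (- (- + 3 * - + 3 * - + 3 * (y₁ * y₁) * k))) (cong (ι (b₂ * b₂ * m) ⊕_) (ι-⊝ (- + 3 * - + 3 * - + 3 * (y₁ * y₁) * k)))))
      (∣𝔼-⊗ˡ (ι (g₃ * g₃)) (divides _ (sym (√-3-norm P (+ 3 * Q))))))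

    g₂²k≡ : g₂ * g₂ * k ≡ E * (n * n * n)
    g₂²k≡ = trans (h g₁ g₂ A₁ b₂ C D) (trans (cong₂ (λ a b → a * a - (b * C) * (b * C) * D) (sym A≡) (sym (trans B≡ (cong (g₁ *_) b₁≡)))) norm≡)
      where
      h : ∀ g₁ g₂ A b C D → g₂ * g₂ * (A * A - (g₁ * b * C) * (g₁ * b * C) * D) ≡ g₂ * A * (g₂ * A) - (g₁ * (g₂ * b) * C) * (g₁ * (g₂ * b) * C) * D
      h = solve-∀

    v[b₂]≡1 : v b₂ ≡ 1ω
    v[b₂]≡1 = v≡1 b₂ (λ z → 3∤P (ℤ∣.divides (+ 0) (trans (cong (_* X₁) z) refl))) (λ L d → ℤ∣.∣m⇒∣m*n Q (ℤ∣.∣m⇒∣m*n X₁ d))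

    v[y₁]≡1 : v y₁ ≡ 1ω
    v[y₁]≡1 = v≡1 y₁ (λ z → Ay≢0 (trans (cong (A *_) (trans y≡ (trans (cong (g₁ *_) z) (ℤₚ.*-zeroʳ g₁)))) (ℤₚ.*-zeroʳ A)))
      (λ L d → ℤ∣.∣n⇒∣m*n P (ℤ∣.∣n⇒∣m*n A₂ d))

    v[g₂]≡1 : v g₂ ≡ 1ω
    v[g₂]≡1 = v≡1 g₂ (λ z → Ay≢0 (trans (cong (_* y) (trans A≡ (cong (_* A₁) z))) refl))
      (λ L d → splitsAB L (subst (_ ℤ∣.∣_) (sym A≡) (ℤ∣.∣m⇒∣m*n A₁ d))
                          (subst (_ ℤ∣.∣_) (sym (trans B≡ (cong (g₁ *_) b₁≡))) (ℤ∣.∣n⇒∣m*n g₁ (ℤ∣.∣m⇒∣m*n b₂ d))) P Q P⊥Q cross)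

    v[E]≡1 : v E ≡ 1ω
    v[E]≡1 = v≡1 E E≢0 (λ L d → splitsE L d P Q P⊥Q cross)

    v-square : ∀ j → v j ≡ 1ω → v (j * j) ≡ 1ω
    v-square j eq = trans (v-* j j) (trans (cong₂ _⊗_ eq eq) (⊗-identityʳ 1ω))

    v-cube : ∀ j → v (j * j * j) ≡ v j ⊗ v j ⊗ v j
    v-cube j = trans (v-* (j * j) j) (cong (_⊗ v j) (v-* j j))

    v[-27]≡1 : v (- + 3 * - + 3 * - + 3) ≡ 1ω
    v[-27]≡1 = trans (v-cube (- + 3)) (cubicValue-cube (v-value (- + 3)) (symbol-≢0 γ⊥3 (⊥-neg {+ 3} (⊥-sym γ⊥3))))

    v[m]≡v[n]³ : v m ≡ v n ⊗ v n ⊗ v n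
    v[m]≡v[n]³ = begin
      v m                                              ≡⟨ ⊗-identityˡ (v m) ⟨
      1ω ⊗ v m                                         ≡⟨ cong (_⊗ v m) (v-square b₂ v[b₂]≡1) ⟨
      v (b₂ * b₂) ⊗ v m                                ≡⟨ v-* (b₂ * b₂) m ⟨
      v (b₂ * b₂ * m)                                  ≡⟨ symbol-cong γ⊥3 b₂²m≈ ⟩
      v (- + 3 * - + 3 * - + 3 * (y₁ * y₁) * k)        ≡⟨ trans (v-* (- + 3 * - + 3 * - + 3 * (y₁ * y₁)) k) (cong (_⊗ v k) (v-* (- + 3 * - + 3 * - + 3) (y₁ * y₁))) ⟩
      v (- + 3 * - + 3 * - + 3) ⊗ v (y₁ * y₁) ⊗ v k    ≡⟨ cong₂ (λ a b → a ⊗ b ⊗ v k) v[-27]≡1 (v-square y₁ v[y₁]≡1) ⟩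
      1ω ⊗ 1ω ⊗ v k                                    ≡⟨ cong (_⊗ v k) (trans (⊗-identityʳ 1ω) (sym (v-square g₂ v[g₂]≡1))) ⟩
      v (g₂ * g₂) ⊗ v k                                ≡⟨ v-* (g₂ * g₂) k ⟨
      v (g₂ * g₂ * k)                                  ≡⟨ cong v g₂²k≡ ⟩
      v (E * (n * n * n))                              ≡⟨ v-* E (n * n * n) ⟩
      v E ⊗ v (n * n * n)                              ≡⟨ cong₂ _⊗_ v[E]≡1 (v-cube n) ⟩
      1ω ⊗ (v n ⊗ v n ⊗ v n)                           ≡⟨ ⊗-identityˡ (v n ⊗ v n ⊗ v n) ⟩
      v n ⊗ v n ⊗ v n                                  ∎
      where open ≡-Reasoning

    -- The value is a cube, so it is 1 unless `v n` vanishes; that would make `v m` vanish, against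
    -- `γ⊥m`.
    v[m]≡1 : v m ≡ 1ω
    v[m]≡1 = trans v[m]≡v[n]³ (cubicValue-cube (v-value n) λ z → symbol-≢0 γ⊥3 (⊥-sym γ⊥m)
      (trans v[m]≡v[n]³ (trans (cong (λ w → w ⊗ w ⊗ w) z) (⊗-zeroʳ (0ω ⊗ 0ω)))))

    generic : ⟨ Γ / ι m ⟩ ≡ 1ω
    generic = begin
      ⟨ Γ / ι m ⟩                        ≡⟨ cong (λ α → ⟨ α / ι m ⟩) Γ≡gγ ⟩
      ⟨ ι g ⊗ γ / ι m ⟩                  ≡⟨ symbol-⊗ ιm⊥3 (ι g) γ ⟩
      ⟨ ι g / ι m ⟩ ⊗ ⟨ γ / ι m ⟩        ≡⟨ cong₂ _⊗_ (symbol-rational {a = g} g⊥m ιm⊥3) (trans (reciprocity γ⊥3 (primary-rational P Q) ιm⊥3 (⊥-sym γ⊥m)) v[m]≡1) ⟩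
      1ω ⊗ 1ω                            ≡⟨ ⊗-identityʳ 1ω ⟩
      1ω                                 ∎
      where open ≡-Reasoning

  symbol≡1 : ⟨ Γ / ι m ⟩ ≡ 1ω
  symbol≡1 = go (A * y ℤₚ.≟ + 0)
    where
    module L₁ = LowestTerms (lowestTerms y B)
    module L₂ = LowestTerms (lowestTerms A L₁.b′)
    module L₃ = LowestTerms (lowestTerms L₂.a′ X)
    go : Dec (A * y ≡ + 0) → ⟨ Γ / ι m ⟩ ≡ 1ω
    go (yes Ay≡0) = degenerate Ay≡0
    go (no Ay≢0) = Generic.generic Ay≢0 {L₁.g} {L₁.a′} {L₁.b′} L₁.a≡ L₁.b≡ L₁.a′⊥b′
      {L₂.g} {L₂.a′} {L₂.b′} L₂.a≡ L₂.b≡ L₂.a′⊥b′ {L₃.g} {L₃.a′} {L₃.b′} L₃.a≡ L₃.b≡ L₃.a′⊥b′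

-- Valuations of A and B

distinctPrimes∣ : ∀ {n} ps → Unique ps → All Prime ps → All (ℕ∣._∣ n) ps → product ps ℕ∣.∣ n
distinctPrimes∣ [] _ _ _ = ℕ∣.1∣ _
distinctPrimes∣ {n} (p ∷ ps) (p∉ps ∷ uniq) (P ∷ Ps) (d ∷ ds) = go (distinctPrimes∣ ps uniq Ps ds)
  where
  go : product ps ℕ∣.∣ n → p ℕ.* product ps ℕ∣.∣ n
  go (ℕ∣.divides r refl) = [ ℕ∣.*-monoˡ-∣ (product ps)
    , (λ e → contradiction refl (All.lookup p∉ps (factorisationHasAllPrimeFactors P e Ps))) ]′ (euclidsLemma r (product ps) P d)

module _ (D : ℕ) (A B : ℤ) where
  private
    g : ℕ
    g = gcdAB A B
    Selected : ℕ → Set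
    Selected p = Prime p × ¬ 2 ℕ∣.∣ p × p ℕ∣.∣ g × ¬ p ℕ∣.∣ D
    -- Literally the filter predicate inside `Cu`, so that `product ps` and `Cu D A B` agree by
    -- computation.
    selected? : ∀ p → Dec (Selected p)
    selected? = λ p → prime? p ×-dec ¬? (2 ℕ∣.∣? p) ×-dec (p ℕ∣.∣? g) ×-dec ¬? (p ℕ∣.∣? D)
    ps : List ℕ
    ps = filter selected? (upTo (suc g))
    allSelected : All Selected ps
    allSelected = All.tabulate (λ {p} p∈ → proj₂ (∈-filter⁻ selected? {p} {upTo (suc g)} p∈))

  prime∣Cu⇒ : ∀ {ℓ} → Prime ℓ → ℓ ℕ∣.∣ Cu D A B → Selected ℓ
  prime∣Cu⇒ L d = All.lookup allSelected (factorisationHasAllPrimeFactors L d (All.map proj₁ allSelected))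

  ⇒prime∣Cu : ∀ {ℓ} → .{{NonZero (gcdAB A B)}} → Selected ℓ → ℓ ℕ∣.∣ Cu D A B
  ⇒prime∣Cu {ℓ} s@(_ , _ , ℓ∣g , _) = ∈⇒∣product (∈-filter⁺ selected? (∈-upTo⁺ (ℕ.s≤s (ℕ∣.∣⇒≤ ℓ∣g))) s)

  Cu∣gcd : Cu D A B ℕ∣.∣ gcdAB A B
  Cu∣gcd = distinctPrimes∣ ps (Uniqueₚ.filter⁺ selected? (Uniqueₚ.upTo⁺ (suc g))) (All.map proj₁ allSelected) (All.map (λ s → proj₁ (proj₂ (proj₂ s))) allSelected)

*-cancelˡ-prime : ∀ {p} → Prime p → ∀ {a b} → + p * a ≡ + p * b → a ≡ b
*-cancelˡ-prime {p} P {a} {b} = ℤₚ.*-cancelˡ-≡ (+ p) a b {{prime⇒nonZero P}}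

prime∣square : ∀ {p} → Prime p → ∀ a → + p ℤ∣.∣ a * a → + p ℤ∣.∣ a
prime∣square P a d = [ (λ e → e) , (λ e → e) ]′ (prime∣*ℤ P a a d)

prime∣cube : ∀ {p} → Prime p → ∀ a → + p ℤ∣.∣ a * a * a → + p ℤ∣.∣ a
prime∣cube P a d = [ prime∣square P a , (λ e → e) ]′ (prime∣*ℤ P (a * a) a d)

prime∣*-cancel : ∀ {p} → Prime p → ∀ {a b} → ¬ + p ℤ∣.∣ a → + p ℤ∣.∣ a * b → + p ℤ∣.∣ b
prime∣*-cancel P {a} {b} n d = [ (λ e → contradiction e n) , (λ e → e) ]′ (prime∣*ℤ P a b d)

odd : ∀ {a} → ¬ + 2 ℤ∣.∣ a → + 2 ℤ∣.∣ a - + 1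
odd {a} n = go (a ℤ÷.%ℕ 2) (ℤ÷.n%ℕd<d a 2) (ℤ÷.a≡a%ℕn+[a/ℕn]*n a 2)
  where
  h : ∀ k → + 1 + k * + 2 - + 1 ≡ k * + 2
  h = solve-∀
  go : ∀ r → r ℕ.< 2 → a ≡ + r + (a ℤ÷./ℕ 2) * + 2 → + 2 ℤ∣.∣ a - + 1
  go 0 _ eq = contradiction (ℤ∣.divides (a ℤ÷./ℕ 2) (trans eq (ℤₚ.+-identityˡ _))) n
  go 1 _ eq = ℤ∣.divides (a ℤ÷./ℕ 2) (trans (cong (_- + 1) eq) (h (a ℤ÷./ℕ 2)))
  go (suc (suc _)) (ℕ.s≤s (ℕ.s≤s ())) _

odd-sum : ∀ {a b} → ¬ + 2 ℤ∣.∣ a → ¬ + 2 ℤ∣.∣ b → + 2 ℤ∣.∣ a + b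
odd-sum {a} {b} m n = subst (+ 2 ℤ∣.∣_) (h a b) (ℤ∣.∣m∣n⇒∣m+n (ℤ∣.∣m∣n⇒∣m+n (odd m) (odd n)) ℤ∣.∣-refl)
  where
  h : ∀ a b → a - + 1 + (b - + 1) + + 2 ≡ a + b
  h = solve-∀

module Valuations {D : ℕ} (squareFree : SquareFree D) {A B n : ℤ} (norm≡ : A * A - B * B * + D ≡ n * n * n)
  (cubeFree : ∀ {ℓ} → Prime ℓ → ¬ (+ ℓ * + ℓ * + ℓ ℤ∣.∣ A × + ℓ * + ℓ * + ℓ ℤ∣.∣ B)) {ℓ : ℕ} (L : Prime ℓ) where
  private
    p : ℤ
    p = + ℓ

  record RamifiedValuation : Set where
    field
      A₂ B₁ : ℤ
      A≡ : A ≡ p * (p * A₂)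
      B≡ : B ≡ p * B₁
      ∤B₁ : ¬ p ℤ∣.∣ B₁

  private
    ∣-form : ∀ {a} → p ℤ∣.∣ a → ∃ λ b → a ≡ p * b
    ∣-form (ℤ∣.divides q eq) = q , trans eq (ℤₚ.*-comm q p)
    ∣p* : ∀ a → p ℤ∣.∣ p * a
    ∣p* a = ℤ∣.∣m⇒∣m*n a ℤ∣.∣-refl

  ∣n : p ℤ∣.∣ A → p ℤ∣.∣ B * B * + D → p ℤ∣.∣ n
  ∣n dA dB = prime∣cube L n (subst (p ℤ∣.∣_) norm≡ (ℤ∣.∣m∣n⇒∣m-n (ℤ∣.∣m⇒∣m*n A dA) dB))

  module Ramified (ℓ∣A : p ℤ∣.∣ A) (ℓ∣D : p ℤ∣.∣ + D) where
    -- Since v(D) = 1, the valuation of A² is even and that of B²D odd; the smaller one equals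
    -- 3v(n). With ℓ ∣ A and cube-freeness, only v(B) = 1 and v(A) ≥ 2 remain. The steps carry out
    -- this comparison by cancelling ℓ as often as possible.
    ramified : RamifiedValuation
    ramified = step₁ (∣-form ℓ∣D) (∣-form ℓ∣A) (∣-form (∣n ℓ∣A (ℤ∣.∣n⇒∣m*n (B * B) ℓ∣D)))
      where
      step₁ : (∃ λ d → + D ≡ p * d) → (∃ λ A₁ → A ≡ p * A₁) → (∃ λ n₁ → n ≡ p * n₁) → RamifiedValuation
      step₁ (d , D≡) (A₁ , A≡) (n₁ , n≡) = step₂ (∣-form p∣B)
        where
        p∤d : ¬ p ℤ∣.∣ d
        p∤d e = squareFree ℓ L (subst (ℕ∣._∣ D) (ℤₚ.abs-* p p) (ℤ∣.∣⇒∣ᵤ {p * p} {+ D} (p²∣D (∣-form e))))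
          where
          p²∣D : (∃ λ d′ → d ≡ p * d′) → p * p ℤ∣.∣ + D
          p²∣D (d′ , refl) = ℤ∣.divides d′ (trans D≡ (h p d′))
            where
            h : ∀ p d → p * (p * d) ≡ d * (p * p)
            h = solve-∀
        norm₁ : p * A₁ * (p * A₁) - B * B * (p * d) ≡ p * n₁ * (p * n₁) * (p * n₁)
        norm₁ = trans (sym (cong₂ (λ a d → a * a - B * B * d) A≡ D≡)) (trans norm≡ (cong (λ n → n * n * n) n≡))
        p∣B : p ℤ∣.∣ B
        p∣B = prime∣square L B (prime∣*-cancel L p∤d (subst (p ℤ∣.∣_) (ℤₚ.*-comm (B * B) d)
          (subst (p ℤ∣.∣_) (sym (*-cancelˡ-prime L (trans (h₁ p A₁ B d) (trans (cong (λ z → p * A₁ * (p * A₁) - z) norm₁) (h₂ p A₁ n₁))))) (∣p* (A₁ * A₁ - p * n₁ * n₁ * n₁)))))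
          where
          h₁ : ∀ p A₁ B d → p * (B * B * d) ≡ p * A₁ * (p * A₁) - (p * A₁ * (p * A₁) - B * B * (p * d))
          h₁ = solve-∀
          h₂ : ∀ p A₁ n₁ → p * A₁ * (p * A₁) - p * n₁ * (p * n₁) * (p * n₁) ≡ p * (p * (A₁ * A₁ - p * n₁ * n₁ * n₁))
          h₂ = solve-∀
        step₂ : (∃ λ B₁ → B ≡ p * B₁) → RamifiedValuation
        step₂ (B₁ , B≡) = step₃ (∣-form p∣A₁)
          where
          A₁²≡ : A₁ * A₁ ≡ p * (B₁ * B₁ * d + n₁ * n₁ * n₁)
          A₁²≡ = *-cancelˡ-prime L (*-cancelˡ-prime L (trans (h₁ p A₁ B₁ d) (trans
            (cong (λ z → z + p * B₁ * (p * B₁) * (p * d)) (trans (sym (cong (λ b → p * A₁ * (p * A₁) - b * b * (p * d)) B≡)) norm₁)) (h₂ p B₁ d n₁))))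
            where
            h₁ : ∀ p A₁ B₁ d → p * (p * (A₁ * A₁)) ≡ p * A₁ * (p * A₁) - p * B₁ * (p * B₁) * (p * d) + p * B₁ * (p * B₁) * (p * d)
            h₁ = solve-∀
            h₂ : ∀ p B₁ d n₁ → p * n₁ * (p * n₁) * (p * n₁) + p * B₁ * (p * B₁) * (p * d) ≡ p * (p * (p * (B₁ * B₁ * d + n₁ * n₁ * n₁)))
            h₂ = solve-∀
          p∣A₁ : p ℤ∣.∣ A₁
          p∣A₁ = prime∣square L A₁ (subst (p ℤ∣.∣_) (sym A₁²≡) (∣p* _))
          step₃ : (∃ λ A₂ → A₁ ≡ p * A₂) → RamifiedValuation
          step₃ (A₂ , A₁≡) = record { A₂ = A₂ ; B₁ = B₁ ; A≡ = trans A≡ (cong (p *_) A₁≡) ; B≡ = B≡ ; ∤B₁ = λ e → noB₂ (∣-form e) }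
            where
            pA₂²≡ : p * (A₂ * A₂) ≡ B₁ * B₁ * d + n₁ * n₁ * n₁
            pA₂²≡ = *-cancelˡ-prime L (trans (h p A₂) (trans (sym (cong (λ a → a * a) A₁≡)) A₁²≡))
              where
              h : ∀ p A₂ → p * (p * (A₂ * A₂)) ≡ p * A₂ * (p * A₂)
              h = solve-∀
            noB₂ : ¬ (∃ λ B₂ → B₁ ≡ p * B₂)
            noB₂ (B₂ , B₁≡) = noN₂ (∣-form p∣n₁)
              where
              p∣n₁ : p ℤ∣.∣ n₁
              p∣n₁ = prime∣cube L n₁ (subst (p ℤ∣.∣_) (trans (cong (_- B₁ * B₁ * d) pA₂²≡) (h (B₁ * B₁ * d) (n₁ * n₁ * n₁)))
                (ℤ∣.∣m∣n⇒∣m-n (∣p* (A₂ * A₂)) (subst (λ b → p ℤ∣.∣ b * b * d) (sym B₁≡) (ℤ∣.∣m⇒∣m*n d (ℤ∣.∣m⇒∣m*n (p * B₂) (∣p* B₂))))))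
                where
                h : ∀ u v → u + v - u ≡ v
                h = solve-∀
              noN₂ : ¬ (∃ λ n₂ → n₁ ≡ p * n₂)
              noN₂ (n₂ , n₁≡) = noA₃ (∣-form p∣A₂)
                where
                A₂²≡ : A₂ * A₂ ≡ p * (B₂ * B₂ * d + p * n₂ * n₂ * n₂)
                A₂²≡ = *-cancelˡ-prime L (trans pA₂²≡ (trans (cong₂ (λ b n → b * b * d + n * n * n) B₁≡ n₁≡) (h p B₂ d n₂)))
                  where
                  h : ∀ p B₂ d n₂ → p * B₂ * (p * B₂) * d + p * n₂ * (p * n₂) * (p * n₂) ≡ p * (p * (B₂ * B₂ * d + p * n₂ * n₂ * n₂))
                  h = solve-∀
                p∣A₂ : p ℤ∣.∣ A₂
                p∣A₂ = prime∣square L A₂ (subst (p ℤ∣.∣_) (sym A₂²≡) (∣p* _))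
                noA₃ : ¬ (∃ λ A₃ → A₂ ≡ p * A₃)
                noA₃ (A₃ , A₂≡) = cubeFree L (ℤ∣.divides A₃ (trans A≡ (trans (cong (p *_) (trans A₁≡ (cong (p *_) A₂≡))) (h₀ p A₃))) , p³∣B (∣-form p∣B₂))
                  where
                  h₀ : ∀ p a → p * (p * (p * a)) ≡ a * (p * p * p)
                  h₀ = solve-∀
                  p∣B₂ : p ℤ∣.∣ B₂
                  p∣B₂ = prime∣square L B₂ (prime∣*-cancel L p∤d (subst (p ℤ∣.∣_) (ℤₚ.*-comm (B₂ * B₂) d)
                    (subst (p ℤ∣.∣_) (trans (cong (_- p * n₂ * n₂ * n₂) pA₃²≡) (h₂ (B₂ * B₂ * d) (p * n₂ * n₂ * n₂)))
                      (ℤ∣.∣m∣n⇒∣m-n (∣p* (A₃ * A₃)) (ℤ∣.∣m⇒∣m*n n₂ (ℤ∣.∣m⇒∣m*n n₂ (∣p* n₂)))))))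
                    where
                    h₁ : ∀ p a → p * (p * (a * a)) ≡ p * a * (p * a)
                    h₁ = solve-∀
                    h₂ : ∀ u v → u + v - v ≡ u
                    h₂ = solve-∀
                    pA₃²≡ : p * (A₃ * A₃) ≡ B₂ * B₂ * d + p * n₂ * n₂ * n₂
                    pA₃²≡ = *-cancelˡ-prime L (trans (h₁ p A₃) (trans (sym (cong (λ a → a * a) A₂≡)) A₂²≡))
                  p³∣B : (∃ λ B₃ → B₂ ≡ p * B₃) → p * p * p ℤ∣.∣ B
                  p³∣B (B₃ , B₂≡) = ℤ∣.divides B₃ (trans B≡ (trans (cong (p *_) (trans B₁≡ (cong (p *_) B₂≡))) (h₀ p B₃)))

  -- `s` is the exact power of ℓ in both A and B. It is ℓ or ℓ² in `unramified`.
  record EqualValuations : Set where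
    field
      s A° B° : ℤ
      A≡ : A ≡ s * A°
      B≡ : B ≡ s * B°
      s≢0 : ¬ s ≡ + 0
      ∤A° : ¬ p ℤ∣.∣ A°
      ∤B° : ¬ p ℤ∣.∣ B°

  module Unramified (ℓ∤D : ¬ p ℤ∣.∣ + D) (ℓ∣A : p ℤ∣.∣ A) (ℓ∣B : p ℤ∣.∣ B) where
    private
      p≢0 : ¬ p ≡ + 0
      p≢0 e = prime≢0 L (ℤₚ.+-injective e)
      ∣A⇒∣B : ∀ {a b z} → a * a - b * b * + D ≡ p * z → p ℤ∣.∣ a → p ℤ∣.∣ b
      ∣A⇒∣B {a} {b} {z} eq d = prime∣square L b (prime∣*-cancel L ℓ∤D (subst (p ℤ∣.∣_) (h a b (+ D))
        (ℤ∣.∣m∣n⇒∣m-n (ℤ∣.∣m⇒∣m*n a d) (subst (p ℤ∣.∣_) (sym eq) (∣p* z)))))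
        where
        h : ∀ a b D → a * a - (a * a - b * b * D) ≡ D * (b * b)
        h = solve-∀
      ∣B⇒∣A : ∀ {a b z} → a * a - b * b * + D ≡ p * z → p ℤ∣.∣ b → p ℤ∣.∣ a
      ∣B⇒∣A {a} {b} {z} eq d = prime∣square L a (subst (p ℤ∣.∣_) (h a b (+ D))
        (ℤ∣.∣m∣n⇒∣m+n (subst (p ℤ∣.∣_) (sym eq) (∣p* z)) (ℤ∣.∣m⇒∣m*n (+ D) (ℤ∣.∣m⇒∣m*n b d))))
        where
        h : ∀ a b D → a * a - b * b * D + b * b * D ≡ a * a
        h = solve-∀

    -- If v(A) and v(B) differed, the norm would have twice the smaller one as valuation. By
    -- cube-freeness this is 2 or 4, not a multiple of 3.
    unramified : EqualValuations
    unramified = step₁ (∣-form ℓ∣A) (∣-form ℓ∣B) (∣-form (∣n ℓ∣A (ℤ∣.∣m⇒∣m*n (+ D) (ℤ∣.∣m⇒∣m*n B ℓ∣B))))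
      where
      step₁ : (∃ λ a → A ≡ p * a) → (∃ λ b → B ≡ p * b) → (∃ λ n₁ → n ≡ p * n₁) → EqualValuations
      step₁ (A₁ , A≡) (B₁ , B≡) (n₁ , n≡) = split (p ℤ∣.∣? A₁)
        where
        h₁ : ∀ p a b D → p * (p * (a * a - b * b * D)) ≡ p * a * (p * a) - p * b * (p * b) * D
        h₁ = solve-∀
        h₂ : ∀ p n → p * n * (p * n) * (p * n) ≡ p * (p * (p * (n * n * n)))
        h₂ = solve-∀
        norm₁ : A₁ * A₁ - B₁ * B₁ * + D ≡ p * (n₁ * n₁ * n₁)
        norm₁ = *-cancelˡ-prime L (*-cancelˡ-prime L (trans (h₁ p A₁ B₁ (+ D)) (trans (sym (cong₂ (λ a b → a * a - b * b * + D) A≡ B≡))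
          (trans norm≡ (trans (cong (λ n → n * n * n) n≡) (h₂ p n₁))))))
        split : Dec (p ℤ∣.∣ A₁) → EqualValuations
        split (no ∤A₁) = record { s = p ; A° = A₁ ; B° = B₁ ; A≡ = A≡ ; B≡ = B≡ ; s≢0 = p≢0 ; ∤A° = ∤A₁ ; ∤B° = ∤A₁ ∘ ∣B⇒∣A norm₁ }
        split (yes ∣A₁) = step₂ (∣-form ∣A₁) (∣-form (∣A⇒∣B norm₁ ∣A₁))
          where
          step₂ : (∃ λ a → A₁ ≡ p * a) → (∃ λ b → B₁ ≡ p * b) → EqualValuations
          step₂ (A₂ , A₁≡) (B₂ , B₁≡) = step₃ (∣-form p∣n₁)
            where
            norm₂ : p * (A₂ * A₂ - B₂ * B₂ * + D) ≡ n₁ * n₁ * n₁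
            norm₂ = *-cancelˡ-prime L (trans (h₁ p A₂ B₂ (+ D)) (trans (sym (cong₂ (λ a b → a * a - b * b * + D) A₁≡ B₁≡)) norm₁))
            p∣n₁ : p ℤ∣.∣ n₁
            p∣n₁ = prime∣cube L n₁ (subst (p ℤ∣.∣_) norm₂ (∣p* _))
            A≡₂ : A ≡ p * p * A₂
            A≡₂ = trans A≡ (trans (cong (p *_) A₁≡) (sym (ℤₚ.*-assoc p p A₂)))
            B≡₂ : B ≡ p * p * B₂
            B≡₂ = trans B≡ (trans (cong (p *_) B₁≡) (sym (ℤₚ.*-assoc p p B₂)))
            step₃ : (∃ λ n₂ → n₁ ≡ p * n₂) → EqualValuations
            step₃ (n₂ , n₁≡) = record { s = p * p ; A° = A₂ ; B° = B₂ ; A≡ = A≡₂ ; B≡ = B≡₂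
              ; s≢0 = λ e → p≢0 ([ (λ z → z) , (λ z → z) ]′ (ℤₚ.i*j≡0⇒i≡0∨j≡0 p e))
              ; ∤A° = λ d → both d (∣A⇒∣B norm₃ d) ; ∤B° = λ d → both (∣B⇒∣A norm₃ d) d }
              where
              norm₃ : A₂ * A₂ - B₂ * B₂ * + D ≡ p * (p * (n₂ * n₂ * n₂))
              norm₃ = *-cancelˡ-prime L (trans norm₂ (trans (cong (λ n → n * n * n) n₁≡) (h₂ p n₂)))
              both : p ℤ∣.∣ A₂ → ¬ p ℤ∣.∣ B₂
              both (ℤ∣.divides u eu) (ℤ∣.divides w ew) = cubeFree L
                ( ℤ∣.divides u (trans A≡₂ (trans (cong (p * p *_) eu) (h p u)))
                , ℤ∣.divides w (trans B≡₂ (trans (cong (p * p *_) ew) (h p w))))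
                where
                h : ∀ p u → p * p * (u * p) ≡ u * (p * p * p)
                h = solve-∀

∣ℤ⇒prime : ∀ {d} → ¬ d ≡ + 0 → ¬ ∣ d ∣ ≡ 1 → ∃ λ p → Prime p × + p ℤ∣.∣ d
∣ℤ⇒prime {d} d≢0 d≢1 with prime-divisor-ℕ ∣ d ∣ {{ℕ.≢-nonZero (d≢0 ∘ ℤₚ.∣i∣≡0⇒i≡0)}} d≢1
... | p , P , p∣d = p , P , ℤ∣.∣ᵤ⇒∣ {+ p} {d} p∣d

unit∣ : ∀ {d} → ∣ d ∣ ≡ 1 → ∀ a → d ℤ∣.∣ a
unit∣ {d} e a = ℤ∣.∣ᵤ⇒∣ {d} {a} (subst (ℕ∣._∣ ∣ a ∣) (sym e) (ℕ∣.1∣ ∣ a ∣))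

-- With d = ge and z = gw in lowest terms, e divides g². A prime factor of e would divide g too, so
-- its square would divide d and hence D; thus e is a unit.
squareFree∣cube⇒∣ : ∀ {D d z} → SquareFree D → ¬ D ≡ 0 → d ℤ∣.∣ + D → d ℤ∣.∣ z * z * z → d ℤ∣.∣ z
squareFree∣cube⇒∣ {D} {d} {z} sf D≢0 d∣D d∣z³ = go (lowestTerms d z)
  where
  go : LowestTerms d z → d ℤ∣.∣ z
  go record { g = g ; a′ = e ; b′ = w ; a≡ = d≡ ; b≡ = z≡ ; a′⊥b′ = e⊥w } = conclude (∣ e ∣ ℕₚ.≟ 1)
    where
    d≢0 : ¬ d ≡ + 0
    d≢0 refl = D≢0 (ℤₚ.+-injective (ℤ∣.0∣⇒≡0 d∣D))
    g≢0 : ¬ g ≡ + 0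
    g≢0 refl = d≢0 d≡
    e∣g² : e ℤ∣.∣ g * g
    e∣g² = absorb e⊥w e∣g²w³
      where
      e∣g²w³ : e ℤ∣.∣ g * g * (w * w * w)
      e∣g²w³ = ℤ∣.*-cancelˡ-∣ g {{ℤ.≢-nonZero g≢0}} (subst₂ ℤ∣._∣_ d≡ (trans (cong (λ z → z * z * z) z≡) (h g w)) d∣z³)
        where
        h : ∀ g w → g * w * (g * w) * (g * w) ≡ g * (g * g * (w * w * w))
        h = solve-∀
      absorb : e ⊥ℤ w → e ℤ∣.∣ g * g * (w * w * w) → e ℤ∣.∣ g * g
      absorb e⊥w dvd = cancel (⊥ℤ-sym (⊥ℤ-* (⊥ℤ-* (⊥ℤ-sym e⊥w) (⊥ℤ-sym e⊥w)) (⊥ℤ-sym e⊥w)))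
        where
        h : ∀ e s t G W → e * (s * G) + G * W * t ≡ (e * s + W * t) * G
        h = solve-∀
        cancel : e ⊥ℤ w * w * w → e ℤ∣.∣ g * g
        cancel (comaximal s t eq) = subst (e ℤ∣.∣_) (trans (h e s t (g * g) (w * w * w)) (trans (cong (_* (g * g)) eq) (ℤₚ.*-identityˡ (g * g))))
          (ℤ∣.∣m∣n⇒∣m+n (ℤ∣.∣m⇒∣m*n (s * (g * g)) ℤ∣.∣-refl) (ℤ∣.∣m⇒∣m*n t dvd))
    conclude : Dec (∣ e ∣ ≡ 1) → d ℤ∣.∣ z
    conclude (yes e≡1) = subst₂ ℤ∣._∣_ (sym d≡) (sym z≡) (ℤ∣.*-monoʳ-∣ g (unit∣ e≡1 w))
    conclude (no e≢1) = contradiction (∣ℤ⇒prime e≢0 e≢1) λ (p , P , p∣e) →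
      sf p P (subst (ℕ∣._∣ D) (ℤₚ.abs-* (+ p) (+ p)) (ℤ∣.∣⇒∣ᵤ (ℤ∣.∣-trans (square p∣e (prime∣square P g (ℤ∣.∣-trans p∣e e∣g²))) d∣D)))
      where
      e≢0 : ¬ e ≡ + 0
      e≢0 refl = d≢0 (trans d≡ (ℤₚ.*-zeroʳ g))
      square : ∀ {p} → + p ℤ∣.∣ e → + p ℤ∣.∣ g → + p * + p ℤ∣.∣ d
      square {p} (ℤ∣.divides u refl) (ℤ∣.divides v refl) = ℤ∣.divides (v * u) (trans d≡ (h v (+ p) u))
        where
        h : ∀ v p u → v * p * (u * p) ≡ v * u * (p * p)
        h = solve-∀

-- Bad primes and the two cases 3 ∣ A, 3 ∤ A

module SymbolOverForm
  {D : ℕ} (squareFree : SquareFree D) (D≢0 : ¬ D ≡ 0) {A B B′ C n X y m : ℤ}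
  (norm≡ : A * A - B * B * + D ≡ n * n * n)
  (cubeFree : ∀ {ℓ} → Prime ℓ → ¬ (+ ℓ * + ℓ * + ℓ ℤ∣.∣ A × + ℓ * + ℓ * + ℓ ℤ∣.∣ B))
  (B≡ : B ≡ B′ * C) (C∣A : C ℤ∣.∣ A)
  (∣C⇒ : ∀ {ℓ} → Prime ℓ → + ℓ ℤ∣.∣ C → ¬ ℓ ≡ 2 × ¬ + ℓ ℤ∣.∣ + D)
  (⇒∣C : ∀ {ℓ} → Prime ℓ → ¬ ℓ ≡ 2 → + ℓ ℤ∣.∣ A → + ℓ ℤ∣.∣ B → ¬ + ℓ ℤ∣.∣ + D → + ℓ ℤ∣.∣ C)
  (m≡ : m ≡ X * X + + 27 * (C * C) * + D * (y * y))
  (m⊥3 : m ⊥ℤ + 3) (m⊥y : m ⊥ℤ y) (m⊥n : m ⊥ℤ n) (m⊥D : m ⊥ℤ + D)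
  where
  private
    module V = Valuations squareFree {A} {B} {n} norm≡ cubeFree

    C∣B : C ℤ∣.∣ B
    C∣B = ℤ∣.divides B′ B≡

    ∣m : ∀ {ℓ} → + ℓ ℤ∣.∣ X → + ℓ ℤ∣.∣ + 27 * (C * C) * + D * (y * y) → + ℓ ℤ∣.∣ m
    ∣m {ℓ} d e = subst (+ ℓ ℤ∣.∣_) (sym m≡) (ℤ∣.∣m∣n⇒∣m+n (ℤ∣.∣m⇒∣m*n X d) e)

    ∣D⇒∤X : ∀ {ℓ} → Prime ℓ → + ℓ ℤ∣.∣ + D → ¬ + ℓ ℤ∣.∣ X
    ∣D⇒∤X L d e = ⊥ℤ-prime L m⊥D (∣m e (ℤ∣.∣m⇒∣m*n (y * y) (ℤ∣.∣n⇒∣m*n (+ 27 * (C * C)) d))) d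

    3∤X : ¬ + 3 ℤ∣.∣ X
    3∤X e = ⊥ℤ3⇒3∤ m⊥3 (∣m e (ℤ∣.∣m⇒∣m*n (y * y) (ℤ∣.∣m⇒∣m*n (+ D) (ℤ∣.∣m⇒∣m*n (C * C) (ℤ∣.divides (+ 9) refl)))))

    ∣AB⇒∤m : ∀ {ℓ} → Prime ℓ → + ℓ ℤ∣.∣ A → + ℓ ℤ∣.∣ B → ¬ + ℓ ℤ∣.∣ m
    ∣AB⇒∤m L dA dB e = ⊥ℤ-prime L m⊥n e (V.∣n L dA (ℤ∣.∣m⇒∣m*n (+ D) (ℤ∣.∣m⇒∣m*n B dB)))

    ∣C⇒∤X : ∀ {ℓ} → Prime ℓ → + ℓ ℤ∣.∣ C → ¬ + ℓ ℤ∣.∣ X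
    ∣C⇒∤X L d e = ∣AB⇒∤m L (ℤ∣.∣-trans d C∣A) (ℤ∣.∣-trans d C∣B)
      (∣m e (ℤ∣.∣m⇒∣m*n (y * y) (ℤ∣.∣m⇒∣m*n (+ D) (ℤ∣.∣n⇒∣m*n (+ 27) (ℤ∣.∣m⇒∣m*n C d)))))

    -- 2 divides A and B, hence n, so m is odd. As C and D are odd too, X² + 27C²Dy² is odd only if
    -- exactly one of X and y is even.
    parity : + 2 ℤ∣.∣ A → + 2 ℤ∣.∣ B → ¬ + 2 ℤ∣.∣ + D → (+ 2 ℤ∣.∣ X × ¬ + 2 ℤ∣.∣ y) ⊎ (+ 2 ℤ∣.∣ y × ¬ + 2 ℤ∣.∣ X)
    parity dA dB 2∤D = go (+ 2 ℤ∣.∣? X) (+ 2 ℤ∣.∣? y)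
      where
      2∤m : ¬ + 2 ℤ∣.∣ m
      2∤m = ∣AB⇒∤m prime[2] dA dB
      2∤C : ¬ + 2 ℤ∣.∣ C
      2∤C d = proj₁ (∣C⇒ prime[2] d) refl
      go : Dec (+ 2 ℤ∣.∣ X) → Dec (+ 2 ℤ∣.∣ y) → (+ 2 ℤ∣.∣ X × ¬ + 2 ℤ∣.∣ y) ⊎ (+ 2 ℤ∣.∣ y × ¬ + 2 ℤ∣.∣ X)
      go (yes d) (no n) = inj₁ (d , n)
      go (no n) (yes d) = inj₂ (d , n)
      go (yes d) (yes e) = contradiction (∣m d (ℤ∣.∣n⇒∣m*n (+ 27 * (C * C) * + D) (ℤ∣.∣m⇒∣m*n y e))) 2∤m
      go (no ∤X) (no ∤y) = contradiction (subst (+ 2 ℤ∣.∣_) (sym m≡) (odd-sum (∤X ∘ prime∣square prime[2] X) last)) 2∤m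
        where
        2∤27 : ¬ + 2 ℤ∣.∣ + 27
        2∤27 d = contradiction (ℤ∣.∣⇒∣ᵤ d) (λ { (ℕ∣.divides k eq) → even≢odd k 13 (trans (ℕₚ.*-comm 2 k) (sym eq)) })
          where
          even≢odd : ∀ m n → ¬ 2 ℕ.* m ≡ suc (2 ℕ.* n)
          even≢odd = ℕₚ.even≢odd
        last : ¬ + 2 ℤ∣.∣ + 27 * (C * C) * + D * (y * y)
        last = ∤y ∘ prime∣square prime[2] y ∘ prime∣*-cancel prime[2] (2∤D ∘ prime∣*-cancel prime[2] (2∤C ∘ prime∣square prime[2] C ∘ prime∣*-cancel prime[2] 2∤27))

    -- The equation is what remains after the common power of ℓ is cancelled from A and B. An odd ℓ
    -- divides C but none of X and V°, so it divides Q. For ℓ = 2 the even one among X and y forces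
    -- a factor 2 into P or Q. The sharper conclusion for odd ℓ is needed at ℓ = 3.
    unramifiedSplit : ∀ {ℓ} → Prime ℓ → + ℓ ℤ∣.∣ A → + ℓ ℤ∣.∣ B → ¬ + ℓ ℤ∣.∣ + D → ∀ {U° V° P Q} → ¬ + ℓ ℤ∣.∣ U° → ¬ + ℓ ℤ∣.∣ V° →
      V° * X * Q ≡ C * U° * y * P → (¬ ℓ ≡ 2 → + ℓ ℤ∣.∣ Q) × + ℓ ℤ∣.∣ P * Q
    unramifiedSplit {ℓ} L dA dB ∤D {U°} {V°} {P} {Q} ∤U ∤V eq = oddCase , byParity (ℓ ℕₚ.≟ 2)
      where
      oddCase : ¬ ℓ ≡ 2 → + ℓ ℤ∣.∣ Q
      oddCase ℓ≢2 = prime∣*-cancel L (∣C⇒∤X L ∣C ∘ prime∣*-cancel L ∤V) (subst (+ ℓ ℤ∣.∣_) (sym eq) (ℤ∣.∣m⇒∣m*n P (ℤ∣.∣m⇒∣m*n y (ℤ∣.∣m⇒∣m*n U° ∣C))))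
        where
        ∣C : + ℓ ℤ∣.∣ C
        ∣C = ⇒∣C L ℓ≢2 dA dB ∤D
      byParity : Dec (ℓ ≡ 2) → + ℓ ℤ∣.∣ P * Q
      byParity (no ℓ≢2) = ℤ∣.∣n⇒∣m*n P (oddCase ℓ≢2)
      byParity (yes refl) = [ evenX , evenY ]′ (parity dA dB ∤D)
        where
        2∤C : ¬ + 2 ℤ∣.∣ C
        2∤C d = proj₁ (∣C⇒ prime[2] d) refl
        evenX : + 2 ℤ∣.∣ X × ¬ + 2 ℤ∣.∣ y → + 2 ℤ∣.∣ P * Q
        evenX (d , ∤y) = ℤ∣.∣m⇒∣m*n Q (prime∣*-cancel L (∤y ∘ prime∣*-cancel L (∤U ∘ prime∣*-cancel L 2∤C))
          (subst (+ 2 ℤ∣.∣_) eq (ℤ∣.∣m⇒∣m*n Q (ℤ∣.∣n⇒∣m*n V° d))))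
        evenY : + 2 ℤ∣.∣ y × ¬ + 2 ℤ∣.∣ X → + 2 ℤ∣.∣ P * Q
        evenY (d , ∤X) = ℤ∣.∣n⇒∣m*n P (prime∣*-cancel L (∤X ∘ prime∣*-cancel L ∤V)
          (subst (+ 2 ℤ∣.∣_) (sym eq) (ℤ∣.∣m⇒∣m*n P (ℤ∣.∣n⇒∣m*n (C * U°) d))))

    ℤ-cancel : ∀ {s a b} → ¬ s ≡ + 0 → s * a ≡ s * b → a ≡ b
    ℤ-cancel {s} {a} {b} s≢0 = ℤₚ.*-cancelˡ-≡ s a b {{ℤ.≢-nonZero s≢0}}

  Γ : Zω
  Γ = (B′ * X) ⊖√-3 (+ 3 * (A * y))

  module ThreeDividesA (3∣A : + 3 ℤ∣.∣ A) where
    private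
      -- For ℓ ∣ D the relation BXQ = CAyP, divided by ℓ, has ℓ left on the right only, since v(B) =
      -- 1 < v(A). As ℓ ∤ X, it must divide Q. For ℓ ∤ D the valuations of A and B cancel.
      splitting : ∀ {ℓ} → Prime ℓ → + ℓ ℤ∣.∣ A → + ℓ ℤ∣.∣ B′ → ∀ {P Q} → B′ * X * Q ≡ A * y * P → (¬ ℓ ≡ 2 → + ℓ ℤ∣.∣ Q) × + ℓ ℤ∣.∣ P * Q
      splitting {ℓ} L dA dB′ {P} {Q} eq = go (+ ℓ ℤ∣.∣? + D)
        where
        dB : + ℓ ℤ∣.∣ B
        dB = subst (+ ℓ ℤ∣.∣_) (sym B≡) (ℤ∣.∣m⇒∣m*n C dB′)
        relation : B * X * Q ≡ C * A * y * P
        relation = trans (cong (λ b → b * X * Q) B≡) (trans (h₁ B′ C X Q) (trans (cong (C *_) eq) (h₂ C A y P)))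
          where
          h₁ : ∀ b c x q → b * c * x * q ≡ c * (b * x * q)
          h₁ = solve-∀
          h₂ : ∀ c a y p → c * (a * y * p) ≡ c * a * y * p
          h₂ = solve-∀
        go : Dec (+ ℓ ℤ∣.∣ + D) → (¬ ℓ ≡ 2 → + ℓ ℤ∣.∣ Q) × + ℓ ℤ∣.∣ P * Q
        go (yes d) = (λ _ → ∣Q) , ℤ∣.∣n⇒∣m*n P ∣Q
          where
          open V.RamifiedValuation L (V.Ramified.ramified L dA d) renaming (A≡ to A≡pp; B≡ to B≡p)
          h₁ : ∀ p b x q → p * (b * x * q) ≡ p * b * x * q
          h₁ = solve-∀
          h₂ : ∀ p a c y q → c * (p * (p * a)) * y * q ≡ p * (p * (c * a * y * q))
          h₂ = solve-∀
          ∣Q : + ℓ ℤ∣.∣ Q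
          ∣Q = prime∣*-cancel L (∣D⇒∤X L d ∘ prime∣*-cancel L ∤B₁) (subst (+ ℓ ℤ∣.∣_) (sym (*-cancelˡ-prime L
            (trans (h₁ (+ ℓ) B₁ X Q) (trans (sym (cong (λ b → b * X * Q) B≡p)) (trans relation (trans (cong (λ a → C * a * y * P) A≡pp) (h₂ (+ ℓ) A₂ C y P)))))))
            (ℤ∣.∣m⇒∣m*n (C * A₂ * y * P) ℤ∣.∣-refl))
        go (no ∤D) = unramifiedSplit L dA dB ∤D ∤A° ∤B° (ℤ-cancel s≢0 (trans (h₁ s B° X Q) (trans (sym (cong (λ b → b * X * Q) B≡s))
            (trans relation (trans (cong (λ a → C * a * y * P) A≡s) (h₂ s A° C y P))))))
          where
          open V.EqualValuations L (V.Unramified.unramified L ∤D dA dB) renaming (A≡ to A≡s; B≡ to B≡s)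
          h₁ : ∀ s b x q → s * (b * x * q) ≡ s * b * x * q
          h₁ = solve-∀
          h₂ : ∀ s a c y q → c * (s * a) * y * q ≡ s * (c * a * y * q)
          h₂ = solve-∀
      -- If 3 ∣ P, then 3 ∤ Q, and as 3 ∤ X the prime 3 divides B′. So 3 is a common prime of A and
      -- B′, and `splitting` puts it into Q, a contradiction.
      3∤numerator : ∀ P Q → P ⊥ℤ Q → B′ * X * Q ≡ A * y * P → ¬ + 3 ℤ∣.∣ P
      3∤numerator P Q P⊥Q eq 3∣P = 3∤Q (proj₁ (splitting prime[3] 3∣A 3∣B′ eq) λ ())
        where
        3∤Q : ¬ + 3 ℤ∣.∣ Q
        3∤Q = ⊥ℤ-prime prime[3] P⊥Q 3∣P
        3∣B′ : + 3 ℤ∣.∣ B′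
        3∣B′ = [ [ (λ d → d) , (λ d → contradiction d 3∤X) ]′ ∘ prime∣*ℤ prime[3] B′ X , (λ d → contradiction d 3∤Q) ]′
          (prime∣*ℤ prime[3] (B′ * X) Q (subst (+ 3 ℤ∣.∣_) (sym eq) (ℤ∣.∣n⇒∣m*n (A * y) 3∣P)))

    Γ-symbol : ⟨ Γ / ι m ⟩ ≡ 1ω
    Γ-symbol = MainSymbol.symbol≡1 A B′ C (+ D) X y (+ 1) n m m≡
      (trans (cong (λ b → A * A - b * b * + D) (sym B≡)) (trans norm≡ (sym (ℤₚ.*-identityˡ (n * n * n)))))
      m⊥3 m⊥y m⊥n (comaximal (+ 0) (+ 1) (cong (_+ + 1) (ℤₚ.*-zeroʳ m))) (λ ())
      (λ L d → contradiction (ℕ∣.∣1⇒≡1 (ℤ∣.∣⇒∣ᵤ d)) (prime≢1 L))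
      (λ L dA dB P Q _ eq → proj₂ (splitting L dA dB eq)) 3∤numerator

  -- Here 3 may divide the numerator B′X of the fraction, so u is first replaced by u(√D)³
  -- divided by a rational integer, which exchanges the roles of A and B.
  module ThreeDoesNotDivideA (3∤A : ¬ + 3 ℤ∣.∣ A) where
    private
      d₁ : ℕ
      d₁ = gcd D ∣ A ∣
      D₁ : ℤ
      D₁ = + d₁
      D₁∣D : D₁ ℤ∣.∣ + D
      D₁∣D = ℤ∣.∣ᵤ⇒∣ {D₁} {+ D} (gcd[m,n]∣m D ∣ A ∣)
      D₁∣A : D₁ ℤ∣.∣ A
      D₁∣A = ℤ∣.∣ᵤ⇒∣ {D₁} {A} (gcd[m,n]∣n D ∣ A ∣)
      ∣D∣A⇒∣D₁ : ∀ {ℓ} → + ℓ ℤ∣.∣ + D → + ℓ ℤ∣.∣ A → + ℓ ℤ∣.∣ D₁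
      ∣D∣A⇒∣D₁ {ℓ} d e = ℤ∣.∣ᵤ⇒∣ {+ ℓ} {D₁} (gcd-greatest (ℤ∣.∣⇒∣ᵤ d) (ℤ∣.∣⇒∣ᵤ e))
      ∣-form : ∀ {d a} → d ℤ∣.∣ a → ∃ λ b → a ≡ d * b
      ∣-form {d} (ℤ∣.divides q eq) = q , trans eq (ℤₚ.*-comm q d)
      D₁≢0 : ¬ D₁ ≡ + 0
      D₁≢0 e = D≢0 (ℤₚ.+-injective (ℤ∣.0∣⇒≡0 (subst (ℤ∣._∣ + D) e D₁∣D)))

    -- D₁ = gcd(D, A) collects the ramified primes dividing A. Then u(√D)³ = D₁³D₂(B₁D₂ + A₂√D), and
    -- the bracket has norm -D₂n₁³. So B₁D₂ takes the place of A, A₂ = B₃C that of B, and E = -D₂.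
    -- Since B₃ divides A, it is prime to 3.
    module Decomposed {D₂ B₁ n₁ A₂ B₃ : ℤ} (D≡ : + D ≡ D₁ * D₂) (D₁⊥D₂ : D₁ ⊥ℤ D₂) (n≡ : n ≡ D₁ * n₁) (B≡₁ : B ≡ D₁ * B₁)
      (A≡₁ : A ≡ D₁ * (D₁ * A₂)) (A₂≡ : A₂ ≡ B₃ * C) where
      private
        E : ℤ
        E = - D₂
        D₂∣D : D₂ ℤ∣.∣ + D
        D₂∣D = ℤ∣.divides D₁ D≡
        B₃∣A : B₃ ℤ∣.∣ A
        B₃∣A = ℤ∣.divides (D₁ * (D₁ * C)) (trans A≡₁ (trans (cong (λ a → D₁ * (D₁ * a)) A₂≡) (h D₁ B₃ C)))
          where
          h : ∀ d b c → d * (d * (b * c)) ≡ d * (d * c) * b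
          h = solve-∀
        BD≡ : B * + D ≡ D₁ * (D₁ * (B₁ * D₂))
        BD≡ = trans (cong₂ _*_ B≡₁ D≡) (h D₁ B₁ D₂)
          where
          h : ∀ d b e → d * b * (d * e) ≡ d * (d * (b * e))
          h = solve-∀
        norm₁ : n₁ * n₁ * n₁ ≡ D₁ * (A₂ * A₂) - B₁ * B₁ * D₂
        norm₁ = sym (ℤ-cancel D₁≢0 (ℤ-cancel D₁≢0 (ℤ-cancel D₁≢0 (trans (h₁ D₁ A₂ B₁ D₂)
          (trans (sym (trans (cong₂ (λ a b → a * a - b * b * + D) A≡₁ B≡₁) (cong (λ d → D₁ * (D₁ * A₂) * (D₁ * (D₁ * A₂)) - D₁ * B₁ * (D₁ * B₁) * d) D≡)))
          (trans norm≡ (trans (cong (λ n → n * n * n) n≡) (h₂ D₁ n₁))))))))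
          where
          h₁ : ∀ d a b e → d * (d * (d * (d * (a * a) - b * b * e))) ≡ d * (d * a) * (d * (d * a)) - d * b * (d * b) * (d * e)
          h₁ = solve-∀
          h₂ : ∀ d n → d * n * (d * n) * (d * n) ≡ d * (d * (d * (n * n * n)))
          h₂ = solve-∀
        newNorm : B₁ * D₂ * (B₁ * D₂) - B₃ * C * (B₃ * C) * + D ≡ E * (n₁ * n₁ * n₁)
        newNorm = trans (cong₂ (λ a d → B₁ * D₂ * (B₁ * D₂) - a * a * d) (sym A₂≡) D≡) (trans (h B₁ D₂ A₂ D₁) (cong (E *_) (sym norm₁)))
          where
          h : ∀ b e a d → b * e * (b * e) - a * a * (d * e) ≡ - e * (d * (a * a) - b * b * e)
          h = solve-∀
        ∣A∣D⇒∤D₂ : ∀ {ℓ} → Prime ℓ → + ℓ ℤ∣.∣ A → + ℓ ℤ∣.∣ + D → ¬ + ℓ ℤ∣.∣ D₂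
        ∣A∣D⇒∤D₂ L dA dD = ⊥ℤ-prime L D₁⊥D₂ (∣D∣A⇒∣D₁ dD dA)
        ∣D₂⇒∤A : ∀ {ℓ} → Prime ℓ → + ℓ ℤ∣.∣ D₂ → ¬ + ℓ ℤ∣.∣ A
        ∣D₂⇒∤A L d dA = ∣A∣D⇒∤D₂ L dA (ℤ∣.∣-trans d D₂∣D) d
        -- A prime of D₂ divides D but not A, because D₁ already absorbs the common primes of D and
        -- A. Hence it divides neither B₃ nor X, and must divide Q.
        splitE : ∀ {ℓ} → Prime ℓ → + ℓ ℤ∣.∣ D₂ → ∀ {P Q} → B₃ * X * Q ≡ B₁ * D₂ * y * P → + ℓ ℤ∣.∣ P * Q
        splitE {ℓ} L d {P} {Q} eq = ℤ∣.∣n⇒∣m*n P (prime∣*-cancel L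
          (∣D⇒∤X L (ℤ∣.∣-trans d D₂∣D) ∘ prime∣*-cancel L (λ e → ∣D₂⇒∤A L d (ℤ∣.∣-trans e B₃∣A)))
          (subst (+ ℓ ℤ∣.∣_) (sym eq) (ℤ∣.∣m⇒∣m*n P (ℤ∣.∣m⇒∣m*n y (ℤ∣.∣n⇒∣m*n B₁ d)))))
        -- The equation is brought back to the original u as AXQ = C(BD)yP, where A and BD have
        -- exchanged places; for ℓ ∤ D the valuations of A and B are equal, so the unramified
        -- argument is symmetric in them.
        splitting : ∀ {ℓ} → Prime ℓ → + ℓ ℤ∣.∣ B₁ * D₂ → + ℓ ℤ∣.∣ B₃ → ∀ {P Q} → B₃ * X * Q ≡ B₁ * D₂ * y * P → + ℓ ℤ∣.∣ P * Q
        splitting {ℓ} L dA₁ dB₃ {P} {Q} eq = go (+ ℓ ℤ∣.∣? + D)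
          where
          dA : + ℓ ℤ∣.∣ A
          dA = ℤ∣.∣-trans dB₃ B₃∣A
          ∤D₂ : ¬ + ℓ ℤ∣.∣ D₂
          ∤D₂ d = ∣D₂⇒∤A L d dA
          dB₁ : + ℓ ℤ∣.∣ B₁
          dB₁ = prime∣*-cancel L ∤D₂ (subst (+ ℓ ℤ∣.∣_) (ℤₚ.*-comm B₁ D₂) dA₁)
          dB : + ℓ ℤ∣.∣ B
          dB = subst (+ ℓ ℤ∣.∣_) (sym B≡₁) (ℤ∣.∣n⇒∣m*n D₁ dB₁)
          relation : A * X * Q ≡ C * (B * + D) * y * P
          relation = trans (cong (λ a → a * X * Q) (trans A≡₁ (cong (λ a → D₁ * (D₁ * a)) A₂≡))) (trans (h₁ D₁ B₃ C X Q)
            (trans (cong (λ z → C * (D₁ * D₁) * z) eq) (trans (h₂ D₁ B₁ D₂ C y P) (cong (λ z → C * z * y * P) (sym BD≡)))))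
            where
            h₁ : ∀ d b c x q → d * (d * (b * c)) * x * q ≡ c * (d * d) * (b * x * q)
            h₁ = solve-∀
            h₂ : ∀ d b e c y p → c * (d * d) * (b * e * y * p) ≡ c * (d * (d * (b * e))) * y * p
            h₂ = solve-∀
          go : Dec (+ ℓ ℤ∣.∣ + D) → + ℓ ℤ∣.∣ P * Q
          -- ℓ ∣ D₁ and ℓ ∣ B₁ would give ℓ² ∣ B, whereas a ramified prime dividing A divides B
          -- exactly once.
          go (yes d) = contradiction (∣B₁′ dB₁ (∣D∣A⇒∣D₁ d dA)) ∤B₁
            where
            open V.RamifiedValuation L (V.Ramified.ramified L dA d) renaming (B₁ to B₁′; A≡ to A≡pp; B≡ to B≡p)
            ∣B₁′ : + ℓ ℤ∣.∣ B₁ → + ℓ ℤ∣.∣ D₁ → + ℓ ℤ∣.∣ B₁′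
            ∣B₁′ (ℤ∣.divides u eu) (ℤ∣.divides w ew) = ℤ∣.divides (w * u) (*-cancelˡ-prime L (trans (sym B≡p) (trans B≡₁ (trans (cong₂ _*_ ew eu) (h w u (+ ℓ))))))
              where
              h : ∀ w u p → w * p * (u * p) ≡ p * (w * u * p)
              h = solve-∀
          go (no ∤D) = proj₂ (unramifiedSplit L dA dB ∤D {B° * + D} {A°} {P} {Q} (λ d → [ ∤B° , ∤D ]′ (prime∣*ℤ L B° (+ D) d)) ∤A° (ℤ-cancel s≢0
              (trans (h₁ s A° X Q) (trans (sym (cong (λ a → a * X * Q) A≡s)) (trans relation (trans (cong (λ b → C * (b * + D) * y * P) B≡s) (h₂ s B° C (+ D) y P)))))))
            where
            open V.EqualValuations L (V.Unramified.unramified L ∤D dA dB) renaming (A≡ to A≡s; B≡ to B≡s)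
            h₁ : ∀ s b x q → s * (b * x * q) ≡ s * b * x * q
            h₁ = solve-∀
            h₂ : ∀ s b c d y q → c * (s * b * d) * y * q ≡ s * (c * (b * d) * y * q)
            h₂ = solve-∀
        3∤numerator : ∀ P Q → P ⊥ℤ Q → B₃ * X * Q ≡ B₁ * D₂ * y * P → ¬ + 3 ℤ∣.∣ P
        3∤numerator P Q P⊥Q eq 3∣P = ⊥ℤ-prime prime[3] P⊥Q 3∣P (prime∣*-cancel prime[3] (3∤X ∘ prime∣*-cancel prime[3] (λ d → 3∤A (ℤ∣.∣-trans d B₃∣A)))
          (subst (+ 3 ℤ∣.∣_) (sym eq) (ℤ∣.∣n⇒∣m*n (B₁ * D₂ * y) 3∣P)))

        ⊥-part : ∀ {a b} → a ℤ∣.∣ b → m ⊥ℤ b → m ⊥ℤ a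
        ⊥-part d e = ⊥ℤ-sym (⊥ℤ-∣ d (⊥ℤ-sym e))

        D₂≢0 : ¬ D₂ ≡ + 0
        D₂≢0 refl = D≢0 (ℤₚ.+-injective (trans D≡ (ℤₚ.*-zeroʳ D₁)))

        Γ′ : Zω
        Γ′ = (B₃ * X) ⊖√-3 (+ 3 * (B₁ * D₂ * y))

        Γ′-symbol : ⟨ Γ′ / ι m ⟩ ≡ 1ω
        Γ′-symbol = MainSymbol.symbol≡1 (B₁ * D₂) B₃ C (+ D) X y E n₁ m m≡ newNorm m⊥3 m⊥y
          (⊥-part (ℤ∣.divides D₁ n≡) m⊥n) (⊥-part (ℤ∣.divides (- D₁) (trans D≡ (h D₁ D₂))) m⊥D)
          (λ e → D₂≢0 (trans (sym (ℤₚ.neg-involutive D₂)) (cong -_ e)))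
          (λ L d P Q _ eq → splitE L (subst (_ ℤ∣.∣_) (ℤₚ.neg-involutive D₂) (ℤ∣.∣m⇒∣-m d)) eq)
          (λ L dA dB P Q _ eq → splitting L dA dB eq) 3∤numerator
          where
          h : ∀ d e → d * e ≡ - d * - e
          h = solve-∀

        ιm⊥3 : ι m ⊥ ι (+ 3)
        ιm⊥3 = ⊥-ι m⊥3

        C⊥m : C ⊥ℤ m
        C⊥m = ⊥ℤ-∣ C∣n³ (⊥ℤ-* (⊥ℤ-* (⊥ℤ-sym m⊥n) (⊥ℤ-sym m⊥n)) (⊥ℤ-sym m⊥n))
          where
          C∣n³ : C ℤ∣.∣ n * n * n
          C∣n³ = subst (C ℤ∣.∣_) norm≡ (ℤ∣.∣m∣n⇒∣m-n (ℤ∣.∣m⇒∣m*n A C∣A) (ℤ∣.∣m⇒∣m*n (+ D) (ℤ∣.∣m⇒∣m*n B C∣B)))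

        D₁⊥m : D₁ ⊥ℤ m
        D₁⊥m = ⊥ℤ-∣ D₁∣D (⊥ℤ-sym m⊥D)

        -- Chosen so that the √-3-coefficients of ΓX and u√-3 Γ′ agree: with A = D₁²B₃C this
        -- requires 3AyX + uB₃X = 0.
        u : ℤ
        u = - (+ 3 * (y * (C * (D₁ * D₁))))

        u⊥m : ι u ⊥ ι m
        u⊥m = ⊥-neg {+ 3 * (y * (C * (D₁ * D₁)))} (⊥-ι (⊥ℤ-* (⊥ℤ-sym m⊥3) (⊥ℤ-* (⊥ℤ-sym m⊥y) (⊥ℤ-* C⊥m (⊥ℤ-* D₁⊥m D₁⊥m)))))

        27C²Dy²⊥m : + 27 * (C * C) * + D * (y * y) ⊥ℤ m
        27C²Dy²⊥m = ⊥ℤ-* (⊥ℤ-* (⊥ℤ-* (⊥ℤ-* (⊥ℤ-sym m⊥3) (⊥ℤ-* (⊥ℤ-sym m⊥3) (⊥ℤ-sym m⊥3))) (⊥ℤ-* C⊥m C⊥m)) (⊥ℤ-sym m⊥D)) (⊥ℤ-* (⊥ℤ-sym m⊥y) (⊥ℤ-sym m⊥y))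

        -- m - X² = 27C²Dy² is prime to m; for its factor C this holds because C divides n³.
        X⊥m : X ⊥ℤ m
        X⊥m = go 27C²Dy²⊥m
          where
          h : ∀ x z s t → x * (- x * s) + (x * x + z) * (s + t) ≡ z * s + (x * x + z) * t
          h = solve-∀
          go : + 27 * (C * C) * + D * (y * y) ⊥ℤ m → X ⊥ℤ m
          go (comaximal s t eq) = comaximal (- X * s) (s + t) (trans (cong (λ z → X * (- X * s) + z * (s + t)) m≡)
            (trans (h X (+ 27 * (C * C) * + D * (y * y)) s t) (trans (cong (λ z → + 27 * (C * C) * + D * (y * y) * s + z * t) (sym m≡)) eq)))

      -- by X² ≡ -27C²Dy² modulo m
      ΓX≈ : Γ ⊗ ι X ≈ ι u ⊗ √-3 ⊗ Γ′ mod ι m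
      ΓX≈ = congruent (divides (ι B′) (begin
        Γ ⊗ ι X ⊖ ι u ⊗ √-3 ⊗ Γ′
          ≡⟨ solve 7 (λ bx ay x u w bx′ ay′ → (bx :- ay :* w) :* x :- u :* w :* (bx′ :- ay′ :* w) := bx :* x :+ u :* ay′ :* (w :* w) :- (ay :* x :+ u :* bx′) :* w)
               refl (ι (B′ * X)) (ι (+ 3 * (A * y))) (ι X) (ι u) √-3 (ι (B₃ * X)) (ι (+ 3 * (B₁ * D₂ * y))) ⟩
        ι (B′ * X) ⊗ ι X ⊕ ι u ⊗ ι (+ 3 * (B₁ * D₂ * y)) ⊗ (√-3 ⊗ √-3) ⊖ (ι (+ 3 * (A * y)) ⊗ ι X ⊕ ι u ⊗ ι (B₃ * X)) ⊗ √-3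
          ≡⟨ cong₂ (λ a b → ι (B′ * X) ⊗ ι X ⊕ a ⊖ b ⊗ √-3)
               (trans (cong₂ _⊗_ (sym (ι-⊗ u (+ 3 * (B₁ * D₂ * y)))) √-3²) (sym (ι-⊗ (u * (+ 3 * (B₁ * D₂ * y))) (- + 3))))
               (trans (sym (trans (ι-⊕ (+ 3 * (A * y) * X) (u * (B₃ * X))) (cong₂ _⊕_ (ι-⊗ (+ 3 * (A * y)) X) (ι-⊗ u (B₃ * X))))) (cong ι √-3-part)) ⟩
        ι (B′ * X) ⊗ ι X ⊕ ι (u * (+ 3 * (B₁ * D₂ * y)) * - + 3) ⊖ 0ω ⊗ √-3
          ≡⟨ solve 2 (λ a w → a :- con (+ 0) :* w := a) refl (ι (B′ * X) ⊗ ι X ⊕ ι (u * (+ 3 * (B₁ * D₂ * y)) * - + 3)) √-3 ⟩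
        ι (B′ * X) ⊗ ι X ⊕ ι (u * (+ 3 * (B₁ * D₂ * y)) * - + 3)
          ≡⟨ trans (ι-⊕ (B′ * X * X) (u * (+ 3 * (B₁ * D₂ * y)) * - + 3)) (cong (_⊕ ι (u * (+ 3 * (B₁ * D₂ * y)) * - + 3)) (ι-⊗ (B′ * X) X)) ⟨
        ι (B′ * X * X + u * (+ 3 * (B₁ * D₂ * y)) * - + 3)
          ≡⟨ cong ι rational-part ⟩
        ι (m * B′)
          ≡⟨ ι-⊗ m B′ ⟩
        ι m ⊗ ι B′ ∎))
        where
        open ≡-Reasoning
        √-3-part : + 3 * (A * y) * X + u * (B₃ * X) ≡ + 0
        √-3-part = trans (cong (λ a → + 3 * (a * y) * X + u * (B₃ * X)) (trans A≡₁ (cong (λ a → D₁ * (D₁ * a)) A₂≡))) (h D₁ B₃ C y X)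
          where
          h : ∀ d b c y x → + 3 * (d * (d * (b * c)) * y) * x + - (+ 3 * (y * (c * (d * d)))) * (b * x) ≡ + 0
          h = solve-∀
        rational-part : B′ * X * X + u * (+ 3 * (B₁ * D₂ * y)) * - + 3 ≡ m * B′
        rational-part = trans (h₁ B′ X D₁ C y B₁ D₂) (trans (cong (λ z → B′ * X * X + + 27 * (y * y) * C * z) (trans (sym BD≡) (cong (_* + D) B≡)))
          (trans (h₂ B′ X C y (+ D)) (cong (_* B′) (sym m≡))))
          where
          h₁ : ∀ b x d c y e f → b * x * x + - (+ 3 * (y * (c * (d * d)))) * (+ 3 * (e * f * y)) * - + 3 ≡ b * x * x + + 27 * (y * y) * c * (d * (d * (e * f)))
          h₁ = solve-∀
          h₂ : ∀ b x c y D → b * x * x + + 27 * (y * y) * c * (b * c * D) ≡ (x * x + + 27 * (c * c) * D * (y * y)) * b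
          h₂ = solve-∀

      Γ-symbol : ⟨ Γ / ι m ⟩ ≡ 1ω
      Γ-symbol = begin
        ⟨ Γ / ι m ⟩                                ≡⟨ ⊗-identityʳ _ ⟨
        ⟨ Γ / ι m ⟩ ⊗ 1ω                           ≡⟨ cong (⟨ Γ / ι m ⟩ ⊗_) (symbol-rational {a = X} (⊥-ι X⊥m) ιm⊥3) ⟨
        ⟨ Γ / ι m ⟩ ⊗ ⟨ ι X / ι m ⟩                ≡⟨ symbol-⊗ ιm⊥3 Γ (ι X) ⟨
        ⟨ Γ ⊗ ι X / ι m ⟩                          ≡⟨ symbol-cong ιm⊥3 ΓX≈ ⟩
        ⟨ ι u ⊗ √-3 ⊗ Γ′ / ι m ⟩                   ≡⟨ trans (symbol-⊗ ιm⊥3 (ι u ⊗ √-3) Γ′) (cong (_⊗ ⟨ Γ′ / ι m ⟩) (symbol-⊗ ιm⊥3 (ι u) √-3)) ⟩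
        ⟨ ι u / ι m ⟩ ⊗ ⟨ √-3 / ι m ⟩ ⊗ ⟨ Γ′ / ι m ⟩ ≡⟨ cong₂ _⊗_ (cong₂ _⊗_ (symbol-rational {a = u} u⊥m ιm⊥3) (symbol-√-3 ιm⊥3)) Γ′-symbol ⟩
        1ω ⊗ 1ω ⊗ 1ω                               ≡⟨ trans (⊗-identityʳ (1ω ⊗ 1ω)) (⊗-identityʳ 1ω) ⟩
        1ω                                         ∎
        where open ≡-Reasoning

    -- As D is square-free, `squareFree∣cube⇒∣` lets D₁ be treated like a single ramified prime: the
    -- same cancellations give D₁ ∣ n, D₁ ∣ B and D₁² ∣ A. Since C is prime to D, it is prime to D₁
    -- and divides the remaining factor A₂.
    Γ-symbol : ⟨ Γ / ι m ⟩ ≡ 1ω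
    Γ-symbol = step₁ (∣-form D₁∣D) (∣-form D₁∣A) (∣-form D₁∣n)
      where
      D₁∣n : D₁ ℤ∣.∣ n
      D₁∣n = squareFree∣cube⇒∣ squareFree D≢0 D₁∣D (subst (D₁ ℤ∣.∣_) norm≡ (ℤ∣.∣m∣n⇒∣m-n (ℤ∣.∣m⇒∣m*n A D₁∣A) (ℤ∣.∣n⇒∣m*n (B * B) D₁∣D)))
      square⇒ : ∀ {z} → D₁ ℤ∣.∣ z * z → D₁ ℤ∣.∣ z
      square⇒ {z} d = squareFree∣cube⇒∣ squareFree D≢0 D₁∣D (ℤ∣.∣m⇒∣m*n z d)
      ⊥-cancel : ∀ {a b c} → a ⊥ℤ b → a ℤ∣.∣ c * b → a ℤ∣.∣ c
      ⊥-cancel {a} {b} {c} (comaximal s t eq) d = subst (a ℤ∣.∣_) (trans (h a b c s t) (trans (cong (c *_) eq) (ℤₚ.*-identityʳ c)))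
        (ℤ∣.∣m∣n⇒∣m+n (ℤ∣.∣m⇒∣m*n (c * s) ℤ∣.∣-refl) (ℤ∣.∣m⇒∣m*n t d))
        where
        h : ∀ a b c s t → a * (c * s) + c * b * t ≡ c * (a * s + b * t)
        h = solve-∀
      step₁ : (∃ λ D₂ → + D ≡ D₁ * D₂) → (∃ λ A₁ → A ≡ D₁ * A₁) → (∃ λ n₁ → n ≡ D₁ * n₁) → ⟨ Γ / ι m ⟩ ≡ 1ω
      step₁ (D₂ , D≡) (A₁ , A≡) (n₁ , n≡) = step₂ (∣-form D₁∣B)
        where
        D₁⊥D₂ : D₁ ⊥ℤ D₂
        D₁⊥D₂ = coprime⇒⊥ℤ D₁ D₂ λ {d} (dD₁ , dD₂) → unit d dD₁ dD₂ (d ℕₚ.≟ 1)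
          where
          unit : ∀ d → d ℕ∣.∣ d₁ → d ℕ∣.∣ ∣ D₂ ∣ → Dec (d ≡ 1) → d ≡ 1
          unit d _ _ (yes e) = e
          unit d dD₁ dD₂ (no d≢1) = contradiction (∣ℤ⇒prime {+ d} d≢0 d≢1) λ (p , P , p∣d) →
            squareFree p P (subst (p ℕ.* p ℕ∣.∣_) (trans (sym (ℤₚ.abs-* D₁ D₂)) (cong ∣_∣ (sym D≡)))
              (ℕ∣.*-pres-∣ (ℕ∣.∣-trans (ℤ∣.∣⇒∣ᵤ p∣d) dD₁) (ℕ∣.∣-trans (ℤ∣.∣⇒∣ᵤ p∣d) dD₂)))
            where
            d≢0 : ¬ + d ≡ + 0
            d≢0 refl = D₁≢0 (cong +_ (ℕ∣.0∣⇒≡0 dD₁))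
        norm₁ : D₁ * (A₁ * A₁) - B * B * D₂ ≡ D₁ * (D₁ * (n₁ * n₁ * n₁))
        norm₁ = ℤ-cancel D₁≢0 (trans (h₁ D₁ A₁ B D₂) (trans (sym (cong₂ (λ a d → a * a - B * B * d) A≡ D≡))
          (trans norm≡ (trans (cong (λ n → n * n * n) n≡) (h₂ D₁ n₁)))))
          where
          h₁ : ∀ d a b e → d * (d * (a * a) - b * b * e) ≡ d * a * (d * a) - b * b * (d * e)
          h₁ = solve-∀
          h₂ : ∀ d n → d * n * (d * n) * (d * n) ≡ d * (d * (d * (n * n * n)))
          h₂ = solve-∀
        D₁∣B : D₁ ℤ∣.∣ B
        D₁∣B = square⇒ (⊥-cancel D₁⊥D₂ (subst (D₁ ℤ∣.∣_) (h (D₁ * (A₁ * A₁)) (B * B * D₂))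
          (ℤ∣.∣m∣n⇒∣m-n (ℤ∣.∣m⇒∣m*n (A₁ * A₁) ℤ∣.∣-refl) (subst (D₁ ℤ∣.∣_) (sym norm₁) (ℤ∣.∣m⇒∣m*n (D₁ * (n₁ * n₁ * n₁)) ℤ∣.∣-refl)))))
          where
          h : ∀ u v → u - (u - v) ≡ v
          h = solve-∀
        step₂ : (∃ λ B₁ → B ≡ D₁ * B₁) → ⟨ Γ / ι m ⟩ ≡ 1ω
        step₂ (B₁ , B≡₁) = step₃ (∣-form D₁∣A₁)
          where
          A₁²≡ : A₁ * A₁ ≡ D₁ * (B₁ * B₁ * D₂ + n₁ * n₁ * n₁)
          A₁²≡ = ℤ-cancel D₁≢0 (trans (h₁ D₁ A₁ B₁ D₂) (trans (cong (_+ D₁ * B₁ * (D₁ * B₁) * D₂)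
              (trans (sym (cong (λ b → D₁ * (A₁ * A₁) - b * b * D₂) B≡₁)) norm₁)) (h₂ D₁ B₁ D₂ n₁)))
            where
            h₁ : ∀ d a b e → d * (a * a) ≡ d * (a * a) - d * b * (d * b) * e + d * b * (d * b) * e
            h₁ = solve-∀
            h₂ : ∀ d b e n → d * (d * (n * n * n)) + d * b * (d * b) * e ≡ d * (d * (b * b * e + n * n * n))
            h₂ = solve-∀
          D₁∣A₁ : D₁ ℤ∣.∣ A₁
          D₁∣A₁ = square⇒ (subst (D₁ ℤ∣.∣_) (sym A₁²≡) (ℤ∣.∣m⇒∣m*n (B₁ * B₁ * D₂ + n₁ * n₁ * n₁) ℤ∣.∣-refl))
          step₃ : (∃ λ A₂ → A₁ ≡ D₁ * A₂) → ⟨ Γ / ι m ⟩ ≡ 1ω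
          step₃ (A₂ , A₁≡) = step₄ (⊥-cancel C⊥D₁² (subst (C ℤ∣.∣_) (trans A≡₂ (h D₁ A₂)) C∣A))
            where
            A≡₂ : A ≡ D₁ * (D₁ * A₂)
            A≡₂ = trans A≡ (cong (D₁ *_) A₁≡)
            h : ∀ d a → d * (d * a) ≡ a * (d * d)
            h = solve-∀
            C⊥D₁ : C ⊥ℤ D₁
            C⊥D₁ = coprime⇒⊥ℤ C D₁ λ {d} (dC , dD₁) → unit d dC dD₁ (d ℕₚ.≟ 1)
              where
              unit : ∀ d → d ℕ∣.∣ ∣ C ∣ → d ℕ∣.∣ d₁ → Dec (d ≡ 1) → d ≡ 1
              unit d _ _ (yes e) = e
              unit d dC dD₁ (no d≢1) = contradiction (∣ℤ⇒prime {+ d} d≢0 d≢1) λ (p , P , p∣d) →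
                proj₂ (∣C⇒ P (ℤ∣.∣-trans p∣d (ℤ∣.∣ᵤ⇒∣ {+ d} {C} dC))) (ℤ∣.∣-trans (ℤ∣.∣-trans p∣d (ℤ∣.∣ᵤ⇒∣ {+ d} {D₁} dD₁)) D₁∣D)
                where
                d≢0 : ¬ + d ≡ + 0
                d≢0 refl = D₁≢0 (cong +_ (ℕ∣.0∣⇒≡0 dD₁))
            C⊥D₁² : C ⊥ℤ D₁ * D₁
            C⊥D₁² = ⊥ℤ-sym (⊥ℤ-* (⊥ℤ-sym C⊥D₁) (⊥ℤ-sym C⊥D₁))
            step₄ : C ℤ∣.∣ A₂ → ⟨ Γ / ι m ⟩ ≡ 1ω
            step₄ (ℤ∣.divides B₃ A₂≡) = Decomposed.Γ-symbol {D₂} {B₁} {n₁} {A₂} {B₃} D≡ D₁⊥D₂ n≡ B≡₁ A≡₂ A₂≡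

  Γ-symbol : ⟨ Γ / ι m ⟩ ≡ 1ω
  Γ-symbol = go (+ 3 ℤ∣.∣? A)
    where
    go : Dec (+ 3 ℤ∣.∣ A) → ⟨ Γ / ι m ⟩ ≡ 1ω
    go (yes 3∣A) = ThreeDividesA.Γ-symbol 3∣A
    go (no 3∤A) = ThreeDoesNotDivideA.Γ-symbol 3∤A

-- Existence and uniqueness of the value in `CubicSym`

res-CubicSymPrime : ∀ {π} → Prime𝔼 π → ¬ π ∣𝔼 ι (+ 3) → ∀ α → CubicSymPrime α π (res α π)
res-CubicSymPrime {π} P π∤3 α = res-value α π ,
  subst (π ∣ω_) (trans (⊖≡-ω (α ↑ exponent π) (res α π)) (cong₂ _-ω_ (trans (↑≡^ω α (exponent π)) (cong (α ^ω_) exponent≡)) refl))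
    (∣𝔼⇒∣ω (∣-difference (res-≈ P π∤3 α)))
  where
  exponent≡ : exponent π ≡ (Nω π ℕ.∸ 1) ℕ./ 3
  exponent≡ = cong (λ n → (n ℕ.∸ 1) ℕ./ 3) (N≡Nω π)

CubicSymPrime⇒res : ∀ {π χ} → Prime𝔼 π → ¬ π ∣𝔼 ι (+ 3) → ∀ α → CubicSymPrime α π χ → χ ≡ res α π
CubicSymPrime⇒res {π} {χ} P π∤3 α (v , d) = sym (res-unique P π∤3 v (congruent (∣ω⇒∣𝔼
  (subst (π ∣ω_) (sym (trans (⊖≡-ω (α ↑ exponent π) χ) (cong (_-ω χ) (trans (↑≡^ω α (exponent π)) (cong (λ n → α ^ω ((n ℕ.∸ 1) ℕ./ 3)) (N≡Nω π)))))) d))))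

symbol⇒CubicSym : ∀ {n} → ι n ⊥ ι (+ 3) → ∀ α → CubicSym α n ⟨ α / ι n ⟩
symbol⇒CubicSym {n} n⊥3 α = map pair F.primes
  , Allₚ.map⁺ (All.zipWith (λ (P , π∤3) → prime⇒PrimeZω P , π∤3 ∘ ∣ω⇒∣𝔼 , res-CubicSymPrime P π∤3 α) (F.allPrime , F.all∤3))
  , (F.ε , (conj F.ε , trans (sym (⊗≡*ω F.ε (conj F.ε))) (N≡1⇒unit {F.ε} F.unit))
    , trans F.product≡ (trans (⊗≡*ω F.ε (Π F.primes)) (cong (F.ε *ω_) (trans (Π≡prodω F.primes) (cong prodω (sym (trans (sym (Listₚ.map-∘ F.primes)) (Listₚ.map-id F.primes))))))))
  , trans (F.symbol≡ α) (trans (Π≡prodω (map (res α) F.primes)) (cong prodω (Listₚ.map-∘ F.primes)))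
  where
  module F = CoprimeFactorisation (coprimeFactorisation n⊥3)
  pair : Zω → Zω × Zω
  pair π = π , res α π

CubicSym⇒symbol : ∀ {n} → ι n ⊥ ι (+ 3) → ∀ {α χ} → CubicSym α n χ → χ ≡ ⟨ α / ι n ⟩
CubicSym⇒symbol {n} n⊥3 {α} {χ} (ps , all , (ε , (η , εη≡1) , n≡) , χ≡) = begin
  χ                                ≡⟨ χ≡ ⟩
  prodω (map proj₂ ps)             ≡⟨ cong prodω (values ps all) ⟩
  prodω (map (res α) (map proj₁ ps)) ≡⟨ Π≡prodω (map (res α) (map proj₁ ps)) ⟨
  Π (map (res α) (map proj₁ ps))   ≡⟨ symbol-unique n⊥3 {ε} (map proj₁ ps) (unit⇒N≡1 {ε} {η} (trans (⊗≡*ω ε η) εη≡1)) (primes ps all)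
                                        (trans n≡ (trans (cong (ε *ω_) (sym (Π≡prodω (map proj₁ ps)))) (sym (⊗≡*ω ε (Π (map proj₁ ps)))))) α ⟨
  ⟨ α / ι n ⟩                      ∎
  where
  open ≡-Reasoning
  Entry : Zω × Zω → Set
  Entry pc = PrimeZω (proj₁ pc) × ¬ (proj₁ pc ∣ω ι (+ 3)) × CubicSymPrime α (proj₁ pc) (proj₂ pc)
  primes : ∀ ps → All Entry ps → All Prime𝔼 (map proj₁ ps)
  primes ps all = Allₚ.map⁺ (All.map (PrimeZω⇒prime ∘ proj₁) all)
  values : ∀ ps → All Entry ps → map proj₂ ps ≡ map (res α) (map proj₁ ps)
  values [] [] = refl
  values (_ ∷ ps) ((P , n , s) ∷ all) = cong₂ _∷_ (CubicSymPrime⇒res (PrimeZω⇒prime P) (n ∘ ∣𝔼⇒∣ω) α s) (values ps all)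

-- From the symbols over f and a to the symbol over m = a f

opaque
  unfolding _⊕_

  ⊕√-3 : ∀ a b → (a + b , + 2 * b) ≡ ι a ⊕ ι b ⊗ √-3
  ⊕√-3 a b = cong₂ _,_ (re a b) (im b)
    where
    re : ∀ a b → a + b ≡ a + (b * + 1 - + 0 * + 2)
    re = solve-∀
    im : ∀ b → + 2 * b ≡ + 0 + (b * + 2 + + 0 * + 1 - + 0 * + 2)
    im = solve-∀

conj-⊕√-3 : ∀ a b → conj (ι a ⊖ ι b ⊗ √-3) ≡ ι a ⊕ ι b ⊗ √-3
conj-⊕√-3 a b = begin
  conj (ι a ⊖ ι b ⊗ √-3)               ≡⟨ trans (conj-⊖ (ι a) (ι b ⊗ √-3)) (cong₂ _⊖_ (conj-ι a) (trans (conj-⊗ (ι b) √-3) (cong₂ _⊗_ (conj-ι b) conj-√-3))) ⟩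
  ι a ⊖ ι b ⊗ ⊝ √-3                    ≡⟨ solve 3 (λ a b w → a :- b :* :- w := a :+ b :* w) refl (ι a) (ι b) √-3 ⟩
  ι a ⊕ ι b ⊗ √-3                      ∎
  where open ≡-Reasoning

module _ (A B′ a b f x y : ℤ) where
  private
    X m : ℤ
    X = a * x + b * y
    m = a * f
    α β : Zω
    α = ι (+ 9 * A * y) ⊕ ι (B′ * X) ⊗ √-3
    β = ι (+ 9 * A) ⊖ ι (B′ * b) ⊗ √-3

  -- modulo a one has X ≡ by, so α is y times the conjugate of β
  α≈y⊗conj-β : α ≈ ι y ⊗ conj β mod ι a
  α≈y⊗conj-β = congruent (divides (ι (B′ * x) ⊗ √-3) (begin
    α ⊖ ι y ⊗ conj β
      ≡⟨ cong₂ (λ s t → s ⊕ t ⊗ √-3 ⊖ ι y ⊗ conj β) (trans (cong ι (h₁ A y)) (ι-⊗ y (+ 9 * A)))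
           (trans (cong ι (h₂ B′ a b x y)) (trans (ι-⊕ (a * (B′ * x)) (y * (B′ * b))) (cong₂ _⊕_ (ι-⊗ a (B′ * x)) (ι-⊗ y (B′ * b))))) ⟩
    ι y ⊗ ι (+ 9 * A) ⊕ (ι a ⊗ ι (B′ * x) ⊕ ι y ⊗ ι (B′ * b)) ⊗ √-3 ⊖ ι y ⊗ conj β
      ≡⟨ cong (λ z → ι y ⊗ ι (+ 9 * A) ⊕ (ι a ⊗ ι (B′ * x) ⊕ ι y ⊗ ι (B′ * b)) ⊗ √-3 ⊖ ι y ⊗ z) (conj-⊕√-3 (+ 9 * A) (B′ * b)) ⟩
    ι y ⊗ ι (+ 9 * A) ⊕ (ι a ⊗ ι (B′ * x) ⊕ ι y ⊗ ι (B′ * b)) ⊗ √-3 ⊖ ι y ⊗ (ι (+ 9 * A) ⊕ ι (B′ * b) ⊗ √-3)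
      ≡⟨ solve 6 (λ y n a u v w → y :* n :+ (a :* u :+ y :* v) :* w :- y :* (n :+ v :* w) := a :* (u :* w)) refl (ι y) (ι (+ 9 * A)) (ι a) (ι (B′ * x)) (ι (B′ * b)) √-3 ⟩
    ι a ⊗ (ι (B′ * x) ⊗ √-3) ∎))
    where
    open ≡-Reasoning
    h₁ : ∀ A y → + 9 * A * y ≡ y * (+ 9 * A)
    h₁ = solve-∀
    h₂ : ∀ B a b x y → B * (a * x + b * y) ≡ a * (B * x) + y * (B * b)
    h₂ = solve-∀

  -- The coefficient 9 is -3 times the square of √-3, so √-3 splits off from both terms.
  α≡√-3⊗Γ : α ≡ √-3 ⊗ (B′ * X) ⊖√-3 (+ 3 * (A * y))
  α≡√-3⊗Γ = begin
    ι (+ 9 * A * y) ⊕ ι (B′ * X) ⊗ √-3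
      ≡⟨ cong (_⊕ ι (B′ * X) ⊗ √-3) (trans (cong ι (h A y)) (ι-⊗ (+ 3 * (A * y)) (+ 3))) ⟩
    ι (+ 3 * (A * y)) ⊗ ι (+ 3) ⊕ ι (B′ * X) ⊗ √-3
      ≡⟨ solve 3 (λ u v w → u :* con (+ 3) :+ v :* w := v :* w :- u :* con (- + 3)) refl (ι (+ 3 * (A * y))) (ι (B′ * X)) √-3 ⟩
    ι (B′ * X) ⊗ √-3 ⊖ ι (+ 3 * (A * y)) ⊗ ι (- + 3)
      ≡⟨ cong (λ z → ι (B′ * X) ⊗ √-3 ⊖ ι (+ 3 * (A * y)) ⊗ z) √-3² ⟨
    ι (B′ * X) ⊗ √-3 ⊖ ι (+ 3 * (A * y)) ⊗ (√-3 ⊗ √-3)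
      ≡⟨ solve 3 (λ u v w → v :* w :- u :* (w :* w) := w :* (v :- u :* w)) refl (ι (+ 3 * (A * y))) (ι (B′ * X)) √-3 ⟩
    √-3 ⊗ (ι (B′ * X) ⊖ ι (+ 3 * (A * y)) ⊗ √-3) ∎
    where
    open ≡-Reasoning
    h : ∀ A y → + 9 * A * y ≡ + 3 * (A * y) * + 3
    h = solve-∀

  -- The identity conj v ⊗ s = 1 shows also that v ≠ 0. Then s = s v³ = (s conj v) v = v, because v²
  -- = conj v for cubic values.
  transfer : ι m ⊥ ι (+ 3) → m ⊥ℤ y → ⟨ (B′ * X) ⊖√-3 (+ 3 * (A * y)) / ι m ⟩ ≡ 1ω → ⟨ α / ι f ⟩ ≡ ⟨ β / ι a ⟩
  transfer m⊥3 m⊥y Γ≡1 = begin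
    s                                    ≡⟨ ⊗-identityʳ s ⟨
    s ⊗ 1ω                               ≡⟨ cong (s ⊗_) (cubicValue-cube v-value v≢0) ⟨
    s ⊗ (v ⊗ v ⊗ v)                      ≡⟨ cong (λ z → s ⊗ (z ⊗ v)) (cubicValue-square v-value) ⟩
    s ⊗ (conj v ⊗ v)                     ≡⟨ solve 3 (λ s c v → s :* (c :* v) := c :* s :* v) refl s (conj v) v ⟩
    conj v ⊗ s ⊗ v                       ≡⟨ cong (_⊗ v) product≡1 ⟩
    1ω ⊗ v                               ≡⟨ ⊗-identityˡ v ⟩
    v                                    ∎
    where
    open ≡-Reasoning
    v s : Zω
    v = ⟨ β / ι a ⟩
    s = ⟨ α / ι f ⟩
    a⊥3 : ι a ⊥ ι (+ 3)
    a⊥3 = ⊥-∣ (divides (ι f) (ι-⊗ a f)) m⊥3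
    f⊥3 : ι f ⊥ ι (+ 3)
    f⊥3 = ⊥-∣ (divides (ι a) (trans (ι-⊗ a f) (⊗-comm (ι a) (ι f)))) m⊥3
    y⊥a : ι y ⊥ ι a
    y⊥a = ⊥-sym (⊥-∣ (divides (ι f) (ι-⊗ a f)) (⊥-ι m⊥y))
    v-value : IsCubicValue v
    v-value = symbol-value a⊥3 β
    α/a≡ : ⟨ α / ι a ⟩ ≡ conj v
    α/a≡ = begin
      ⟨ α / ι a ⟩                              ≡⟨ symbol-cong a⊥3 α≈y⊗conj-β ⟩
      ⟨ ι y ⊗ conj β / ι a ⟩                   ≡⟨ symbol-⊗ a⊥3 (ι y) (conj β) ⟩
      ⟨ ι y / ι a ⟩ ⊗ ⟨ conj β / ι a ⟩         ≡⟨ cong₂ _⊗_ (symbol-rational {a = y} y⊥a a⊥3) (cong (λ μ → ⟨ conj β / μ ⟩) (sym (conj-ι a))) ⟩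
      1ω ⊗ ⟨ conj β / conj (ι a) ⟩             ≡⟨ trans (⊗-identityˡ _) (symbol-conj a⊥3 β) ⟩
      conj v                                   ∎
    product≡1 : conj v ⊗ s ≡ 1ω
    product≡1 = begin
      conj v ⊗ s                               ≡⟨ cong (_⊗ s) α/a≡ ⟨
      ⟨ α / ι a ⟩ ⊗ ⟨ α / ι f ⟩                ≡⟨ symbol-⊗ʳ a⊥3 f⊥3 α ⟨
      ⟨ α / ι a ⊗ ι f ⟩                        ≡⟨ cong₂ ⟨_/_⟩ α≡√-3⊗Γ (sym (ι-⊗ a f)) ⟩
      ⟨ √-3 ⊗ (B′ * X) ⊖√-3 (+ 3 * (A * y)) / ι m ⟩ ≡⟨ symbol-⊗ m⊥3 √-3 _ ⟩
      ⟨ √-3 / ι m ⟩ ⊗ ⟨ (B′ * X) ⊖√-3 (+ 3 * (A * y)) / ι m ⟩ ≡⟨ cong₂ _⊗_ (symbol-√-3 m⊥3) Γ≡1 ⟩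
      1ω ⊗ 1ω                                  ≡⟨ ⊗-identityʳ 1ω ⟩
      1ω                                       ∎
    v≢0 : ¬ v ≡ 0ω
    v≢0 z = contradiction (trans (sym product≡1) (trans (cong (λ w → conj w ⊗ s) z) (trans (cong (_⊗ s) (conj-ι (+ 0))) (⊗-zeroˡ s)))) λ ()

-- Coprimality data and the comparison of both symbols

theorem2p4 : (D : ℕ) → 1 ℕ.< D → SquareFree D →
    (A B : ℤ) → InS D A B →
    (B' : ℤ) → B ≡ B' * + Cu D A B →
    (a b c : ℤ) → Primitive a b c → + 0 < a →
    b * b - a * c ≡ - (+ 27 * + Cu D A B * + Cu D A B * + D) →
    (x y : ℤ) →
    gcd ∣ a * formVal a b c x y ∣ ∣ + 3 * normD D A B * + D * y ∣ ≡ 1 →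
    (∃ λ χ → CubicSym ((+ 9 * A * y + B' * (a * x + b * y)) , (+ 2 * B' * (a * x + b * y))) (formVal a b c x y) χ
    × CubicSym ((+ 9 * A - B' * b) , (- (+ 2 * B' * b))) a χ)
    × (∀ χL χR →
    CubicSym ((+ 9 * A * y + B' * (a * x + b * y)) , (+ 2 * B' * (a * x + b * y))) (formVal a b c x y) χL →
    CubicSym ((+ 9 * A - B' * b) , (- (+ 2 * B' * b))) a χR →
    χL ≡ χR)
theorem2p4 D 1<D squareFree A B ((n , norm≡) , _ , cubeFreeℕ) B' B≡ a b c _ _ disc≡ x y gcd≡1 =
    (⟨ α / ι f ⟩ , symbol⇒CubicSym f⊥3 α , subst (CubicSym β a) (sym L≡R) (symbol⇒CubicSym a⊥3 β))
  , λ χL χR symL symR → trans (CubicSym⇒symbol f⊥3 symL) (trans L≡R (sym (CubicSym⇒symbol a⊥3 symR)))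
  where
  C f X m : ℤ
  C = + Cu D A B
  f = formVal a b c x y
  X = a * x + b * y
  m = a * f
  α β : Zω
  α = (+ 9 * A * y + B' * X) , (+ 2 * B' * X)
  β = (+ 9 * A - B' * b) , (- (+ 2 * B' * b))

  ⊥-factor : ∀ {d z} → d ℤ∣.∣ z → m ⊥ℤ z → m ⊥ℤ d
  ⊥-factor d∣z m⊥z = ⊥ℤ-sym (⊥ℤ-∣ d∣z (⊥ℤ-sym m⊥z))

  m⊥all : m ⊥ℤ + 3 * normD D A B * + D * y
  m⊥all = coprime⇒⊥ℤ m (+ 3 * normD D A B * + D * y) (gcd≡1⇒coprime gcd≡1)

  m⊥3ND : m ⊥ℤ + 3 * normD D A B * + D
  m⊥3ND = ⊥-factor (ℤ∣.∣m⇒∣m*n y ℤ∣.∣-refl) m⊥all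

  m⊥y : m ⊥ℤ y
  m⊥y = ⊥-factor (ℤ∣.∣n⇒∣m*n (+ 3 * normD D A B * + D) ℤ∣.∣-refl) m⊥all

  m⊥D : m ⊥ℤ + D
  m⊥D = ⊥-factor (ℤ∣.∣n⇒∣m*n (+ 3 * normD D A B) ℤ∣.∣-refl) m⊥3ND

  m⊥3 : m ⊥ℤ + 3
  m⊥3 = ⊥-factor (ℤ∣.∣m⇒∣m*n (+ D) (ℤ∣.∣m⇒∣m*n (normD D A B) ℤ∣.∣-refl)) m⊥3ND

  m⊥n : m ⊥ℤ n
  m⊥n = ⊥-factor (ℤ∣.∣m⇒∣m*n (+ D) (ℤ∣.∣n⇒∣m*n (+ 3) (subst (n ℤ∣.∣_) (sym norm≡) (ℤ∣.∣n⇒∣m*n (n * n) ℤ∣.∣-refl)))) m⊥3ND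

  -- Completing the square: a f = (ax + by)² - (b² - ac)y².
  m≡ : m ≡ X * X + + 27 * (C * C) * + D * (y * y)
  m≡ = trans (h₁ a b c x y) (trans (cong (λ d → X * X - d * (y * y)) disc≡) (h₂ X C (+ D) y))
    where
    h₁ : ∀ a b c x y → a * (a * x * x + + 2 * b * x * y + c * y * y) ≡ (a * x + b * y) * (a * x + b * y) - (b * b - a * c) * (y * y)
    h₁ = solve-∀
    h₂ : ∀ X C D y → X * X - - (+ 27 * C * C * D) * (y * y) ≡ X * X + + 27 * (C * C) * D * (y * y)
    h₂ = solve-∀

  D≢0 : ¬ D ≡ 0
  D≢0 refl = contradiction 1<D λ ()

  gcd∣A : + gcdAB A B ℤ∣.∣ A
  gcd∣A = ℤ∣.∣ᵤ⇒∣ {+ gcdAB A B} {A} (gcd[m,n]∣m ∣ A ∣ ∣ B ∣)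

  ∣gcd : ∀ {d} → + d ℤ∣.∣ A → + d ℤ∣.∣ B → d ℕ∣.∣ gcdAB A B
  ∣gcd dA dB = gcd-greatest (ℤ∣.∣⇒∣ᵤ dA) (ℤ∣.∣⇒∣ᵤ dB)

  cubeFree : ∀ {ℓ} → Prime ℓ → ¬ (+ ℓ * + ℓ * + ℓ ℤ∣.∣ A × + ℓ * + ℓ * + ℓ ℤ∣.∣ B)
  cubeFree {ℓ} L (dA , dB) = cubeFreeℕ ℓ L (∣gcd (subst (ℤ∣._∣ A) ℓ³≡ dA) (subst (ℤ∣._∣ B) ℓ³≡ dB))
    where
    ℓ³≡ : + ℓ * + ℓ * + ℓ ≡ + (ℓ ℕ.* ℓ ℕ.* ℓ)
    ℓ³≡ = sym (trans (ℤₚ.pos-* (ℓ ℕ.* ℓ) ℓ) (cong (_* + ℓ) (ℤₚ.pos-* ℓ ℓ)))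

  -- 0 is divisible by 2³, so cube-freeness excludes A = B = 0. The primes below the bound
  -- `suc (gcdAB A B)` in `Cu` then include all prime divisors of the gcd.
  instance
    gcd-nonZero : NonZero (gcdAB A B)
    gcd-nonZero = ℕ.≢-nonZero λ g≡0 → cubeFreeℕ 2 prime[2] (subst (8 ℕ∣.∣_) (sym g≡0) (8 ℕ∣.∣0))

  C∣A : C ℤ∣.∣ A
  C∣A = ℤ∣.∣-trans (ℤ∣.∣ᵤ⇒∣ {C} {+ gcdAB A B} (Cu∣gcd D A B)) gcd∣A

  ∣C⇒ : ∀ {ℓ} → Prime ℓ → + ℓ ℤ∣.∣ C → ¬ ℓ ≡ 2 × ¬ + ℓ ℤ∣.∣ + D
  ∣C⇒ L d = (λ { refl → proj₁ (proj₂ selected) ℕ∣.∣-refl }) , proj₂ (proj₂ (proj₂ selected)) ∘ ℤ∣.∣⇒∣ᵤ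
    where selected = prime∣Cu⇒ D A B L (ℤ∣.∣⇒∣ᵤ d)

  ⇒∣C : ∀ {ℓ} → Prime ℓ → ¬ ℓ ≡ 2 → + ℓ ℤ∣.∣ A → + ℓ ℤ∣.∣ B → ¬ + ℓ ℤ∣.∣ + D → + ℓ ℤ∣.∣ C
  ⇒∣C {ℓ} L ℓ≢2 dA dB ∤D = ℤ∣.∣ᵤ⇒∣ {+ ℓ} {C} (⇒prime∣Cu D A B
    (L , (λ 2∣ℓ → [ (λ ()) , (λ e → ℓ≢2 (sym e)) ]′ (prime⇒irreducible L 2∣ℓ)) , ∣gcd dA dB , ∤D ∘ ℤ∣.∣ᵤ⇒∣))

  Γ≡1 : ⟨ (B' * X) ⊖√-3 (+ 3 * (A * y)) / ι m ⟩ ≡ 1ω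
  Γ≡1 = SymbolOverForm.Γ-symbol squareFree D≢0 {A} {B} {B'} {C} {n} {X} {y} {m} norm≡ cubeFree B≡ C∣A ∣C⇒ ⇒∣C m≡ m⊥3 m⊥y m⊥n m⊥D

  ιm⊥3 : ι m ⊥ ι (+ 3)
  ιm⊥3 = ⊥-ι m⊥3

  a⊥3 : ι a ⊥ ι (+ 3)
  a⊥3 = ⊥-∣ (divides (ι f) (ι-⊗ a f)) ιm⊥3

  f⊥3 : ι f ⊥ ι (+ 3)
  f⊥3 = ⊥-∣ (divides (ι a) (trans (ι-⊗ a f) (⊗-comm (ι a) (ι f)))) ιm⊥3

  α≡ : α ≡ ι (+ 9 * A * y) ⊕ ι (B' * X) ⊗ √-3
  α≡ = trans (cong (+ 9 * A * y + B' * X ,_) (ℤₚ.*-assoc (+ 2) B' X)) (⊕√-3 (+ 9 * A * y) (B' * X))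

  β≡ : β ≡ ι (+ 9 * A) ⊖ ι (B' * b) ⊗ √-3
  β≡ = trans (cong (+ 9 * A - B' * b ,_) (h B' b)) (trans (⊕√-3 (+ 9 * A) (- (B' * b)))
    (trans (cong (λ z → ι (+ 9 * A) ⊕ z ⊗ √-3) (ι-⊝ (B' * b))) (solve 3 (λ a b w → a :+ :- b :* w := a :- b :* w) refl (ι (+ 9 * A)) (ι (B' * b)) √-3)))
    where
    h : ∀ B b → - (+ 2 * B * b) ≡ + 2 * - (B * b)
    h = solve-∀

  L≡R : ⟨ α / ι f ⟩ ≡ ⟨ β / ι a ⟩
  L≡R = trans (cong (λ z → ⟨ z / ι f ⟩) α≡) (trans (transfer A B' a b f x y ιm⊥3 m⊥y Γ≡1) (cong (λ z → ⟨ z / ι a ⟩) (sym β≡)))
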